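{- Let $G$ be a finite simple graph that contains neither a triangle nor an ISK4. Then $G$ is a series-parallel graph, or $G$ is a complete bipartite graph, or $G$ has a clique cutset of size at most two, or $G$ has a star cutset.
   Context: Graphs are finite and simple. $G$ contains $H$ if $H$ is isomorphic to an induced subgraph of $G$; $G$ is $F$-free if it does not contain $F$. A subdivision of a graph is obtained by repeatedly replacing an edge $vw$ by a path $v u w$ through a new vertex $u$ (a graph is a subdivision of itself). An ISK4 of $G$ is an induced subgraph of $G$ that is a subdivision of $K_4$; $G$ is ISK4-free if it has no ISK4. A graph is series-parallel if no subgraph (not necessarily induced) of it is a subdivision of $K_4$. A cutset is a set $C$ of vertices such that $G\setminus C$ is disconnected; a clique cutset is a cutset that is a clique; a star cutset is a cutset $C$ containing a vertex $c$ adjacent to all other vertices of $C$. -}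

module Defs where

open import Data.Nat using (ℕ; zero; suc; _≤_)
open import Data.Fin using (Fin; zero; suc; _≟_)
open import Data.Fin.Subset using (Subset; _∈_; _∉_; ∣_∣)
open import Data.Bool using (Bool; true; false; _∧_; _∨_; not)
open import Data.Bool.Properties using (∧-comm; ∨-comm)
open import Data.Product using (Σ; ∃; _×_; _,_)
open import Data.Empty using (⊥; ⊥-elim)
open import Relation.Nullary using (¬_; yes; no)
open import Relation.Nullary.Decidable using (⌊_⌋)
open import Relation.Binary.PropositionalEquality using (_≡_; _≢_; refl; sym; trans; cong; cong₂)
open import Function.Definitions using (Injective)
open import Function.Bundles using (Bijection)

record Graph (n : ℕ) : Set where
  field
    adj     : Fin n → Fin n → Bool
    adj-sym : ∀ i j → adj i j ≡ adj j i
    adj-irr : ∀ i → adj i i ≡ false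
open Graph public

eqb : ∀ {n} → Fin n → Fin n → Bool
eqb i j = ⌊ i ≟ j ⌋

eqb-sym : ∀ {n} (i j : Fin n) → eqb i j ≡ eqb j i
eqb-sym i j with i ≟ j | j ≟ i
... | yes _ | yes _ = refl
... | no _  | no _  = refl
... | yes p | no ¬q = ⊥-elim (¬q (sym p))
... | no ¬p | yes q = ⊥-elim (¬p (sym q))

eqb-refl : ∀ {n} (i : Fin n) → eqb i i ≡ true
eqb-refl i with i ≟ i
... | yes _ = refl
... | no ¬p = ⊥-elim (¬p refl)

K : (k : ℕ) → Graph k
K k = record
  { adj     = λ i j → not (eqb i j)
  ; adj-sym = λ i j → cong not (eqb-sym i j)
  ; adj-irr = λ i → cong not (eqb-refl i)
  }

Contains : ∀ {n m} → Graph n → Graph m → Set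
Contains {n} {m} G H =
  Σ (Fin m → Fin n) λ f →
    Injective _≡_ _≡_ f × (∀ i j → adj G (f i) (f j) ≡ adj H i j)

HasSubgraph : ∀ {n m} → Graph n → Graph m → Set
HasSubgraph {n} {m} G H =
  Σ (Fin m → Fin n) λ f →
    Injective _≡_ _≡_ f × (∀ i j → adj H i j ≡ true → adj G (f i) (f j) ≡ true)

Iso : ∀ {n m} → Graph n → Graph m → Set
Iso {n} {m} G H =
  Σ (Bijection (≡-setoid n) (≡-setoid m)) λ b →
    ∀ i j → adj H (Bijection.to b i) (Bijection.to b j) ≡ adj G i j
  where
  open import Relation.Binary.PropositionalEquality using () renaming (setoid to ≡-setoid′)
  ≡-setoid : ℕ → _
  ≡-setoid k = ≡-setoid′ (Fin k)

samePair : ∀ {n} → Fin n → Fin n → Fin n → Fin n → Bool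
samePair v w i j = (eqb i v ∧ eqb j w) ∨ (eqb i w ∧ eqb j v)

samePair-sym : ∀ {n} (v w i j : Fin n) → samePair v w j i ≡ samePair v w i j
samePair-sym v w i j =
  trans (cong₂ _∨_ (∧-comm (eqb j v) (eqb i w)) (∧-comm (eqb j w) (eqb i v)))
        (∨-comm (eqb i w ∧ eqb j v) (eqb i v ∧ eqb j w))

-- replace the edge vw by a path v u w through a new vertex u;
-- the new vertex is `zero`, old vertex i becomes `suc i`.
subdivAdj : ∀ {n} → Graph n → Fin n → Fin n → Fin (suc n) → Fin (suc n) → Bool
subdivAdj G v w zero    zero    = false
subdivAdj G v w zero    (suc j) = eqb j v ∨ eqb j w
subdivAdj G v w (suc i) zero    = eqb i v ∨ eqb i w
subdivAdj G v w (suc i) (suc j) = adj G i j ∧ not (samePair v w i j)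

subdivAdj-sym : ∀ {n} (G : Graph n) v w i j → subdivAdj G v w i j ≡ subdivAdj G v w j i
subdivAdj-sym G v w zero    zero    = refl
subdivAdj-sym G v w zero    (suc j) = refl
subdivAdj-sym G v w (suc i) zero    = refl
subdivAdj-sym G v w (suc i) (suc j) =
  cong₂ (λ a b → a ∧ not b) (adj-sym G i j) (sym (samePair-sym v w i j))

subdivAdj-irr : ∀ {n} (G : Graph n) v w i → subdivAdj G v w i i ≡ false
subdivAdj-irr G v w zero    = refl
subdivAdj-irr G v w (suc i) = cong (λ a → a ∧ not (samePair v w i i)) (adj-irr G i)

subdivide : ∀ {n} → Graph n → Fin n → Fin n → Graph (suc n)
subdivide G v w = record
  { adj     = subdivAdj G v w
  ; adj-sym = subdivAdj-sym G v w
  ; adj-irr = subdivAdj-irr G v w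
  }

data Subdivision {k : ℕ} (K₀ : Graph k) : {m : ℕ} → Graph m → Set where
  base : ∀ {m} {H : Graph m} → Iso K₀ H → Subdivision K₀ H
  step : ∀ {m} {H : Graph m} {H′ : Graph (suc m)} →
         Subdivision K₀ H → (v w : Fin m) → adj H v w ≡ true →
         Iso (subdivide H v w) H′ → Subdivision K₀ H′

TriangleFree : ∀ {n} → Graph n → Set
TriangleFree G = ¬ Contains G (K 3)

HasISK4 : ∀ {n} → Graph n → Set
HasISK4 G = Σ ℕ λ m → Σ (Graph m) λ H → Subdivision (K 4) H × Contains G H

ISK4Free : ∀ {n} → Graph n → Set
ISK4Free G = ¬ HasISK4 G

SeriesParallel : ∀ {n} → Graph n → Set
SeriesParallel G =
  ¬ (Σ ℕ λ m → Σ (Graph m) λ H → Subdivision (K 4) H × HasSubgraph G H)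

CompleteBipartite : ∀ {n} → Graph n → Set
CompleteBipartite {n} G =
  Σ (Fin n → Bool) λ side →
    (Σ (Fin n) λ a → side a ≡ true) ×
    (Σ (Fin n) λ b → side b ≡ false) ×
    (∀ i j → adj G i j ≡ not (eqb′ (side i) (side j)))
  where
  eqb′ : Bool → Bool → Bool
  eqb′ true  true  = true
  eqb′ false false = true
  eqb′ _     _     = false

data Reach {n} (G : Graph n) (C : Subset n) (u : Fin n) : Fin n → Set where
  here : u ∉ C → Reach G C u u
  next : ∀ {v w} → Reach G C u v → adj G v w ≡ true → w ∉ C → Reach G C u w

Cutset : ∀ {n} → Graph n → Subset n → Set
Cutset {n} G C =
  Σ (Fin n) λ u → Σ (Fin n) λ v → u ∉ C × v ∉ C × ¬ Reach G C u v

IsClique : ∀ {n} → Graph n → Subset n → Set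
IsClique G C = ∀ x y → x ∈ C → y ∈ C → x ≢ y → adj G x y ≡ true

HasSmallCliqueCutset : ∀ {n} → Graph n → Set
HasSmallCliqueCutset {n} G =
  Σ (Subset n) λ C → Cutset G C × IsClique G C × ∣ C ∣ ≤ 2

HasStarCutset : ∀ {n} → Graph n → Set
HasStarCutset {n} G =
  Σ (Subset n) λ C → Cutset G C ×
    (Σ (Fin n) λ c → c ∈ C × (∀ x → x ∈ C → x ≢ c → adj G c x ≡ true))

{-# OPTIONS --safe #-}
module Submission where

-- Suppose that G has no star cutset and is not complete bipartite; both are decidable. If G is not series-parallel, take
-- a subdivision of K₄ in G with the fewest vertices. A chord of it yields a smaller one, a triangle, a K₃,₃ or a wheel
-- (a hole and a hub with at least four neighbours, the spokes, on it), so without chord it is an ISK4.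
--
-- K₃,₃: the vertices A complete to one side and the vertices B complete to the other are complete to each other. If a
-- component of the rest attached to two vertices of the same side, a shortest path through it would close an ISK4, so
-- it attaches to at most one vertex α of A and one β of B, and {α, β} is a star cutset; without such a component, G is
-- complete bipartite.
--
-- Wheels: call a wheel proper if every vertex off the rim and not adjacent to the hub x has at most two neighbours in
-- each closed sector. A shortest wheel is proper. In a proper wheel with the fewest spokes for its hub, a shortest path
-- avoiding the rim and N[x] between rim vertices separated by spokes yields an ISK4 or a proper wheel with the same hub
-- and fewer spokes. So N[x] separates the sectors: it is a star cutset.

open import Defs
open import Data.Nat using (ℕ)
open import Data.Sum using (_⊎_)
open import Data.Nat using (zero; suc; pred; _+_; _≤_; _<_; z≤n; s≤s; _≡ᵇ_)
open import Data.Nat.Properties hiding (suc-injective) renaming (_≟_ to _≟ℕ_)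
open import Data.Nat.Induction using (<-rec)
open import Data.Nat.Tactic.RingSolver using (solve-∀)
open import Data.Bool using (Bool; true; false; if_then_else_; _∧_; _∨_; _xor_; not)
open import Data.Bool.Properties using () renaming (_≟_ to _≟ᵇ_)
open import Data.Fin using (Fin; zero; suc; _≟_; toℕ)
open import Data.Fin.Properties using (suc-injective; toℕ-injective; toℕ<n; all?) renaming (any? to anyF?)
open import Data.Fin.Subset using (Subset) renaming (_∈_ to _∈ˢ_; _∉_ to _∉ˢ_)
open import Data.Fin.Subset.Properties using (anySubset?) renaming (_∈?_ to _∈ˢ?_)
open import Data.List using (List; []; _∷_; _++_; reverse; map)
open import Data.List.Properties using (unfold-reverse; reverse-++; reverse-involutive; ++-assoc; ∷-injective)
open import Data.List.Membership.Propositional using (_∈_; _∉_)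
open import Data.List.Membership.Propositional.Properties using (∈-++⁺ˡ; ∈-++⁺ʳ; ∈-++⁻; ∈-∃++)
open import Data.List.Relation.Unary.Any using (here; there; any?)
open import Data.List.Relation.Unary.Any.Properties using (reverse⁺; reverse⁻)
open import Data.Vec using (tabulate; lookup)
open import Data.Vec.Properties using (lookup∘tabulate; lookup⇒[]=; []=⇒lookup)
open import Data.Product using (∃; _×_; _,_; proj₁; proj₂)
open import Data.Sum using (inj₁; inj₂; [_,_]′)
open import Data.Unit using (⊤; tt)
open import Data.Empty using (⊥; ⊥-elim)
open import Function.Bundles using (Bijection)
open import Function.Construct.Identity using (bijection)
open import Relation.Nullary using (¬_; Dec; yes; no)
open import Relation.Nullary.Decidable using (does; _×-dec_; _⊎-dec_; _→-dec_; ¬?)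
open import Relation.Binary.PropositionalEquality using (_≡_; _≢_; refl; sym; trans; cong; cong₂; subst)

-- On a hole, a vertex outside with exactly three neighbours already gives an ISK4. So all counts of
-- neighbours jump from two to four; this is where the four spokes of a wheel come from. Rerouting
-- the rim through non-neighbours of the hub removes spokes but may lengthen the rim, so minimal
-- length cannot be kept while spokes are being minimised. Properness is the trace of minimal length
-- that survives: only one sector of the rerouted wheel is new, and a bound of three neighbours
-- there is enough. If the kept arc has fewer than four spokes there is no new wheel; three give an
-- ISK4 at once, while for two and one an ear through the removed arc has to be found. Holes and
-- subdivisions are handled through the sums they assign to functions on vertices. Cutting,
-- reversing or rerouting a path is then an identity of sums, and the same identity controls
-- disjointness, numbers of neighbours and length. Both alternatives that are searched for range
-- over subsets of a finite set. Once they are excluded only refutations remain, and case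
-- distinctions may be made under a double negation.

module _ {A : Set} where

  -- The indicator `δ v` turns this into a count of occurrences, `nb w` into a count of neighbours,
  -- the constant 1 into the length. An identity proved for every `f` serves all three, and
  -- regrouping paths becomes arithmetic for the ring solver.
  wsum : (A → ℕ) → List A → ℕ
  wsum f []       = 0
  wsum f (x ∷ xs) = f x + wsum f xs

  wsum-++ : ∀ f xs ys → wsum f (xs ++ ys) ≡ wsum f xs + wsum f ys
  wsum-++ f []       ys = refl
  wsum-++ f (x ∷ xs) ys = trans (cong (f x +_) (wsum-++ f xs ys)) (sym (+-assoc (f x) (wsum f xs) (wsum f ys)))

  wsum-reverse : ∀ f xs → wsum f (reverse xs) ≡ wsum f xs
  wsum-reverse f []       = refl
  wsum-reverse f (x ∷ xs)
    rewrite unfold-reverse x xs | wsum-++ f (reverse xs) (x ∷ []) | wsum-reverse f xs | +-identityʳ (f x)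
    = +-comm (wsum f xs) (f x)

  wtotal : (A → ℕ) → List (List A) → ℕ
  wtotal f []       = 0
  wtotal f (l ∷ ls) = wsum f l + wtotal f ls

  Pair : A → A → A → A → Set
  Pair u w a b = (a ≡ u × b ≡ w) ⊎ (a ≡ w × b ≡ u)

  -- Consecutive, in either order, on the path from u to w whose interior vertices are listed.
  On : A → List A → A → A → A → Set
  On u []       w a b = Pair u w a b
  On u (x ∷ xs) w a b = Pair u x a b ⊎ On x xs w a b

  Pair-sym : ∀ {u w a b} → Pair u w a b → Pair u w b a
  Pair-sym (inj₁ (p , q)) = inj₂ (q , p)
  Pair-sym (inj₂ (p , q)) = inj₁ (q , p)

  Pair-flip : ∀ {u w a b} → Pair u w a b → Pair w u a b
  Pair-flip (inj₁ p) = inj₂ p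
  Pair-flip (inj₂ p) = inj₁ p

  Pair-turn : ∀ {u w a b} → Pair u w a b → Pair a b u w
  Pair-turn (inj₁ (refl , refl)) = inj₁ (refl , refl)
  Pair-turn (inj₂ (refl , refl)) = inj₂ (refl , refl)

  On-sym : ∀ {u} xs {w a b} → On u xs w a b → On u xs w b a
  On-sym []       p        = Pair-sym p
  On-sym (x ∷ xs) (inj₁ p) = inj₁ (Pair-sym p)
  On-sym (x ∷ xs) (inj₂ p) = inj₂ (On-sym xs p)

  On-++⁺ˡ : ∀ {u} xs {v} ys {w a b} → On u xs v a b → On u (xs ++ v ∷ ys) w a b
  On-++⁺ˡ []       ys p        = inj₁ p
  On-++⁺ˡ (x ∷ xs) ys (inj₁ p) = inj₁ p
  On-++⁺ˡ (x ∷ xs) ys (inj₂ p) = inj₂ (On-++⁺ˡ xs ys p)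

  On-++⁺ʳ : ∀ {u} xs {v} ys {w a b} → On v ys w a b → On u (xs ++ v ∷ ys) w a b
  On-++⁺ʳ []       ys p = inj₂ p
  On-++⁺ʳ (x ∷ xs) ys p = inj₂ (On-++⁺ʳ xs ys p)

  On-++⁻ : ∀ {u} xs {v} ys {w a b} → On u (xs ++ v ∷ ys) w a b → On u xs v a b ⊎ On v ys w a b
  On-++⁻ []       ys p        = p
  On-++⁻ (x ∷ xs) ys (inj₁ p) = inj₁ (inj₁ p)
  On-++⁻ (x ∷ xs) ys (inj₂ p) = [ (λ q → inj₁ (inj₂ q)) , inj₂ ]′ (On-++⁻ xs ys p)

  On-reverse : ∀ {u} xs {w a b} → On u xs w a b → On w (reverse xs) u a b
  On-reverse []       p = Pair-flip p
  On-reverse {u} (x ∷ xs) {w} {a} {b} p =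
    subst (λ l → On w l u a b) (sym (unfold-reverse x xs)) (go p)
    where
    go : On u (x ∷ xs) w a b → On w (reverse xs ++ x ∷ []) u a b
    go (inj₁ q) = On-++⁺ʳ (reverse xs) [] (Pair-flip q)
    go (inj₂ q) = On-++⁺ˡ (reverse xs) [] (On-reverse xs q)

  On-∈ : ∀ {u} xs {w a b} → On u xs w a b → a ∈ u ∷ w ∷ xs
  On-∈ []       (inj₁ (refl , _)) = here refl
  On-∈ []       (inj₂ (refl , _)) = there (here refl)
  On-∈ (x ∷ xs) (inj₁ (inj₁ (refl , _))) = here refl
  On-∈ (x ∷ xs) (inj₁ (inj₂ (refl , _))) = there (there (here refl))
  On-∈ (x ∷ xs) (inj₂ p) with On-∈ xs p
  ... | here e          = there (there (here e))
  ... | there (here e)  = there (here e)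
  ... | there (there i) = there (there (there i))

  On-∈ʳ : ∀ {u} xs {w a b} → On u xs w a b → b ∈ u ∷ w ∷ xs
  On-∈ʳ xs p = On-∈ xs (On-sym xs p)

-- Disjoint lists of vertices

module _ {n : ℕ} where

  private V = Fin n

  δ : V → V → ℕ
  δ v u = if eqb v u then 1 else 0

  δ-refl : ∀ v → δ v v ≡ 1
  δ-refl v rewrite eqb-refl v = refl

  ∈⇒1≤ : ∀ {v : V} {xs} → v ∈ xs → 1 ≤ wsum (δ v) xs
  ∈⇒1≤ {v} (here refl) rewrite δ-refl v = s≤s z≤n
  ∈⇒1≤ {v} {x ∷ xs} (there i) = ≤-trans (∈⇒1≤ i) (m≤n+m _ (δ v x))

  1≤⇒∈ : ∀ {v : V} xs → 1 ≤ wsum (δ v) xs → v ∈ xs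
  1≤⇒∈ {v} (x ∷ xs) h with v ≟ x
  ... | yes e = here e
  ... | no _  = there (1≤⇒∈ xs h)

  _∈?_ : (v : V) (xs : List V) → Dec (v ∈ xs)
  v ∈? xs = any? (v ≟_) xs

  -- A single inequality says both that no list has a repetition and that no two lists meet. It is
  -- inherited by every family of lists with no larger sums.
  record Apart (ls : List (List V)) : Set where
    constructor mk-apart
    field once : ∀ v → wtotal (δ v) ls ≤ 1
  open Apart public

  Apart-mono : ∀ {ls ls′} → (∀ f → wtotal f ls′ ≤ wtotal f ls) → Apart ls → Apart ls′
  Apart-mono h d = mk-apart λ v → ≤-trans (h (δ v)) (once d v)

  -- Only the position of a list in the family is kept: two different positions of one vertex
  -- contradict `Apart`, whatever the lists contain.
  data _∈at_ (v : V) : List (List V) → ℕ → Set where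
    at0 : ∀ {l ls} → v ∈ l → (v ∈at (l ∷ ls)) 0
    atS : ∀ {l ls i} → (v ∈at ls) i → (v ∈at (l ∷ ls)) (suc i)

  at⇒1≤ : ∀ {v ls i} → (v ∈at ls) i → 1 ≤ wtotal (δ v) ls
  at⇒1≤ (at0 p) = ≤-trans (∈⇒1≤ p) (m≤m+n _ _)
  at⇒1≤ {v} {l ∷ ls} (atS p) = ≤-trans (at⇒1≤ p) (m≤n+m _ (wsum (δ v) l))

  at⇒2≤ : ∀ {v ls i j} → i ≢ j → (v ∈at ls) i → (v ∈at ls) j → 2 ≤ wtotal (δ v) ls
  at⇒2≤ ne (at0 p) (at0 q) = ⊥-elim (ne refl)
  at⇒2≤ ne (at0 p) (atS q) = +-mono-≤ (∈⇒1≤ p) (at⇒1≤ q)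
  at⇒2≤ {v} {l ∷ ls} ne (atS p) (at0 q) = +-mono-≤ (∈⇒1≤ q) (at⇒1≤ p)
  at⇒2≤ {v} {l ∷ ls} ne (atS p) (atS q) = ≤-trans (at⇒2≤ (λ e → ne (cong suc e)) p q) (m≤n+m _ (wsum (δ v) l))

  apart : ∀ {ls} → Apart ls → ∀ {v i j} → i ≢ j → (v ∈at ls) i → (v ∈at ls) j → ⊥
  apart d {v} ne p q = <⇒≱ (at⇒2≤ ne p q) (once d v)

  Uniq : List V → Set
  Uniq xs = ∀ v → wsum (δ v) xs ≤ 1

  Uniq-head : ∀ (x : V) xs → Uniq (x ∷ xs) → x ∉ xs
  Uniq-head x xs u i = <⇒≱ (+-mono-≤ (≤-reflexive (sym (δ-refl x))) (∈⇒1≤ i)) (u x)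

  Uniq-tail : ∀ (x : V) xs → Uniq (x ∷ xs) → Uniq xs
  Uniq-tail x xs u v = ≤-trans (m≤n+m _ (δ v x)) (u v)

  wsum≤wtotal : ∀ (f : V → ℕ) {l ls} → l ∈ ls → wsum f l ≤ wtotal f ls
  wsum≤wtotal f (here refl) = m≤m+n _ _
  wsum≤wtotal f {ls = l ∷ ls} (there i) = ≤-trans (wsum≤wtotal f i) (m≤n+m _ (wsum f l))

  apart-uniq : ∀ {l ls} → l ∈ ls → Apart ls → Uniq l
  apart-uniq i d v = ≤-trans (wsum≤wtotal (δ v) i) (once d v)

  Within : List (List V) → List ℕ → List V → Set
  Within ls is xs = ∀ {x} → x ∈ xs → ∃ λ i → i ∈ is × (x ∈at ls) i

  _∉ᵇ_ : ℕ → List ℕ → Bool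
  i ∉ᵇ []       = true
  i ∉ᵇ (j ∷ js) = not (i ≡ᵇ j) ∧ (i ∉ᵇ js)

  disjointᵇ : List ℕ → List ℕ → Bool
  disjointᵇ []       js = true
  disjointᵇ (i ∷ is) js = (i ∉ᵇ js) ∧ disjointᵇ is js

  private
    ∧-left : ∀ {a b} → a ∧ b ≡ true → a ≡ true
    ∧-left {true} h = refl
    ∧-right : ∀ {a b} → a ∧ b ≡ true → b ≡ true
    ∧-right {true} h = h

    ∉ᵇ⇒≢ : ∀ {i j} js → (i ∉ᵇ js) ≡ true → j ∈ js → i ≢ j
    ∉ᵇ⇒≢ {i} (j ∷ js) h (here refl) refl with i ≡ᵇ i | ≡⇒≡ᵇ i i refl
    ∉ᵇ⇒≢ {i} (j ∷ js) () (here refl) refl | true | _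
    ∉ᵇ⇒≢ {i} (j ∷ js) h (there p) e = ∉ᵇ⇒≢ js (∧-right {not (i ≡ᵇ j)} h) p e

    disjointᵇ⇒≢ : ∀ {i j} is js → disjointᵇ is js ≡ true → i ∈ is → j ∈ js → i ≢ j
    disjointᵇ⇒≢ (i ∷ is) js h (here refl) q = ∉ᵇ⇒≢ js (∧-left {i ∉ᵇ js} h) q
    disjointᵇ⇒≢ (i ∷ is) js h (there p) q = disjointᵇ⇒≢ is js (∧-right {i ∉ᵇ js} h) p q

  -- Positions are numerals, so `disjointᵇ` evaluates and callers supply `refl`. A union of segments
  -- is thereby separated from another one without a case for each pair.
  apart-within : ∀ {ls} → Apart ls → ∀ {is js xs ys} → Within ls is xs → Within ls js ys →
                 disjointᵇ is js ≡ true → ∀ {x} → x ∈ xs → x ∈ ys → ⊥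
  apart-within d {is} {js} wx wy h p q with wx p | wy q
  ... | i , i∈ , pi | j , j∈ , pj = apart d (disjointᵇ⇒≢ is js h i∈ j∈) pi pj

  within-∷ : ∀ {ls v i is xs} → (v ∈at ls) i → Within ls is xs → Within ls (i ∷ is) (v ∷ xs)
  within-∷ {i = i} p w (here refl) = i , here refl , p
  within-∷ p w (there q) = let j , j∈ , r = w q in j , there j∈ , r

  within-seg : ∀ {ls i xs} → (∀ {x} → x ∈ xs → (x ∈at ls) i) → Within ls (i ∷ []) xs
  within-seg {i = i} h p = i , here refl , h p

  δ≤1 : ∀ (v u : V) → δ v u ≤ 1
  δ≤1 v u with eqb v u
  ... | true  = ≤-refl
  ... | false = z≤n

eqb⇒≡ : ∀ {n} {i j : Fin n} → eqb i j ≡ true → i ≡ j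
eqb⇒≡ {i = i} {j} h with i ≟ j
... | yes e = e
eqb⇒≡ () | no _

≢⇒eqb : ∀ {n} {i j : Fin n} → i ≢ j → eqb i j ≡ false
≢⇒eqb {i = i} {j} h with i ≟ j
... | yes e = ⊥-elim (h e)
... | no _  = refl

∨-true : ∀ {a b} → a ∨ b ≡ true → a ≡ true ⊎ b ≡ true
∨-true {true}  h = inj₁ refl
∨-true {false} h = inj₂ h

∧-true : ∀ {a b} → a ∧ b ≡ true → a ≡ true × b ≡ true
∧-true {true} {true} h = refl , refl

not-true : ∀ {x} → x ≡ true → not x ≡ true → ⊥
not-true refl ()

samePair⇒Pair : ∀ {n} {v w i j : Fin n} → samePair v w i j ≡ true → Pair v w i j
samePair⇒Pair {v = v} {w} {i} {j} h with ∨-true {eqb i v ∧ eqb j w} h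
... | inj₁ p = let q , r = ∧-true {eqb i v} p in inj₁ (eqb⇒≡ q , eqb⇒≡ r)
... | inj₂ p = let q , r = ∧-true {eqb i w} p in inj₂ (eqb⇒≡ q , eqb⇒≡ r)

¬Pair⇒samePair : ∀ {n} {v w i j : Fin n} → ¬ Pair v w i j → samePair v w i j ≡ false
¬Pair⇒samePair {v = v} {w} {i} {j} h with samePair v w i j in e
... | false = refl
... | true  = ⊥-elim (h (samePair⇒Pair e))

Pair⇒samePair : ∀ {n} {v w i j : Fin n} → Pair v w i j → samePair v w i j ≡ true
Pair⇒samePair {v = v} {w} (inj₁ (refl , refl)) rewrite eqb-refl v | eqb-refl w = refl
Pair⇒samePair {v = v} {w} (inj₂ (refl , refl)) rewrite eqb-refl v | eqb-refl w with eqb w v ∧ eqb v w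
... | true  = refl
... | false = refl

bool-ext : ∀ {x y : Bool} → (x ≡ true → y ≡ true) → (y ≡ true → x ≡ true) → x ≡ y
bool-ext {true}  {true}  p q = refl
bool-ext {true}  {false} p q = sym (p refl)
bool-ext {false} {true}  p q = q refl
bool-ext {false} {false} p q = refl

Iso-refl : ∀ {n} {H : Graph n} → Iso H H
Iso-refl {n} = bijection _ , λ i j → refl

-- Walks and subdivisions of K₄

module Paths-in {n : ℕ} (G : Graph n) where

  V : Set
  V = Fin n

  infix 4 _~_ _≁_

  _~_ _≁_ : V → V → Set
  a ~ b = adj G a b ≡ true
  a ≁ b = ¬ a ~ b

  ~-sym : ∀ {a b} → a ~ b → b ~ a
  ~-sym {a} {b} h = trans (adj-sym G b a) h

  ~-irr : ∀ {a} → a ≁ a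
  ~-irr {a} h with trans (sym (adj-irr G a)) h
  ... | ()

  ~⇒≢ : ∀ {a b} → a ~ b → a ≢ b
  ~⇒≢ h refl = ~-irr h

  _~?_ : ∀ a b → Dec (a ~ b)
  a ~? b with adj G a b
  ... | true  = yes refl
  ... | false = no λ ()

  -- The list holds the interior vertices.
  Walk : V → List V → V → Set
  Walk u []       w = u ~ w
  Walk u (x ∷ xs) w = u ~ x × Walk x xs w

  Walk-++ : ∀ {u} xs {v} ys {w} → Walk u xs v → Walk v ys w → Walk u (xs ++ v ∷ ys) w
  Walk-++ []       ys p       q = p , q
  Walk-++ (x ∷ xs) ys (p , r) q = p , Walk-++ xs ys r q

  Walk-++⁻ : ∀ {u} xs {v} ys {w} → Walk u (xs ++ v ∷ ys) w → Walk u xs v × Walk v ys w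
  Walk-++⁻ []       ys p       = p
  Walk-++⁻ (x ∷ xs) ys (p , q) = let r , s = Walk-++⁻ xs ys q in (p , r) , s

  Walk-reverse : ∀ {u} xs {w} → Walk u xs w → Walk w (reverse xs) u
  Walk-reverse []       p = ~-sym p
  Walk-reverse {u} (x ∷ xs) {w} (p , q) =
    subst (λ l → Walk w l u) (sym (unfold-reverse x xs)) (Walk-++ (reverse xs) [] (Walk-reverse xs q) (~-sym p))

  On⇒~ : ∀ {u} xs {w} → Walk u xs w → ∀ {a b} → On u xs w a b → a ~ b
  On⇒~ []       p       (inj₁ (refl , refl)) = p
  On⇒~ []       p       (inj₂ (refl , refl)) = ~-sym p
  On⇒~ (x ∷ xs) (p , q) (inj₁ (inj₁ (refl , refl))) = p
  On⇒~ (x ∷ xs) (p , q) (inj₁ (inj₂ (refl , refl))) = ~-sym p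
  On⇒~ (x ∷ xs) (p , q) (inj₂ o) = On⇒~ xs q o

  -- A not necessarily induced subdivision of K₄ with corners a, b, c, d; ab is the interior of the path from a to b, etc.
  record TK4 : Set where
    field
      a b c d           : V
      ab ac ad bc bd cd : List V
      wab : Walk a ab b
      wac : Walk a ac c
      wad : Walk a ad d
      wbc : Walk b bc c
      wbd : Walk b bd d
      wcd : Walk c cd d

    segs : List (List V)
    segs = (a ∷ []) ∷ (b ∷ []) ∷ (c ∷ []) ∷ (d ∷ []) ∷ ab ∷ ac ∷ ad ∷ bc ∷ bd ∷ cd ∷ []

    field
      ap : Apart segs

    at-a : (a ∈at segs) 0
    at-a = at0 (here refl)
    at-b : (b ∈at segs) 1
    at-b = atS (at0 (here refl))
    at-c : (c ∈at segs) 2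
    at-c = atS (atS (at0 (here refl)))
    at-d : (d ∈at segs) 3
    at-d = atS (atS (atS (at0 (here refl))))
    in-ab : ∀ {v} → v ∈ ab → (v ∈at segs) 4
    in-ab p = atS (atS (atS (atS (at0 p))))
    in-ac : ∀ {v} → v ∈ ac → (v ∈at segs) 5
    in-ac p = atS (atS (atS (atS (atS (at0 p)))))
    in-ad : ∀ {v} → v ∈ ad → (v ∈at segs) 6
    in-ad p = atS (atS (atS (atS (atS (atS (at0 p))))))
    in-bc : ∀ {v} → v ∈ bc → (v ∈at segs) 7
    in-bc p = atS (atS (atS (atS (atS (atS (atS (at0 p)))))))
    in-bd : ∀ {v} → v ∈ bd → (v ∈at segs) 8
    in-bd p = atS (atS (atS (atS (atS (atS (atS (atS (at0 p))))))))
    in-cd : ∀ {v} → v ∈ cd → (v ∈at segs) 9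
    in-cd p = atS (atS (atS (atS (atS (atS (atS (atS (atS (at0 p)))))))))

    Vert : V → Set
    Vert v = ∃ λ i → (v ∈at segs) i

    Edge : V → V → Set
    Edge x y = On a ab b x y ⊎ On a ac c x y ⊎ On a ad d x y ⊎ On b bc c x y ⊎ On b bd d x y ⊎ On c cd d x y

  -- The graph with vertex set S and edge set E is a subdivision of K₄.
  record Rep (S : V → Set) (E : V → V → Set) : Set where
    constructor rep
    field
      {m}  : ℕ
      H    : Graph m
      sub  : Subdivision (K 4) H
      f    : Fin m → V
      inj  : ∀ {i j} → f i ≡ f j → i ≡ j
      im   : ∀ i → S (f i)
      sur  : ∀ {v} → S v → ∃ λ i → f i ≡ v
      to   : ∀ i j → adj H i j ≡ true → E (f i) (f j)
      from : ∀ i j → E (f i) (f j) → adj H i j ≡ true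

  Rep-map : ∀ {S S′ : V → Set} {E E′ : V → V → Set} → (∀ {v} → S v → S′ v) → (∀ {v} → S′ v → S v) →
            (∀ {a b} → E a b → E′ a b) → (∀ {a b} → E′ a b → E a b) → Rep S E → Rep S′ E′
  Rep-map s s′ e e′ (rep H sub f inj im sur to from) =
    rep H sub f inj (λ i → s (im i)) (λ p → sur (s′ p)) (λ i j p → e (to i j p)) (λ i j p → from i j (e′ p))

  -- `subdivide` deletes the edge `v w`. The edge may therefore not occur a second time in `E`,
  -- where it would have to survive.
  Rep-insert : ∀ {S : V → Set} {E : V → V → Set} {v w u : V} → Rep S (λ a b → Pair v w a b ⊎ E a b) → ¬ S u → S v → S w →
    (∀ {a b} → E a b → S a × S b) → (∀ {a b} → E a b → E b a) → ¬ E v w →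
    Rep (λ a → a ≡ u ⊎ S a) (λ a b → Pair u w a b ⊎ Pair v u a b ⊎ E a b)
  Rep-insert {S} {E} {v} {w} {u} (rep {m} H sub f inj im sur to from) ¬Su Sv Sw E⊆ Esym ¬Evw
    with sur Sv | sur Sw
  ... | i , refl | j , refl = rep H′ (step sub i j (from i j (inj₁ (inj₁ (refl , refl)))) (Iso-refl {H = H′})) g ginj gim gsur gto gfrom
    where
    H′ = subdivide H i j
    g : Fin (suc m) → V
    g zero = u
    g (suc k) = f k
    ne : ∀ {k} → f k ≢ u
    ne {k} refl = ¬Su (im k)
    ginj : ∀ {k l} → g k ≡ g l → k ≡ l
    ginj {zero}  {zero}  e = refl
    ginj {zero}  {suc l} e = ⊥-elim (ne (sym e))
    ginj {suc k} {zero}  e = ⊥-elim (ne e)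
    ginj {suc k} {suc l} e = cong suc (inj e)
    gim : ∀ k → g k ≡ u ⊎ S (g k)
    gim zero = inj₁ refl
    gim (suc k) = inj₂ (im k)
    gsur : ∀ {x} → x ≡ u ⊎ S x → ∃ λ k → g k ≡ x
    gsur (inj₁ refl) = zero , refl
    gsur (inj₂ p) = let k , e = sur p in suc k , e
    E′ : V → V → Set
    E′ a b = Pair u (f j) a b ⊎ Pair (f i) u a b ⊎ E a b
    E′sym : ∀ {a b} → E′ a b → E′ b a
    E′sym (inj₁ p) = inj₁ (Pair-sym p)
    E′sym (inj₂ (inj₁ p)) = inj₂ (inj₁ (Pair-sym p))
    E′sym (inj₂ (inj₂ p)) = inj₂ (inj₂ (Esym p))
    to0 : ∀ k → eqb k i ∨ eqb k j ≡ true → E′ u (f k)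
    to0 k h with ∨-true {eqb k i} h
    ... | inj₁ p = inj₂ (inj₁ (inj₂ (refl , cong f (eqb⇒≡ p))))
    ... | inj₂ p = inj₁ (inj₁ (refl , cong f (eqb⇒≡ p)))
    from0 : ∀ k → E′ u (f k) → eqb k i ∨ eqb k j ≡ true
    from0 k (inj₁ (inj₁ (_ , e))) rewrite inj e | eqb-refl j with eqb j i
    ... | true  = refl
    ... | false = refl
    from0 k (inj₁ (inj₂ (_ , e))) = ⊥-elim (ne e)
    from0 k (inj₂ (inj₁ (inj₁ (_ , e)))) = ⊥-elim (ne e)
    from0 k (inj₂ (inj₁ (inj₂ (_ , e)))) rewrite inj e | eqb-refl i = refl
    from0 k (inj₂ (inj₂ e)) = ⊥-elim (¬Su (proj₁ (E⊆ e)))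
    gto : ∀ k l → adj H′ k l ≡ true → E′ (g k) (g l)
    gto zero    (suc l) h = to0 l h
    gto (suc k) zero    h = E′sym (to0 k h)
    gto (suc k) (suc l) h with ∧-true {adj H k l} h
    ... | p , q with to k l p
    ...   | inj₂ e = inj₂ (inj₂ e)
    ...   | inj₁ pr with Pair⇒samePair {v = i} {j} {k} {l} (pull pr)
      where
      pull : Pair (f i) (f j) (f k) (f l) → Pair i j k l
      pull (inj₁ (x , y)) = inj₁ (inj x , inj y)
      pull (inj₂ (x , y)) = inj₂ (inj x , inj y)
    ...     | sp = ⊥-elim (not-true sp q)
    no-pair : ∀ k l → E (f k) (f l) → ¬ Pair i j k l
    no-pair k l e (inj₁ (refl , refl)) = ¬Evw e
    no-pair k l e (inj₂ (refl , refl)) = ¬Evw (Esym e)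
    gfrom : ∀ k l → E′ (g k) (g l) → adj H′ k l ≡ true
    gfrom zero zero (inj₁ (inj₁ (_ , e))) = ⊥-elim (ne (sym e))
    gfrom zero zero (inj₁ (inj₂ (e , _))) = ⊥-elim (ne (sym e))
    gfrom zero zero (inj₂ (inj₁ (inj₁ (e , _)))) = ⊥-elim (ne (sym e))
    gfrom zero zero (inj₂ (inj₁ (inj₂ (_ , e)))) = ⊥-elim (ne (sym e))
    gfrom zero zero (inj₂ (inj₂ e)) = ⊥-elim (¬Su (proj₁ (E⊆ e)))
    gfrom zero (suc l) e = from0 l e
    gfrom (suc k) zero e = from0 k (E′sym e)
    gfrom (suc k) (suc l) (inj₁ (inj₁ (e , _))) = ⊥-elim (ne e)
    gfrom (suc k) (suc l) (inj₁ (inj₂ (_ , e))) = ⊥-elim (ne e)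
    gfrom (suc k) (suc l) (inj₂ (inj₁ (inj₁ (_ , e)))) = ⊥-elim (ne e)
    gfrom (suc k) (suc l) (inj₂ (inj₁ (inj₂ (e , _)))) = ⊥-elim (ne e)
    gfrom (suc k) (suc l) (inj₂ (inj₂ e)) rewrite from k l (inj₂ e) | ¬Pair⇒samePair {v = i} {j} {k} {l} (no-pair k l e) = refl

  -- The path is grown from `v`: its first interior vertex subdivides `v w`, and the remaining ones
  -- subdivide the new edge from there to `w`.
  Rep-path : ∀ {S : V → Set} {E : V → V → Set} {v w : V} (us : List V) → Rep S (λ a b → Pair v w a b ⊎ E a b) → Uniq us → (∀ {u} → u ∈ us → ¬ S u) →
    S v → S w → v ≢ w → (∀ {a b} → E a b → S a × S b) → (∀ {a b} → E a b → E b a) → ¬ E v w →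
    Rep (λ a → a ∈ us ⊎ S a) (λ a b → On v us w a b ⊎ E a b)
  Rep-path [] r un fr Sv Sw ne E⊆ Es ¬E = Rep-map inj₂ (λ { (inj₂ s) → s }) (λ e → e) (λ e → e) r
  Rep-path {S} {E} {v} {w} (u ∷ us) r un fr Sv Sw ne E⊆ Es ¬E =
    Rep-map fwd bwd efwd ebwd
      (Rep-path {λ a → a ≡ u ⊎ S a} {λ a b → Pair v u a b ⊎ E a b} {u} {w} us
        (Rep-insert r (fr (here refl)) Sv Sw E⊆ Es ¬E) (Uniq-tail u us un) fr′
        (inj₁ refl) (inj₂ Sw) (λ { refl → fr (here refl) Sw }) E⊆′ Es′ ¬E′)
    where
    fr′ : ∀ {x} → x ∈ us → ¬ (x ≡ u ⊎ S x)
    fr′ i (inj₁ refl) = Uniq-head u us un i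
    fr′ i (inj₂ s) = fr (there i) s
    E⊆′ : ∀ {a b} → Pair v u a b ⊎ E a b → (a ≡ u ⊎ S a) × (b ≡ u ⊎ S b)
    E⊆′ (inj₁ (inj₁ (refl , refl))) = inj₂ Sv , inj₁ refl
    E⊆′ (inj₁ (inj₂ (refl , refl))) = inj₁ refl , inj₂ Sv
    E⊆′ (inj₂ e) = inj₂ (proj₁ (E⊆ e)) , inj₂ (proj₂ (E⊆ e))
    Es′ : ∀ {a b} → Pair v u a b ⊎ E a b → Pair v u b a ⊎ E b a
    Es′ (inj₁ p) = inj₁ (Pair-sym p)
    Es′ (inj₂ e) = inj₂ (Es e)
    ¬E′ : ¬ (Pair v u u w ⊎ E u w)
    ¬E′ (inj₁ (inj₁ (refl , _))) = fr (here refl) Sv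
    ¬E′ (inj₁ (inj₂ (_ , refl))) = ne refl
    ¬E′ (inj₂ e) = fr (here refl) (proj₁ (E⊆ e))
    fwd : ∀ {x} → x ∈ us ⊎ (x ≡ u ⊎ S x) → x ∈ u ∷ us ⊎ S x
    fwd (inj₁ i) = inj₁ (there i)
    fwd (inj₂ (inj₁ e)) = inj₁ (here e)
    fwd (inj₂ (inj₂ s)) = inj₂ s
    bwd : ∀ {x} → x ∈ u ∷ us ⊎ S x → x ∈ us ⊎ (x ≡ u ⊎ S x)
    bwd (inj₁ (here e)) = inj₂ (inj₁ e)
    bwd (inj₁ (there i)) = inj₁ i
    bwd (inj₂ s) = inj₂ (inj₂ s)
    efwd : ∀ {a b} → On u us w a b ⊎ (Pair v u a b ⊎ E a b) → On v (u ∷ us) w a b ⊎ E a b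
    efwd (inj₁ o) = inj₁ (inj₂ o)
    efwd (inj₂ (inj₁ p)) = inj₁ (inj₁ p)
    efwd (inj₂ (inj₂ e)) = inj₂ e
    ebwd : ∀ {a b} → On v (u ∷ us) w a b ⊎ E a b → On u us w a b ⊎ (Pair v u a b ⊎ E a b)
    ebwd (inj₁ (inj₁ p)) = inj₂ (inj₁ p)
    ebwd (inj₁ (inj₂ o)) = inj₁ o
    ebwd (inj₂ e) = inj₂ (inj₂ e)

  Rep⇒ISK4 : ∀ {S : V → Set} {E : V → V → Set} → Rep S E →
             (∀ {x y} → S x → S y → x ~ y → E x y) → (∀ {x y} → E x y → x ~ y) → HasISK4 G
  Rep⇒ISK4 (rep {m} H sub f inj im sur to from) ind adj′ = m , H , sub , f , inj ,
    λ i j → bool-ext (λ p → from i j (ind (im i) (im j) p)) (λ p → adj′ (to i j p))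

  module Arcs (f : Fin 4 → V) (f-inj : ∀ {i j} → f i ≡ f j → i ≡ j) where

    Arc : Set
    Arc = Fin 4 × List V × Fin 4

    OnA : List Arc → V → V → Set
    OnA []                x y = ⊥
    OnA ((i , us , j) ∷ as) x y = On (f i) us (f j) x y ⊎ OnA as x y

    strip : List Arc → List Arc
    strip []                  = []
    strip ((i , us , j) ∷ as) = (i , [] , j) ∷ strip as

    clash : Fin 4 → Fin 4 → List Arc → Bool
    clash k l []                  = false
    clash k l ((i , us , j) ∷ as) = samePair i j k l ∨ clash k l as

    -- No arc is a loop and no two arcs have the same pair of ends. Interiors do not enter, so as a
    -- Boolean function it is settled by `refl` for the six arcs of K₄.
    simple : List Arc → List Arc → Bool
    simple []                    done = true
    simple ((k , us , l) ∷ todo) done =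
      (not (clash k l (strip todo ++ done)) ∧ not (eqb k l)) ∧ simple todo ((k , us , l) ∷ done)

    Placed : (V → Set) → List Arc → Set
    Placed S as = ∀ {k us l u} → (k , us , l) ∈ as → u ∈ us → S u × (∀ i → u ≢ f i)

    Fresh : (V → Set) → List Arc → Set
    Fresh S []                  = ⊤
    Fresh S ((k , us , l) ∷ as) = ((∀ {u} → u ∈ us → ¬ S u) × Uniq us) × Fresh (λ x → x ∈ us ⊎ S x) as

    Union : (V → Set) → List Arc → V → Set
    Union S []                  = S
    Union S ((k , us , l) ∷ as) = Union (λ x → x ∈ us ⊎ S x) as

    move : List Arc → List Arc → List Arc
    move []       done = done
    move (a ∷ as) done = move as (a ∷ done)

    OnA-sym : ∀ as {x y} → OnA as x y → OnA as y x
    OnA-sym ((i , us , j) ∷ as) (inj₁ o) = inj₁ (On-sym us o)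
    OnA-sym (_ ∷ as)            (inj₂ o) = inj₂ (OnA-sym as o)

    OnA-++⁻ : ∀ as {bs x y} → OnA (as ++ bs) x y → OnA as x y ⊎ OnA bs x y
    OnA-++⁻ []       o        = inj₂ o
    OnA-++⁻ (_ ∷ as) (inj₁ o) = inj₁ (inj₁ o)
    OnA-++⁻ (_ ∷ as) (inj₂ o) = [ (λ p → inj₁ (inj₂ p)) , inj₂ ]′ (OnA-++⁻ as o)

    OnA-++⁺ˡ : ∀ as {bs x y} → OnA as x y → OnA (as ++ bs) x y
    OnA-++⁺ˡ (_ ∷ as) (inj₁ o) = inj₁ o
    OnA-++⁺ˡ (_ ∷ as) (inj₂ o) = inj₂ (OnA-++⁺ˡ as o)

    OnA-++⁺ʳ : ∀ as {bs x y} → OnA bs x y → OnA (as ++ bs) x y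
    OnA-++⁺ʳ []       o = o
    OnA-++⁺ʳ (_ ∷ as) o = inj₂ (OnA-++⁺ʳ as o)

    Placed-strip : ∀ {S : V → Set} as → Placed S (strip as)
    Placed-strip ((i , us , j) ∷ as) (here refl) ()
    Placed-strip {S} (_ ∷ as)        (there p) q = Placed-strip {S} as p q

    Placed-++ : ∀ {S : V → Set} as {bs} → Placed S as → Placed S bs → Placed S (as ++ bs)
    Placed-++ as p q i = [ p , q ]′ (∈-++⁻ as i)

    OnA-⊆ : ∀ {S : V → Set} as → (∀ i → S (f i)) → Placed S as → ∀ {x y} → OnA as x y → S x
    OnA-⊆ ((i , us , j) ∷ as) c p (inj₁ o) with On-∈ us o
    ... | here refl         = c i
    ... | there (here refl) = c j
    ... | there (there q)   = proj₁ (p (here refl) q)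
    OnA-⊆ {S} (_ ∷ as) c p (inj₂ o) = OnA-⊆ {S} as c (λ q → p (there q)) o

    OnA-clash : ∀ {S : V → Set} as k l → k ≢ l → Placed S as → OnA as (f k) (f l) → clash k l as ≡ true
    OnA-clash ((i , us , j) ∷ as) k l ne p (inj₁ o)
      with On-∈ us o | On-∈ʳ us o
    ... | there (there q) | _ = ⊥-elim (proj₂ (p (here refl) q) k refl)
    ... | _ | there (there q) = ⊥-elim (proj₂ (p (here refl) q) l refl)
    ... | here e          | here e′         = ⊥-elim (ne (f-inj (trans e (sym e′))))
    ... | there (here e)  | there (here e′) = ⊥-elim (ne (f-inj (trans e (sym e′))))
    ... | here e          | there (here e′)
      rewrite Pair⇒samePair {v = i} {j} {k} {l} (inj₁ (f-inj e , f-inj e′)) = refl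
    ... | there (here e)  | here e′
      rewrite Pair⇒samePair {v = i} {j} {k} {l} (inj₂ (f-inj e , f-inj e′)) = refl
    OnA-clash {S} ((i , us , j) ∷ as) k l ne p (inj₂ o)
      rewrite OnA-clash {S} as k l ne (λ q → p (there q)) o with samePair i j k l
    ... | true  = refl
    ... | false = refl

    Rep-arcs : ∀ todo done {S : V → Set} → Rep S (OnA (strip todo ++ done)) → (∀ i → S (f i)) → Placed S done →
               Fresh S todo → simple todo done ≡ true → Rep (Union S todo) (OnA (move todo done))
    Rep-arcs []                    done r c p fr s = r
    Rep-arcs ((k , us , l) ∷ todo) done {S} r c p ((fr , un) , frs) s
      with ∧-true {not (clash k l (strip todo ++ done)) ∧ not (eqb k l)} s
    ... | s₁ , s₂ with ∧-true {not (clash k l (strip todo ++ done))} s₁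
    ...   | s₃ , s₄ =
      Rep-arcs todo ((k , us , l) ∷ done)
        (Rep-map (λ z → z) (λ z → z) there′ back′
          (Rep-path {S} {OnA (strip todo ++ done)} us r un fr (c k) (c l) (λ e → k≢l (f-inj e))
            (λ o → OnA-⊆ {S} all c pl o , OnA-⊆ {S} all c pl (OnA-sym all o)) (OnA-sym all) no-clash))
        (λ i → inj₂ (c i)) placed frs s₂
      where
      all = strip todo ++ done
      pl : Placed S all
      pl = Placed-++ {S} (strip todo) (Placed-strip {S} todo) p
      k≢l : k ≢ l
      k≢l refl = not-true (eqb-refl k) s₄
      no-clash : ¬ OnA all (f k) (f l)
      no-clash o = not-true (OnA-clash {S} all k l k≢l pl o) s₃
      there′ : ∀ {x y} → On (f k) us (f l) x y ⊎ OnA all x y → OnA (strip todo ++ (k , us , l) ∷ done) x y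
      there′ (inj₁ o) = OnA-++⁺ʳ (strip todo) (inj₁ o)
      there′ (inj₂ o) with OnA-++⁻ (strip todo) o
      ... | inj₁ q = OnA-++⁺ˡ (strip todo) q
      ... | inj₂ q = OnA-++⁺ʳ (strip todo) (inj₂ q)
      back′ : ∀ {x y} → OnA (strip todo ++ (k , us , l) ∷ done) x y → On (f k) us (f l) x y ⊎ OnA all x y
      back′ o with OnA-++⁻ (strip todo) o
      ... | inj₁ q        = inj₂ (OnA-++⁺ˡ (strip todo) q)
      ... | inj₂ (inj₁ q) = inj₁ q
      ... | inj₂ (inj₂ q) = inj₂ (OnA-++⁺ʳ (strip todo) q)
      placed : Placed (λ x → x ∈ us ⊎ S x) ((k , us , l) ∷ done)
      placed (here refl) q = inj₁ q , λ { i refl → fr q (c i) }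
      placed (there r) q = inj₂ (proj₁ (p r q)) , proj₂ (p r q)

  module _ (t : TK4) where
    open TK4 t
    private
      pattern 0F = zero
      pattern 1F = suc zero
      pattern 2F = suc (suc zero)
      pattern 3F = suc (suc (suc zero))

      corner : Fin 4 → V
      corner 0F = a
      corner 1F = b
      corner 2F = c
      corner 3F = d

      corner-at : ∀ i → (corner i ∈at segs) (toℕ i)
      corner-at 0F = at-a
      corner-at 1F = at-b
      corner-at 2F = at-c
      corner-at 3F = at-d

      corner-inj : ∀ {i j} → corner i ≡ corner j → i ≡ j
      corner-inj {i} {j} e with toℕ i ≟ℕ toℕ j
      ... | yes p = toℕ-injective p
      ... | no ne = ⊥-elim (apart ap ne (corner-at i) (subst (λ v → (v ∈at segs) (toℕ j)) (sym e) (corner-at j)))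

      open Arcs corner corner-inj

      arcs : List Arc
      arcs = (0F , ab , 1F) ∷ (0F , ac , 2F) ∷ (0F , ad , 3F) ∷ (1F , bc , 2F) ∷ (1F , bd , 3F) ∷ (2F , cd , 3F) ∷ []

      IsCorner : V → Set
      IsCorner v = ∃ λ i → corner i ≡ v

      K4-edges : ∀ i j → i ≢ j → OnA (strip arcs) (corner i) (corner j)
      K4-edges 0F 0F ne = ⊥-elim (ne refl)
      K4-edges 1F 1F ne = ⊥-elim (ne refl)
      K4-edges 2F 2F ne = ⊥-elim (ne refl)
      K4-edges 3F 3F ne = ⊥-elim (ne refl)
      K4-edges 0F 1F ne = inj₁ (inj₁ (refl , refl))
      K4-edges 1F 0F ne = inj₁ (inj₂ (refl , refl))
      K4-edges 0F 2F ne = inj₂ (inj₁ (inj₁ (refl , refl)))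
      K4-edges 2F 0F ne = inj₂ (inj₁ (inj₂ (refl , refl)))
      K4-edges 0F 3F ne = inj₂ (inj₂ (inj₁ (inj₁ (refl , refl))))
      K4-edges 3F 0F ne = inj₂ (inj₂ (inj₁ (inj₂ (refl , refl))))
      K4-edges 1F 2F ne = inj₂ (inj₂ (inj₂ (inj₁ (inj₁ (refl , refl)))))
      K4-edges 2F 1F ne = inj₂ (inj₂ (inj₂ (inj₁ (inj₂ (refl , refl)))))
      K4-edges 1F 3F ne = inj₂ (inj₂ (inj₂ (inj₂ (inj₁ (inj₁ (refl , refl))))))
      K4-edges 3F 1F ne = inj₂ (inj₂ (inj₂ (inj₂ (inj₁ (inj₂ (refl , refl))))))
      K4-edges 2F 3F ne = inj₂ (inj₂ (inj₂ (inj₂ (inj₂ (inj₁ (inj₁ (refl , refl)))))))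
      K4-edges 3F 2F ne = inj₂ (inj₂ (inj₂ (inj₂ (inj₂ (inj₁ (inj₂ (refl , refl)))))))

      K4-irr : ∀ i → ¬ OnA (strip arcs) (corner i) (corner i)
      K4-irr i o = no-loop arcs refl o
        where
        proper : List Arc → Bool
        proper []                  = true
        proper ((k , us , l) ∷ as) = not (eqb k l) ∧ proper as
        no-loop : ∀ as → proper as ≡ true → ∀ {v} → ¬ OnA (strip as) v v
        no-loop ((k , us , l) ∷ as) p (inj₂ q) = no-loop as (proj₂ (∧-true {not (eqb k l)} p)) q
        no-loop ((k , us , l) ∷ as) p (inj₁ q) = ne q
          where
          k≢l : k ≢ l
          k≢l refl = not-true (eqb-refl k) (proj₁ (∧-true {not (eqb k k)} p))
          ne : ∀ {v} → ¬ Pair (corner k) (corner l) v v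
          ne (inj₁ (e , e′)) = k≢l (corner-inj (trans (sym e) e′))
          ne (inj₂ (e , e′)) = k≢l (corner-inj (trans (sym e′) e))

      base-rep : Rep IsCorner (OnA (strip arcs))
      base-rep = rep (K 4) (base (Iso-refl {H = K 4})) corner corner-inj (λ i → i , refl) (λ p → p) to from
        where
        to : ∀ i j → not (eqb i j) ≡ true → OnA (strip arcs) (corner i) (corner j)
        to i j h = K4-edges i j λ { refl → not-true (eqb-refl i) h }
        from : ∀ i j → OnA (strip arcs) (corner i) (corner j) → not (eqb i j) ≡ true
        from i j o = cong not (≢⇒eqb λ { refl → K4-irr i o })

      tk4-rep : Rep (Union IsCorner arcs) (OnA (move arcs []))
      tk4-rep = Rep-arcs arcs [] base-rep (λ i → i , refl) (λ ()) fresh refl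
        where
        corner-fresh : ∀ {v} i → (v ∈at segs) (4 + i) → ¬ IsCorner v
        corner-fresh i p (k , refl) = apart ap (λ e → <⇒≢ (≤-trans (toℕ<n k) (m≤m+n 4 i)) e) (corner-at k) p
        un : ∀ {l} → l ∈ segs → Uniq l
        un i = apart-uniq i ap
        f4 : ∀ {u} → u ∈ ab → ¬ IsCorner u
        f4 p = corner-fresh 0 (in-ab p)
        f5 : ∀ {u} → u ∈ ac → ¬ (u ∈ ab ⊎ IsCorner u)
        f5 p = [ (λ q → apart ap (λ ()) (in-ac p) (in-ab q)) , corner-fresh 1 (in-ac p) ]′
        f6 : ∀ {u} → u ∈ ad → ¬ (u ∈ ac ⊎ u ∈ ab ⊎ IsCorner u)
        f6 p = [ (λ q → apart ap (λ ()) (in-ad p) (in-ac q)) , [ (λ q → apart ap (λ ()) (in-ad p) (in-ab q)) , corner-fresh 2 (in-ad p) ]′ ]′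
        f7 : ∀ {u} → u ∈ bc → ¬ (u ∈ ad ⊎ u ∈ ac ⊎ u ∈ ab ⊎ IsCorner u)
        f7 p = [ (λ q → apart ap (λ ()) (in-bc p) (in-ad q)) , [ (λ q → apart ap (λ ()) (in-bc p) (in-ac q)) ,
               [ (λ q → apart ap (λ ()) (in-bc p) (in-ab q)) , corner-fresh 3 (in-bc p) ]′ ]′ ]′
        f8 : ∀ {u} → u ∈ bd → ¬ (u ∈ bc ⊎ u ∈ ad ⊎ u ∈ ac ⊎ u ∈ ab ⊎ IsCorner u)
        f8 p = [ (λ q → apart ap (λ ()) (in-bd p) (in-bc q)) , [ (λ q → apart ap (λ ()) (in-bd p) (in-ad q)) ,
               [ (λ q → apart ap (λ ()) (in-bd p) (in-ac q)) , [ (λ q → apart ap (λ ()) (in-bd p) (in-ab q)) , corner-fresh 4 (in-bd p) ]′ ]′ ]′ ]′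
        f9 : ∀ {u} → u ∈ cd → ¬ (u ∈ bd ⊎ u ∈ bc ⊎ u ∈ ad ⊎ u ∈ ac ⊎ u ∈ ab ⊎ IsCorner u)
        f9 p = [ (λ q → apart ap (λ ()) (in-cd p) (in-bd q)) , [ (λ q → apart ap (λ ()) (in-cd p) (in-bc q)) ,
               [ (λ q → apart ap (λ ()) (in-cd p) (in-ad q)) , [ (λ q → apart ap (λ ()) (in-cd p) (in-ac q)) ,
               [ (λ q → apart ap (λ ()) (in-cd p) (in-ab q)) , corner-fresh 5 (in-cd p) ]′ ]′ ]′ ]′ ]′
        fresh : Fresh IsCorner arcs
        fresh = (f4 , un (there (there (there (there (here refl))))))
              , (f5 , un (there (there (there (there (there (here refl)))))))
              , (f6 , un (there (there (there (there (there (there (here refl))))))))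
              , (f7 , un (there (there (there (there (there (there (there (here refl)))))))))
              , (f8 , un (there (there (there (there (there (there (there (there (here refl))))))))))
              , (f9 , un (there (there (there (there (there (there (there (there (there (here refl)))))))))))
              , tt

    -- From here on an ISK4 is found by exhibiting six disjoint paths and checking that there is no
    -- further edge; no `Subdivision` has to be built again.
    induced-TK4 : (∀ {x y} → Vert x → Vert y → x ~ y → Edge x y) → HasISK4 G
    induced-TK4 ind = Rep⇒ISK4 tk4-rep (λ p q x~y → edge⇒ (ind (vert p) (vert q) x~y)) ⇒adj
      where
      vert : ∀ {v} → Union IsCorner arcs v → Vert v
      vert (inj₁ p) = 9 , in-cd p
      vert (inj₂ (inj₁ p)) = 8 , in-bd p
      vert (inj₂ (inj₂ (inj₁ p))) = 7 , in-bc p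
      vert (inj₂ (inj₂ (inj₂ (inj₁ p)))) = 6 , in-ad p
      vert (inj₂ (inj₂ (inj₂ (inj₂ (inj₁ p))))) = 5 , in-ac p
      vert (inj₂ (inj₂ (inj₂ (inj₂ (inj₂ (inj₁ p)))))) = 4 , in-ab p
      vert (inj₂ (inj₂ (inj₂ (inj₂ (inj₂ (inj₂ (i , refl))))))) = toℕ i , corner-at i
      edge⇒ : ∀ {x y} → Edge x y → OnA (move arcs []) x y
      edge⇒ (inj₁ o) = inj₂ (inj₂ (inj₂ (inj₂ (inj₂ (inj₁ o)))))
      edge⇒ (inj₂ (inj₁ o)) = inj₂ (inj₂ (inj₂ (inj₂ (inj₁ o))))
      edge⇒ (inj₂ (inj₂ (inj₁ o))) = inj₂ (inj₂ (inj₂ (inj₁ o)))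
      edge⇒ (inj₂ (inj₂ (inj₂ (inj₁ o)))) = inj₂ (inj₂ (inj₁ o))
      edge⇒ (inj₂ (inj₂ (inj₂ (inj₂ (inj₁ o))))) = inj₂ (inj₁ o)
      edge⇒ (inj₂ (inj₂ (inj₂ (inj₂ (inj₂ o))))) = inj₁ o
      ⇒adj : ∀ {x y} → OnA (move arcs []) x y → x ~ y
      ⇒adj (inj₁ o) = On⇒~ cd wcd o
      ⇒adj (inj₂ (inj₁ o)) = On⇒~ bd wbd o
      ⇒adj (inj₂ (inj₂ (inj₁ o))) = On⇒~ bc wbc o
      ⇒adj (inj₂ (inj₂ (inj₂ (inj₁ o)))) = On⇒~ ad wad o
      ⇒adj (inj₂ (inj₂ (inj₂ (inj₂ (inj₁ o))))) = On⇒~ ac wac o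
      ⇒adj (inj₂ (inj₂ (inj₂ (inj₂ (inj₂ (inj₁ o)))))) = On⇒~ ab wab o

module _ {n : ℕ} where

  On? : ∀ (u : Fin n) xs w a b → Dec (On u xs w a b)
  On? u []       w a b = ((a ≟ u) ×-dec (b ≟ w)) ⊎-dec ((a ≟ w) ×-dec (b ≟ u))
  On? u (x ∷ xs) w a b = (((a ≟ u) ×-dec (b ≟ x)) ⊎-dec ((a ≟ x) ×-dec (b ≟ u))) ⊎-dec On? x xs w a b

  wtotal-at : ∀ {v : Fin n} ls → 1 ≤ wtotal (δ v) ls → ∃ λ i → (v ∈at ls) i
  wtotal-at {v} (l ∷ ls) h with v ∈? l
  ... | yes p = 0 , at0 p
  ... | no np with wtotal-at ls (subst (λ k → 1 ≤ k + wtotal (δ v) ls) (none l np) h)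
    where
    none : ∀ l → v ∉ l → wsum (δ v) l ≡ 0
    none l np with wsum (δ v) l in e
    ... | zero  = refl
    ... | suc k = ⊥-elim (np (1≤⇒∈ l (subst (1 ≤_) (sym e) (s≤s z≤n))))
  ...   | i , p = suc i , atS p

eqb-suc : ∀ {n} (i j : Fin n) → eqb (Fin.suc i) (suc j) ≡ eqb i j
eqb-suc i j with i ≟ j
... | yes refl = refl
... | no _     = refl

wsum-map : ∀ {A B : Set} (f : B → ℕ) (g : A → B) xs → wsum f (map g xs) ≡ wsum (λ x → f (g x)) xs
wsum-map f g []       = refl
wsum-map f g (x ∷ xs) = cong (f (g x) +_) (wsum-map f g xs)

wsum-mono : ∀ {A : Set} {f g : A → ℕ} → (∀ x → f x ≤ g x) → ∀ xs → wsum f xs ≤ wsum g xs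
wsum-mono h []       = z≤n
wsum-mono h (x ∷ xs) = +-mono-≤ (h x) (wsum-mono h xs)

wtotal-mono : ∀ {A : Set} {f g : A → ℕ} → (∀ x → f x ≤ g x) → ∀ ls → wtotal f ls ≤ wtotal g ls
wtotal-mono h []       = z≤n
wtotal-mono h (l ∷ ls) = +-mono-≤ (wsum-mono h l) (wtotal-mono h ls)

wtotal-zero : ∀ {A : Set} (ls : List (List A)) → wtotal (λ _ → 0) ls ≡ 0
wtotal-zero []             = refl
wtotal-zero ([] ∷ ls)      = wtotal-zero ls
wtotal-zero ((x ∷ l) ∷ ls) = wtotal-zero (l ∷ ls)

wtotal-map : ∀ {A B : Set} (f : B → ℕ) (g : A → B) ls → wtotal f (map (map g) ls) ≡ wtotal (λ x → f (g x)) ls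
wtotal-map f g []       = refl
wtotal-map f g (l ∷ ls) = cong₂ _+_ (wsum-map f g l) (wtotal-map f g ls)

module _ {n m : ℕ} (f : Fin n → Fin m) (f-inj : ∀ {i j} → f i ≡ f j → i ≡ j) where

  Apart-map : ∀ ls → Apart ls → Apart (map (map f) ls)
  Apart-map ls d = mk-apart go
   where
   go : ∀ v → wtotal (δ v) (map (map f) ls) ≤ 1
   go v rewrite wtotal-map (δ v) f ls with anyF? (λ u → f u ≟ v)
   ... | yes (u , refl) = ≤-trans (wtotal-mono le ls) (once d u)
     where
     le : ∀ x → δ (f u) (f x) ≤ δ u x
     le x with f u ≟ f x
     ... | no _ = z≤n
     ... | yes e rewrite f-inj e | eqb-refl x = s≤s z≤n
   ... | no ne = ≤-trans (wtotal-mono le ls) (≤-trans (≤-reflexive (wtotal-zero ls)) z≤n)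
     where
     le : ∀ x → δ v (f x) ≤ 0
     le x with v ≟ f x
     ... | yes e = ⊥-elim (ne (x , sym e))
     ... | no _  = z≤n

-- Edges have to be preserved but not reflected, because the six paths are only a subgraph; thus the
-- map of a `HasSubgraph` witness will do.
TK4-map : ∀ {n m} (G : Graph n) (H : Graph m) (f : Fin n → Fin m) → (∀ {i j} → f i ≡ f j → i ≡ j) →
          (∀ {x y} → adj G x y ≡ true → adj H (f x) (f y) ≡ true) → Paths-in.TK4 G → Paths-in.TK4 H
TK4-map G H f f-inj hom t = record
  { a = f a ; b = f b ; c = f c ; d = f d
  ; ab = map f ab ; ac = map f ac ; ad = map f ad ; bc = map f bc ; bd = map f bd ; cd = map f cd
  ; wab = walk ab wab ; wac = walk ac wac ; wad = walk ad wad
  ; wbc = walk bc wbc ; wbd = walk bd wbd ; wcd = walk cd wcd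
  ; ap = Apart-map f f-inj segs ap
  }
  where
  open Paths-in.TK4 t
  walk : ∀ {u} xs {w} → Paths-in.Walk G u xs w → Paths-in.Walk H (f u) (map f xs) (f w)
  walk []       p       = hom p
  walk (x ∷ xs) (p , q) = hom p , walk xs q

-- Permuting the corners of a subdivision

module Relabel {n : ℕ} (G : Graph n) where
  open Paths-in G

  weight : (V → ℕ) → TK4 → ℕ
  weight f t = wtotal f (TK4.segs t)

  -- Equality of all weights keeps the vertex set and the size at once. One inclusion of edges is
  -- enough, since it transfers the absence of an edge from `t` to `t′`.
  record Same (t t′ : TK4) : Set where
    field
      weight≡ : ∀ f → weight f t′ ≡ weight f t
      edge⊆   : ∀ {x y} → TK4.Edge t′ x y → TK4.Edge t x y

  Same-refl : ∀ t → Same t t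
  Same-refl t = record { weight≡ = λ f → refl ; edge⊆ = λ e → e }

  Same-trans : ∀ {t t′ t″} → Same t t′ → Same t′ t″ → Same t t″
  Same-trans s s′ = record { weight≡ = λ f → trans (Same.weight≡ s′ f) (Same.weight≡ s f) ; edge⊆ = λ e → Same.edge⊆ s (Same.edge⊆ s′ e) }

  vert⇒ : ∀ {t t′} → Same t t′ → ∀ {v} → TK4.Vert t v → TK4.Vert t′ v
  vert⇒ {t} {t′} s {v} (i , p) = wtotal-at (TK4.segs t′) (subst (1 ≤_) (sym (Same.weight≡ s (δ v))) (at⇒1≤ p))

  private
    apart≡ : ∀ {ls ls′ : List (List V)} → (∀ f → wtotal f ls′ ≡ wtotal f ls) → Apart ls → Apart ls′
    apart≡ h = Apart-mono (λ f → ≤-reflexive (h f))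

    abstract
      perm₁ : ∀ a b c d ab ac ad bc bd cd →
        b + 0 + (a + 0 + (c + 0 + (d + 0 + (ab + (bc + (bd + (ac + (ad + (cd + 0))))))))) ≡
        a + 0 + (b + 0 + (c + 0 + (d + 0 + (ab + (ac + (ad + (bc + (bd + (cd + 0)))))))))
      perm₁ = solve-∀

    abstract
      perm₂ : ∀ a b c d ab ac ad bc bd cd →
        a + 0 + (c + 0 + (b + 0 + (d + 0 + (ac + (ab + (ad + (bc + (cd + (bd + 0))))))))) ≡
        a + 0 + (b + 0 + (c + 0 + (d + 0 + (ab + (ac + (ad + (bc + (bd + (cd + 0)))))))))
      perm₂ = solve-∀

    abstract
      perm₃ : ∀ a b c d ab ac ad bc bd cd →
        a + 0 + (b + 0 + (d + 0 + (c + 0 + (ab + (ad + (ac + (bd + (bc + (cd + 0))))))))) ≡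
        a + 0 + (b + 0 + (c + 0 + (d + 0 + (ab + (ac + (ad + (bc + (bd + (cd + 0)))))))))
      perm₃ = solve-∀

  module _ (t : TK4) where
    open TK4 t

    private
      w₁ : ∀ f → wtotal f ((b ∷ []) ∷ (a ∷ []) ∷ (c ∷ []) ∷ (d ∷ []) ∷ reverse ab ∷ bc ∷ bd ∷ ac ∷ ad ∷ cd ∷ []) ≡ wtotal f segs
      w₁ f rewrite wsum-reverse f ab = perm₁ (f a) (f b) (f c) (f d) (wsum f ab) (wsum f ac) (wsum f ad) (wsum f bc) (wsum f bd) (wsum f cd)
      w₂ : ∀ f → wtotal f ((a ∷ []) ∷ (c ∷ []) ∷ (b ∷ []) ∷ (d ∷ []) ∷ ac ∷ ab ∷ ad ∷ reverse bc ∷ cd ∷ bd ∷ []) ≡ wtotal f segs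
      w₂ f rewrite wsum-reverse f bc = perm₂ (f a) (f b) (f c) (f d) (wsum f ab) (wsum f ac) (wsum f ad) (wsum f bc) (wsum f bd) (wsum f cd)
      w₃ : ∀ f → wtotal f ((a ∷ []) ∷ (b ∷ []) ∷ (d ∷ []) ∷ (c ∷ []) ∷ ab ∷ ad ∷ ac ∷ bd ∷ bc ∷ reverse cd ∷ []) ≡ wtotal f segs
      w₃ f rewrite wsum-reverse f cd = perm₃ (f a) (f b) (f c) (f d) (wsum f ab) (wsum f ac) (wsum f ad) (wsum f bc) (wsum f bd) (wsum f cd)

    swap-ab : TK4
    swap-ab = record
      { a = b ; b = a ; c = c ; d = d
      ; ab = reverse ab ; ac = bc ; ad = bd ; bc = ac ; bd = ad ; cd = cd
      ; wab = Walk-reverse ab wab ; wac = wbc ; wad = wbd ; wbc = wac ; wbd = wad ; wcd = wcd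
      ; ap = apart≡ w₁ ap }

    swap-bc : TK4
    swap-bc = record
      { a = a ; b = c ; c = b ; d = d
      ; ab = ac ; ac = ab ; ad = ad ; bc = reverse bc ; bd = cd ; cd = bd
      ; wab = wac ; wac = wab ; wad = wad ; wbc = Walk-reverse bc wbc ; wbd = wcd ; wcd = wbd
      ; ap = apart≡ w₂ ap }

    swap-cd : TK4
    swap-cd = record
      { a = a ; b = b ; c = d ; d = c
      ; ab = ab ; ac = ad ; ad = ac ; bc = bd ; bd = bc ; cd = reverse cd
      ; wab = wab ; wac = wad ; wad = wac ; wbc = wbd ; wbd = wbc ; wcd = Walk-reverse cd wcd
      ; ap = apart≡ w₃ ap }

    On-unreverse : ∀ {u : V} xs {w x y} → On u (reverse xs) w x y → On w xs u x y
    On-unreverse {u} xs {w} {x} {y} o = subst (λ l → On w l u x y) (reverse-involutive xs) (On-reverse (reverse xs) o)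

    same-ab : Same t swap-ab
    same-ab = record { weight≡ = w₁ ; edge⊆ = e }
      where
      e : ∀ {x y} → TK4.Edge swap-ab x y → Edge x y
      e (inj₁ o) = inj₁ (On-unreverse ab o)
      e (inj₂ (inj₁ o)) = inj₂ (inj₂ (inj₂ (inj₁ o)))
      e (inj₂ (inj₂ (inj₁ o))) = inj₂ (inj₂ (inj₂ (inj₂ (inj₁ o))))
      e (inj₂ (inj₂ (inj₂ (inj₁ o)))) = inj₂ (inj₁ o)
      e (inj₂ (inj₂ (inj₂ (inj₂ (inj₁ o))))) = inj₂ (inj₂ (inj₁ o))
      e (inj₂ (inj₂ (inj₂ (inj₂ (inj₂ o))))) = inj₂ (inj₂ (inj₂ (inj₂ (inj₂ o))))

    same-bc : Same t swap-bc
    same-bc = record { weight≡ = w₂ ; edge⊆ = e }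
      where
      e : ∀ {x y} → TK4.Edge swap-bc x y → Edge x y
      e (inj₁ o) = inj₂ (inj₁ o)
      e (inj₂ (inj₁ o)) = inj₁ o
      e (inj₂ (inj₂ (inj₁ o))) = inj₂ (inj₂ (inj₁ o))
      e (inj₂ (inj₂ (inj₂ (inj₁ o)))) = inj₂ (inj₂ (inj₂ (inj₁ (On-unreverse bc o))))
      e (inj₂ (inj₂ (inj₂ (inj₂ (inj₁ o))))) = inj₂ (inj₂ (inj₂ (inj₂ (inj₂ o))))
      e (inj₂ (inj₂ (inj₂ (inj₂ (inj₂ o))))) = inj₂ (inj₂ (inj₂ (inj₂ (inj₁ o))))

    same-cd : Same t swap-cd
    same-cd = record { weight≡ = w₃ ; edge⊆ = e }
      where
      e : ∀ {x y} → TK4.Edge swap-cd x y → Edge x y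
      e (inj₁ o) = inj₁ o
      e (inj₂ (inj₁ o)) = inj₂ (inj₂ (inj₁ o))
      e (inj₂ (inj₂ (inj₁ o))) = inj₂ (inj₁ o)
      e (inj₂ (inj₂ (inj₂ (inj₁ o)))) = inj₂ (inj₂ (inj₂ (inj₂ (inj₁ o))))
      e (inj₂ (inj₂ (inj₂ (inj₂ (inj₁ o))))) = inj₂ (inj₂ (inj₂ (inj₁ o)))
      e (inj₂ (inj₂ (inj₂ (inj₂ (inj₂ o))))) = inj₂ (inj₂ (inj₂ (inj₂ (inj₂ (On-unreverse cd o)))))

  _⟫_ : ∀ {t t′} → Same t t′ → (σ : (t : TK4) → ∃ (Same t)) → Same t (proj₁ (σ t′))
  s ⟫ σ = Same-trans s (proj₂ (σ _))

  σab σbc σcd : (t : TK4) → ∃ (Same t)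
  σab t = swap-ab t , same-ab t
  σbc t = swap-bc t , same-bc t
  σcd t = swap-cd t , same-cd t

  -- The exchanges of a and b, of b and c, of c and d generate all permutations of the corners, so
  -- each of the six paths can take the place of `ab`.
  edge-to-ab : ∀ t {x y} → TK4.Edge t x y → ∃ λ t′ → Same t t′ × On (TK4.a t′) (TK4.ab t′) (TK4.b t′) x y
  edge-to-ab t (inj₁ o) = t , Same-refl t , o
  edge-to-ab t (inj₂ (inj₁ o)) = _ , same-bc t , o
  edge-to-ab t (inj₂ (inj₂ (inj₁ o))) = _ , (same-cd t ⟫ σbc) , o
  edge-to-ab t (inj₂ (inj₂ (inj₂ (inj₁ o)))) = _ , (same-ab t ⟫ σbc) , o
  edge-to-ab t (inj₂ (inj₂ (inj₂ (inj₂ (inj₁ o))))) = _ , ((same-ab t ⟫ σcd) ⟫ σbc) , o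
  edge-to-ab t (inj₂ (inj₂ (inj₂ (inj₂ (inj₂ o))))) = _ , ((((same-bc t) ⟫ σab) ⟫ σcd) ⟫ σbc) , o

  Edge? : ∀ (t : TK4) x y → Dec (TK4.Edge t x y)
  Edge? t x y = On? a ab b x y ⊎-dec (On? a ac c x y ⊎-dec (On? a ad d x y ⊎-dec
                (On? b bc c x y ⊎-dec (On? b bd d x y ⊎-dec On? c cd d x y))))
    where open TK4 t

-- Six disjoint paths in every subdivision of K₄

module Subdivide {n : ℕ} (H : Graph n) (v w : Fin n) (v~w : adj H v w ≡ true) where

  open Paths-in H
  open Relabel H
  private
    H′ = subdivide H v w
    module G′ = Paths-in H′

  lift-edge : ∀ {x y} → x ~ y → ¬ Pair x y v w → suc x G′.~ suc y
  lift-edge {x} {y} e np rewrite e | ¬Pair⇒samePair {v = v} {w} {x} {y} (λ q → np (Pair-turn q)) = refl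

  lift-walk : ∀ {x} xs {y} → Walk x xs y → ¬ On x xs y v w → G′.Walk (suc x) (map suc xs) (suc y)
  lift-walk []       e       ¬o = lift-edge e ¬o
  lift-walk (z ∷ zs) (e , p) ¬o = lift-edge e (λ q → ¬o (inj₁ q)) , lift-walk zs p (λ q → ¬o (inj₂ q))

  to-new : ∀ {x y} → Pair x y v w → suc x G′.~ zero × zero G′.~ suc y
  to-new (inj₁ (refl , refl)) rewrite eqb-refl v | eqb-refl w with eqb w v
  ... | true  = refl , refl
  ... | false = refl , refl
  to-new (inj₂ (refl , refl)) rewrite eqb-refl v | eqb-refl w with eqb w v
  ... | true  = refl , refl
  ... | false = refl , refl

  via : ∀ {x} xs {y} → On x xs y v w → List (Fin (suc n))
  via []       o        = zero ∷ []
  via (z ∷ zs) (inj₁ o) = zero ∷ suc z ∷ map suc zs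
  via (z ∷ zs) (inj₂ o) = suc z ∷ via zs o

  wsum-via : ∀ f {x} xs {y} (o : On x xs y v w) → wsum f (via xs o) ≡ f zero + wsum (λ u → f (suc u)) xs
  wsum-via f []       o = refl
  wsum-via f (z ∷ zs) (inj₁ o) = cong (λ k → f zero + (f (suc z) + k)) (wsum-map f suc zs)
  wsum-via f (z ∷ zs) (inj₂ o) rewrite wsum-via f zs o = lem (f (suc z)) (f zero) _
    where
    abstract
      lem : ∀ a b c → a + (b + c) ≡ b + (a + c)
      lem = solve-∀

  -- A path without repeated vertex traverses the edge `v w` only once, at `o`; its other edges are
  -- kept by the subdivision.
  walk-via : ∀ {x} xs {y} → Walk x xs y → Uniq (x ∷ y ∷ xs) → (o : On x xs y v w) → G′.Walk (suc x) (via xs o) (suc y)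
  walk-via []       e       un o = to-new o
  walk-via {x} (z ∷ zs) {y} (e , p) un (inj₁ o) = proj₁ (to-new o) , proj₂ (to-new o) ,
    lift-walk zs p (λ q → x∉ (x∈ o (On-∈ zs q) (On-∈ʳ zs q)))
    where
    x∉ : x ∉ z ∷ y ∷ zs
    x∉ (here e) = Uniq-head x (y ∷ z ∷ zs) un (there (here e))
    x∉ (there (here e)) = Uniq-head x (y ∷ z ∷ zs) un (here e)
    x∉ (there (there i)) = Uniq-head x (y ∷ z ∷ zs) un (there (there i))
    x∈ : Pair x z v w → v ∈ z ∷ y ∷ zs → w ∈ z ∷ y ∷ zs → x ∈ z ∷ y ∷ zs
    x∈ (inj₁ (refl , _)) i j = i
    x∈ (inj₂ (_ , refl)) i j = j
  walk-via {x} (z ∷ zs) {y} (e , p) un (inj₂ o) =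
    lift-edge e (λ q → x∉ (x∈ q (On-∈ zs o) (On-∈ʳ zs o))) , walk-via zs p un′ o
    where
    x∉ : x ∉ z ∷ y ∷ zs
    x∉ (here e) = Uniq-head x (y ∷ z ∷ zs) un (there (here e))
    x∉ (there (here e)) = Uniq-head x (y ∷ z ∷ zs) un (here e)
    x∉ (there (there i)) = Uniq-head x (y ∷ z ∷ zs) un (there (there i))
    x∈ : Pair x z v w → v ∈ z ∷ y ∷ zs → w ∈ z ∷ y ∷ zs → x ∈ z ∷ y ∷ zs
    x∈ (inj₁ (refl , _)) i j = i
    x∈ (inj₂ (_ , refl)) i j = j
    un′ : Uniq (z ∷ y ∷ zs)
    un′ u = ≤-trans (≤-reflexive (lem (δ u z) (δ u y) _)) (Uniq-tail x (y ∷ z ∷ zs) un u)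
      where
      abstract
        lem : ∀ a b c → a + (b + c) ≡ b + (a + c)
        lem = solve-∀

  v≢w : v ≢ w
  v≢w = ~⇒≢ v~w

  lift-disjoint : ∀ (t : TK4) → ¬ TK4.Edge t v w → G′.TK4
  lift-disjoint t ¬e = record
    { a = suc a ; b = suc b ; c = suc c ; d = suc d
    ; ab = map suc ab ; ac = map suc ac ; ad = map suc ad ; bc = map suc bc ; bd = map suc bd ; cd = map suc cd
    ; wab = lift-walk ab wab (λ o → ¬e (inj₁ o))
    ; wac = lift-walk ac wac (λ o → ¬e (inj₂ (inj₁ o)))
    ; wad = lift-walk ad wad (λ o → ¬e (inj₂ (inj₂ (inj₁ o))))
    ; wbc = lift-walk bc wbc (λ o → ¬e (inj₂ (inj₂ (inj₂ (inj₁ o)))))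
    ; wbd = lift-walk bd wbd (λ o → ¬e (inj₂ (inj₂ (inj₂ (inj₂ (inj₁ o))))))
    ; wcd = lift-walk cd wcd (λ o → ¬e (inj₂ (inj₂ (inj₂ (inj₂ (inj₂ o))))))
    ; ap = Apart-map suc suc-injective segs ap }
    where open TK4 t

  -- The new vertex goes into the path `ab`. The other paths keep all their edges: each shares at
  -- most one corner with the path from `a` to `b`, whereas `v` and `w` are two distinct vertices of
  -- it.
  lift-ab : ∀ (t : TK4) → On (TK4.a t) (TK4.ab t) (TK4.b t) v w → G′.TK4
  lift-ab t o = record
    { a = suc a ; b = suc b ; c = suc c ; d = suc d
    ; ab = via ab o ; ac = map suc ac ; ad = map suc ad ; bc = map suc bc ; bd = map suc bd ; cd = map suc cd
    ; wab = walk-via ab wab un o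
    ; wac = lift-walk ac wac (λ q → meet-a (On-∈ ac q) (On-∈ʳ ac q)
              (apart-within ap (within-∷ at-b (within-seg in-ab)) (within-∷ at-a (within-∷ at-c (within-seg in-ac))) refl))
    ; wad = lift-walk ad wad (λ q → meet-a (On-∈ ad q) (On-∈ʳ ad q)
              (apart-within ap (within-∷ at-b (within-seg in-ab)) (within-∷ at-a (within-∷ at-d (within-seg in-ad))) refl))
    ; wbc = lift-walk bc wbc (λ q → meet-b (On-∈ bc q) (On-∈ʳ bc q)
              (apart-within ap (within-∷ at-a (within-seg in-ab)) (within-∷ at-b (within-∷ at-c (within-seg in-bc))) refl))
    ; wbd = lift-walk bd wbd (λ q → meet-b (On-∈ bd q) (On-∈ʳ bd q)
              (apart-within ap (within-∷ at-a (within-seg in-ab)) (within-∷ at-b (within-∷ at-d (within-seg in-bd))) refl))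
    ; wcd = lift-walk cd wcd (λ q →
              apart-within ap (within-∷ at-a (within-∷ at-b (within-seg in-ab))) (within-∷ at-c (within-∷ at-d (within-seg in-cd))) refl
                (On-∈ ab o) (On-∈ cd q))
    ; ap = mk-apart once′ }
    where
    open TK4 t
    meet-a : ∀ {ys} → v ∈ ys → w ∈ ys → (∀ {x} → x ∈ b ∷ ab → x ∈ ys → ⊥) → ⊥
    meet-a {ys} p q h = v≢w (trans (≡a (On-∈ ab o) p) (sym (≡a (On-∈ʳ ab o) q)))
      where
      ≡a : ∀ {x} → x ∈ a ∷ b ∷ ab → x ∈ ys → x ≡ a
      ≡a (here e)  j = e
      ≡a (there i) j = ⊥-elim (h i j)
    meet-b : ∀ {ys} → v ∈ ys → w ∈ ys → (∀ {x} → x ∈ a ∷ ab → x ∈ ys → ⊥) → ⊥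
    meet-b {ys} p q h = v≢w (trans (≡b (On-∈ ab o) p) (sym (≡b (On-∈ʳ ab o) q)))
      where
      ≡b : ∀ {x} → x ∈ a ∷ b ∷ ab → x ∈ ys → x ≡ b
      ≡b (here e)          j = ⊥-elim (h (here e) j)
      ≡b (there (here e))  j = e
      ≡b (there (there i)) j = ⊥-elim (h (there i) j)
    un : Uniq (a ∷ b ∷ ab)
    un u = ≤-trans (≤-trans (m≤m+n _ _)
             (≤-reflexive (sym (rearrange (δ u a) (δ u b) (wsum (δ u) ab) (δ u c) (δ u d) _)))) (once ap u)
      where
      abstract
        rearrange : ∀ a b ab c d r → a + 0 + (b + 0 + (c + 0 + (d + 0 + (ab + r)))) ≡ (a + (b + ab)) + (c + (d + r))
        rearrange = solve-∀
    total : ∀ f → wtotal f ((suc a ∷ []) ∷ (suc b ∷ []) ∷ (suc c ∷ []) ∷ (suc d ∷ []) ∷ via ab o ∷ map suc ac ∷ map suc ad ∷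
                            map suc bc ∷ map suc bd ∷ map suc cd ∷ []) ≡ f zero + wtotal (λ u → f (suc u)) segs
    total f rewrite wsum-via f ab o | wsum-map f suc ac | wsum-map f suc ad | wsum-map f suc bc | wsum-map f suc bd | wsum-map f suc cd
      = lem (f zero) (f (suc a)) (f (suc b)) (f (suc c)) (f (suc d)) (wsum (λ u → f (suc u)) ab) _
      where
      abstract
        lem : ∀ z a b c d ab r → a + 0 + (b + 0 + (c + 0 + (d + 0 + (z + ab + r)))) ≡ z + (a + 0 + (b + 0 + (c + 0 + (d + 0 + (ab + r)))))
        lem = solve-∀
    once′ : ∀ u → wtotal (δ u) ((suc a ∷ []) ∷ (suc b ∷ []) ∷ (suc c ∷ []) ∷ (suc d ∷ []) ∷ via ab o ∷ map suc ac ∷ map suc ad ∷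
                            map suc bc ∷ map suc bd ∷ map suc cd ∷ []) ≤ 1
    once′ zero    rewrite total (δ zero) = s≤s (≤-reflexive (wtotal-zero segs))
    once′ (suc u) rewrite total (δ (suc u)) = ≤-trans (wtotal-mono le segs) (once ap u)
      where
      le : ∀ x → δ (suc u) (suc x) ≤ δ u x
      le x rewrite eqb-suc u x = ≤-refl

  lift-TK4 : TK4 → G′.TK4
  lift-TK4 t with Edge? t v w
  ... | no ne = lift-disjoint t ne
  ... | yes e with edge-to-ab t e
  ...   | t′ , _ , o = lift-ab t′ o

TK4-K4 : Paths-in.TK4 (K 4)
TK4-K4 = record
  { a = zero ; b = suc zero ; c = suc (suc zero) ; d = suc (suc (suc zero))
  ; ab = [] ; ac = [] ; ad = [] ; bc = [] ; bd = [] ; cd = []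
  ; wab = refl ; wac = refl ; wad = refl ; wbc = refl ; wbd = refl ; wcd = refl
  ; ap = mk-apart λ { zero → ≤-refl ; (suc zero) → ≤-refl ; (suc (suc zero)) → ≤-refl ; (suc (suc (suc zero))) → ≤-refl } }

TK4-iso : ∀ {n m} (G : Graph n) (H : Graph m) → Iso G H → Paths-in.TK4 G → Paths-in.TK4 H
TK4-iso G H (b , eq) = TK4-map G H (Bijection.to b) (Bijection.injective b) (λ {x} {y} e → trans (eq x y) e)

Subdivision⇒TK4 : ∀ {m} {H : Graph m} → Subdivision (K 4) H → Paths-in.TK4 H
Subdivision⇒TK4 {H = H} (base i) = TK4-iso (K 4) H i TK4-K4
Subdivision⇒TK4 {H = H′} (step {H = H} s v w e i) =
  TK4-iso (subdivide H v w) H′ i (Subdivide.lift-TK4 H v w e (Subdivision⇒TK4 s))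

-- Positions in lists without repetition

module _ {n : ℕ} where

  private V = Fin n

  Uniq-[] : Uniq {n} []
  Uniq-[] v = z≤n

  Uniq-∷ : ∀ (x : V) xs → x ∉ xs → Uniq xs → Uniq (x ∷ xs)
  Uniq-∷ x xs ne u v with v ≟ x
  ... | no _ = u v
  ... | yes refl with wsum (δ v) xs in e
  ...   | zero  = ≤-refl
  ...   | suc k = ⊥-elim (ne (1≤⇒∈ xs (subst (1 ≤_) (sym e) (s≤s z≤n))))

  len : List V → ℕ
  len = wsum (λ _ → 1)

  Cons : List V → V → V → Set
  Cons []          u v = ⊥
  Cons (a ∷ [])    u v = ⊥
  Cons (a ∷ b ∷ l) u v = Pair a b u v ⊎ Cons (b ∷ l) u v

  On⇒Cons : ∀ {y} m {z u v} → On y m z u v → Cons (y ∷ m ++ z ∷ []) u v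
  On⇒Cons []      o        = inj₁ o
  On⇒Cons (a ∷ m) (inj₁ o) = inj₁ o
  On⇒Cons (a ∷ m) (inj₂ o) = inj₂ (On⇒Cons m o)

  Cons-∈ : ∀ l {u v} → Cons l u v → u ∈ l × v ∈ l
  Cons-∈ (a ∷ b ∷ l) (inj₁ (inj₁ (p , q))) = here p , there (here q)
  Cons-∈ (a ∷ b ∷ l) (inj₁ (inj₂ (p , q))) = there (here p) , here q
  Cons-∈ (a ∷ b ∷ l) (inj₂ c) = let p , q = Cons-∈ (b ∷ l) c in there p , there q

  Cons-far : ∀ A c B → Uniq (A ++ c ∷ B) → ∀ {u v} → Cons (A ++ c ∷ B) u v → u ∈ A → v ∈ B → ⊥
  Cons-far (a ∷ []) c B un (inj₁ (inj₁ (_ , refl))) i j = Uniq-head c B (Uniq-tail a (c ∷ B) un) j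
  Cons-far (a ∷ []) c B un (inj₁ (inj₂ (_ , refl))) i j = Uniq-head a (c ∷ B) un (there j)
  Cons-far (a ∷ []) c B un (inj₂ o) (here refl) j = Uniq-head a (c ∷ B) un (proj₁ (Cons-∈ (c ∷ B) o))
  Cons-far (a ∷ a′ ∷ A) c B un (inj₁ (inj₁ (_ , refl))) i j = Uniq-head a′ (A ++ c ∷ B) (Uniq-tail a (a′ ∷ A ++ c ∷ B) un) (∈-++⁺ʳ A (there j))
  Cons-far (a ∷ a′ ∷ A) c B un (inj₁ (inj₂ (_ , refl))) i j = Uniq-head a (a′ ∷ A ++ c ∷ B) un (there (∈-++⁺ʳ A (there j)))
  Cons-far (a ∷ a′ ∷ A) c B un (inj₂ o) (here refl) j = Uniq-head a (a′ ∷ A ++ c ∷ B) un (proj₁ (Cons-∈ (a′ ∷ A ++ c ∷ B) o))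
  Cons-far (a ∷ a′ ∷ A) c B un (inj₂ o) (there i) j = Cons-far (a′ ∷ A) c B (Uniq-tail a (a′ ∷ A ++ c ∷ B) un) o i j

  head-pos : ∀ A {c R y} {l : List V} → y ∷ l ≡ A ++ c ∷ R → y ∈ A ⊎ y ≡ c
  head-pos []      e = inj₂ (proj₁ (∷-injective e))
  head-pos (a ∷ A) e = inj₁ (here (proj₁ (∷-injective e)))

  last-pos : ∀ (l R : List V) {z c B} → l ++ z ∷ [] ≡ R ++ c ∷ B → z ∈ B ⊎ z ≡ c
  last-pos []      []            e = inj₂ (proj₁ (∷-injective e))
  last-pos []      (r ∷ [])      e with proj₂ (∷-injective e)
  ... | ()
  last-pos []      (r ∷ r′ ∷ R)  e with proj₂ (∷-injective e)
  ... | ()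
  last-pos (a ∷ l) []            e = inj₁ (subst (_ ∈_) (proj₂ (∷-injective e)) (∈-++⁺ʳ l (here refl)))
  last-pos (a ∷ l) (r ∷ R)       e = last-pos l R (proj₂ (∷-injective e))

  snoc-split : ∀ (l X : List V) {z c Y} → l ++ z ∷ [] ≡ X ++ c ∷ Y → (Y ≡ []) ⊎ (∃ λ Y′ → Y ≡ Y′ ++ z ∷ [] × l ≡ X ++ c ∷ Y′)
  snoc-split []      []           e = inj₁ (sym (proj₂ (∷-injective e)))
  snoc-split []      (r ∷ [])     e with proj₂ (∷-injective e)
  ... | ()
  snoc-split []      (r ∷ r′ ∷ R) e with proj₂ (∷-injective e)
  ... | ()
  snoc-split (a ∷ l) []           e = inj₂ (l , sym (proj₂ (∷-injective e)) , cong (_∷ l) (proj₁ (∷-injective e)))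
  snoc-split (a ∷ l) (r ∷ R)      e with snoc-split l R (proj₂ (∷-injective e))
  ... | inj₁ q = inj₁ q
  ... | inj₂ (Y′ , q , q′) = inj₂ (Y′ , q , cong₂ _∷_ (proj₁ (∷-injective e)) q′)

  reverse-mid : ∀ (A : List V) {v} B → reverse (A ++ v ∷ B) ≡ reverse B ++ v ∷ reverse A
  reverse-mid A {v} B = trans (reverse-++ A (v ∷ B))
    (trans (cong (_++ reverse A) (unfold-reverse v B)) (++-assoc (reverse B) (v ∷ []) (reverse A)))

  append-not-[] : ∀ (M : List V) {v B} → M ++ v ∷ B ≢ []
  append-not-[] []      ()
  append-not-[] (_ ∷ _) ()

  On-changeR : ∀ {a : V} P {y y′ r s} → On a P y r s → r ≢ y → s ≢ y → On a P y′ r s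
  On-changeR []      (inj₁ (_ , e)) r≢ s≢ = ⊥-elim (s≢ e)
  On-changeR []      (inj₂ (e , _)) r≢ s≢ = ⊥-elim (r≢ e)
  On-changeR (_ ∷ P) (inj₁ o) r≢ s≢ = inj₁ o
  On-changeR (_ ∷ P) (inj₂ o) r≢ s≢ = inj₂ (On-changeR P o r≢ s≢)

  On-change : ∀ {z z′ : V} P {y y′ r s} → On z P y r s → r ≢ z → s ≢ z → r ≢ y → s ≢ y → On z′ P y′ r s
  On-change []      (inj₁ (e , _)) rz sz ry sy = ⊥-elim (rz e)
  On-change []      (inj₂ (_ , e)) rz sz ry sy = ⊥-elim (sz e)
  On-change (_ ∷ P) (inj₁ (inj₁ (e , _))) rz sz ry sy = ⊥-elim (rz e)
  On-change (_ ∷ P) (inj₁ (inj₂ (_ , e))) rz sz ry sy = ⊥-elim (sz e)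
  On-change (_ ∷ P) (inj₂ o) rz sz ry sy = inj₂ (On-changeR P o ry sy)

  len-++ : ∀ (A B : List V) → len (A ++ B) ≡ len A + len B
  len-++ = wsum-++ (λ _ → 1)

  init-last : ∀ (p : V) P → ∃ λ P′ → ∃ λ q → p ∷ P ≡ P′ ++ q ∷ []
  init-last p []      = [] , p , refl
  init-last p (r ∷ P) = let P′ , q , e = init-last r P in p ∷ P′ , q , cong (p ∷_) e

¬¬-em : ∀ (P : Set) → ¬ ¬ (P ⊎ ¬ P)
¬¬-em P h = h (inj₂ λ p → h (inj₁ p))

-- Finiteness lets the double negation pass through the quantifier. Predicates defined by the
-- existence of walks may then be treated as decidable whenever the goal is `⊥`.
¬¬-all-dec : ∀ {n} (P : Fin n → Set) → ¬ ¬ (∀ v → Dec (P v))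
¬¬-all-dec {zero}  P h = h λ ()
¬¬-all-dec {suc n} P h = ¬¬-em (P zero) λ d → ¬¬-all-dec (λ v → P (suc v)) λ ds → h (λ { zero → dec d ; (suc v) → ds v })
  where
  dec : P zero ⊎ ¬ P zero → Dec (P zero)
  dec (inj₁ p) = yes p
  dec (inj₂ p) = no p

-- Holes, ears and shortest paths

module Holes {n : ℕ} (G : Graph n) where
  open Paths-in G public
  open Relabel G

  nb : V → V → ℕ
  nb w v = if adj G w v then 1 else 0

  nb-yes : ∀ {w v} → w ~ v → nb w v ≡ 1
  nb-yes h rewrite h = refl

  nb-no : ∀ {w v} → w ≁ v → nb w v ≡ 0
  nb-no {w} {v} h with adj G w v
  ... | true  = ⊥-elim (h refl)
  ... | false = refl

  cnt : V → List V → ℕ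
  cnt w = wsum (nb w)

  cnt≡0⇒≁ : ∀ {w} l → cnt w l ≡ 0 → ∀ {v} → v ∈ l → w ≁ v
  cnt≡0⇒≁ {w} (x ∷ l) h (here refl) e rewrite e with h
  ... | ()
  cnt≡0⇒≁ {w} (x ∷ l) h (there p) e = cnt≡0⇒≁ l (m+n≡0⇒n≡0 (nb w x) h) p e

  ≁⇒cnt≡0 : ∀ {w} l → (∀ {v} → v ∈ l → w ≁ v) → cnt w l ≡ 0
  ≁⇒cnt≡0 [] h = refl
  ≁⇒cnt≡0 {w} (x ∷ l) h rewrite nb-no {w} {x} (h (here refl)) = ≁⇒cnt≡0 l (λ p → h (there p))

  ∈⇒1≤cnt : ∀ {w v l} → v ∈ l → w ~ v → 1 ≤ cnt w l
  ∈⇒1≤cnt {w} {v} (here refl) e rewrite e = s≤s z≤n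
  ∈⇒1≤cnt {w} {v} {x ∷ l} (there p) e = ≤-trans (∈⇒1≤cnt p e) (m≤n+m _ (nb w x))

  data First (P : V → Set) (l : List V) : Set where
    first : ∀ A v B → l ≡ A ++ v ∷ B → P v → (∀ {u} → u ∈ A → ¬ P u) → First P l

  data Last (P : V → Set) (l : List V) : Set where
    last : ∀ A v B → l ≡ A ++ v ∷ B → P v → (∀ {u} → u ∈ B → ¬ P u) → Last P l

  find-first : ∀ {P : V → Set} → (∀ v → Dec (P v)) → ∀ l → First P l ⊎ (∀ {u} → u ∈ l → ¬ P u)
  find-first P? [] = inj₂ λ ()
  find-first {P} P? (x ∷ l) with P? x
  ... | yes p = inj₁ (first [] x l refl p λ ())
  ... | no np with find-first P? l
  ...   | inj₁ (first A v B refl p h) = inj₁ (first (x ∷ A) v B refl p λ { (here refl) → np ; (there i) → h i })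
  ...   | inj₂ h = inj₂ λ { (here refl) → np ; (there i) → h i }

  find-last : ∀ {P : V → Set} → (∀ v → Dec (P v)) → ∀ l → Last P l ⊎ (∀ {u} → u ∈ l → ¬ P u)
  find-last P? [] = inj₂ λ ()
  find-last {P} P? (x ∷ l) with find-last P? l
  ... | inj₁ (last A v B refl p h) = inj₁ (last (x ∷ A) v B refl p h)
  ... | inj₂ h with P? x
  ...   | yes p = inj₁ (last [] x l refl p h)
  ...   | no np = inj₂ λ { (here refl) → np ; (there i) → h i }

  first-nb : ∀ w l → 1 ≤ cnt w l → First (w ~_) l
  first-nb w l h with find-first (w ~?_) l
  ... | inj₁ f = f
  ... | inj₂ g rewrite ≁⇒cnt≡0 l g with h
  ...   | ()

  last-nb : ∀ w l → 1 ≤ cnt w l → Last (w ~_) l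
  last-nb w l h with find-last (w ~?_) l
  ... | inj₁ f = f
  ... | inj₂ g rewrite ≁⇒cnt≡0 l g with h
  ...   | ()

  -- A hole is represented by its weight W f = Σ f(v) over its vertices v;
  -- Split W y m z ys is the hole with that weight, cut at y and z into two arcs with interiors m and ys.
  Weight : Set
  Weight = (V → ℕ) → ℕ

  record In (W : Weight) (v : V) : Set where
    constructor in!
    field pos : 1 ≤ W (δ v)
  open In

  record Split (W : Weight) (y : V) (m : List V) (z : V) (ys : List V) : Set where
    field
      walk₁ : Walk y m z
      walk₂ : Walk z ys y
      wt    : ∀ f → f y + wsum f m + f z + wsum f ys ≡ W f
      un    : ∀ v → W (δ v) ≤ 1
      ind   : ∀ {a b} → In W a → In W b → a ~ b → On y m z a b ⊎ On z ys y a b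

    segs : List (List V)
    segs = (y ∷ []) ∷ m ∷ (z ∷ []) ∷ ys ∷ []

    total : ∀ f → wtotal f segs ≡ W f
    total f = trans (lem (f y) (wsum f m) (f z) (wsum f ys)) (wt f)
      where
      abstract
        lem : ∀ a b c d → a + 0 + (b + (c + 0 + (d + 0))) ≡ a + b + c + d
        lem = solve-∀

    ap : Apart segs
    ap = mk-apart λ v → ≤-trans (≤-reflexive (total (δ v))) (un v)

    at-y : (y ∈at segs) 0
    at-y = at0 (here refl)
    in-m : ∀ {a} → a ∈ m → (a ∈at segs) 1
    in-m p = atS (at0 p)
    at-z : (z ∈at segs) 2
    at-z = atS (atS (at0 (here refl)))
    in-ys : ∀ {a} → a ∈ ys → (a ∈at segs) 3
    in-ys p = atS (atS (atS (at0 p)))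

    at⇒In : ∀ {a i} → (a ∈at segs) i → In W a
    at⇒In {a} p = in! (subst (1 ≤_) (total (δ a)) (at⇒1≤ p))

    In⇒at : ∀ {a} → In W a → ∃ λ i → (a ∈at segs) i
    In⇒at {a} p = wtotal-at segs (subst (1 ≤_) (sym (total (δ a))) (pos p))

    y≢z : y ≢ z
    y≢z refl = apart ap (λ ()) at-y at-z

    far : ∀ {a b} → a ∈ m → b ∈ ys → a ≁ b
    far p q e with ind (at⇒In (in-m p)) (at⇒In (in-ys q)) e
    ... | inj₁ o = apart-within ap (within-∷ at-y (within-∷ at-z (within-seg in-m))) (within-seg in-ys) refl (On-∈ʳ m o) q
    ... | inj₂ o = apart-within ap (within-∷ at-z (within-∷ at-y (within-seg in-ys))) (within-seg in-m) refl (On-∈ ys o) p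

    ind-m : ∀ {a b} → a ∈ m → In W b → a ~ b → On y m z a b
    ind-m p q e with ind (at⇒In (in-m p)) q e
    ... | inj₁ o = o
    ... | inj₂ o = ⊥-elim (apart-within ap (within-∷ at-z (within-∷ at-y (within-seg in-ys))) (within-seg in-m) refl (On-∈ ys o) p)

  module _ {W : Weight} where

    swap : ∀ {y m z ys} → Split W y m z ys → Split W z ys y m
    swap {y} {m} {z} {ys} s = record
      { walk₁ = walk₂ ; walk₂ = walk₁
      ; wt = λ f → trans (lem (f z) (wsum f ys) (f y) (wsum f m)) (wt f)
      ; un = un ; ind = λ p q e → [ inj₂ , inj₁ ]′ (ind p q e) }
      where
      open Split s
      abstract
        lem : ∀ a b c d → a + b + c + d ≡ c + d + a + b
        lem = solve-∀

    flip : ∀ {y m z ys} → Split W y m z ys → Split W y (reverse ys) z (reverse m)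
    flip {y} {m} {z} {ys} s = record
      { walk₁ = Walk-reverse ys walk₂ ; walk₂ = Walk-reverse m walk₁
      ; wt = wt′
      ; un = un ; ind = λ p q e → [ (λ o → inj₂ (On-reverse m o)) , (λ o → inj₁ (On-reverse ys o)) ]′ (ind p q e) }
      where
      open Split s
      abstract
        lem : ∀ a b c d → a + d + c + b ≡ a + b + c + d
        lem = solve-∀
      wt′ : ∀ f → f y + wsum f (reverse ys) + f z + wsum f (reverse m) ≡ W f
      wt′ f rewrite wsum-reverse f ys | wsum-reverse f m = trans (lem (f y) (wsum f m) (f z) (wsum f ys)) (wt f)

    moveR : ∀ {y} A {v} B {z ys} → Split W y (A ++ v ∷ B) z ys → Split W y A v (B ++ z ∷ ys)
    moveR {y} A {v} B {z} {ys} s = record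
      { walk₁ = proj₁ (Walk-++⁻ A B walk₁) ; walk₂ = Walk-++ B ys (proj₂ (Walk-++⁻ A B walk₁)) walk₂
      ; wt = wt′ ; un = un ; ind = ind′ }
      where
      open Split s
      abstract
        lem : ∀ y A v B z ys → y + A + v + (B + (z + ys)) ≡ y + (A + (v + B)) + z + ys
        lem = solve-∀
      wt′ : ∀ f → f y + wsum f A + f v + wsum f (B ++ z ∷ ys) ≡ W f
      wt′ f with wt f
      ... | e rewrite wsum-++ f A (v ∷ B) | wsum-++ f B (z ∷ ys) = trans (lem (f y) (wsum f A) (f v) (wsum f B) (f z) (wsum f ys)) e
      ind′ : ∀ {a b} → In W a → In W b → a ~ b → On y A v a b ⊎ On v (B ++ z ∷ ys) y a b
      ind′ p q e with ind p q e
      ... | inj₂ o = inj₂ (On-++⁺ʳ B ys o)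
      ... | inj₁ o with On-++⁻ A B o
      ...   | inj₁ o′ = inj₁ o′
      ...   | inj₂ o′ = inj₂ (On-++⁺ˡ B ys o′)

    moveL : ∀ {y} A {v} B {z ys} → Split W y (A ++ v ∷ B) z ys → Split W v B z (ys ++ y ∷ A)
    moveL {y} A {v} B {z} {ys} s = record
      { walk₁ = proj₂ (Walk-++⁻ A B walk₁) ; walk₂ = Walk-++ ys A walk₂ (proj₁ (Walk-++⁻ A B walk₁))
      ; wt = wt′ ; un = un ; ind = ind′ }
      where
      open Split s
      abstract
        lem : ∀ y A v B z ys → v + B + z + (ys + (y + A)) ≡ y + (A + (v + B)) + z + ys
        lem = solve-∀
      wt′ : ∀ f → f v + wsum f B + f z + wsum f (ys ++ y ∷ A) ≡ W f
      wt′ f with wt f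
      ... | e rewrite wsum-++ f A (v ∷ B) | wsum-++ f ys (y ∷ A) = trans (lem (f y) (wsum f A) (f v) (wsum f B) (f z) (wsum f ys)) e
      ind′ : ∀ {a b} → In W a → In W b → a ~ b → On v B z a b ⊎ On z (ys ++ y ∷ A) v a b
      ind′ p q e with ind p q e
      ... | inj₂ o = inj₂ (On-++⁺ˡ ys A o)
      ... | inj₁ o with On-++⁻ A B o
      ...   | inj₁ o′ = inj₂ (On-++⁺ʳ ys A o′)
      ...   | inj₂ o′ = inj₁ o′

    rebase : ∀ {y m z ys} → Split W y m z ys → ∀ {v} → In W v → ∃ λ m′ → ∃ λ z′ → ∃ λ ys′ → Split W v m′ z′ ys′
    rebase {y} {m} {z} {ys} s p with Split.In⇒at s p
    ... | _ , at0 (here refl) = _ , _ , _ , s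
    ... | _ , atS (at0 q) with ∈-∃++ q
    ...   | A , B , refl = _ , _ , _ , moveL A B s
    rebase s p | _ , atS (atS (at0 (here refl))) = _ , _ , _ , swap s
    rebase s p | _ , atS (atS (atS (at0 q))) with ∈-∃++ q
    ...   | A , B , refl = _ , _ , _ , moveL A B (swap s)

    rebase₂ : ∀ {y m z ys} → Split W y m z ys → ∀ {v u} → In W v → In W u → u ≢ v → ∃ λ m′ → ∃ λ ys′ → Split W v m′ u ys′
    rebase₂ s p q ne with rebase s p
    ... | m , z , ys , s′ with Split.In⇒at s′ q
    ... | _ , at0 (here e) = ⊥-elim (ne e)
    ... | _ , atS (at0 r) with ∈-∃++ r
    ...   | A , B , refl = _ , _ , moveR A B s′
    rebase₂ s p q ne | m , z , ys , s′ | _ , atS (atS (at0 (here refl))) = _ , _ , s′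
    rebase₂ s p q ne | m , z , ys , s′ | _ , atS (atS (atS (at0 r))) with ∈-∃++ r
    ...   | A , B , refl = _ , _ , swap (moveL A B (swap s′))

  -- A tripod with centre `w` and feet `y`, `t`, `z`, together with the three arcs of the hole
  -- between its feet, is a subdivision of K₄. The hypotheses on the tripod say that it has no
  -- further edges, neither inside nor to the hole.
  module Ear {W : Weight} {y : V} (A : List V) {t : V} (B : List V) {z : V} {ys : List V}
    (s : Split W y (A ++ t ∷ B) z ys) (w : V) (R₁ R₂ R₃ : List V)
    (w₁ : Walk w R₁ y) (w₂ : Walk w R₂ z) (w₃ : Walk w R₃ t)
    (uniq : Uniq (w ∷ R₁ ++ R₂ ++ R₃)) (out : ∀ {a} → a ∈ w ∷ R₁ ++ R₂ ++ R₃ → ¬ In W a)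
    (indP : ∀ {r q} → r ∈ w ∷ R₁ ++ R₂ ++ R₃ → q ∈ w ∷ R₁ ++ R₂ ++ R₃ ⊎ In W q → r ~ q →
            On w R₁ y r q ⊎ On w R₂ z r q ⊎ On w R₃ t r q)
    where
    private
      open Split s using (wt; un; ind; walk₁; walk₂)
      P = w ∷ R₁ ++ R₂ ++ R₃
      segs′ : List (List V)
      segs′ = (w ∷ []) ∷ (y ∷ []) ∷ (t ∷ []) ∷ (z ∷ []) ∷ R₁ ∷ R₃ ∷ R₂ ∷ A ∷ reverse ys ∷ B ∷ []
      abstract
        lem : ∀ w y t z r₁ r₃ r₂ a ys b → w + 0 + (y + 0 + (t + 0 + (z + 0 + (r₁ + (r₃ + (r₂ + (a + (ys + (b + 0))))))))) ≡
              (w + (r₁ + (r₂ + r₃))) + (y + (a + (t + b)) + z + ys)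
        lem = solve-∀
      total′ : ∀ f → wtotal f segs′ ≡ wsum f P + W f
      total′ f with wt f
      ... | e rewrite sym e | wsum-++ f R₁ (R₂ ++ R₃) | wsum-++ f R₂ R₃ | wsum-++ f A (t ∷ B) | wsum-reverse f ys
        = lem (f w) (f y) (f t) (f z) (wsum f R₁) (wsum f R₃) (wsum f R₂) (wsum f A) (wsum f ys) (wsum f B)
      once′ : ∀ v → wtotal (δ v) segs′ ≤ 1
      once′ v rewrite total′ (δ v) with v ∈? P
      ... | yes p = ≤-trans (≤-reflexive (trans (cong (wsum (δ v) P +_) (n<1⇒n≡0 (≰⇒> (λ h → out p (in! h))))) (+-identityʳ _))) (uniq v)
      ... | no np = ≤-trans (≤-reflexive (cong (_+ W (δ v)) (n<1⇒n≡0 (≰⇒> (λ h → np (1≤⇒∈ P h)))))) (un v)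
      tk : TK4
      tk = record
        { a = w ; b = y ; c = t ; d = z
        ; ab = R₁ ; ac = R₃ ; ad = R₂ ; bc = A ; bd = reverse ys ; cd = B
        ; wab = w₁ ; wac = w₃ ; wad = w₂
        ; wbc = proj₁ (Walk-++⁻ A B walk₁) ; wbd = Walk-reverse ys walk₂ ; wcd = proj₂ (Walk-++⁻ A B walk₁)
        ; ap = mk-apart once′ }
      where-is : ∀ {v} → TK4.Vert tk v → v ∈ P ⊎ In W v
      where-is {v} (i , p) with v ∈? P
      ... | yes q = inj₁ q
      ... | no nq = inj₂ (in! (subst (λ k → 1 ≤ k + W (δ v)) (n<1⇒n≡0 (≰⇒> (λ h → nq (1≤⇒∈ P h))))
                          (subst (1 ≤_) (total′ (δ v)) (at⇒1≤ p))))
      edgeP : ∀ {x y′} → On w R₁ y x y′ ⊎ On w R₂ z x y′ ⊎ On w R₃ t x y′ → TK4.Edge tk x y′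
      edgeP (inj₁ o) = inj₁ o
      edgeP (inj₂ (inj₁ o)) = inj₂ (inj₂ (inj₁ o))
      edgeP (inj₂ (inj₂ o)) = inj₂ (inj₁ o)
      edgeQ : ∀ {x y′} → On y (A ++ t ∷ B) z x y′ ⊎ On z ys y x y′ → TK4.Edge tk x y′
      edgeQ (inj₂ o) = inj₂ (inj₂ (inj₂ (inj₂ (inj₁ (On-reverse ys o)))))
      edgeQ (inj₁ o) with On-++⁻ A B o
      ... | inj₁ o′ = inj₂ (inj₂ (inj₂ (inj₁ o′)))
      ... | inj₂ o′ = inj₂ (inj₂ (inj₂ (inj₂ (inj₂ o′))))
      flipP : ∀ {x y′} → On w R₁ y x y′ ⊎ On w R₂ z x y′ ⊎ On w R₃ t x y′ → On w R₁ y y′ x ⊎ On w R₂ z y′ x ⊎ On w R₃ t y′ x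
      flipP (inj₁ o) = inj₁ (On-sym R₁ o)
      flipP (inj₂ (inj₁ o)) = inj₂ (inj₁ (On-sym R₂ o))
      flipP (inj₂ (inj₂ o)) = inj₂ (inj₂ (On-sym R₃ o))
      induced : ∀ {x y′} → x ∈ P ⊎ In W x → y′ ∈ P ⊎ In W y′ → x ~ y′ → TK4.Edge tk x y′
      induced (inj₁ p) q e = edgeP (indP p q e)
      induced (inj₂ p) (inj₁ q) e = edgeP (flipP (indP q (inj₂ p) (~-sym e)))
      induced (inj₂ p) (inj₂ q) e = edgeQ (ind p q e)

    isk4 : HasISK4 G
    isk4 = induced-TK4 tk (λ p q e → induced (where-is p) (where-is q) e)

  split-count : ∀ {W : Weight} {y m z ys w} → Split W y m z ys → w ~ y → w ~ z → W (nb w) ≡ 2 + (cnt w m + cnt w ys)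
  split-count {W} {y} {m} {z} {ys} {w} s wy wz with Split.wt s (nb w)
  ... | e rewrite nb-yes {w} wy | nb-yes {w} wz = trans (sym e) (lem (cnt w m) (cnt w ys))
    where
    abstract
      lem : ∀ a b → 1 + a + 1 + b ≡ 2 + (a + b)
      lem = solve-∀

  other-nb : ∀ {W : Weight} {y m z ys w} → Split W y m z ys → 2 ≤ W (nb w) → ∃ λ v → In W v × v ≢ y × w ~ v
  other-nb {W} {y} {m} {z} {ys} {w} s h with w ~? z
  ... | yes e = z , Split.at⇒In s (Split.at-z s) , (λ { refl → Split.y≢z s refl }) , e
  ... | no nz with find-first (w ~?_) m
  ...   | inj₁ (first A v B refl wv _) = v , Split.at⇒In s (Split.in-m s v∈) ,
            (λ { refl → apart (Split.ap s) (λ ()) (Split.at-y s) (Split.in-m s v∈) }) , wv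
    where
    v∈ : v ∈ A ++ v ∷ B
    v∈ = ∈-++⁺ʳ A (here refl)
  ...   | inj₂ nm with find-first (w ~?_) ys
  ...     | inj₁ (first A v B refl wv _) = v , Split.at⇒In s (Split.in-ys s v∈) ,
            (λ { refl → apart (Split.ap s) (λ ()) (Split.at-y s) (Split.in-ys s v∈) }) , wv
    where
    v∈ : v ∈ A ++ v ∷ B
    v∈ = ∈-++⁺ʳ A (here refl)
  ...     | inj₂ nys = ⊥-elim (<⇒≱ h (≤-trans (≤-reflexive (sym (Split.wt s (nb w)))) few))
    where
    nb≤1 : nb w y ≤ 1
    nb≤1 with adj G w y
    ... | true  = ≤-refl
    ... | false = z≤n
    few : nb w y + cnt w m + nb w z + cnt w ys ≤ 1
    few rewrite ≁⇒cnt≡0 m nm | ≁⇒cnt≡0 ys nys | nb-no {w} nz | +-identityʳ (nb w y) | +-identityʳ (nb w y) | +-identityʳ (nb w y) = nb≤1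

  some-nb : ∀ {W : Weight} {y m z ys w} → Split W y m z ys → 1 ≤ W (nb w) → ∃ λ v → In W v × w ~ v
  some-nb {W} {y} {m} {z} {ys} {w} s h with w ~? y
  ... | yes e = y , Split.at⇒In s (Split.at-y s) , e
  ... | no ny with w ~? z
  ...   | yes e = z , Split.at⇒In s (Split.at-z s) , e
  ...   | no nz with find-first (w ~?_) m
  ...     | inj₁ (first A v B refl wv _) = v , Split.at⇒In s (Split.in-m s (∈-++⁺ʳ A (here refl))) , wv
  ...     | inj₂ nm with find-first (w ~?_) ys
  ...       | inj₁ (first A v B refl wv _) = v , Split.at⇒In s (Split.in-ys s (∈-++⁺ʳ A (here refl))) , wv
  ...       | inj₂ nys = ⊥-elim (<⇒≱ h (≤-trans (≤-reflexive (sym (Split.wt s (nb w)))) few))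
    where
    few : nb w y + cnt w m + nb w z + cnt w ys ≤ 0
    few rewrite ≁⇒cnt≡0 m nm | ≁⇒cnt≡0 ys nys | nb-no {w} nz | nb-no {w} ny = z≤n

  -- An ear whose three legs are single edges. The hole is cut at two of the neighbours, and the
  -- third is sought on the two arcs.
  three-neighbours : ∀ {W : Weight} {y m z ys} → Split W y m z ys → ∀ {w} → ¬ In W w → W (nb w) ≡ 3 → HasISK4 G
  three-neighbours {W} s {w} out h = go₁ s
    where
    core : ∀ {y} A {t} B {z ys} → Split W y (A ++ t ∷ B) z ys → w ~ y → w ~ t → w ~ z →
           cnt w A ≡ 0 → cnt w B ≡ 0 → cnt w ys ≡ 0 → HasISK4 G
    core {y} A {t} B {z} {ys} s wy wt wz a0 b0 c0 =
      Ear.isk4 A B s w [] [] [] wy wz wt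
        (λ v → ≤-trans (≤-reflexive (+-identityʳ _)) (δ≤1 v w))
        (λ { (here refl) → out }) indP
      where
      indP : ∀ {r q} → r ∈ w ∷ [] → q ∈ w ∷ [] ⊎ In W q → r ~ q → Pair w y r q ⊎ Pair w z r q ⊎ Pair w t r q
      indP (here refl) (inj₁ (here refl)) e = ⊥-elim (~-irr e)
      indP (here refl) (inj₂ q) e with Split.In⇒at s q
      ... | _ , at0 (here refl) = inj₁ (inj₁ (refl , refl))
      ... | _ , atS (atS (at0 (here refl))) = inj₂ (inj₁ (inj₁ (refl , refl)))
      ... | _ , atS (atS (atS (at0 i))) = ⊥-elim (cnt≡0⇒≁ ys c0 i e)
      ... | _ , atS (at0 i) with ∈-++⁻ A i
      ...   | inj₁ j = ⊥-elim (cnt≡0⇒≁ A a0 j e)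
      ...   | inj₂ (here refl) = inj₂ (inj₂ (inj₁ (refl , refl)))
      ...   | inj₂ (there j) = ⊥-elim (cnt≡0⇒≁ B b0 j e)
    go₃ : ∀ {y m z ys} → Split W y m z ys → w ~ y → w ~ z → cnt w m + cnt w ys ≡ 1 → HasISK4 G
    go₃ {y} {m} {z} {ys} s wy wz e with cnt w m in em
    ... | suc k with first-nb w m (subst (1 ≤_) (sym em) (s≤s z≤n))
    ...   | first A t B refl wt h =
      core A B s wy wt wz (≁⇒cnt≡0 A h) b0 (m+n≡0⇒n≡0 k (cong pred e))
      where
      b0 : cnt w B ≡ 0
      b0 with trans (sym (wsum-++ (nb w) A (t ∷ B))) em
      ... | q rewrite ≁⇒cnt≡0 A h | nb-yes {w} wt = trans (cong pred q) (m+n≡0⇒m≡0 k (cong pred e))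
    go₃ {y} {m} {z} {ys} s wy wz e | zero with first-nb w ys (≤-reflexive (sym e))
    ...   | first A t B refl wt h = core A B (swap s) wz wt wy (≁⇒cnt≡0 A h) b0 em
      where
      b0 : cnt w B ≡ 0
      b0 with trans (sym (wsum-++ (nb w) A (t ∷ B))) e
      ... | q rewrite ≁⇒cnt≡0 A h | nb-yes {w} wt = cong pred q
    fin : ∀ {y m v ys} → Split W y m v ys → w ~ y → w ~ v → HasISK4 G
    fin {y} {m} {v} {ys} s wy wv = go₃ s wy wv (cong pred (cong pred (trans (sym (split-count s wy wv)) h)))
    go₁ : ∀ {y m z ys} → Split W y m z ys → HasISK4 G
    go₁ s with some-nb s (≤-trans (s≤s z≤n) (≤-reflexive (sym h)))
    ... | v , v∈ , wv with rebase s v∈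
    ...   | _ , _ , _ , s′ with other-nb s′ (≤-trans (s≤s (s≤s z≤n)) (≤-reflexive (sym h)))
    ...     | u , u∈ , u≢v , wu with rebase₂ s′ v∈ u∈ u≢v
    ...       | _ , _ , s″ = fin s″ wv wu

  Triangle-free : Set
  Triangle-free = ∀ {a b c : V} → a ~ b → b ~ c → a ~ c → ⊥

  No-K33 : Set
  No-K33 = ∀ {a₁ a₂ a₃ b₁ b₂ b₃ : V} → a₁ ≢ a₂ → a₁ ≢ a₃ → a₂ ≢ a₃ → b₁ ≢ b₂ → b₁ ≢ b₃ → b₂ ≢ b₃ →
    a₁ ~ b₁ → a₁ ~ b₂ → a₁ ~ b₃ → a₂ ~ b₁ → a₂ ~ b₂ → a₂ ~ b₃ → a₃ ~ b₁ → a₃ ~ b₂ → a₃ ~ b₃ → ⊥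

  No-wheel : Set
  No-wheel = ∀ {W : Weight} {y m z ys x} → Split W y m z ys → ¬ In W x → 4 ≤ W (nb x) → ⊥

  -- Chords of a smallest subdivision of K₄

  size : TK4 → ℕ
  size t = weight (λ _ → 1) t

  Small : TK4 → Set
  Small t = ∀ t′ → size t′ < size t → ⊥

  Small-same : ∀ {t t′} → Same t t′ → Small t → Small t′
  Small-same s h t″ lt = h t″ (subst (size t″ <_) (Same.weight≡ s (λ _ → 1)) lt)

  -- A chord allows other subdivisions on the same vertices. Whatever list `D` such a subdivision
  -- leaves out must be empty by minimality. The weight equation also yields that the new paths are
  -- disjoint, so each case below is a choice of paths and an identity of sums.
  drop : ∀ t → Small t → ∀ ls (mk : Apart ls → TK4) → (∀ ap → TK4.segs (mk ap) ≡ ls) → ∀ D →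
         (∀ f → weight f t ≡ wtotal f ls + wsum f D) → D ≡ []
  drop t small ls mk eq [] w = refl
  drop t small ls mk eq (u ∷ D) w = ⊥-elim (small (mk ap′) lt)
    where
    ap′ : Apart ls
    ap′ = Apart-mono (λ f → ≤-trans (m≤m+n _ _) (≤-reflexive (sym (w f)))) (TK4.ap t)
    lt : size (mk ap′) < size t
    lt = ≤-trans (s≤s (≤-reflexive (cong (wtotal (λ _ → 1)) (eq ap′))))
           (≤-trans (s≤s (m≤m+n (wtotal (λ _ → 1) ls) (wsum (λ _ → 1) D)))
             (≤-reflexive (trans (sym (+-suc (wtotal (λ _ → 1) ls) (wsum (λ _ → 1) D))) (sym (w (λ _ → 1))))))

  -- The skipped vertices are `d ∷ D`, so a shortcut is strictly shorter and, by the equation for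
  -- every `f`, uses old vertices only.
  record Shortcut (u : V) (xs : List V) (w : V) : Set where
    constructor shortcut
    field
      xs′  : List V
      d    : V
      D    : List V
      walk : Walk u xs′ w
      eq   : ∀ f → wsum f xs ≡ wsum f xs′ + (f d + wsum f D)

  private abstract
    lem₁ : ∀ z a y b → z + (a + (y + b)) ≡ y + b + (z + a)
    lem₁ = solve-∀

  from-end : ∀ {u} z zs {w y} → Walk u (z ∷ zs) w → y ∈ w ∷ z ∷ zs → u ~ y → y ≢ z → Shortcut u (z ∷ zs) w
  from-end z zs wk (here refl) e ne = shortcut [] z zs e (λ f → refl)
  from-end z zs wk (there (here refl)) e ne = ⊥-elim (ne refl)
  from-end z zs {y = y} (_ , wk) (there (there i)) e ne with ∈-∃++ i
  ... | A , B , refl = shortcut (y ∷ B) z A (e , proj₂ (Walk-++⁻ A B wk))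
          (λ f → trans (cong (f z +_) (wsum-++ f A (y ∷ B))) (lem₁ (f z) (wsum f A) (f y) (wsum f B)))

  shorten : ∀ {u} xs {w x y} → Walk u xs w → x ∈ u ∷ w ∷ xs → y ∈ u ∷ w ∷ xs → x ~ y → ¬ On u xs w x y → Shortcut u xs w
  shorten [] wk (here refl) (here refl) e no-on = ⊥-elim (~-irr e)
  shorten [] wk (here refl) (there (here refl)) e no-on = ⊥-elim (no-on (inj₁ (refl , refl)))
  shorten [] wk (there (here refl)) (here refl) e no-on = ⊥-elim (no-on (inj₂ (refl , refl)))
  shorten [] wk (there (here refl)) (there (here refl)) e no-on = ⊥-elim (~-irr e)
  shorten (z ∷ zs) wk (here refl) (here refl) e no-on = ⊥-elim (~-irr e)
  shorten (z ∷ zs) wk (here refl) (there j) e no-on = from-end z zs wk j e (λ { refl → no-on (inj₁ (inj₁ (refl , refl))) })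
  shorten (z ∷ zs) wk (there i) (here refl) e no-on = from-end z zs wk i (~-sym e) (λ { refl → no-on (inj₁ (inj₂ (refl , refl))) })
  shorten (z ∷ zs) {w} (p , wk) (there i) (there j) e no-on
    with shorten zs wk (re i) (re j) e (λ o → no-on (inj₂ o))
    where
    re : ∀ {v} → v ∈ w ∷ z ∷ zs → v ∈ z ∷ w ∷ zs
    re (here q)          = there (here q)
    re (there (here q))  = here q
    re (there (there q)) = there (there q)
  ... | shortcut xs′ d D wk′ eq = shortcut (z ∷ xs′) d D (p , wk′)
          (λ f → trans (cong (f z +_) (eq f)) (sym (+-assoc (f z) _ _)))

  private abstract
    lα : ∀ a b c d ab x ac ad bc bd cd →
      a + 0 + (b + 0 + (c + 0 + (d + 0 + (ab + x + (ac + (ad + (bc + (bd + (cd + 0))))))))) ≡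
      a + 0 + (b + 0 + (c + 0 + (d + 0 + (ab + (ac + (ad + (bc + (bd + (cd + 0))))))))) + x
    lα = solve-∀
    lβ₁ : ∀ a b c d ab ac ad B₁ v B₂ bd cd →
      a + 0 + (b + 0 + (c + 0 + (d + 0 + (ab + (ac + (ad + (B₁ + (v + B₂) + (bd + (cd + 0))))))))) ≡
      a + 0 + (v + 0 + (c + 0 + (d + 0 + (0 + (ac + (ad + (B₂ + (B₁ + (b + bd) + (cd + 0))))))))) + ab
    lβ₁ = solve-∀
    lβ₂ : ∀ a b c d ab ac ad B₁ v B₂ bd cd →
      a + 0 + (b + 0 + (c + 0 + (d + 0 + (ab + (ac + (ad + (B₁ + (v + B₂) + (bd + (cd + 0))))))))) ≡
      a + 0 + (b + 0 + (c + 0 + (v + 0 + (ab + (ac + (0 + (bd + (d + cd) + (B₁ + (B₂ + 0))))))))) + ad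
    lβ₂ = solve-∀
    lγ : ∀ a b c d A₁ v A₂ B₁ w B₂ ad bc bd cd →
      a + 0 + (b + 0 + (c + 0 + (d + 0 + (A₁ + (v + A₂) + (B₁ + (w + B₂) + (ad + (bc + (bd + (cd + 0))))))))) ≡
      v + 0 + (b + 0 + (c + 0 + (d + 0 + (A₂ + (w + B₂ + (A₁ + (a + ad) + (bc + (bd + (cd + 0))))))))) + B₁
    lγ = solve-∀
    lδ₁ : ∀ a b c d A₁ v A₂ ac ad bc bd B₁ w B₂ →
      a + 0 + (b + 0 + (c + 0 + (d + 0 + (A₁ + (v + A₂) + (ac + (ad + (bc + (bd + (B₁ + (w + B₂) + 0))))))))) ≡
      v + 0 + (b + 0 + (d + 0 + (w + 0 + (A₂ + (A₁ + (a + ad) + (0 + (bd + (bc + (c + B₁) + (B₂ + 0))))))))) + ac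
    lδ₁ = solve-∀
    lδ₂ : ∀ a b c d A₁ v A₂ ac ad bc bd B₁ w B₂ →
      a + 0 + (b + 0 + (c + 0 + (d + 0 + (A₁ + (v + A₂) + (ac + (ad + (bc + (bd + (B₁ + (w + B₂) + 0))))))))) ≡
      b + 0 + (c + 0 + (d + 0 + (w + 0 + (bc + (bd + (A₂ + (v + 0) + (ac + (a + ad) + (B₁ + (B₂ + 0))))))))) + A₁
    lδ₂ = solve-∀

  -- A chord within one of the six paths is a shortcut of that path.
  α : ∀ t → Small t → ∀ {x y} → x ∈ TK4.a t ∷ TK4.b t ∷ TK4.ab t → y ∈ TK4.a t ∷ TK4.b t ∷ TK4.ab t → x ~ y →
      ¬ On (TK4.a t) (TK4.ab t) (TK4.b t) x y → ⊥
  α t small p q e no-on with shorten (TK4.ab t) (TK4.wab t) p q e no-on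
  ... | shortcut ab′ x D wk eq = absurd (drop t small ls′
          (λ ap′ → record { a = a ; b = b ; c = c ; d = d ; ab = ab′ ; ac = ac ; ad = ad ; bc = bc ; bd = bd ; cd = cd
                          ; wab = wk ; wac = wac ; wad = wad ; wbc = wbc ; wbd = wbd ; wcd = wcd ; ap = ap′ })
          (λ _ → refl) (x ∷ D) w)
    where
    open TK4 t
    absurd : x ∷ D ≡ [] → ⊥
    absurd ()
    ls′ : List (List V)
    ls′ = (a ∷ []) ∷ (b ∷ []) ∷ (c ∷ []) ∷ (d ∷ []) ∷ ab′ ∷ ac ∷ ad ∷ bc ∷ bd ∷ cd ∷ []
    w : ∀ f → weight f t ≡ wtotal f ls′ + wsum f (x ∷ D)
    w f rewrite eq f = lα (f a) (f b) (f c) (f d) (wsum f ab′) (f x + wsum f D) (wsum f ac) (wsum f ad) (wsum f bc) (wsum f bd) (wsum f cd)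

  -- With the edge `a v` in place of the path `ab`, the vertex `v` takes over as a corner and `b`
  -- becomes an interior vertex of the path from `v` to `d`. The interior of `ab` is left out.
  β-ab : ∀ t → Small t → ∀ {v} → TK4.a t ~ v → v ∈ TK4.bc t → TK4.ab t ≡ []
  β-ab t small {v} e i with ∈-∃++ i
  ... | B₁ , B₂ , eq = drop t small ls′
          (λ ap′ → record { a = a ; b = v ; c = c ; d = d ; ab = [] ; ac = ac ; ad = ad ; bc = B₂ ; bd = reverse B₁ ++ b ∷ bd ; cd = cd
                          ; wab = e ; wac = wac ; wad = wad ; wbc = proj₂ wk
                          ; wbd = Walk-++ (reverse B₁) bd (Walk-reverse B₁ (proj₁ wk)) wbd ; wcd = wcd ; ap = ap′ })
          (λ _ → refl) ab w
    where
    open TK4 t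
    ls′ : List (List V)
    ls′ = (a ∷ []) ∷ (v ∷ []) ∷ (c ∷ []) ∷ (d ∷ []) ∷ [] ∷ ac ∷ ad ∷ B₂ ∷ (reverse B₁ ++ b ∷ bd) ∷ cd ∷ []
    wk : Walk b B₁ v × Walk v B₂ c
    wk = Walk-++⁻ B₁ B₂ (subst (λ l → Walk b l c) eq wbc)
    w : ∀ f → weight f t ≡ wtotal f ls′ + wsum f ab
    w f rewrite trans (cong (wsum f) eq) (wsum-++ f B₁ (v ∷ B₂)) | wsum-++ f (reverse B₁) (b ∷ bd) | wsum-reverse f B₁
      = lβ₁ (f a) (f b) (f c) (f d) (wsum f ab) (wsum f ac) (wsum f ad) (wsum f B₁) (f v) (wsum f B₂) (wsum f bd) (wsum f cd)

  β-ac : ∀ t → Small t → ∀ {v} → TK4.a t ~ v → v ∈ TK4.bc t → TK4.ac t ≡ []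
  β-ac t small e i = β-ab (swap-bc t) (Small-same (same-bc t) small) e (reverse⁺ i)

  -- Again `v` becomes a corner, now instead of `d`: the corners `b` and `c` are joined through `d`,
  -- and the two pieces of the old `bc` lead to `v`. The interior of `ad` is left out.
  β-ad : ∀ t → Small t → ∀ {v} → TK4.a t ~ v → v ∈ TK4.bc t → TK4.ad t ≡ []
  β-ad t small {v} e i with ∈-∃++ i
  ... | B₁ , B₂ , eq = drop t small ls′
          (λ ap′ → record { a = a ; b = b ; c = c ; d = v ; ab = ab ; ac = ac ; ad = [] ; bc = bd ++ d ∷ reverse cd ; bd = B₁ ; cd = reverse B₂
                          ; wab = wab ; wac = wac ; wad = e ; wbc = Walk-++ bd (reverse cd) wbd (Walk-reverse cd wcd)
                          ; wbd = proj₁ wk ; wcd = Walk-reverse B₂ (proj₂ wk) ; ap = ap′ })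
          (λ _ → refl) ad w
    where
    open TK4 t
    ls′ : List (List V)
    ls′ = (a ∷ []) ∷ (b ∷ []) ∷ (c ∷ []) ∷ (v ∷ []) ∷ ab ∷ ac ∷ [] ∷ (bd ++ d ∷ reverse cd) ∷ B₁ ∷ reverse B₂ ∷ []
    wk : Walk b B₁ v × Walk v B₂ c
    wk = Walk-++⁻ B₁ B₂ (subst (λ l → Walk b l c) eq wbc)
    w : ∀ f → weight f t ≡ wtotal f ls′ + wsum f ad
    w f rewrite trans (cong (wsum f) eq) (wsum-++ f B₁ (v ∷ B₂)) | wsum-++ f bd (d ∷ reverse cd) | wsum-reverse f cd | wsum-reverse f B₂
      = lβ₂ (f a) (f b) (f c) (f d) (wsum f ab) (wsum f ac) (wsum f ad) (wsum f B₁) (f v) (wsum f B₂) (wsum f bd) (wsum f cd)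

  -- The corner `a` is moved to `v`, from where the chord leads to `w`. The piece of `ac` between
  -- `a` and `w` is left out.
  γ₁ : ∀ t → Small t → ∀ A₁ {v} A₂ B₁ {w} B₂ → TK4.ab t ≡ A₁ ++ v ∷ A₂ → TK4.ac t ≡ B₁ ++ w ∷ B₂ → v ~ w → B₁ ≡ []
  γ₁ t small A₁ {v} A₂ B₁ {w} B₂ eqA eqB e = drop t small ls′
          (λ ap′ → record { a = v ; b = b ; c = c ; d = d ; ab = A₂ ; ac = w ∷ B₂ ; ad = reverse A₁ ++ a ∷ ad ; bc = bc ; bd = bd ; cd = cd
                          ; wab = proj₂ wA ; wac = e , proj₂ wB ; wad = Walk-++ (reverse A₁) ad (Walk-reverse A₁ (proj₁ wA)) wad
                          ; wbc = wbc ; wbd = wbd ; wcd = wcd ; ap = ap′ })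
          (λ _ → refl) B₁ wt
    where
    open TK4 t
    ls′ : List (List V)
    ls′ = (v ∷ []) ∷ (b ∷ []) ∷ (c ∷ []) ∷ (d ∷ []) ∷ A₂ ∷ (w ∷ B₂) ∷ (reverse A₁ ++ a ∷ ad) ∷ bc ∷ bd ∷ cd ∷ []
    wA : Walk a A₁ v × Walk v A₂ b
    wA = Walk-++⁻ A₁ A₂ (subst (λ l → Walk a l b) eqA wab)
    wB : Walk a B₁ w × Walk w B₂ c
    wB = Walk-++⁻ B₁ B₂ (subst (λ l → Walk a l c) eqB wac)
    wt : ∀ f → weight f t ≡ wtotal f ls′ + wsum f B₁
    wt f rewrite trans (cong (wsum f) eqA) (wsum-++ f A₁ (v ∷ A₂)) | trans (cong (wsum f) eqB) (wsum-++ f B₁ (w ∷ B₂)) | wsum-++ f (reverse A₁) (a ∷ ad) | wsum-reverse f A₁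
      = lγ (f a) (f b) (f c) (f d) (wsum f A₁) (f v) (wsum f A₂) (wsum f B₁) (f w) (wsum f B₂) (wsum f ad) (wsum f bc) (wsum f bd) (wsum f cd)

  -- Both ends of the chord become corners in place of `a` and `c`, which turn into interior
  -- vertices; the interior of `ac` is left out.
  δ-ac : ∀ t → Small t → ∀ A₁ {v} A₂ B₁ {w} B₂ → TK4.ab t ≡ A₁ ++ v ∷ A₂ → TK4.cd t ≡ B₁ ++ w ∷ B₂ → v ~ w → TK4.ac t ≡ []
  δ-ac t small A₁ {v} A₂ B₁ {w} B₂ eqA eqB e = drop t small ls′
          (λ ap′ → record { a = v ; b = b ; c = d ; d = w ; ab = A₂ ; ac = reverse A₁ ++ a ∷ ad ; ad = [] ; bc = bd ; bd = bc ++ c ∷ B₁ ; cd = reverse B₂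
                          ; wab = proj₂ wA ; wac = Walk-++ (reverse A₁) ad (Walk-reverse A₁ (proj₁ wA)) wad ; wad = e
                          ; wbc = wbd ; wbd = Walk-++ bc B₁ wbc (proj₁ wB) ; wcd = Walk-reverse B₂ (proj₂ wB) ; ap = ap′ })
          (λ _ → refl) ac wt
    where
    open TK4 t
    ls′ : List (List V)
    ls′ = (v ∷ []) ∷ (b ∷ []) ∷ (d ∷ []) ∷ (w ∷ []) ∷ A₂ ∷ (reverse A₁ ++ a ∷ ad) ∷ [] ∷ bd ∷ (bc ++ c ∷ B₁) ∷ reverse B₂ ∷ []
    wA : Walk a A₁ v × Walk v A₂ b
    wA = Walk-++⁻ A₁ A₂ (subst (λ l → Walk a l b) eqA wab)
    wB : Walk c B₁ w × Walk w B₂ d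
    wB = Walk-++⁻ B₁ B₂ (subst (λ l → Walk c l d) eqB wcd)
    wt : ∀ f → weight f t ≡ wtotal f ls′ + wsum f ac
    wt f rewrite trans (cong (wsum f) eqA) (wsum-++ f A₁ (v ∷ A₂)) | trans (cong (wsum f) eqB) (wsum-++ f B₁ (w ∷ B₂)) | wsum-++ f (reverse A₁) (a ∷ ad) | wsum-reverse f A₁
                 | wsum-++ f bc (c ∷ B₁) | wsum-reverse f B₂
      = lδ₁ (f a) (f b) (f c) (f d) (wsum f A₁) (f v) (wsum f A₂) (wsum f ac) (wsum f ad) (wsum f bc) (wsum f bd) (wsum f B₁) (f w) (wsum f B₂)

  -- Here only `w` becomes a corner: it replaces `a`, and `v` lies on the path from `b` to it. The
  -- piece of `ab` between `a` and `v` is left out.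
  δ-A₁ : ∀ t → Small t → ∀ A₁ {v} A₂ B₁ {w} B₂ → TK4.ab t ≡ A₁ ++ v ∷ A₂ → TK4.cd t ≡ B₁ ++ w ∷ B₂ → v ~ w → A₁ ≡ []
  δ-A₁ t small A₁ {v} A₂ B₁ {w} B₂ eqA eqB e = drop t small ls′
          (λ ap′ → record { a = b ; b = c ; c = d ; d = w ; ab = bc ; ac = bd ; ad = reverse A₂ ++ v ∷ [] ; bc = reverse ac ++ a ∷ ad ; bd = B₁ ; cd = reverse B₂
                          ; wab = wbc ; wac = wbd ; wad = Walk-++ (reverse A₂) [] (Walk-reverse A₂ (proj₂ wA)) e
                          ; wbc = Walk-++ (reverse ac) ad (Walk-reverse ac wac) wad ; wbd = proj₁ wB ; wcd = Walk-reverse B₂ (proj₂ wB) ; ap = ap′ })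
          (λ _ → refl) A₁ wt
    where
    open TK4 t
    ls′ : List (List V)
    ls′ = (b ∷ []) ∷ (c ∷ []) ∷ (d ∷ []) ∷ (w ∷ []) ∷ bc ∷ bd ∷ (reverse A₂ ++ v ∷ []) ∷ (reverse ac ++ a ∷ ad) ∷ B₁ ∷ reverse B₂ ∷ []
    wA : Walk a A₁ v × Walk v A₂ b
    wA = Walk-++⁻ A₁ A₂ (subst (λ l → Walk a l b) eqA wab)
    wB : Walk c B₁ w × Walk w B₂ d
    wB = Walk-++⁻ B₁ B₂ (subst (λ l → Walk c l d) eqB wcd)
    wt : ∀ f → weight f t ≡ wtotal f ls′ + wsum f A₁
    wt f rewrite trans (cong (wsum f) eqA) (wsum-++ f A₁ (v ∷ A₂)) | trans (cong (wsum f) eqB) (wsum-++ f B₁ (w ∷ B₂)) | wsum-++ f (reverse A₂) (v ∷ []) | wsum-reverse f A₂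
                 | wsum-++ f (reverse ac) (a ∷ ad) | wsum-reverse f ac | wsum-reverse f B₂
      = lδ₂ (f a) (f b) (f c) (f d) (wsum f A₁) (f v) (wsum f A₂) (wsum f ac) (wsum f ad) (wsum f bc) (wsum f bd) (wsum f B₁) (f w) (wsum f B₂)

  short-len : ∀ {u xs w} (s : Shortcut u xs w) → len (Shortcut.xs′ s) < len xs
  short-len (shortcut xs′ d D wk eq) = ≤-trans (≤-trans (≤-reflexive (sym (+-comm (len xs′) 1)))
    (+-monoʳ-≤ (len xs′) (s≤s z≤n))) (≤-reflexive (sym (eq (λ _ → 1))))

  short-⊆ : ∀ {u xs w} (s : Shortcut u xs w) → ∀ {v} → v ∈ Shortcut.xs′ s → v ∈ xs
  short-⊆ {xs = xs} (shortcut xs′ d D wk eq) {v} p =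
    1≤⇒∈ xs (≤-trans (∈⇒1≤ p) (≤-trans (m≤m+n _ _) (≤-reflexive (sym (eq (δ v))))))

  private abstract
    l₁ : ∀ z A x B → z + (A + (x + B)) ≡ B + (z + (A + x))
    l₁ = solve-∀

  uniq-or-short : ∀ {u} xs {w} → Walk u xs w → u ≢ w → Uniq (u ∷ w ∷ xs) ⊎ Shortcut u xs w
  uniq-or-short {u} [] {w} wk ne = inj₁ (Uniq-∷ u (w ∷ []) (λ { (here e) → ne e }) (Uniq-∷ w [] (λ ()) Uniq-[]))
  uniq-or-short {u} (z ∷ zs) {w} (e , wk) ne with u ∈? zs
  ... | yes p with ∈-∃++ p
  ...   | A , B , refl = inj₂ (shortcut B z (A ++ u ∷ []) (proj₂ (Walk-++⁻ A B wk)) eq)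
    where
    eq : ∀ f → f z + wsum f (A ++ u ∷ B) ≡ wsum f B + (f z + wsum f (A ++ u ∷ []))
    eq f rewrite wsum-++ f A (u ∷ B) | wsum-++ f A (u ∷ []) | +-identityʳ (f u) = l₁ (f z) (wsum f A) (f u) (wsum f B)
  uniq-or-short {u} (z ∷ zs) {w} (e , wk) ne | no u∉ with z ≟ w
  ... | yes refl = inj₂ (shortcut [] z zs e (λ f → refl))
  ... | no z≢w with uniq-or-short zs wk z≢w
  ...   | inj₂ (shortcut xs′ d D wk′ eq) = inj₂ (shortcut (z ∷ xs′) d D (e , wk′) (λ f → trans (cong (f z +_) (eq f)) (sym (+-assoc (f z) _ _))))
  ...   | inj₁ un = inj₁ (Uniq-∷ u (w ∷ z ∷ zs) u∉′ un′)
    where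
    u∉′ : u ∉ w ∷ z ∷ zs
    u∉′ (here p) = ne p
    u∉′ (there (here refl)) = ~-irr e
    u∉′ (there (there p)) = u∉ p
    un′ : Uniq (w ∷ z ∷ zs)
    un′ v = ≤-trans (≤-reflexive (swap₁ (δ v w) (δ v z) _)) (un v)
      where
      abstract
        swap₁ : ∀ a b c → a + (b + c) ≡ b + (a + c)
        swap₁ = solve-∀

  record Sub (xs : List V) (r s : V) : Set where
    constructor sub
    field
      zs   : List V
      walk : Walk r zs s
      lt   : len zs < len xs
      ⊆    : ∀ {v} → v ∈ zs → v ∈ xs

  private
    lt-left : ∀ A (v : V) B → len A < len (A ++ v ∷ B)
    lt-left A v B rewrite wsum-++ (λ _ → 1) A (v ∷ B) = ≤-trans (≤-reflexive (sym (+-comm (len A) 1))) (+-monoʳ-≤ (len A) (s≤s z≤n))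
    lt-right : ∀ A (v : V) B → len B < len (A ++ v ∷ B)
    lt-right A v B rewrite wsum-++ (λ _ → 1) A (v ∷ B) = m≤n+m (suc (len B)) (len A)

  prefix : ∀ {u} xs {w r} → Walk u xs w → r ∈ xs → Sub xs u r
  prefix xs {r = r} wk p with ∈-∃++ p
  ... | A , B , refl = sub A (proj₁ (Walk-++⁻ A B wk)) (lt-left A r B) ∈-++⁺ˡ

  suffix : ∀ {u} xs {w r} → Walk u xs w → r ∈ xs → Sub xs r w
  suffix xs {r = r} wk p with ∈-∃++ p
  ... | A , B , refl = sub B (proj₂ (Walk-++⁻ A B wk)) (lt-right A r B) (λ q → ∈-++⁺ʳ A (there q))

  between : ∀ {u} xs {w r s} → Walk u xs w → r ∈ xs → s ∈ xs → r ≢ s → Sub xs r s ⊎ Sub xs s r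
  between xs {r = r} wk p q ne with ∈-∃++ p
  ... | A , B , refl with ∈-++⁻ A q
  ...   | inj₂ (here refl) = ⊥-elim (ne refl)
  ...   | inj₁ q′ with suffix A (proj₁ (Walk-++⁻ A B wk)) q′
  ...     | sub zs wk′ lt ⊆ = inj₂ (sub zs wk′ (<-trans lt (lt-left A r B)) (λ i → ∈-++⁺ˡ (⊆ i)))
  between xs {r = r} wk p q ne | A , B , refl | inj₂ (there q′) with prefix B (proj₂ (Walk-++⁻ A B wk)) q′
  ...     | sub zs wk′ lt ⊆ = inj₁ (sub zs wk′ (<-trans lt (lt-right A r B)) (λ i → ∈-++⁺ʳ A (there (⊆ i))))

  module Shortest (Ok : V → Set) {u : V} (xs : List V) {w : V} (wk : Walk u xs w) (ok : ∀ {v} → v ∈ xs → Ok v)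
    (least : ∀ xs′ → len xs′ < len xs → Walk u xs′ w → (∀ {v} → v ∈ xs′ → Ok v) → ⊥) where

    private
      no-short : Shortcut u xs w → ⊥
      no-short s = least (Shortcut.xs′ s) (short-len s) (Shortcut.walk s) (λ p → ok (short-⊆ s p))

    uniq : u ≢ w → Uniq (u ∷ w ∷ xs)
    uniq ne with uniq-or-short xs wk ne
    ... | inj₁ un = un
    ... | inj₂ s = ⊥-elim (no-short s)

    induced : ∀ {x y} → x ∈ u ∷ w ∷ xs → y ∈ u ∷ w ∷ xs → x ~ y → On u xs w x y
    induced {x} {y} p q e with On? u xs w x y
    ... | yes o = o
    ... | no no-on = ⊥-elim (no-short (shorten xs wk p q e no-on))

  module Link (Ok : V → Set) where

    data Linked (u : V) : V → Set where
      same : Ok u → Linked u u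
      walk : ∀ {v} xs → Ok u → Ok v → (∀ {x} → x ∈ xs → Ok x) → Walk u xs v → Linked u v

    ok-right : ∀ {u v} → Linked u v → Ok v
    ok-right (same o) = o
    ok-right (walk _ _ o _ _) = o

    linked-sym : ∀ {u v} → Linked u v → Linked v u
    linked-sym (same o) = same o
    linked-sym (walk xs o o′ h wk) = walk (reverse xs) o′ o (λ p → h (reverse⁻ p)) (Walk-reverse xs wk)

    linked-trans : ∀ {u v w} → Linked u v → Linked v w → Linked u w
    linked-trans (same _) l = l
    linked-trans l@(walk _ _ _ _ _) (same _) = l
    linked-trans {v = v} (walk xs o o₁ h wk) (walk ys o₂ o₃ h′ wk′) = walk (xs ++ v ∷ ys) o o₃ all (Walk-++ xs ys wk wk′)
      where
      all : ∀ {x} → x ∈ xs ++ v ∷ ys → Ok x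
      all p with ∈-++⁻ xs p
      ... | inj₁ q = h q
      ... | inj₂ (here refl) = o₂
      ... | inj₂ (there q) = h′ q

    linked-step : ∀ {u v} → Ok u → Ok v → u ~ v → Linked u v
    linked-step o o′ e = walk [] o o′ (λ ()) e

  -- `S` is a union of components left after deleting `C`, containing `u` but not `v`. Arbitrary
  -- predicates are allowed because the components that occur are described by walks and not
  -- computed.
  No-star : Set₁
  No-star = ∀ (C S : V → Set) {u v c : V} → S u → ¬ C u → ¬ S v → ¬ C v → C c →
            (∀ {x} → C x → x ≢ c → c ~ x) → (∀ {a b} → S a → a ~ b → ¬ C b → S b) → ⊥

  ⟨_,_,_,_⟩ : V → List V → V → List V → Weight
  ⟨ y , m , z , ys ⟩ f = f y + wsum f m + f z + wsum f ys

  wsum-⊆ : ∀ (f : V → ℕ) l₁ l₂ → Uniq l₁ → (∀ {v} → v ∈ l₁ → v ∈ l₂) → wsum f l₁ ≤ wsum f l₂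
  wsum-⊆ f [] l₂ un h = z≤n
  wsum-⊆ f (v ∷ l₁) l₂ un h with ∈-∃++ (h (here refl))
  ... | A , B , refl = ≤-trans (+-monoʳ-≤ (f v) (wsum-⊆ f l₁ (A ++ B) (Uniq-tail v l₁ un) h′)) (≤-reflexive eq)
    where
    h′ : ∀ {u} → u ∈ l₁ → u ∈ A ++ B
    h′ i with ∈-++⁻ A (h (there i))
    ... | inj₁ j = ∈-++⁺ˡ j
    ... | inj₂ (here refl) = ⊥-elim (Uniq-head v l₁ un i)
    ... | inj₂ (there j) = ∈-++⁺ʳ A j
    abstract
      lem : ∀ v a b → v + (a + b) ≡ a + (v + b)
      lem = solve-∀
    eq : f v + wsum f (A ++ B) ≡ wsum f (A ++ v ∷ B)
    eq rewrite wsum-++ f A B | wsum-++ f A (v ∷ B) = lem (f v) (wsum f A) (wsum f B)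

  module _ {W : Weight} where

    In-y : ∀ {y m z ys} → Split W y m z ys → In W y
    In-y s = Split.at⇒In s (Split.at-y s)
    In-z : ∀ {y m z ys} → Split W y m z ys → In W z
    In-z s = Split.at⇒In s (Split.at-z s)
    In-m : ∀ {y m z ys} → Split W y m z ys → ∀ {v} → v ∈ m → In W v
    In-m s p = Split.at⇒In s (Split.in-m s p)
    In-ys : ∀ {y m z ys} → Split W y m z ys → ∀ {v} → v ∈ ys → In W v
    In-ys s p = Split.at⇒In s (Split.in-ys s p)

    ≁-left : ∀ {y} A {v} B {z ys} → Split W y (A ++ v ∷ B) z ys → ∀ {u} → u ∈ B → u ≁ y
    ≁-left {y} A B {ys = ys} s i = Split.far (moveL A B s) i (∈-++⁺ʳ ys (here refl))

    ≁-right : ∀ {y} A {v} B {z ys} → Split W y (A ++ v ∷ B) z ys → ∀ {u} → u ∈ A → u ≁ z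
    ≁-right A B s i = Split.far (moveR A B s) i (∈-++⁺ʳ B (here refl))

    ≁-mid : ∀ {y} A {v} B {z ys} → Split W y (A ++ v ∷ B) z ys → ∀ {u w} → u ∈ A → w ∈ B → u ≁ w
    ≁-mid A B s i j = Split.far (moveR A B s) i (∈-++⁺ˡ j)

    uniq-closed : ∀ {y m z ys} → Split W y m z ys → Uniq (y ∷ z ∷ m)
    uniq-closed {y} {m} {z} {ys} s v = ≤-trans (≤-trans (m≤m+n _ (wsum (δ v) ys)) (≤-reflexive (trans (lem (δ v y) (δ v z) _ _) (Split.wt s (δ v))))) (Split.un s v)
      where
      abstract
        lem : ∀ y z m ys → y + (z + m) + ys ≡ y + m + z + ys
        lem = solve-∀

    flip-swap : ∀ {y m z ys} → Split W y m z ys → Split W z (reverse m) y (reverse ys)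
    flip-swap s = flip (swap s)

    -- Interior vertices of the two arcs are not adjacent, so a walk on the hole leaves the arc `M`
    -- only through `a` or `b`.
    cross : ∀ {a M b N} → Split W a M b N → ∀ {u} xs {w} → Walk u xs w → u ∈ M →
            (∀ {v} → v ∈ xs → In W v × v ≢ a × v ≢ b) → In W w → w ≢ a → w ≢ b → w ∈ M × (∀ {v} → v ∈ xs → v ∈ M)
    cross {a} {M} {b} {N} s [] e u∈ h w∈ wa wb = stay u∈ e w∈ wa wb , λ ()
      where
      stay : ∀ {u v} → u ∈ M → u ~ v → In W v → v ≢ a → v ≢ b → v ∈ M
      stay u∈ e v∈ va vb with Split.In⇒at s v∈
      ... | _ , at0 (here p) = ⊥-elim (va p)
      ... | _ , atS (at0 p) = p
      ... | _ , atS (atS (at0 (here p))) = ⊥-elim (vb p)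
      ... | _ , atS (atS (atS (at0 p))) = ⊥-elim (Split.far s u∈ p e)
    cross {a} {M} {b} {N} s (v ∷ xs) (e , wk) u∈ h w∈ wa wb with cross s [] e u∈ (λ ()) (proj₁ (h (here refl))) (proj₁ (proj₂ (h (here refl)))) (proj₂ (proj₂ (h (here refl))))
    ... | v∈ , _ with cross s xs wk v∈ (λ i → h (there i)) w∈ wa wb
    ...   | w∈M , rest = w∈M , λ { (here refl) → v∈ ; (there i) → rest i }

    private
      same-list : ∀ {a} M {b} → Uniq (a ∷ b ∷ M) → (∀ {r q} → r ∈ a ∷ b ∷ M → q ∈ a ∷ b ∷ M → r ~ q → On a M b r q) →
                  ∀ s → Walk a s b → Uniq (a ∷ s) → (∀ {v} → v ∈ s → v ∈ M) → s ≡ M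
      same-list [] un ind [] wk us h = refl
      same-list [] un ind (v ∷ s) wk us h with h (here refl)
      ... | ()
      same-list {a} (c ∷ M) {b} un ind [] wk us h with ind (here refl) (there (here refl)) wk
      ... | inj₁ (inj₁ (_ , refl)) = ⊥-elim (Uniq-head b (b ∷ M) (Uniq-tail a (b ∷ b ∷ M) un) (here refl))
      ... | inj₁ (inj₂ (refl , _)) = ⊥-elim (Uniq-head a (b ∷ a ∷ M) un (there (here refl)))
      ... | inj₂ o = ⊥-elim (a∉ (On-∈ M o))
        where
        a∉ : a ∉ c ∷ b ∷ M
        a∉ (here e) = Uniq-head a (b ∷ c ∷ M) un (there (here e))
        a∉ (there (here e)) = Uniq-head a (b ∷ c ∷ M) un (here e)
        a∉ (there (there i)) = Uniq-head a (b ∷ c ∷ M) un (there (there i))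
      same-list {a} (c ∷ M) {b} un ind (v ∷ s) (e , wk) us h with ind (here refl) (there (there (h (here refl)))) e
      ... | inj₁ (inj₂ (refl , _)) = ⊥-elim (Uniq-head a (b ∷ a ∷ M) un (there (here refl)))
      ... | inj₂ o = ⊥-elim (a∉ (On-∈ M o))
        where
        a∉ : a ∉ c ∷ b ∷ M
        a∉ (here e) = Uniq-head a (b ∷ c ∷ M) un (there (here e))
        a∉ (there (here e)) = Uniq-head a (b ∷ c ∷ M) un (here e)
        a∉ (there (there i)) = Uniq-head a (b ∷ c ∷ M) un (there (there i))
      ... | inj₁ (inj₁ (_ , refl)) = cong (c ∷_) (same-list M un′ ind′ s wk (Uniq-tail a (c ∷ s) us) h′)
        where
        abstract
          sw : ∀ b c m → c + (b + m) ≡ b + (c + m)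
          sw = solve-∀
        un′ : Uniq (c ∷ b ∷ M)
        un′ u = ≤-trans (≤-reflexive (sw (δ u b) (δ u c) _)) (Uniq-tail a (b ∷ c ∷ M) un u)
        emb : ∀ {r} → r ∈ c ∷ b ∷ M → r ∈ a ∷ b ∷ c ∷ M
        emb (here p) = there (there (here p))
        emb (there (here p)) = there (here p)
        emb (there (there p)) = there (there (there p))
        ind′ : ∀ {r q} → r ∈ c ∷ b ∷ M → q ∈ c ∷ b ∷ M → r ~ q → On c M b r q
        ind′ {r} {q} i j e′ with ind (emb i) (emb j) e′
        ... | inj₂ o = o
        ... | inj₁ (inj₁ (refl , _)) = ⊥-elim (Uniq-head a (b ∷ c ∷ M) un (re i))
          where
          re : ∀ {r} → r ∈ c ∷ b ∷ M → r ∈ b ∷ c ∷ M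
          re (here p) = there (here p)
          re (there (here p)) = here p
          re (there (there p)) = there (there p)
        ... | inj₁ (inj₂ (_ , refl)) = ⊥-elim (Uniq-head a (b ∷ c ∷ M) un (re j))
          where
          re : ∀ {r} → r ∈ c ∷ b ∷ M → r ∈ b ∷ c ∷ M
          re (here p) = there (here p)
          re (there (here p)) = here p
          re (there (there p)) = there (there p)
        h′ : ∀ {u} → u ∈ s → u ∈ M
        h′ i with h (there i)
        ... | here refl = ⊥-elim (Uniq-head c s (Uniq-tail a (c ∷ s) us) i)
        ... | there j = j

    arc-ind : ∀ {a M b N} → Split W a M b N → a ≁ b → ∀ {r q} → r ∈ a ∷ b ∷ M → q ∈ a ∷ b ∷ M → r ~ q → On a M b r q
    arc-ind {a} {M} {b} {N} s a≁b i j e = go i j e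
      where
      go : ∀ {r q} → r ∈ a ∷ b ∷ M → q ∈ a ∷ b ∷ M → r ~ q → On a M b r q
      go (here refl) (here refl) e = ⊥-elim (~-irr e)
      go (here refl) (there (here refl)) e = ⊥-elim (a≁b e)
      go (there (here refl)) (here refl) e = ⊥-elim (a≁b (~-sym e))
      go (there (here refl)) (there (here refl)) e = ⊥-elim (~-irr e)
      go (there (there i)) (here refl) e = Split.ind-m s i (In-y s) e
      go (there (there i)) (there (here refl)) e = Split.ind-m s i (In-z s) e
      go (there (there i)) (there (there j)) e = Split.ind-m s i (In-m s j) e
      go (here refl) (there (there j)) e = On-sym M (Split.ind-m s j (In-y s) (~-sym e))
      go (there (here refl)) (there (there j)) e = On-sym M (Split.ind-m s j (In-z s) (~-sym e))

    private
      uniq-as : ∀ {a b : V} s → Uniq (a ∷ b ∷ s) → Uniq (a ∷ s)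
      uniq-as {a} {b} s un u = ≤-trans (+-monoʳ-≤ (δ u a) (m≤n+m _ (δ u b))) (un u)

    private
      inside : ∀ {a b v} s → (∀ {u} → u ∈ a ∷ b ∷ v ∷ s → In W u) → a ~ v → Walk v s b → Uniq (a ∷ b ∷ v ∷ s) → a ≁ b →
               ∀ {M N} → Split W a M b N → v ∈ M → v ∷ s ≡ M
      inside {a} {b} {v} s h e wk un a≁b {M} {N} sp v∈ =
        same-list M (uniq-closed sp) (arc-ind sp a≁b) (v ∷ s) (e , wk) (uniq-as (v ∷ s) un) sub′
        where
        av : ∀ {u} → u ∈ v ∷ s → u ≢ a × u ≢ b
        av i = (λ { refl → Uniq-head a (b ∷ v ∷ s) un (there i) }) , (λ { refl → Uniq-head b (v ∷ s) (Uniq-tail a (b ∷ v ∷ s) un) i })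
        sub′ : ∀ {u} → u ∈ v ∷ s → u ∈ M
        sub′ (here refl) = v∈
        sub′ (there i) with prefix s wk i
        ... | sub zs wk′ _ ⊆ = proj₁ (cross sp zs wk′ v∈ (λ j → h (there (there (there (⊆ j)))) , av (there (⊆ j)))
                (h (there (there (there i)))) (proj₁ (av (there i))) (proj₂ (av (there i))))

    -- The path starts into one of the two arcs and cannot leave it, and an arc without chord
    -- carries no second path between its ends. This recovers a `Split` from the bare paths in terms
    -- of which `Proper` is stated.
    arc-unique : ∀ {y m z ys} → Split W y m z ys → ∀ {a} s {b} → (∀ {v} → v ∈ a ∷ b ∷ s → In W v) → Walk a s b →
                 Uniq (a ∷ b ∷ s) → a ≁ b → ∃ λ N → Split W a s b N
    arc-unique sp [] h wk un a≁b = ⊥-elim (a≁b wk)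
    arc-unique sp {a} (v ∷ s) {b} h (e , wk) un a≁b
      with rebase₂ sp (h (here refl)) (h (there (here refl))) (λ { refl → Uniq-head a (a ∷ v ∷ s) un (here refl) })
    ... | M , N , sp′ with Split.In⇒at sp′ (h (there (there (here refl))))
    ...   | _ , at0 (here refl) = ⊥-elim (Uniq-head a (b ∷ a ∷ s) un (there (here refl)))
    ...   | _ , atS (atS (at0 (here refl))) = ⊥-elim (Uniq-head b (b ∷ s) (Uniq-tail a (b ∷ b ∷ s) un) (here refl))
    ...   | _ , atS (at0 v∈) = _ , subst (λ l → Split W a l b N) (sym (inside s h e wk un a≁b sp′ v∈)) sp′
    ...   | _ , atS (atS (atS (at0 v∈))) = _ , subst (λ l → Split W a l b (reverse M)) (sym (inside s h e wk un a≁b (flip sp′) (reverse⁺ v∈))) (flip sp′)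

    reroute : ∀ {y m z ys} → Split W y m z ys → (∀ {r q} → r ∈ y ∷ z ∷ m → q ∈ y ∷ z ∷ m → r ~ q → On y m z r q) → ∀ P → Walk z P y → Uniq P → (∀ {r} → r ∈ P → r ∉ y ∷ z ∷ m) →
              (∀ {r q} → r ∈ P → q ∈ P ⊎ q ∈ y ∷ z ∷ m → r ~ q → On z P y r q) → Split ⟨ y , m , z , P ⟩ y m z P
    reroute {y} {m} {z} {ys} s closed P wk un out ind = record
      { walk₁ = Split.walk₁ s ; walk₂ = wk ; wt = λ f → refl ; un = un′ ; ind = λ p q e → ind′ (place p) (place q) e }
      where
      W′ = ⟨ y , m , z , P ⟩
      abstract
        lem : ∀ y m z p → y + m + z + p ≡ y + (z + m) + p
        lem = solve-∀
      sum : ∀ v → W′ (δ v) ≡ wsum (δ v) (y ∷ z ∷ m) + wsum (δ v) P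
      sum v = lem (δ v y) (wsum (δ v) m) (δ v z) (wsum (δ v) P)
      none : ∀ {v} l → v ∉ l → wsum (δ v) l ≡ 0
      none l h = n<1⇒n≡0 (≰⇒> (λ p → h (1≤⇒∈ l p)))
      un′ : ∀ v → W′ (δ v) ≤ 1
      un′ v rewrite sum v with v ∈? P
      ... | yes p = ≤-trans (≤-reflexive (cong (_+ wsum (δ v) P) (none (y ∷ z ∷ m) (out p)))) (un v)
      ... | no np = ≤-trans (≤-reflexive (trans (cong (wsum (δ v) (y ∷ z ∷ m) +_) (none P np)) (+-identityʳ _))) (uniq-closed s v)
      place : ∀ {v} → In W′ v → v ∈ P ⊎ v ∈ y ∷ z ∷ m
      place {v} (in! p) with v ∈? P
      ... | yes q = inj₁ q
      ... | no nq = inj₂ (1≤⇒∈ (y ∷ z ∷ m) (≤-trans p (≤-reflexive (trans (sum v) (trans (cong (wsum (δ v) (y ∷ z ∷ m) +_) (none P nq)) (+-identityʳ _))))))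
      ind′ : ∀ {r q} → r ∈ P ⊎ r ∈ y ∷ z ∷ m → q ∈ P ⊎ q ∈ y ∷ z ∷ m → r ~ q → On y m z r q ⊎ On z P y r q
      ind′ (inj₁ p) q e = inj₂ (ind p q e)
      ind′ (inj₂ p) (inj₁ q) e = inj₂ (On-sym P (ind q (inj₂ p) (~-sym e)))
      ind′ (inj₂ p) (inj₂ q) e = inj₁ (closed p q e)

  In⇒∈ : ∀ y m z P {v} → In ⟨ y , m , z , P ⟩ v → v ∈ P ⊎ v ∈ y ∷ z ∷ m
  In⇒∈ y m z P {v} (in! p) with v ∈? P
  ... | yes q = inj₁ q
  ... | no nq = inj₂ (1≤⇒∈ (y ∷ z ∷ m) (≤-trans p (≤-reflexive (trans (lem (δ v y) (wsum (δ v) m) (δ v z) (wsum (δ v) P))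
                  (trans (cong (wsum (δ v) (y ∷ z ∷ m) +_) (n<1⇒n≡0 (≰⇒> (λ h → nq (1≤⇒∈ P h))))) (+-identityʳ _))))))
    where
    abstract
      lem : ∀ y m z p → y + m + z + p ≡ y + (z + m) + p
      lem = solve-∀

  module _ (no-isk4 : ¬ HasISK4 G) where

    -- The feet may come in any order around the hole: after cutting at `y` and `z`, the third foot
    -- lies on one of the two arcs, and these are exchanged if necessary.
    ear-any : ∀ {W : Weight} {y₀ m₀ z₀ ys₀} → Split W y₀ m₀ z₀ ys₀ → ∀ {y z t} → In W y → In W z → In W t → y ≢ z → y ≢ t → z ≢ t →
      ∀ w R₁ R₃ → Walk w R₁ y → w ~ z → Walk w R₃ t → Uniq (w ∷ R₁ ++ R₃) → (∀ {a} → a ∈ w ∷ R₁ ++ R₃ → ¬ In W a) →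
      (∀ {r q} → r ∈ w ∷ R₁ ++ R₃ → q ∈ w ∷ R₁ ++ R₃ ⊎ In W q → r ~ q → On w R₁ y r q ⊎ Pair w z r q ⊎ On w R₃ t r q) → ⊥
    ear-any sp y∈ z∈ t∈ y≢z y≢t z≢t w R₁ R₃ w₁ w₂ w₃ un out ind
      with rebase₂ sp y∈ z∈ (λ e → y≢z (sym e))
    ... | m , ys , s with Split.In⇒at s t∈
    ...   | _ , at0 (here e) = y≢t (sym e)
    ...   | _ , atS (atS (at0 (here e))) = z≢t (sym e)
    ...   | _ , atS (at0 i) with ∈-∃++ i
    ...     | A , B , refl = no-isk4 (Ear.isk4 A B s w R₁ [] R₃ w₁ w₂ w₃ un out ind)
    ear-any sp y∈ z∈ t∈ y≢z y≢t z≢t w R₁ R₃ w₁ w₂ w₃ un out ind | m , ys , s | _ , atS (atS (atS (at0 i))) with ∈-∃++ i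
    ...     | A , B , refl = no-isk4 (Ear.isk4 A B (swap s) w [] R₁ R₃ w₂ w₁ w₃ un out (λ p q e → turn (ind p q e)))
      where
      turn : ∀ {X Y Z : Set} → X ⊎ Y ⊎ Z → Y ⊎ X ⊎ Z
      turn (inj₁ x) = inj₂ (inj₁ x)
      turn (inj₂ (inj₁ y)) = inj₁ y
      turn (inj₂ (inj₂ z)) = inj₂ (inj₂ z)

-- A smallest subdivision of K₄ is induced

module MinimalTK4 {n : ℕ} (G : Graph n)
  (tf : Holes.Triangle-free G) (no-isk4 : ¬ HasISK4 G) (no-wheel : Holes.No-wheel G) (no-k33 : Holes.No-K33 G) where

  open Holes G
  open Relabel G

  private
    reverse≡[] : ∀ (xs : List V) → reverse xs ≡ [] → xs ≡ []
    reverse≡[] xs e = trans (sym (reverse-involutive xs)) (cong reverse e)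

    reverse-split : ∀ (A : List V) {v} B {l} → l ≡ A ++ v ∷ B → reverse l ≡ reverse B ++ v ∷ reverse A
    reverse-split A {v} B refl = trans (reverse-++ A (v ∷ B))
      (trans (cong (_++ reverse A) (unfold-reverse v B)) (++-assoc (reverse B) (v ∷ []) (reverse A)))

  -- By `γ₁` from both sides nothing lies between the corner and either end of the chord, so the
  -- three vertices form a triangle.
  γ : ∀ t → Small t → ∀ {v w} → v ∈ TK4.ab t → w ∈ TK4.ac t → v ~ w → ⊥
  γ t small p q e with ∈-∃++ p | ∈-∃++ q
  ... | A₁ , A₂ , eqA | B₁ , B₂ , eqB
    with γ₁ t small A₁ A₂ B₁ B₂ eqA eqB e | γ₁ (swap-bc t) (Small-same (same-bc t) small) B₁ B₂ A₁ A₂ eqB eqA (~-sym e)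
  ...   | refl | refl = tf (proj₁ (subst (λ l → Walk (TK4.a t) l (TK4.b t)) eqA (TK4.wab t))) e
                           (proj₁ (subst (λ l → Walk (TK4.a t) l (TK4.c t)) eqB (TK4.wac t)))

  exchange : ∀ t → ∃ λ t′ → Same t t′ × TK4.ab t′ ≡ TK4.cd t × TK4.cd t′ ≡ TK4.ab t
  exchange t = _ , (((same-bc t ⟫ σab) ⟫ σcd) ⟫ σbc) , refl , refl

  δ-A₂ : ∀ t → Small t → ∀ A₁ {v} A₂ B₁ {w} B₂ → TK4.ab t ≡ A₁ ++ v ∷ A₂ → TK4.cd t ≡ B₁ ++ w ∷ B₂ → v ~ w → A₂ ≡ []
  δ-A₂ t small A₁ A₂ B₁ B₂ eqA eqB e =
    reverse≡[] A₂ (δ-A₁ (swap-ab t) (Small-same (same-ab t) small) (reverse A₂) (reverse A₁) B₁ B₂ (reverse-split A₁ A₂ eqA) eqB e)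

  -- The four paths between the two in question and all pieces next to `v` and `w` are empty. What
  -- is left is K₃,₃ with sides `v`, `c`, `d` and `w`, `a`, `b`.
  δ-chord : ∀ t → Small t → ∀ {v w} → v ∈ TK4.ab t → w ∈ TK4.cd t → v ~ w → ⊥
  δ-chord t small {v} {w} p q e with ∈-∃++ p | ∈-∃++ q
  ... | A₁ , A₂ , eqA | B₁ , B₂ , eqB = finish
    where
    open TK4 t
    t′ = proj₁ (exchange t)
    small′ : Small t′
    small′ = Small-same (proj₁ (proj₂ (exchange t))) small
    A₁≡[] : A₁ ≡ []
    A₁≡[] = δ-A₁ t small A₁ A₂ B₁ B₂ eqA eqB e
    A₂≡[] : A₂ ≡ []
    A₂≡[] = δ-A₂ t small A₁ A₂ B₁ B₂ eqA eqB e
    B₁≡[] : B₁ ≡ []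
    B₁≡[] = δ-A₁ t′ small′ B₁ B₂ A₁ A₂ eqB eqA (~-sym e)
    B₂≡[] : B₂ ≡ []
    B₂≡[] = δ-A₂ t′ small′ B₁ B₂ A₁ A₂ eqB eqA (~-sym e)
    a~c : a ~ c
    a~c = subst (λ l → Walk a l c) (δ-ac t small A₁ A₂ B₁ B₂ eqA eqB e) wac
    a~d : a ~ d
    a~d = subst (λ l → Walk a l d)
      (δ-ac (swap-cd t) (Small-same (same-cd t) small) A₁ A₂ (reverse B₂) (reverse B₁) eqA (reverse-split B₁ B₂ eqB) e) wad
    b~c : b ~ c
    b~c = subst (λ l → Walk b l c)
      (δ-ac (swap-ab t) (Small-same (same-ab t) small) (reverse A₂) (reverse A₁) B₁ B₂ (reverse-split A₁ A₂ eqA) eqB e) wbc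
    b~d : b ~ d
    b~d = subst (λ l → Walk b l d)
      (δ-ac (swap-cd (swap-ab t)) (Small-same (same-ab t ⟫ σcd) small) (reverse A₂) (reverse A₁) (reverse B₂) (reverse B₁)
        (reverse-split A₁ A₂ eqA) (reverse-split B₁ B₂ eqB) e) wbd
    wA : Walk a (A₁ ++ v ∷ A₂) b
    wA = subst (λ l → Walk a l b) eqA wab
    wB : Walk c (B₁ ++ w ∷ B₂) d
    wB = subst (λ l → Walk c l d) eqB wcd
    a~v : a ~ v
    a~v = subst (λ l → Walk a l v) A₁≡[] (proj₁ (Walk-++⁻ A₁ A₂ wA))
    v~b : v ~ b
    v~b = subst (λ l → Walk v l b) A₂≡[] (proj₂ (Walk-++⁻ A₁ A₂ wA))
    c~w : c ~ w
    c~w = subst (λ l → Walk c l w) B₁≡[] (proj₁ (Walk-++⁻ B₁ B₂ wB))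
    w~d : w ~ d
    w~d = subst (λ l → Walk w l d) B₂≡[] (proj₂ (Walk-++⁻ B₁ B₂ wB))
    ne : ∀ {x y i j} → i ≢ j → (x ∈at segs) i → (y ∈at segs) j → x ≢ y
    ne i≢j p q refl = apart ap i≢j p q
    finish : ⊥
    finish = no-k33 {v} {c} {d} {w} {a} {b}
      (ne (λ ()) (in-ab p) at-c) (ne (λ ()) (in-ab p) at-d) (ne (λ ()) at-c at-d)
      (ne (λ ()) (in-cd q) at-a) (ne (λ ()) (in-cd q) at-b) (ne (λ ()) at-a at-b)
      e (~-sym a~v) v~b c~w (~-sym a~c) (~-sym b~c) (~-sym w~d) (~-sym a~d) (~-sym b~d)

  β-at : ∀ {t t′} → Same t t′ → Small t → ∀ {v} → TK4.a t′ ~ v → v ∈ TK4.bc t′ → TK4.ab t′ ≡ []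
  β-at {t′ = t′} s small = β-ab t′ (Small-same s small)

  γ-at : ∀ {t t′} → Same t t′ → Small t → ∀ {v w} → v ∈ TK4.ab t′ → w ∈ TK4.ac t′ → v ~ w → ⊥
  γ-at {t′ = t′} s small = γ t′ (Small-same s small)

  δ-at : ∀ {t t′} → Same t t′ → Small t → ∀ {v w} → v ∈ TK4.ab t′ → w ∈ TK4.cd t′ → v ~ w → ⊥
  δ-at {t′ = t′} s small = δ-chord t′ (Small-same s small)

  -- The only kind of chord that survives these reductions: from a corner into the interior of a
  -- path between two other corners.
  Spoke : TK4 → V → V → Set
  Spoke t x y = ∃ λ t′ → Same t t′ × TK4.a t′ ≡ x × y ∈ TK4.bc t′

  module Chord (t : TK4) (small : Small t) {x y : V} (e : x ~ y) (not-edge : ¬ TK4.Edge t x y) where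

    α-chord : ∀ {t′} → Same t t′ → x ∈ TK4.a t′ ∷ TK4.b t′ ∷ TK4.ab t′ → y ∈ TK4.a t′ ∷ TK4.b t′ ∷ TK4.ab t′ → ⊥
    α-chord {t′} s p q = α t′ (Small-same s small) p q e (λ o → not-edge (Same.edge⊆ s (inj₁ o)))

    γ-chord : ∀ {t′} → Same t t′ → x ∈ TK4.ab t′ → y ∈ TK4.ac t′ → ⊥
    γ-chord {t′} s p q = γ t′ (Small-same s small) p q e

    locate : ∀ {v} → TK4.Vert t v → ∃ λ t′ → Same t t′ × (v ≡ TK4.a t′ ⊎ v ∈ TK4.ab t′)
    locate (_ , at0 (here p)) = t , Same-refl t , inj₁ p
    locate (_ , atS (at0 (here p))) = _ , same-ab t , inj₁ p
    locate (_ , atS (atS (at0 (here p)))) = _ , (same-bc t ⟫ σab) , inj₁ p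
    locate (_ , atS (atS (atS (at0 (here p))))) = _ , ((same-cd t ⟫ σbc) ⟫ σab) , inj₁ p
    locate (_ , atS (atS (atS (atS (at0 p))))) = t , Same-refl t , inj₂ p
    locate (_ , atS (atS (atS (atS (atS (at0 p)))))) = _ , same-bc t , inj₂ p
    locate (_ , atS (atS (atS (atS (atS (atS (at0 p))))))) = _ , (same-cd t ⟫ σbc) , inj₂ p
    locate (_ , atS (atS (atS (atS (atS (atS (atS (at0 p)))))))) = _ , (same-ab t ⟫ σbc) , inj₂ p
    locate (_ , atS (atS (atS (atS (atS (atS (atS (atS (at0 p))))))))) = _ , ((same-ab t ⟫ σcd) ⟫ σbc) , inj₂ p
    locate (_ , atS (atS (atS (atS (atS (atS (atS (atS (atS (at0 p)))))))))) = _ , proj₁ (proj₂ (exchange t)) , inj₂ p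

    corner-case : ∀ {t′} → Same t t′ → x ≡ TK4.a t′ → TK4.Vert t′ y → Spoke t x y
    corner-case s refl (_ , at0 (here refl)) = ⊥-elim (~-irr e)
    corner-case s refl (_ , atS (at0 (here refl))) = ⊥-elim (α-chord s (here refl) (there (here refl)))
    corner-case s refl (_ , atS (atS (at0 (here refl)))) = ⊥-elim (α-chord (s ⟫ σbc) (here refl) (there (here refl)))
    corner-case s refl (_ , atS (atS (atS (at0 (here refl))))) = ⊥-elim (α-chord ((s ⟫ σcd) ⟫ σbc) (here refl) (there (here refl)))
    corner-case s refl (_ , atS (atS (atS (atS (at0 p))))) = ⊥-elim (α-chord s (here refl) (there (there p)))
    corner-case s refl (_ , atS (atS (atS (atS (atS (at0 p)))))) = ⊥-elim (α-chord (s ⟫ σbc) (here refl) (there (there p)))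
    corner-case s refl (_ , atS (atS (atS (atS (atS (atS (at0 p))))))) = ⊥-elim (α-chord ((s ⟫ σcd) ⟫ σbc) (here refl) (there (there p)))
    corner-case s refl (_ , atS (atS (atS (atS (atS (atS (atS (at0 p)))))))) = _ , s , refl , p
    corner-case s refl (_ , atS (atS (atS (atS (atS (atS (atS (atS (at0 p))))))))) = _ , (s ⟫ σcd) , refl , p
    corner-case s refl (_ , atS (atS (atS (atS (atS (atS (atS (atS (atS (at0 p)))))))))) = _ , ((s ⟫ σbc) ⟫ σcd) , refl , p

    inner-case : ∀ {t′} → Same t t′ → x ∈ TK4.ab t′ → TK4.Vert t′ y → Spoke t y x
    inner-case s i (_ , at0 (here refl)) = ⊥-elim (α-chord s (there (there i)) (here refl))
    inner-case s i (_ , atS (at0 (here refl))) = ⊥-elim (α-chord s (there (there i)) (there (here refl)))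
    inner-case s i (_ , atS (atS (at0 (here refl)))) = _ , ((s ⟫ σbc) ⟫ σab) , refl , i
    inner-case s i (_ , atS (atS (atS (at0 (here refl))))) = _ , (((s ⟫ σcd) ⟫ σbc) ⟫ σab) , refl , i
    inner-case s i (_ , atS (atS (atS (atS (at0 p))))) = ⊥-elim (α-chord s (there (there i)) (there (there p)))
    inner-case s i (_ , atS (atS (atS (atS (atS (at0 p)))))) = ⊥-elim (γ-chord s i p)
    inner-case s i (_ , atS (atS (atS (atS (atS (atS (at0 p))))))) = ⊥-elim (γ-chord (s ⟫ σcd) i p)
    inner-case s i (_ , atS (atS (atS (atS (atS (atS (atS (at0 p)))))))) = ⊥-elim (γ-chord (s ⟫ σab) (reverse⁺ i) p)
    inner-case s i (_ , atS (atS (atS (atS (atS (atS (atS (atS (at0 p))))))))) = ⊥-elim (γ-chord ((s ⟫ σab) ⟫ σcd) (reverse⁺ i) p)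
    inner-case s i (_ , atS (atS (atS (atS (atS (atS (atS (atS (atS (at0 p)))))))))) = ⊥-elim (δ-at s small i p e)

    chord : TK4.Vert t x → TK4.Vert t y → Spoke t x y ⊎ Spoke t y x
    chord p q with locate p
    ... | t′ , s , inj₁ eq = inj₁ (corner-case s eq (vert⇒ s q))
    ... | t′ , s , inj₂ i  = inj₂ (inner-case s i (vert⇒ s q))

  -- By `β-ab`, `β-ac` and `β-ad` the corner `a` is adjacent to `b`, `c` and `d`, and also to `v`:
  -- four spokes. It remains to see that the cycle through `b`, `c` and `d` has no chord.
  module Hub (t : TK4) (small : Small t) {v : V} (a~v : TK4.a t ~ v) (v∈ : v ∈ TK4.bc t) where
    open TK4 t

    a~b : a ~ b
    a~b = subst (λ l → Walk a l b) (β-ab t small a~v v∈) wab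
    a~c : a ~ c
    a~c = subst (λ l → Walk a l c) (β-ac t small a~v v∈) wac
    a~d : a ~ d
    a~d = subst (λ l → Walk a l d) (β-ad t small a~v v∈) wad

    data Rim : V → Set where
      r-b  : Rim b
      r-c  : Rim c
      r-d  : Rim d
      r-bc : ∀ {u} → u ∈ bc → Rim u
      r-bd : ∀ {u} → u ∈ bd → Rim u
      r-cd : ∀ {u} → u ∈ cd → Rim u

    private
      at-B : Same t _
      at-B = (same-ab t ⟫ σbc) ⟫ σcd
      at-C : Same t _
      at-C = ((same-bc t ⟫ σab) ⟫ σbc) ⟫ σcd
      at-D : Same t _
      at-D = (((same-cd t ⟫ σbc) ⟫ σab) ⟫ σbc) ⟫ σcd

      nonempty : ∀ {u : V} {l} → u ∈ l → l ≡ [] → ⊥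
      nonempty () refl

    -- Such a chord would force the path from `b` to `c` to be an edge, but `bc` contains `v`.
    b-cd : ∀ {u} → b ~ u → u ∈ cd → ⊥
    b-cd e q = nonempty v∈ (β-at at-B small e q)

    c-bd : ∀ {u} → c ~ u → u ∈ bd → ⊥
    c-bd e q = nonempty v∈ (reverse≡[] bc (β-at at-C small e q))

    -- Here the path that becomes an edge is `bd`, and `b`, `d` form a triangle with `a`.
    d-bc : ∀ {u} → d ~ u → u ∈ bc → ⊥
    d-bc e q = tf a~b (subst (λ l → Walk b l d) (reverse≡[] bd (β-at at-D small e q)) wbd) a~d

    rim-chord : ∀ {x y} → x ~ y → ¬ Edge x y → Rim x → Rim y → ⊥
    rim-chord {x} {y} e ne = go
      where
      on-bc : x ∈ b ∷ c ∷ bc → y ∈ b ∷ c ∷ bc → ⊥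
      on-bc p q = Chord.α-chord t small e ne (same-ab t ⟫ σbc) p q
      on-bd : x ∈ b ∷ d ∷ bd → y ∈ b ∷ d ∷ bd → ⊥
      on-bd p q = Chord.α-chord t small e ne ((same-ab t ⟫ σcd) ⟫ σbc) p q
      on-cd : x ∈ c ∷ d ∷ cd → y ∈ c ∷ d ∷ cd → ⊥
      on-cd p q = Chord.α-chord t small e ne (proj₁ (proj₂ (exchange t))) p q
      bc-bd : ∀ {u w} → u ~ w → u ∈ bc → w ∈ bd → ⊥
      bc-bd e p q = γ-at at-B small p q e
      bc-cd : ∀ {u w} → u ~ w → u ∈ bc → w ∈ cd → ⊥
      bc-cd e p q = γ-at at-C small (reverse⁺ p) q e
      bd-cd : ∀ {u w} → u ~ w → u ∈ bd → w ∈ cd → ⊥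
      bd-cd e p q = γ-at at-D small (reverse⁺ p) (reverse⁺ q) e
      go : Rim x → Rim y → ⊥
      go r-b r-b = ~-irr e
      go r-b r-c = on-bc (here refl) (there (here refl))
      go r-b r-d = on-bd (here refl) (there (here refl))
      go r-b (r-bc q) = on-bc (here refl) (there (there q))
      go r-b (r-bd q) = on-bd (here refl) (there (there q))
      go r-b (r-cd q) = b-cd e q
      go r-c r-b = on-bc (there (here refl)) (here refl)
      go r-c r-c = ~-irr e
      go r-c r-d = on-cd (here refl) (there (here refl))
      go r-c (r-bc q) = on-bc (there (here refl)) (there (there q))
      go r-c (r-bd q) = c-bd e q
      go r-c (r-cd q) = on-cd (here refl) (there (there q))
      go r-d r-b = on-bd (there (here refl)) (here refl)
      go r-d r-c = on-cd (there (here refl)) (here refl)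
      go r-d r-d = ~-irr e
      go r-d (r-bc q) = d-bc e q
      go r-d (r-bd q) = on-bd (there (here refl)) (there (there q))
      go r-d (r-cd q) = on-cd (there (here refl)) (there (there q))
      go (r-bc p) r-b = on-bc (there (there p)) (here refl)
      go (r-bc p) r-c = on-bc (there (there p)) (there (here refl))
      go (r-bc p) r-d = d-bc (~-sym e) p
      go (r-bc p) (r-bc q) = on-bc (there (there p)) (there (there q))
      go (r-bc p) (r-bd q) = bc-bd e p q
      go (r-bc p) (r-cd q) = bc-cd e p q
      go (r-bd p) r-b = on-bd (there (there p)) (here refl)
      go (r-bd p) r-c = c-bd (~-sym e) p
      go (r-bd p) r-d = on-bd (there (there p)) (there (here refl))
      go (r-bd p) (r-bc q) = bc-bd (~-sym e) q p
      go (r-bd p) (r-bd q) = on-bd (there (there p)) (there (there q))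
      go (r-bd p) (r-cd q) = bd-cd e p q
      go (r-cd p) r-b = b-cd (~-sym e) p
      go (r-cd p) r-c = on-cd (there (there p)) (here refl)
      go (r-cd p) r-d = on-cd (there (there p)) (there (here refl))
      go (r-cd p) (r-bc q) = bc-cd (~-sym e) q p
      go (r-cd p) (r-bd q) = bd-cd (~-sym e) q p
      go (r-cd p) (r-cd q) = on-cd (there (there p)) (there (there q))

    outer : List V
    outer = cd ++ d ∷ reverse bd

    W : Weight
    W f = f b + wsum f bc + f c + wsum f outer

    private
      abstract
        lem : ∀ a b c d ab ac ad bc bd cd →
          a + 0 + (b + 0 + (c + 0 + (d + 0 + (ab + (ac + (ad + (bc + (bd + (cd + 0))))))))) ≡ (b + bc + c + (cd + (d + bd))) + (a + ab + ac + ad)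
        lem = solve-∀
      w≤ : ∀ f → W f + (f a + wsum f ab + wsum f ac + wsum f ad) ≡ wtotal f segs
      w≤ f rewrite wsum-++ f cd (d ∷ reverse bd) | wsum-reverse f bd =
        sym (lem (f a) (f b) (f c) (f d) (wsum f ab) (wsum f ac) (wsum f ad) (wsum f bc) (wsum f bd) (wsum f cd))

    rim : ∀ {u} → In W u → Rim u
    rim {u} (in! p) with wtotal-at {v = u} ((b ∷ []) ∷ bc ∷ (c ∷ []) ∷ outer ∷ []) (subst (1 ≤_) (lem′ (δ u b) (wsum (δ u) bc) (δ u c) (wsum (δ u) outer)) p)
      where
      abstract
        lem′ : ∀ a b c d → a + b + c + d ≡ a + 0 + (b + (c + 0 + (d + 0)))
        lem′ = solve-∀
    ... | _ , at0 (here refl) = r-b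
    ... | _ , atS (at0 i) = r-bc i
    ... | _ , atS (atS (at0 (here refl))) = r-c
    ... | _ , atS (atS (atS (at0 i))) with ∈-++⁻ cd i
    ...   | inj₁ j = r-cd j
    ...   | inj₂ (here refl) = r-d
    ...   | inj₂ (there j) = r-bd (reverse⁻ j)

    rim≢a : ¬ Rim a
    rim≢a r = apart ap (proj₁ (proj₂ (where-is r))) at-a (proj₂ (proj₂ (where-is r)))
      where
      where-is : ∀ {u} → Rim u → ∃ λ i → 0 ≢ i × (u ∈at segs) i
      where-is r-b = _ , (λ ()) , at-b
      where-is r-c = _ , (λ ()) , at-c
      where-is r-d = _ , (λ ()) , at-d
      where-is (r-bc p) = _ , (λ ()) , in-bc p
      where-is (r-bd p) = _ , (λ ()) , in-bd p
      where-is (r-cd p) = _ , (λ ()) , in-cd p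

    rim-split : Split W b bc c outer
    rim-split = record
      { walk₁ = wbc
      ; walk₂ = Walk-++ cd (reverse bd) wcd (Walk-reverse bd wbd)
      ; wt = λ f → refl
      ; un = λ u → ≤-trans (m≤m+n (W (δ u)) _) (≤-trans (≤-reflexive (w≤ (δ u))) (once ap u))
      ; ind = λ p q e → ind (rim p) (rim q) e }
      where
      at-end : ∀ {z l} {x y : V} → l ≡ [] → On a l z x y → x ≡ a ⊎ y ≡ a
      at-end refl (inj₁ (p , _)) = inj₁ p
      at-end refl (inj₂ (_ , p)) = inj₂ p
      not-a : ∀ {z l} {x y : V} → Rim x → Rim y → l ≡ [] → On a l z x y → ⊥
      not-a rx ry eq o with at-end eq o
      ... | inj₁ refl = rim≢a rx
      ... | inj₂ refl = rim≢a ry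
      ind : ∀ {x y} → Rim x → Rim y → x ~ y → On b bc c x y ⊎ On c outer b x y
      ind {x} {y} rx ry e with Edge? t x y
      ... | no ne = ⊥-elim (rim-chord e ne rx ry)
      ... | yes (inj₁ o) = ⊥-elim (not-a rx ry (β-ab t small a~v v∈) o)
      ... | yes (inj₂ (inj₁ o)) = ⊥-elim (not-a rx ry (β-ac t small a~v v∈) o)
      ... | yes (inj₂ (inj₂ (inj₁ o))) = ⊥-elim (not-a rx ry (β-ad t small a~v v∈) o)
      ... | yes (inj₂ (inj₂ (inj₂ (inj₁ o)))) = inj₁ o
      ... | yes (inj₂ (inj₂ (inj₂ (inj₂ (inj₁ o))))) = inj₂ (On-++⁺ʳ cd (reverse bd) (On-reverse bd o))
      ... | yes (inj₂ (inj₂ (inj₂ (inj₂ (inj₂ o))))) = inj₂ (On-++⁺ˡ cd (reverse bd) o)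

    hub : ⊥
    hub = no-wheel rim-split (λ p → rim≢a (rim p)) four
      where
      four : 4 ≤ W (nb a)
      four rewrite nb-yes {a} a~b | nb-yes {a} a~c =
        +-mono-≤ (+-mono-≤ (s≤s (∈⇒1≤cnt v∈ a~v)) (≤-refl {1})) (∈⇒1≤cnt {a} {d} {outer} (∈-++⁺ʳ cd (here refl)) a~d)

  minimal : ∀ t → Small t → ⊥
  minimal t small = no-isk4 (induced-TK4 t induced)
    where
    spoke : ∀ {x y} → x ~ y → Spoke t x y → ⊥
    spoke e (t′ , s , refl , i) = Hub.hub t′ (Small-same s small) e i
    induced : ∀ {x y} → TK4.Vert t x → TK4.Vert t y → x ~ y → TK4.Edge t x y
    induced {x} {y} p q e with Edge? t x y
    ... | yes o = o
    ... | no ne with Chord.chord t small e ne p q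
    ...   | inj₁ s = ⊥-elim (spoke e s)
    ...   | inj₂ s = ⊥-elim (spoke (~-sym e) s)

  no-TK4 : TK4 → ⊥
  no-TK4 t = <-rec (λ k → ∀ t → size t ≡ k → ⊥) (λ k ih t eq → minimal t (λ t′ lt → ih (subst (size t′ <_) eq lt) t′ refl)) (size t) t refl

-- Graphs containing K₃,₃

module BipartiteSubgraphs {n : ℕ} (G : Graph n)
  (tf : Holes.Triangle-free G) (no-isk4 : ¬ HasISK4 G) where

  open Holes G

  -- The hole b α₁ b′ α₃ with an ear through α₂.
  K-ear : ∀ {α₁ α₂ α₃ b b′ : V} → α₁ ≢ α₂ → α₁ ≢ α₃ → α₂ ≢ α₃ → b ≢ b′ →
    α₁ ~ b → α₁ ~ b′ → α₂ ~ b → α₂ ~ b′ → α₃ ~ b → α₃ ~ b′ →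
    ∀ R → Walk α₂ R α₁ → Uniq (α₂ ∷ α₁ ∷ R) → (∀ {r q} → r ∈ α₂ ∷ α₁ ∷ R → q ∈ α₂ ∷ α₁ ∷ R → r ~ q → On α₂ R α₁ r q) →
    (∀ {r} → r ∈ R → r ≁ b × r ≁ b′ × r ≁ α₃ × r ≢ b × r ≢ b′ × r ≢ α₃) → ⊥
  K-ear {α₁} {α₂} {α₃} {b} {b′} 1≢2 1≢3 2≢3 b≢b′ 1b 1b′ 2b 2b′ 3b 3b′ R wk un ind out =
    no-isk4 (Ear.isk4 [] [] hole α₂ [] [] R 2b 2b′ wk uniq outside indP)
    where
    W : Weight
    W f = f b + (f α₁ + 0) + f b′ + (f α₃ + 0)
    ≁₁₃ : α₁ ≁ α₃
    ≁₁₃ e = tf e 3b 1b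
    ≁₂₃ : α₂ ≁ α₃
    ≁₂₃ e = tf e 3b 2b
    ≁bb : b ≁ b′
    ≁bb e = tf 1b e 1b′
    data Pos : V → Set where
      p-b  : Pos b
      p-1  : Pos α₁
      p-b′ : Pos b′
      p-3  : Pos α₃
    abstract
      l : ∀ a b c d → a + (b + 0) + c + (d + 0) ≡ a + (b + (c + (d + 0)))
      l = solve-∀
    four : Uniq (b ∷ α₁ ∷ b′ ∷ α₃ ∷ [])
    four = Uniq-∷ b (α₁ ∷ b′ ∷ α₃ ∷ []) (λ { (here refl) → ~-irr 1b ; (there (here refl)) → b≢b′ refl ; (there (there (here refl))) → ~-irr 3b })
          (Uniq-∷ α₁ (b′ ∷ α₃ ∷ []) (λ { (here refl) → ~-irr 1b′ ; (there (here refl)) → 1≢3 refl })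
          (Uniq-∷ b′ (α₃ ∷ []) (λ { (here refl) → ~-irr 3b′ }) (Uniq-∷ α₃ [] (λ ()) Uniq-[])))
    pos : ∀ {v} → In W v → Pos v
    pos {v} (in! p) with 1≤⇒∈ {v = v} (b ∷ α₁ ∷ b′ ∷ α₃ ∷ []) (subst (1 ≤_) (l (δ v b) (δ v α₁) (δ v b′) (δ v α₃)) p)
    ... | here refl = p-b
    ... | there (here refl) = p-1
    ... | there (there (here refl)) = p-b′
    ... | there (there (there (here refl))) = p-3
    indQ : ∀ {x y} → Pos x → Pos y → x ~ y → On b (α₁ ∷ []) b′ x y ⊎ On b′ (α₃ ∷ []) b x y
    indQ p-b p-b e = ⊥-elim (~-irr e)
    indQ p-b p-1 e = inj₁ (inj₁ (inj₁ (refl , refl)))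
    indQ p-b p-b′ e = ⊥-elim (≁bb e)
    indQ p-b p-3 e = inj₂ (inj₂ (inj₂ (refl , refl)))
    indQ p-1 p-b e = inj₁ (inj₁ (inj₂ (refl , refl)))
    indQ p-1 p-1 e = ⊥-elim (~-irr e)
    indQ p-1 p-b′ e = inj₁ (inj₂ (inj₁ (refl , refl)))
    indQ p-1 p-3 e = ⊥-elim (≁₁₃ e)
    indQ p-b′ p-b e = ⊥-elim (≁bb (~-sym e))
    indQ p-b′ p-1 e = inj₁ (inj₂ (inj₂ (refl , refl)))
    indQ p-b′ p-b′ e = ⊥-elim (~-irr e)
    indQ p-b′ p-3 e = inj₂ (inj₁ (inj₁ (refl , refl)))
    indQ p-3 p-b e = inj₂ (inj₂ (inj₁ (refl , refl)))
    indQ p-3 p-1 e = ⊥-elim (≁₁₃ (~-sym e))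
    indQ p-3 p-b′ e = inj₂ (inj₁ (inj₂ (refl , refl)))
    indQ p-3 p-3 e = ⊥-elim (~-irr e)
    hole : Split W b (α₁ ∷ []) b′ (α₃ ∷ [])
    hole = record
      { walk₁ = ~-sym 1b , 1b′ ; walk₂ = ~-sym 3b′ , 3b ; wt = λ f → refl
      ; un = λ v → ≤-trans (≤-reflexive (l (δ v b) (δ v α₁) (δ v b′) (δ v α₃))) (four v)
      ; ind = λ p q e → indQ (pos p) (pos q) e }
    uniq : Uniq (α₂ ∷ R)
    uniq v = ≤-trans (+-monoʳ-≤ (δ v α₂) (m≤n+m _ (δ v α₁))) (un v)
    outR : ∀ {r} → r ∈ α₂ ∷ R → ¬ Pos r
    outR (here refl) p-b = ~-irr 2b
    outR (here refl) p-1 = 1≢2 refl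
    outR (here refl) p-b′ = ~-irr 2b′
    outR (here refl) p-3 = 2≢3 refl
    outR (there i) p-b = proj₁ (proj₂ (proj₂ (proj₂ (out i)))) refl
    outR (there i) p-1 = Uniq-head α₁ R (Uniq-tail α₂ (α₁ ∷ R) un) i
    outR (there i) p-b′ = proj₁ (proj₂ (proj₂ (proj₂ (proj₂ (out i))))) refl
    outR (there i) p-3 = proj₂ (proj₂ (proj₂ (proj₂ (proj₂ (out i))))) refl
    outside : ∀ {r} → r ∈ α₂ ∷ R → ¬ In W r
    outside p q = outR p (pos q)
    emb : ∀ {r} → r ∈ α₂ ∷ R → r ∈ α₂ ∷ α₁ ∷ R
    emb (here e) = here e
    emb (there i) = there (there i)
    indX : ∀ {r q} → r ∈ α₂ ∷ R → Pos q → r ~ q → Pair α₂ b r q ⊎ Pair α₂ b′ r q ⊎ On α₂ R α₁ r q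
    indX p p-1 e = inj₂ (inj₂ (ind (emb p) (there (here refl)) e))
    indX (here refl) p-b e = inj₁ (inj₁ (refl , refl))
    indX (here refl) p-b′ e = inj₂ (inj₁ (inj₁ (refl , refl)))
    indX (here refl) p-3 e = ⊥-elim (≁₂₃ e)
    indX (there i) p-b e = ⊥-elim (proj₁ (out i) e)
    indX (there i) p-b′ e = ⊥-elim (proj₁ (proj₂ (out i)) e)
    indX (there i) p-3 e = ⊥-elim (proj₁ (proj₂ (proj₂ (out i))) e)
    indP : ∀ {r q} → r ∈ α₂ ∷ R → q ∈ α₂ ∷ R ⊎ In W q → r ~ q → Pair α₂ b r q ⊎ Pair α₂ b′ r q ⊎ On α₂ R α₁ r q
    indP p (inj₁ q) e = inj₂ (inj₂ (ind (emb p) (emb q) e))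
    indP p (inj₂ q) e = indX p (pos q) e

  record K33 : Set where
    field
      a b   : Fin 3 → V
      a-inj : ∀ {i j} → i ≢ j → a i ≢ a j
      b-inj : ∀ {i j} → i ≢ j → b i ≢ b j
      a~b   : ∀ i j → a i ~ b j

    inA inB : V → Set
    inA v = ∀ j → v ~ b j
    inB v = ∀ i → v ~ a i

    Out : V → Set
    Out v = ¬ inA v × ¬ inB v

    a∈A : ∀ i → inA (a i)
    a∈A i j = a~b i j
    b∈B : ∀ i → inB (b i)
    b∈B i j = ~-sym (a~b j i)

  swapK : K33 → K33
  swapK k = record { a = K33.b k ; b = K33.a k ; a-inj = K33.b-inj k ; b-inj = K33.a-inj k ; a~b = λ i j → ~-sym (K33.a~b k j i) }

  private
    0F 1F 2F : Fin 3
    0F = zero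
    1F = suc zero
    2F = suc (suc zero)

  module Basic (k : K33) where
    open K33 k

    A-indep : ∀ {x y} → inA x → inA y → x ≁ y
    A-indep p q e = tf e (q 0F) (p 0F)

    A∩B : ∀ {x} → inA x → inB x → ⊥
    A∩B p q = tf (q 0F) (a~b 0F 0F) (p 0F)

    -- If `v` missed `α`, then `b 0F`, `κ₁`, `b 1F`, `α` would form a hole, and `κ₂` with legs to
    -- `b 0F`, to `b 1F` and through `v` to `κ₁` would be an ear.
    sees-all : ∀ {v κ₁ κ₂} → inA κ₁ → inA κ₂ → κ₁ ≢ κ₂ → v ~ κ₁ → v ~ κ₂ → ∀ {α} → inA α → v ≢ b 0F → v ≢ b 1F → v ~ α
    sees-all {v} {κ₁} {κ₂} p₁ p₂ ne e₁ e₂ {α} pα ≢0 ≢1 with v ~? α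
    ... | yes e = e
    ... | no ne′ = ⊥-elim (K-ear {κ₁} {κ₂} {α} {b 0F} {b 1F} ne (λ { refl → ne′ e₁ }) (λ { refl → ne′ e₂ }) (b-inj λ ())
            (p₁ 0F) (p₁ 1F) (p₂ 0F) (p₂ 1F) (pα 0F) (pα 1F) (v ∷ []) (~-sym e₂ , e₁) uniq ind
            (λ { (here refl) → (λ e → tf e₁ (p₁ 0F) e) , (λ e → tf e₁ (p₁ 1F) e) , ne′ , ≢0 , ≢1 , λ { refl → A-indep pα p₁ e₁ } }))
      where
      uniq : Uniq (κ₂ ∷ κ₁ ∷ v ∷ [])
      uniq = Uniq-∷ κ₂ (κ₁ ∷ v ∷ []) (λ { (here e) → ne (sym e) ; (there (here refl)) → ~-irr e₂ })
             (Uniq-∷ κ₁ (v ∷ []) (λ { (here refl) → ~-irr e₁ }) (Uniq-∷ v [] (λ ()) Uniq-[]))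
      ind : ∀ {r q} → r ∈ κ₂ ∷ κ₁ ∷ v ∷ [] → q ∈ κ₂ ∷ κ₁ ∷ v ∷ [] → r ~ q → On κ₂ (v ∷ []) κ₁ r q
      ind (here refl) (here refl) e = ⊥-elim (~-irr e)
      ind (here refl) (there (here refl)) e = ⊥-elim (A-indep p₂ p₁ e)
      ind (here refl) (there (there (here refl))) e = inj₁ (inj₁ (refl , refl))
      ind (there (here refl)) (here refl) e = ⊥-elim (A-indep p₁ p₂ e)
      ind (there (here refl)) (there (here refl)) e = ⊥-elim (~-irr e)
      ind (there (here refl)) (there (there (here refl))) e = inj₂ (inj₂ (refl , refl))
      ind (there (there (here refl))) (here refl) e = inj₁ (inj₂ (refl , refl))
      ind (there (there (here refl))) (there (here refl)) e = inj₂ (inj₁ (refl , refl))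
      ind (there (there (here refl))) (there (there (here refl))) e = ⊥-elim (~-irr e)

    complete : ∀ {α β} → inA α → inB β → α ~ β
    complete {α} {β} p q with β ≟ b 0F | β ≟ b 1F
    ... | yes refl | _ = p 0F
    ... | no _ | yes refl = p 1F
    ... | no ne₀ | no ne₁ = ~-sym (sees-all (a∈A 0F) (a∈A 1F) (a-inj λ ()) (q 0F) (q 1F) p ne₀ ne₁)

    single : ∀ {v κ₁ κ₂} → Out v → inA κ₁ → inA κ₂ → κ₁ ≢ κ₂ → v ~ κ₁ → v ~ κ₂ → ⊥
    single {v} (_ , ∉B) p₁ p₂ ne e₁ e₂ = ∉B λ i → sees-all p₁ p₂ ne e₁ e₂ (a∈A i) (λ { refl → ∉B (b∈B 0F) }) (λ { refl → ∉B (b∈B 1F) })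

    other : ∀ κ₁ κ₂ → ∃ λ i → a i ≢ κ₁ × a i ≢ κ₂
    other κ₁ κ₂ with a 0F ≟ κ₁ | a 0F ≟ κ₂
    ... | no p | no q = 0F , p , q
    ... | yes refl | _ with a 1F ≟ κ₂
    ...   | no q = 1F , a-inj (λ ()) , q
    ...   | yes refl = 2F , a-inj (λ ()) , a-inj (λ ())
    other κ₁ κ₂ | no p | yes refl with a 1F ≟ κ₁
    ...   | no q = 1F , q , a-inj (λ ())
    ...   | yes refl = 2F , a-inj (λ ()) , a-inj (λ ())

  -- The subgraph `k` is quantified inside so that the induction may be applied with its two sides
  -- exchanged.
  No-joining-path : ℕ → Set
  No-joining-path l = ∀ (k : K33) {p} ps {q κ₁ κ₂} → len ps ≡ l → let open K33 k in
    Walk p ps q → Out p → Out q → (∀ {v} → v ∈ ps → Out v) → inA κ₁ → inA κ₂ → κ₁ ≢ κ₂ → p ~ κ₁ → q ~ κ₂ → ⊥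

  module Connect (l : ℕ) (ih : ∀ {l′} → l′ < l → No-joining-path l′) (k : K33)
    {p : V} (ps : List V) {q κ₁ κ₂ : V} (eq : len ps ≡ l) (wk : Walk p ps q) (op : K33.Out k p) (oq : K33.Out k q)
    (ops : ∀ {v} → v ∈ ps → K33.Out k v) (κ₁∈ : K33.inA k κ₁) (κ₂∈ : K33.inA k κ₂) (ne : κ₁ ≢ κ₂) (e₁ : p ~ κ₁) (e₂ : q ~ κ₂) where

    open K33 k
    open Basic k

    swap-out : ∀ {v} → Out v → K33.Out (swapK k) v
    swap-out (x , y) = y , x

    p≢q : p ≢ q
    p≢q refl = single op κ₁∈ κ₂∈ ne e₁ e₂

    module S = Shortest Out ps wk ops
      (λ ps′ lt wk′ ok → ih (subst (len ps′ <_) eq lt) k ps′ refl wk′ op oq ok κ₁∈ κ₂∈ ne e₁ e₂)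

    R : List V
    R = p ∷ ps ++ q ∷ []

    R⊆ : ∀ {r} → r ∈ R → r ∈ p ∷ q ∷ ps
    R⊆ (here e) = here e
    R⊆ (there i) with ∈-++⁻ ps i
    ... | inj₁ j = there (there j)
    ... | inj₂ (here e) = there (here e)

    R-out : ∀ {r} → r ∈ R → Out r
    R-out i with R⊆ i
    ... | here refl = op
    ... | there (here refl) = oq
    ... | there (there j) = ops j

    -- A middle vertex attached to `α` would start or end a shorter joining path, because `α`
    -- differs from `κ₁` or from `κ₂`.
    A-attach : ∀ {r α} → r ∈ R → inA α → r ~ α → (r ≡ p × α ≡ κ₁) ⊎ (r ≡ q × α ≡ κ₂)
    A-attach {r} {α} i α∈ e with R⊆ i
    ... | here refl with α ≟ κ₁
    ...   | yes x = inj₁ (refl , x)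
    ...   | no x = ⊥-elim (single op α∈ κ₁∈ x e e₁)
    A-attach {r} {α} i α∈ e | there (here refl) with α ≟ κ₂
    ...   | yes x = inj₂ (refl , x)
    ...   | no x = ⊥-elim (single oq α∈ κ₂∈ x e e₂)
    A-attach {r} {α} i α∈ e | there (there j) with α ≟ κ₁ | α ≟ κ₂
    ...   | _ | no x with suffix ps wk j
    ...     | sub zs wk′ lt ⊆ = ⊥-elim (ih (subst (len zs <_) eq lt) k zs refl wk′ (ops j) oq (λ v → ops (⊆ v)) α∈ κ₂∈ x e e₂)
    A-attach {r} {α} i α∈ e | there (there j) | no x | _ with prefix ps wk j
    ...     | sub zs wk′ lt ⊆ = ⊥-elim (ih (subst (len zs <_) eq lt) k zs refl wk′ op (ops j) (λ v → ops (⊆ v)) κ₁∈ α∈ (λ y → x (sym y)) e₁ e)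
    A-attach {r} {α} i α∈ e | there (there j) | yes refl | yes refl = ⊥-elim (ne refl)

    Attached : Fin 3 → Set
    Attached i = ∃ λ r → r ∈ ps × r ~ b i

    -- Two of the `b i` attached to the interior of the path would be joined by a single vertex or
    -- by a shorter path; the induction hypothesis is used for `swapK k`.
    one-attached : ∀ {i j} → i ≢ j → Attached i → Attached j → ⊥
    one-attached i≢j (r , r∈ , er) (s , s∈ , es) with r ≟ s
    ... | yes refl = Basic.single (swapK k) (swap-out (ops r∈)) (b∈B _) (b∈B _) (b-inj i≢j) er es
    ... | no r≢s with between ps wk r∈ s∈ r≢s
    ...   | inj₁ (sub zs wk′ lt ⊆) = ih (subst (len zs <_) eq lt) (swapK k) zs refl wk′ (swap-out (ops r∈)) (swap-out (ops s∈))
              (λ v → swap-out (ops (⊆ v))) (b∈B _) (b∈B _) (b-inj i≢j) er es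
    ...   | inj₂ (sub zs wk′ lt ⊆) = ih (subst (len zs <_) eq lt) (swapK k) zs refl wk′ (swap-out (ops s∈)) (swap-out (ops r∈))
              (λ v → swap-out (ops (⊆ v))) (b∈B _) (b∈B _) (b-inj (λ x → i≢j (sym x))) es er

    attached? : ∀ i → Attached i ⊎ (∀ {r} → r ∈ R → r ≁ b i)
    attached? i with find-first (λ r → r ~? b i) ps
    ... | inj₁ (first X r Y refl e _) = inj₁ (r , ∈-++⁺ʳ X (here refl) , e)
    ... | inj₂ no-att = inj₂ λ r∈ → go (R⊆ r∈)
      where
      go : ∀ {r} → r ∈ p ∷ q ∷ ps → r ≁ b i
      -- The ends of the path already see a vertex of `A`, and a neighbour `b i` would close a
      -- triangle with it.
      go (here refl) e = tf e₁ (κ₁∈ i) e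
      go (there (here refl)) e = tf e₂ (κ₂∈ i) e
      go (there (there j)) e = no-att j e

    -- At most one of the three `b i` is attached to the path, and `K-ear` needs only two.
    free-pair : ∃ λ i → ∃ λ j → i ≢ j × (∀ {r} → r ∈ R → r ≁ b i) × (∀ {r} → r ∈ R → r ≁ b j)
    free-pair with attached? 0F | attached? 1F | attached? 2F
    ... | inj₂ x | inj₂ y | _ = 0F , 1F , (λ ()) , x , y
    ... | inj₂ x | inj₁ y | inj₂ z = 0F , 2F , (λ ()) , x , z
    ... | inj₂ x | inj₁ y | inj₁ z = ⊥-elim (one-attached (λ ()) y z)
    ... | inj₁ x | inj₁ y | _ = ⊥-elim (one-attached (λ ()) x y)
    ... | inj₁ x | inj₂ y | inj₁ z = ⊥-elim (one-attached (λ ()) x z)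
    ... | inj₁ x | inj₂ y | inj₂ z = 1F , 2F , (λ ()) , y , z

    absurd-path : ⊥
    absurd-path with other κ₁ κ₂ | free-pair
    ... | i₃ , ≢1 , ≢2 | i , j , i≢j , free-i , free-j =
      K-ear {κ₂} {κ₁} {a i₃} {b i} {b j} (λ x → ne (sym x)) (λ x → ≢2 (sym x)) (λ x → ≢1 (sym x)) (b-inj i≢j)
        (κ₂∈ i) (κ₂∈ j) (κ₁∈ i) (κ₁∈ j) (a~b i₃ i) (a~b i₃ j) R (~-sym e₁ , Walk-++ ps [] wk e₂) uniq ind out
      where
      not-in : ∀ {r κ} → inA κ → r ∈ R → r ≢ κ
      not-in κ∈ i refl = proj₁ (R-out i) κ∈
      uniqR : Uniq R
      uniqR v = ≤-trans (≤-reflexive sums) (S.uniq p≢q v)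
        where
        abstract
          l′ : ∀ p s q → p + (s + (q + 0)) ≡ p + (q + s)
          l′ = solve-∀
        sums : wsum (δ v) R ≡ wsum (δ v) (p ∷ q ∷ ps)
        sums rewrite wsum-++ (δ v) ps (q ∷ []) = l′ (δ v p) (wsum (δ v) ps) (δ v q)
      uniq : Uniq (κ₁ ∷ κ₂ ∷ R)
      uniq = Uniq-∷ κ₁ (κ₂ ∷ R) (λ { (here x) → ne x ; (there i) → not-in κ₁∈ i refl })
             (Uniq-∷ κ₂ R (λ i → not-in κ₂∈ i refl) uniqR)
      onR : ∀ {r s} → On p ps q r s → On κ₁ R κ₂ r s
      onR o = inj₂ (On-++⁺ˡ ps [] o)
      ind : ∀ {r s} → r ∈ κ₁ ∷ κ₂ ∷ R → s ∈ κ₁ ∷ κ₂ ∷ R → r ~ s → On κ₁ R κ₂ r s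
      ind (here refl) (here refl) e = ⊥-elim (~-irr e)
      ind (here refl) (there (here refl)) e = ⊥-elim (A-indep κ₁∈ κ₂∈ e)
      ind (there (here refl)) (here refl) e = ⊥-elim (A-indep κ₂∈ κ₁∈ e)
      ind (there (here refl)) (there (here refl)) e = ⊥-elim (~-irr e)
      ind (there (there i)) (there (there j)) e = onR (S.induced (R⊆ i) (R⊆ j) e)
      ind (here refl) (there (there j)) e with A-attach j κ₁∈ (~-sym e)
      ... | inj₁ (refl , _) = inj₁ (inj₁ (refl , refl))
      ... | inj₂ (_ , x) = ⊥-elim (ne x)
      ind (there (here refl)) (there (there j)) e with A-attach j κ₂∈ (~-sym e)
      ... | inj₁ (_ , x) = ⊥-elim (ne (sym x))
      ... | inj₂ (refl , _) = inj₂ (On-++⁺ʳ ps [] (inj₂ (refl , refl)))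
      ind (there (there j)) (here refl) e with A-attach j κ₁∈ e
      ... | inj₁ (refl , _) = inj₁ (inj₂ (refl , refl))
      ... | inj₂ (_ , x) = ⊥-elim (ne x)
      ind (there (there j)) (there (here refl)) e with A-attach j κ₂∈ e
      ... | inj₁ (_ , x) = ⊥-elim (ne (sym x))
      ... | inj₂ (refl , _) = inj₂ (On-++⁺ʳ ps [] (inj₁ (refl , refl)))
      out : ∀ {r} → r ∈ R → r ≁ b i × r ≁ b j × r ≁ a i₃ × r ≢ b i × r ≢ b j × r ≢ a i₃
      out r∈ = free-i r∈ , free-j r∈ , no-α , (λ { refl → proj₂ (R-out r∈) (b∈B i) }) , (λ { refl → proj₂ (R-out r∈) (b∈B j) }) ,
               (λ { refl → proj₁ (R-out r∈) (a∈A i₃) })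
        where
        no-α : _ ≁ a i₃
        no-α e with A-attach r∈ (a∈A i₃) e
        ... | inj₁ (_ , x) = ≢1 x
        ... | inj₂ (_ , x) = ≢2 x

  connect : ∀ l → No-joining-path l
  connect = <-rec No-joining-path λ l ih k ps eq wk op oq ops κ₁∈ κ₂∈ ne e₁ e₂ →
    Connect.absurd-path l ih k ps eq wk op oq ops κ₁∈ κ₂∈ ne e₁ e₂

  module Separate (k : K33) (no-star : Holes.No-star G) {u : V} (ou : K33.Out k u) where
    open K33 k
    open Basic k
    open Link Out

    linked-A : ∀ {x y κ₁ κ₂} → Linked x y → inA κ₁ → inA κ₂ → κ₁ ≢ κ₂ → x ~ κ₁ → y ~ κ₂ → ⊥
    linked-A (same o) p₁ p₂ ne e₁ e₂ = single o p₁ p₂ ne e₁ e₂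
    linked-A (walk xs o o′ h wk) p₁ p₂ ne e₁ e₂ = connect _ k xs refl wk o o′ h p₁ p₂ ne e₁ e₂

    linked-B : ∀ {x y κ₁ κ₂} → Linked x y → inB κ₁ → inB κ₂ → κ₁ ≢ κ₂ → x ~ κ₁ → y ~ κ₂ → ⊥
    linked-B (same (p , q)) p₁ p₂ ne e₁ e₂ = Basic.single (swapK k) (q , p) p₁ p₂ ne e₁ e₂
    linked-B (walk xs (p , q) (p′ , q′) h wk) p₁ p₂ ne e₁ e₂ =
      connect _ (swapK k) xs refl wk (q , p) (q′ , p′) (λ v → proj₂ (h v) , proj₁ (h v)) p₁ p₂ ne e₁ e₂

    Att : V → Set
    Att κ = ∃ λ v → Linked u v × v ~ κ

    -- The component of `u` is attached to at most `α` in `A` and `β` in `B`. Deleting these two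
    -- separates it from a further `a i`, and they form a star because `A` is complete to `B`.
    cut : ∀ {α β} → inA α → inB β → (∀ {κ} → inA κ → Att κ → κ ≡ α) → (∀ {κ} → inB κ → Att κ → κ ≡ β) → ⊥
    cut {α} {β} α∈ β∈ onlyA onlyB with other α α
    ... | i , ≢α , _ = no-star (λ x → x ≡ α ⊎ x ≡ β) (Linked u) {u} {a i} {α} (same ou)
        (λ { (inj₁ refl) → proj₁ ou α∈ ; (inj₂ refl) → proj₂ ou β∈ })
        (λ l → proj₁ (ok-right l) (a∈A i))
        (λ { (inj₁ x) → ≢α x ; (inj₂ refl) → A∩B (a∈A i) β∈ })
        (inj₁ refl)
        (λ { (inj₁ x) ne → ⊥-elim (ne x) ; (inj₂ refl) _ → complete α∈ β∈ })
        closed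
      where
      inA? : ∀ v → Dec (inA v)
      inA? v with v ~? b 0F | v ~? b 1F | v ~? b 2F
      ... | yes p | yes q | yes r = yes λ { zero → p ; (suc zero) → q ; (suc (suc zero)) → r }
      ... | no p | _ | _ = no λ h → p (h 0F)
      ... | yes _ | no p | _ = no λ h → p (h 1F)
      ... | yes _ | yes _ | no p = no λ h → p (h 2F)
      inB? : ∀ v → Dec (inB v)
      inB? v with v ~? a 0F | v ~? a 1F | v ~? a 2F
      ... | yes p | yes q | yes r = yes λ { zero → p ; (suc zero) → q ; (suc (suc zero)) → r }
      ... | no p | _ | _ = no λ h → p (h 0F)
      ... | yes _ | no p | _ = no λ h → p (h 1F)
      ... | yes _ | yes _ | no p = no λ h → p (h 2F)
      closed : ∀ {x y} → Linked u x → x ~ y → ¬ (y ≡ α ⊎ y ≡ β) → Linked u y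
      closed {x} {y} l e ny with inA? y | inB? y
      ... | yes p | _ = ⊥-elim (ny (inj₁ (onlyA p (x , l , e))))
      ... | no _ | yes p = ⊥-elim (ny (inj₂ (onlyB p (x , l , e))))
      ... | no p | no q = linked-trans l (linked-step (ok-right l) (p , q) e)

    separated : ⊥
    separated = ¬¬-em (∃ λ κ → inA κ × Att κ) λ dA → ¬¬-em (∃ λ κ → inB κ × Att κ) λ dB → go dA dB
      where
      go : (∃ λ κ → inA κ × Att κ) ⊎ ¬ (∃ λ κ → inA κ × Att κ) → (∃ λ κ → inB κ × Att κ) ⊎ ¬ (∃ λ κ → inB κ × Att κ) → ⊥
      go dA dB = cut (proj₁ (proj₂ A)) (proj₁ (proj₂ B)) (proj₂ (proj₂ A)) (proj₂ (proj₂ B))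
        where
        pickA : (∃ λ κ → inA κ × Att κ) ⊎ ¬ (∃ λ κ → inA κ × Att κ) → ∃ λ α → inA α × (∀ {κ} → inA κ → Att κ → κ ≡ α)
        -- If the component is not attached to `A`, any vertex of `A` will do.
        pickA (inj₂ none) = a 0F , a∈A 0F , λ {κ} p q → ⊥-elim (none (κ , p , q))
        pickA (inj₁ (α , α∈ , v , lv , ev)) = α , α∈ , only
          where
          only : ∀ {κ} → inA κ → Att κ → κ ≡ α
          only {κ} p (w , lw , ew) with κ ≟ α
          ... | yes x = x
          ... | no ne = ⊥-elim (linked-A (linked-trans (linked-sym lw) lv) p α∈ ne ew ev)
        pickB : (∃ λ κ → inB κ × Att κ) ⊎ ¬ (∃ λ κ → inB κ × Att κ) → ∃ λ β → inB β × (∀ {κ} → inB κ → Att κ → κ ≡ β)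
        pickB (inj₂ none) = b 0F , b∈B 0F , λ {κ} p q → ⊥-elim (none (κ , p , q))
        pickB (inj₁ (β , β∈ , v , lv , ev)) = β , β∈ , only
          where
          only : ∀ {κ} → inB κ → Att κ → κ ≡ β
          only {κ} p (w , lw , ew) with κ ≟ β
          ... | yes x = x
          ... | no ne = ⊥-elim (linked-B (linked-trans (linked-sym lw) lv) p β∈ ne ew ev)
        A = pickA dA
        B = pickB dB

-- Sectors of wheels and rerouted rims

module Wheels {n : ℕ} (G : Graph n)
  (tf : Holes.Triangle-free G) (no-isk4 : ¬ HasISK4 G) where

  open Holes G

  common≁ : ∀ {x a b} → x ~ a → x ~ b → a ≁ b
  common≁ xa xb e = tf xa e xb

  Uniq-one : ∀ (v : V) → Uniq (v ∷ [])
  Uniq-one v = Uniq-∷ v [] (λ ()) Uniq-[]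

  -- The hub closes a sector into a hole: its only neighbours there are the two spokes at the ends,
  -- which are not adjacent for lack of triangles.
  cone : ∀ {W : Weight} {a s b R x} → Split W a s b R → x ~ a → x ~ b → cnt x s ≡ 0 → ¬ In W x →
         Split ⟨ a , s , b , x ∷ [] ⟩ a s b (x ∷ [])
  cone {W} {a} {s} {b} {R} {x} sp xa xb s0 x∉ = reroute sp (arc-ind sp (common≁ xa xb)) (x ∷ []) (~-sym xb , xa) (Uniq-one x) out ind
    where
    out : ∀ {r} → r ∈ x ∷ [] → r ∉ a ∷ b ∷ s
    out (here refl) (here refl) = ~-irr xa
    out (here refl) (there (here refl)) = ~-irr xb
    out (here refl) (there (there i)) = x∉ (In-m sp i)
    ind : ∀ {r q} → r ∈ x ∷ [] → q ∈ x ∷ [] ⊎ q ∈ a ∷ b ∷ s → r ~ q → On b (x ∷ []) a r q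
    ind (here refl) (inj₁ (here refl)) e = ⊥-elim (~-irr e)
    ind (here refl) (inj₂ (here refl)) e = inj₂ (inj₁ (refl , refl))
    ind (here refl) (inj₂ (there (here refl))) e = inj₁ (inj₂ (refl , refl))
    ind (here refl) (inj₂ (there (there i))) e = ⊥-elim (cnt≡0⇒≁ s s0 i e)

  record TwoNbs (w : V) (l : List V) : Set where
    constructor two-nbs
    field
      {y z} : V
      y∈    : y ∈ l
      z∈    : z ∈ l
      y≢z   : y ≢ z
      w~y   : w ~ y
      w~z   : w ~ z
      only  : ∀ {q} → q ∈ l → w ~ q → q ≡ y ⊎ q ≡ z

  find-two : ∀ w l → Uniq l → cnt w l ≡ 2 → TwoNbs w l
  find-two w l un h with first-nb w l (≤-trans (s≤s z≤n) (≤-reflexive (sym h)))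
  ... | first A y B refl wy A0 = go (first-nb w B (≤-reflexive (sym cB)))
    where
    cB : cnt w B ≡ 1
    cB with trans (sym (wsum-++ (nb w) A (y ∷ B))) h
    ... | q rewrite ≁⇒cnt≡0 A A0 | nb-yes {w} wy = cong pred q
    go : First (w ~_) B → TwoNbs w (A ++ y ∷ B)
    go (first A′ z B′ refl wz A′0) = two-nbs (∈-++⁺ʳ A (here refl)) z∈ y≢z wy wz only
      where
      z∈ : z ∈ A ++ y ∷ A′ ++ z ∷ B′
      z∈ = ∈-++⁺ʳ A (there (∈-++⁺ʳ A′ (here refl)))
      cB′ : cnt w B′ ≡ 0
      cB′ with trans (sym (wsum-++ (nb w) A′ (z ∷ B′))) cB
      ... | q rewrite ≁⇒cnt≡0 A′ A′0 | nb-yes {w} wz = cong pred q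
      y≢z : y ≢ z
      y≢z refl = <⇒≱ two (un y)
        where
        two : 2 ≤ wsum (δ y) (A ++ y ∷ A′ ++ y ∷ B′)
        two rewrite wsum-++ (δ y) A (y ∷ A′ ++ y ∷ B′) | δ-refl y =
          ≤-trans (s≤s (∈⇒1≤ (∈-++⁺ʳ A′ (here refl)))) (m≤n+m _ (wsum (δ y) A))
      only : ∀ {q} → q ∈ A ++ y ∷ A′ ++ z ∷ B′ → w ~ q → q ≡ y ⊎ q ≡ z
      only i e with ∈-++⁻ A i
      ... | inj₁ j = ⊥-elim (A0 j e)
      ... | inj₂ (here p) = inj₁ p
      ... | inj₂ (there j) with ∈-++⁻ A′ j
      ...   | inj₁ k = ⊥-elim (A′0 k e)
      ...   | inj₂ (here p) = inj₂ p
      ...   | inj₂ (there k) = ⊥-elim (cnt≡0⇒≁ B′ cB′ k e)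

  closed-In : ∀ {W : Weight} {y m z ys} → Split W y m z ys → ∀ {v} → v ∈ y ∷ z ∷ m → In W v
  closed-In s (here refl) = In-y s
  closed-In s (there (here refl)) = In-z s
  closed-In s (there (there i)) = In-m s i

  closed∩ys : ∀ {W : Weight} {y m z ys} → Split W y m z ys → ∀ {v} → v ∈ ys → v ∉ y ∷ z ∷ m
  closed∩ys s i j = apart-within (Split.ap s) (within-∷ (Split.at-y s) (within-∷ (Split.at-z s) (within-seg (Split.in-m s))))
                      (within-seg (Split.in-ys s)) refl j i

  -- A nonempty complementary arc replaces the assumption that the ends are not adjacent: a stray
  -- edge between them would be a chord of the hole.
  arc-ind′ : ∀ {W : Weight} {a M b n N} → Split W a M b (n ∷ N) → ∀ {r q} → r ∈ a ∷ b ∷ M → q ∈ a ∷ b ∷ M → r ~ q → On a M b r q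
  arc-ind′ {W} {a} {M} {b} {c} {N} s i j e with Split.ind s (closed-In s i) (closed-In s j) e
  ... | inj₁ o = o
  ... | inj₂ o = ⊥-elim (bad i j e o)
    where
    c∉ : c ∉ a ∷ b ∷ M
    c∉ = closed∩ys s (here refl)
    b∉ : b ∉ c ∷ a ∷ N
    b∉ (here refl) = c∉ (there (here refl))
    b∉ (there (here refl)) = Split.y≢z s refl
    b∉ (there (there k)) = closed∩ys s (there k) (there (here refl))
    bad : ∀ {r q} → r ∈ a ∷ b ∷ M → q ∈ a ∷ b ∷ M → r ~ q → ¬ On b (c ∷ N) a r q
    bad i j e (inj₁ (inj₁ (_ , refl))) = c∉ j
    bad i j e (inj₁ (inj₂ (refl , _))) = c∉ i
    bad i j e (inj₂ o) with On-∈ N o | On-∈ʳ N o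
    ... | here refl | _ = c∉ i
    ... | there (there k) | _ = closed∩ys s (there k) i
    ... | _ | here refl = c∉ j
    ... | _ | there (there k) = closed∩ys s (there k) j
    ... | there (here refl) | there (here refl) = ~-irr e

  -- A vertex w with exactly two neighbours in a closed sector of x and a further neighbour away from the sector:
  -- w and a path from w to x outside the sector form an ear of the hole through x and the sector.
  module TwoPlus {W : Weight} {x : V} (x∉ : ¬ In W x) {w : V} (w∉ : ¬ In W w) (x≁w : x ≁ w) (w≢x : w ≢ x) where

    core : ∀ {a s b R} → Split W a s b R → x ~ a → x ~ b → cnt x s ≡ 0 → cnt w (a ∷ b ∷ s) ≡ 2 →
      ∀ P → Walk w P x → Uniq P → (∀ {r} → r ∈ P → r ∈ R) → (∀ {r} → r ∈ P → r ≁ a) → (∀ {r} → r ∈ P → r ≁ b) →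
      (∀ {r q} → r ∈ w ∷ P → q ∈ w ∷ x ∷ P → r ~ q → On w P x r q) → ⊥
    core {a} {s} {b} {R} sp xa xb s0 c2 P wk un P⊆ ≁a ≁b ind with find-two w (a ∷ b ∷ s) (uniq-closed sp) c2
    ... | two-nbs {y} {z} y∈ z∈ y≢z wy wz only =
      ear-any no-isk4 H (closed-In H y∈) (closed-In H z∈) (In-ys H (here refl)) y≢z (≢x y∈) (≢x z∈) w [] P wy wz wk
        (Uniq-∷ w P (λ i → w∉ (In-ys sp (P⊆ i))) un) out indP
      where
      H = cone sp xa xb s0 x∉
      ≢x : ∀ {v} → v ∈ a ∷ b ∷ s → v ≢ x
      ≢x i refl = x∉ (closed-In sp i)
      out : ∀ {r} → r ∈ w ∷ P → ¬ In ⟨ a , s , b , x ∷ [] ⟩ r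
      out i p with In⇒∈ a s b (x ∷ []) p
      out (here refl) p | inj₁ (here e) = w≢x e
      out (here refl) p | inj₂ j = w∉ (closed-In sp j)
      out (there i) p | inj₁ (here refl) = x∉ (In-ys sp (P⊆ i))
      out (there i) p | inj₂ j = closed∩ys sp (P⊆ i) j
      indP : ∀ {r q} → r ∈ w ∷ P → q ∈ w ∷ P ⊎ In ⟨ a , s , b , x ∷ [] ⟩ q → r ~ q → Pair w y r q ⊎ Pair w z r q ⊎ On w P x r q
      indP i (inj₁ (here refl)) e = inj₂ (inj₂ (ind i (here refl) e))
      indP i (inj₁ (there j)) e = inj₂ (inj₂ (ind i (there (there j)) e))
      indP i (inj₂ p) e with In⇒∈ a s b (x ∷ []) p
      ... | inj₁ (here refl) = inj₂ (inj₂ (ind i (there (here refl)) e))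
      indP (here refl) (inj₂ p) e | inj₂ j with only j e
      ... | inj₁ refl = inj₁ (inj₁ (refl , refl))
      ... | inj₂ refl = inj₂ (inj₁ (inj₁ (refl , refl)))
      indP (there i) (inj₂ p) e | inj₂ (here refl) = ⊥-elim (≁a i e)
      indP (there i) (inj₂ p) e | inj₂ (there (here refl)) = ⊥-elim (≁b i e)
      indP (there i) (inj₂ p) e | inj₂ (there (there j)) = ⊥-elim (Split.far sp j (P⊆ i) (~-sym e))

    direct : ∀ {a s b R} → Split W a s b R → x ~ a → x ~ b → cnt x s ≡ 0 → cnt w (a ∷ b ∷ s) ≡ 2 →
      ∀ {t} → t ∈ R → w ~ t → x ~ t → ⊥
    direct sp xa xb s0 c2 {t} t∈ wt xt = core sp xa xb s0 c2 (t ∷ []) (wt , ~-sym xt) (Uniq-one t)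
      (λ { (here refl) → t∈ }) (λ { (here refl) → common≁ xt xa }) (λ { (here refl) → common≁ xt xb }) ind
      where
      ind : ∀ {r q} → r ∈ w ∷ t ∷ [] → q ∈ w ∷ x ∷ t ∷ [] → r ~ q → On w (t ∷ []) x r q
      ind (here refl) (here refl) e = ⊥-elim (~-irr e)
      ind (here refl) (there (here refl)) e = ⊥-elim (x≁w (~-sym e))
      ind (here refl) (there (there (here refl))) e = inj₁ (inj₁ (refl , refl))
      ind (there (here refl)) (here refl) e = inj₁ (inj₂ (refl , refl))
      ind (there (here refl)) (there (here refl)) e = inj₂ (inj₁ (refl , refl))
      ind (there (here refl)) (there (there (here refl))) e = ⊥-elim (~-irr e)

    along : ∀ {a s b} X {v} A {t} Y → Split W a s b (X ++ v ∷ A ++ t ∷ Y) → x ~ a → x ~ b → cnt x s ≡ 0 → cnt w (a ∷ b ∷ s) ≡ 2 →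
      w ~ v → v ≁ b → x ≁ v → cnt x A ≡ 0 → x ~ t → cnt w A ≡ 0 → w ≁ t → ⊥
    along {a} {s} {b} X {v} A {t} Y sp xa xb s0 c2 wv v≁b x≁v xA xt wA w≁t =
      core sp xa xb s0 c2 (v ∷ A ++ t ∷ []) (wv , Walk-++ A [] (Split.walk₁ arc) (~-sym xt)) un
        (λ i → ∈-++⁺ʳ X (⊆R i)) ≁a ≁b ind
      where
      sp₁ : Split W b (X ++ v ∷ A ++ t ∷ Y) a s
      sp₁ = swap sp
      sp₂ : Split W v (A ++ t ∷ Y) a (s ++ b ∷ X)
      sp₂ = moveL X (A ++ t ∷ Y) sp₁
      arc : Split W v A t (Y ++ a ∷ s ++ b ∷ X)
      arc = moveR A Y sp₂
      arc-on : ∀ {r q} → r ∈ v ∷ t ∷ A → q ∈ v ∷ t ∷ A → r ~ q → On v A t r q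
      arc-on = go Y arc
        where
        go : ∀ Y → Split W v A t (Y ++ a ∷ s ++ b ∷ X) → ∀ {r q} → r ∈ v ∷ t ∷ A → q ∈ v ∷ t ∷ A → r ~ q → On v A t r q
        go []      sp = arc-ind′ sp
        go (_ ∷ _) sp = arc-ind′ sp
      ⊆R : ∀ {r} → r ∈ v ∷ A ++ t ∷ [] → r ∈ v ∷ A ++ t ∷ Y
      ⊆R (here e) = here e
      ⊆R (there i) with ∈-++⁻ A i
      ... | inj₁ j = there (∈-++⁺ˡ j)
      ... | inj₂ (here e) = there (∈-++⁺ʳ A (here e))
      re : ∀ {r} → r ∈ v ∷ A ++ t ∷ [] → r ∈ v ∷ t ∷ A
      re (here e) = here e
      re (there i) with ∈-++⁻ A i
      ... | inj₁ j = there (there j)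
      ... | inj₂ (here e) = there (here e)
      un : Uniq (v ∷ A ++ t ∷ [])
      un u = ≤-trans (≤-reflexive sums) (uniq-closed arc u)
        where
        abstract
          l′ : ∀ p s q → p + (s + (q + 0)) ≡ p + (q + s)
          l′ = solve-∀
        sums : wsum (δ u) (v ∷ A ++ t ∷ []) ≡ wsum (δ u) (v ∷ t ∷ A)
        sums rewrite wsum-++ (δ u) A (t ∷ []) = l′ (δ u v) (wsum (δ u) A) (δ u t)
      ≁a : ∀ {r} → r ∈ v ∷ A ++ t ∷ [] → r ≁ a
      ≁a i with re i
      ... | here refl = ≁-right (X ++ v ∷ A) Y (subst (λ l → Split W b l a s) (sym (++-assoc X (v ∷ A) (t ∷ Y))) sp₁) (∈-++⁺ʳ X (here refl))
      ... | there (here refl) = common≁ xt xa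
      ... | there (there j) = ≁-right (X ++ v ∷ A) Y (subst (λ l → Split W b l a s) (sym (++-assoc X (v ∷ A) (t ∷ Y))) sp₁) (∈-++⁺ʳ X (there j))
      ≁b : ∀ {r} → r ∈ v ∷ A ++ t ∷ [] → r ≁ b
      ≁b i with re i
      ... | here refl = v≁b
      ... | there (here refl) = common≁ xt xb
      ... | there (there j) = ≁-left X (A ++ t ∷ Y) sp₁ (∈-++⁺ˡ j)
      ind : ∀ {r q} → r ∈ w ∷ v ∷ A ++ t ∷ [] → q ∈ w ∷ x ∷ v ∷ A ++ t ∷ [] → r ~ q → On w (v ∷ A ++ t ∷ []) x r q
      ind (here refl) (here refl) e = ⊥-elim (~-irr e)
      ind (here refl) (there (here refl)) e = ⊥-elim (x≁w (~-sym e))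
      ind (here refl) (there (there j)) e with re j
      ... | here refl = inj₁ (inj₁ (refl , refl))
      ... | there (here refl) = ⊥-elim (w≁t e)
      ... | there (there k) = ⊥-elim (cnt≡0⇒≁ A wA k e)
      ind (there i) (here refl) e with re i
      ... | here refl = inj₁ (inj₂ (refl , refl))
      ... | there (here refl) = ⊥-elim (w≁t (~-sym e))
      ... | there (there k) = ⊥-elim (cnt≡0⇒≁ A wA k (~-sym e))
      ind (there i) (there (here refl)) e with re i
      ... | here refl = ⊥-elim (x≁v (~-sym e))
      ... | there (here refl) = inj₂ (On-++⁺ʳ A [] (inj₁ (refl , refl)))
      ... | there (there k) = ⊥-elim (cnt≡0⇒≁ A xA k (~-sym e))
      ind (there i) (there (there j)) e = inj₂ (On-++⁺ˡ A [] (arc-on (re i) (re j) e))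

    -- The leg starts at the last neighbour of `w` before the next spoke `t`, follows the rim to `t`
    -- and goes on to the hub; if `w` sees `t` itself, the leg consists of `t` alone.
    forward : ∀ {a s b} R₁ {v} R₂ → Split W a s b (R₁ ++ v ∷ R₂) → x ~ a → x ~ b → cnt x s ≡ 0 → cnt w (a ∷ b ∷ s) ≡ 2 →
      w ~ v → v ≁ b → x ≁ v → 1 ≤ cnt x R₂ → ⊥
    forward {a} {s} {b} R₁ {v} R₂ sp xa xb s0 c2 wv v≁b x≁v h with first-nb x R₂ h
    ... | first A t B refl xt A0 with w ~? t
    ...   | yes wt = direct sp xa xb s0 c2 (∈-++⁺ʳ R₁ (there (∈-++⁺ʳ A (here refl)))) wt xt
    ...   | no w≁t with find-last (w ~?_) (v ∷ A)
    ...     | inj₂ none = none (here refl) wv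
    ...     | inj₁ (last X v′ A₂ eq wv′ A₂0) =
      along (R₁ ++ X) A₂ B (subst (Split W a s b) eqR sp) xa xb s0 c2 wv′ (v′≁b) (x≁v′) xA₂ xt (≁⇒cnt≡0 A₂ A₂0) w≁t
      where
      eqR : R₁ ++ v ∷ A ++ t ∷ B ≡ (R₁ ++ X) ++ v′ ∷ A₂ ++ t ∷ B
      eqR = trans (cong (R₁ ++_) (trans (cong (_++ t ∷ B) eq) (++-assoc X (v′ ∷ A₂) (t ∷ B)))) (sym (++-assoc R₁ X (v′ ∷ A₂ ++ t ∷ B)))
      v′∈ : v′ ∈ v ∷ A
      v′∈ = subst (v′ ∈_) (sym eq) (∈-++⁺ʳ X (here refl))
      A₂⊆ : ∀ {u} → u ∈ A₂ → u ∈ v ∷ A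
      A₂⊆ i = subst (_ ∈_) (sym eq) (∈-++⁺ʳ X (there i))
      x≁vA : ∀ {u} → u ∈ v ∷ A → x ≁ u
      x≁vA (here refl) = x≁v
      x≁vA (there i) = A0 i
      x≁v′ : x ≁ v′
      x≁v′ = x≁vA v′∈
      xA₂ : cnt x A₂ ≡ 0
      xA₂ = ≁⇒cnt≡0 A₂ (λ i → x≁vA (A₂⊆ i))
      v′≁b : v′ ≁ b
      v′≁b with v′∈
      ... | here refl = v≁b
      ... | there i = ≁-left R₁ (A ++ t ∷ B) (swap sp) (∈-++⁺ˡ i)

    two-plus : ∀ {a s b R} → Split W a s b R → x ~ a → x ~ b → cnt x s ≡ 0 → cnt w (a ∷ b ∷ s) ≡ 2 →
      ∀ {v} → v ∈ R → w ~ v → v ≁ a → v ≁ b → 1 ≤ cnt x R → ⊥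
    two-plus {a} {s} {b} sp xa xb s0 c2 {v} v∈ wv v≁a v≁b h with x ~? v
    ... | yes xv = direct sp xa xb s0 c2 v∈ wv xv
    ... | no x≁v with ∈-∃++ v∈
    ...   | R₁ , R₂ , refl with find-first (x ~?_) R₂
    ...     | inj₁ (first A t B refl xt _) = forward R₁ (A ++ t ∷ B) sp xa xb s0 c2 wv v≁b x≁v (∈⇒1≤cnt {x} {t} {A ++ t ∷ B} (∈-++⁺ʳ A (here refl)) xt)
    -- No spoke comes after `v`, so one comes before it, and the leg is taken in the opposite
    -- direction.
    ...     | inj₂ none = forward (reverse R₂) (reverse R₁) (subst (Split W b (reverse s) a) eq (flip-swap sp)) xb xa
                            (trans (wsum-reverse (nb x) s) s0) c2′ wv v≁a x≁v h′
      where
      eq : reverse (R₁ ++ v ∷ R₂) ≡ reverse R₂ ++ v ∷ reverse R₁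
      eq = trans (reverse-++ R₁ (v ∷ R₂)) (trans (cong (_++ reverse R₁) (unfold-reverse v R₂)) (++-assoc (reverse R₂) (v ∷ []) (reverse R₁)))
      abstract
        sw : ∀ a b s → b + (a + s) ≡ a + (b + s)
        sw = solve-∀
      c2′ : cnt w (b ∷ a ∷ reverse s) ≡ 2
      c2′ rewrite wsum-reverse (nb w) s = trans (sw (nb w a) (nb w b) _) c2
      h′ : 1 ≤ cnt x (reverse R₁)
      h′ with wsum-++ (nb x) R₁ (v ∷ R₂)
      ... | q rewrite wsum-reverse (nb x) R₁ | nb-no {x} x≁v | ≁⇒cnt≡0 R₂ none | +-identityʳ (cnt x R₁) = ≤-trans h (≤-reflexive q)

  nb≤1 : ∀ x v → nb x v ≤ 1
  nb≤1 x v with adj G x v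
  ... | true  = ≤-refl
  ... | false = z≤n

  cnt≤len : ∀ x l → cnt x l ≤ len l
  cnt≤len x [] = z≤n
  cnt≤len x (v ∷ l) = +-mono-≤ (nb≤1 x v) (cnt≤len x l)

  no-three : ∀ {W : Weight} {y m z ys w} → Split W y m z ys → ¬ In W w → W (nb w) ≢ 3
  no-three s w∉ h = no-isk4 (three-neighbours s w∉ h)

  closed-count : ∀ {W : Weight} {y m z ys} x → Split W y m z ys → cnt x (y ∷ z ∷ m) + cnt x ys ≡ W (nb x)
  closed-count {W} {y} {m} {z} {ys} x s = trans (lem (nb x y) (nb x z) _ _) (Split.wt s (nb x))
    where
    abstract
      lem : ∀ y z m ys → y + (z + m) + ys ≡ y + m + z + ys
      lem = solve-∀

  cone-count : ∀ {W : Weight} {a s b R x} (sp : Split W a s b R) {p} → x ≁ p → ⟨ a , s , b , x ∷ [] ⟩ (nb p) ≡ cnt p (a ∷ b ∷ s)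
  cone-count {W} {a} {s} {b} {R} {x} sp {p} x≁p rewrite nb-no {p} {x} (λ e → x≁p (~-sym e)) = lem (nb p a) (cnt p s) (nb p b)
    where
    abstract
      lem : ∀ a s b → a + s + b + 0 ≡ a + (b + s)
      lem = solve-∀

  ¬In-cone : ∀ {W : Weight} {a s b R x} (sp : Split W a s b R) {p} → ¬ In W p → p ≢ x → ¬ In ⟨ a , s , b , x ∷ [] ⟩ p
  ¬In-cone {a = a} {s} {b} {x = x} sp p∉ p≢x i with In⇒∈ a s b (x ∷ []) i
  ... | inj₁ (here e) = p≢x e
  ... | inj₂ j = p∉ (closed-In sp j)

  -- The paths a s b quantified over are the closed sectors of the wheel with hub x.
  Proper : Weight → V → Set
  Proper W x = ∀ {a} s {b} → (∀ {v} → v ∈ a ∷ b ∷ s → In W v) → Walk a s b → Uniq (a ∷ b ∷ s) → x ~ a → x ~ b → cnt x s ≡ 0 →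
    ∀ {p} → ¬ In W p → x ≁ p → p ≢ x → cnt p (a ∷ b ∷ s) ≤ 2

  -- The sector and the hub form a hole, and `p` would have exactly three neighbours on it.
  sector-≢3 : ∀ {W : Weight} {a s b R x} → Split W a s b R → ¬ In W x → x ~ a → x ~ b → cnt x s ≡ 0 →
    ∀ {p} → ¬ In W p → x ≁ p → p ≢ x → cnt p (a ∷ b ∷ s) ≢ 3
  sector-≢3 sp x∉ xa xb s0 p∉ x≁p p≢x h =
    no-three (cone sp xa xb s0 x∉) (¬In-cone sp p∉ p≢x) (trans (cone-count sp x≁p) h)

  -- More than two neighbours means at least four, and then `p` is the hub of a wheel whose rim is
  -- the sector with `x`. This rim is shorter, since `x` replaces an arc containing the remaining
  -- spokes, of which there are at least two.
  shortest-proper : ∀ {W : Weight} {y m z ys x} → Split W y m z ys → ¬ In W x → 4 ≤ W (nb x) →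
    (∀ {W′ : Weight} {y′ m′ z′ ys′ x′} → Split W′ y′ m′ z′ ys′ → ¬ In W′ x′ → 4 ≤ W′ (nb x′) → W′ (λ _ → 1) < W (λ _ → 1) → ⊥) →
    Proper W x
  shortest-proper {W} {x = x} sp₀ x∉ k≥4 least {a} s {b} in-W wk un xa xb s0 {p} p∉ x≁p p≢x = ≮⇒≥ many
    where
    many : 2 < cnt p (a ∷ b ∷ s) → ⊥
    many h with arc-unique sp₀ s in-W wk un (common≁ xa xb)
    ... | N , sp with m≤n⇒m<n∨m≡n h
    ...   | inj₂ e = sector-≢3 sp x∉ xa xb s0 p∉ x≁p p≢x (sym e)
    ...   | inj₁ lt = least (cone sp xa xb s0 x∉) (¬In-cone sp p∉ p≢x) (≤-trans lt (≤-reflexive (sym (cone-count sp x≁p)))) shorter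
      where
      N≥2 : 2 ≤ len N
      N≥2 = ≤-trans two (cnt≤len x N)
        where
        two : 2 ≤ cnt x N
        two with closed-count x sp
        ... | e rewrite nb-yes {x} xa | nb-yes {x} xb | s0 = ≤-pred (≤-pred (≤-trans k≥4 (≤-reflexive (sym e))))
      shorter : ⟨ a , s , b , x ∷ [] ⟩ (λ _ → 1) < W (λ _ → 1)
      shorter = ≤-trans (≤-reflexive (sym (+-suc (1 + len s + 1) 1)))
                 (≤-trans (+-monoʳ-≤ (1 + len s + 1) N≥2) (≤-reflexive (Split.wt sp (λ _ → 1))))

  -- The path P from z to y replaces the arc ys of the hole.
  record Detour (W : Weight) (x y : V) (m : List V) (z : V) (ys P : List V) : Set where
    field
      sp   : Split W y m z ys
      y≁z  : y ≁ z
      walk : Walk z P y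
      uniq : Uniq P
      out  : ∀ {r} → r ∈ P → ¬ In W r
      x≁   : ∀ {r} → r ∈ P → x ≁ r
      x∉P  : x ∉ P
      ind  : ∀ {r q} → r ∈ P → q ∈ P ⊎ q ∈ y ∷ z ∷ m → r ~ q → On z P y r q

    hole : Split ⟨ y , m , z , P ⟩ y m z P
    hole = reroute sp (arc-ind sp y≁z) P walk uniq (λ i j → out i (closed-In sp j)) ind

    count : ⟨ y , m , z , P ⟩ (nb x) ≡ cnt x (y ∷ z ∷ m)
    count rewrite ≁⇒cnt≡0 P x≁ = lem (nb x y) (cnt x m) (nb x z)
      where
      abstract
        lem : ∀ a s b → a + s + b + 0 ≡ a + (b + s)
        lem = solve-∀

    hub-out : ¬ In W x → ¬ In ⟨ y , m , z , P ⟩ x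
    hub-out x∉ i with In⇒∈ y m z P i
    ... | inj₁ j = x∉P j
    ... | inj₂ j = x∉ (closed-In sp j)

    ≢3 : ¬ In W x → cnt x (y ∷ z ∷ m) ≢ 3
    ≢3 x∉ h = no-three hole (hub-out x∉) (trans count h)

  flip-count : ∀ x y (m : List V) z → cnt x (z ∷ y ∷ reverse m) ≡ cnt x (y ∷ z ∷ m)
  flip-count x y m z rewrite wsum-reverse (nb x) m = sw (nb x y) (nb x z) (cnt x m)
    where
    abstract
      sw : ∀ y z m → z + (y + m) ≡ y + (z + m)
      sw = solve-∀

  -- The hub has two neighbours on the new hole and reaches it a third time along the removed arc.
  module TwoSpokeArc {W : Weight} {x : V} (x∉ : ¬ In W x) {y : V} {m : List V} {z : V} (r₀ : V) (rest : List V) (lx : V) (L P : List V)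
    (d : Detour W x y m z (r₀ ∷ rest ++ lx ∷ L) P) {q : V} (q∈ : q ∈ P) (q~y : q ~ y) (x~lx : x ~ lx) (L0 : cnt x L ≡ 0)
    (c2 : cnt x (y ∷ z ∷ m) ≡ 2) (att : ∀ {e r} → e ∈ lx ∷ L → r ∈ P → e ~ r → r ≡ q) where

    open Detour d

    private
      W′ = ⟨ y , m , z , P ⟩

      sp₁ : Split W z ((r₀ ∷ rest) ++ lx ∷ L) y m
      sp₁ = swap sp

      arc : Split W lx L y (m ++ z ∷ r₀ ∷ rest)
      arc = moveL (r₀ ∷ rest) L sp₁

      arc-on : ∀ {r s} → r ∈ lx ∷ y ∷ L → s ∈ lx ∷ y ∷ L → r ~ s → On lx L y r s
      arc-on = go m arc
        where
        go : ∀ m → Split W lx L y (m ++ z ∷ r₀ ∷ rest) → ∀ {r s} → r ∈ lx ∷ y ∷ L → s ∈ lx ∷ y ∷ L → r ~ s → On lx L y r s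
        go []      sp = arc-ind′ sp
        go (_ ∷ _) sp = arc-ind′ sp

      on-ys : ∀ {v} → v ∈ lx ∷ L → v ∈ r₀ ∷ rest ++ lx ∷ L
      on-ys i = there (∈-++⁺ʳ rest i)

      ≁z : ∀ {v} → v ∈ lx ∷ L → v ≁ z
      ≁z i = ≁-left [] (rest ++ lx ∷ L) sp₁ (∈-++⁺ʳ rest i)

      up : ∀ {v} → v ∈ lx ∷ L → v ∈ lx ∷ y ∷ L
      up (here e) = here e
      up (there i) = there (there i)

      x-only : ∀ {v} → v ∈ lx ∷ L → x ~ v → v ≡ lx
      x-only (here e) _ = e
      x-only (there i) e = ⊥-elim (cnt≡0⇒≁ L L0 i e)

      full : ∀ {r s} → r ∈ x ∷ lx ∷ L → s ∈ x ∷ lx ∷ L → r ~ s → On x (lx ∷ L) y r s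
      full (here refl) (here refl) e = ⊥-elim (~-irr e)
      full (here refl) (there j) e with x-only j e
      ... | refl = inj₁ (inj₁ (refl , refl))
      full (there i) (here refl) e with x-only i (~-sym e)
      ... | refl = inj₁ (inj₂ (refl , refl))
      full (there i) (there j) e = inj₂ (arc-on (up i) (up j) e)

      core : ∀ R {t} → In W′ t → (∀ {s} → s ∈ y ∷ z ∷ m → x ~ s → s ≢ t) → Walk x R t → Uniq R → (∀ {v} → v ∈ R → v ∈ lx ∷ L) →
        (∀ {r s} → r ∈ x ∷ R → s ∈ x ∷ R → r ~ s → On x R t r s) → (∀ {r s} → r ∈ R → s ∈ P → r ~ s → On x R t r s) →
        (∀ {r} → r ∈ R → r ~ y → On x R t r y) → ⊥
      core R {t} t∈ ≢t wk un R⊆ indR indPR indy with find-two x (y ∷ z ∷ m) (uniq-closed sp) c2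
      ... | two-nbs {u} {v} u∈ v∈ u≢v xu xv only =
        ear-any no-isk4 hole (closed-In hole u∈) (closed-In hole v∈) t∈ u≢v (≢t u∈ xu) (≢t v∈ xv) x [] R xu xv wk
          (Uniq-∷ x R (λ i → x∉ (In-ys sp (on-ys (R⊆ i)))) un) out′ ind′
        where
        out′ : ∀ {r} → r ∈ x ∷ R → ¬ In W′ r
        out′ (here refl) i = hub-out x∉ i
        out′ (there r∈) i with In⇒∈ y m z P i
        ... | inj₁ j = out j (In-ys sp (on-ys (R⊆ r∈)))
        ... | inj₂ j = closed∩ys sp (on-ys (R⊆ r∈)) j
        ind′ : ∀ {r s} → r ∈ x ∷ R → s ∈ x ∷ R ⊎ In W′ s → r ~ s → Pair x u r s ⊎ Pair x v r s ⊎ On x R t r s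
        ind′ i (inj₁ j) e = inj₂ (inj₂ (indR i j e))
        ind′ i (inj₂ j) e with In⇒∈ y m z P j
        ind′ (here refl) (inj₂ j) e | inj₁ k = ⊥-elim (x≁ k e)
        ind′ (there i) (inj₂ j) e | inj₁ k = inj₂ (inj₂ (indPR i k e))
        ind′ (here refl) (inj₂ j) e | inj₂ k with only k e
        ... | inj₁ refl = inj₁ (inj₁ (refl , refl))
        ... | inj₂ refl = inj₂ (inj₁ (inj₁ (refl , refl)))
        ind′ (there i) (inj₂ j) e | inj₂ (here refl) = inj₂ (inj₂ (indy i e))
        ind′ (there i) (inj₂ j) e | inj₂ (there (here refl)) = ⊥-elim (≁z (R⊆ i) e)
        ind′ (there i) (inj₂ j) e | inj₂ (there (there k)) = ⊥-elim (Split.far sp k (on-ys (R⊆ i)) (~-sym e))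

      uniq-lxL : Uniq (lx ∷ L)
      uniq-lxL v = ≤-trans (+-monoʳ-≤ (δ v lx) (m≤n+m _ (δ v y))) (uniq-closed arc v)

    -- The leg stops at the first neighbour of `q`, which becomes the third foot. This is needed in
    -- particular when `y` is a spoke, for then `y` is already one of the other two feet.
    attached : ∀ {e₀} → e₀ ∈ lx ∷ L → q ~ e₀ → ⊥
    attached e₀∈ q~e₀ with find-first (q ~?_) (lx ∷ L)
    ... | inj₂ none = none e₀∈ q~e₀
    ... | inj₁ (first X e Y eq q~e X0) =
      core (X ++ e ∷ []) (In-ys hole q∈) (λ { s∈ _ refl → out q∈ (closed-In sp s∈) })
        (Walk-++ X [] (proj₁ (Walk-++⁻ X Y walk-full)) (~-sym q~e)) un R⊆
        (λ i j a → cut (full′ (up′ i) (up′ j) a) (R∩ i) (R∩ j) a) attP atty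
      where
      walk-full : Walk x (X ++ e ∷ Y) y
      walk-full = subst (λ l → Walk x l y) eq (x~lx , Split.walk₁ arc)
      full′ : ∀ {r s} → r ∈ x ∷ lx ∷ L → s ∈ x ∷ lx ∷ L → r ~ s → On x (X ++ e ∷ Y) y r s
      full′ i j a = subst (λ l → On x l y _ _) eq (full i j a)
      uniqX : Uniq (X ++ e ∷ Y)
      uniqX = subst Uniq eq uniq-lxL
      XY : ∀ {v} → v ∈ X ++ e ∷ [] → v ∉ Y
      XY {v} i j = <⇒≱ two (uniqX v)
        where
        abstract
          ass : ∀ a b c → a + (b + 0) + c ≡ a + (b + c)
          ass = solve-∀
        two : 2 ≤ wsum (δ v) (X ++ e ∷ Y)
        two with +-mono-≤ (∈⇒1≤ i) (∈⇒1≤ j)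
        ... | h rewrite wsum-++ (δ v) X (e ∷ Y) | wsum-++ (δ v) X (e ∷ []) = ≤-trans h (≤-reflexive (ass (wsum (δ v) X) (δ v e) (wsum (δ v) Y)))
      R⊆ : ∀ {v} → v ∈ X ++ e ∷ [] → v ∈ lx ∷ L
      R⊆ i with ∈-++⁻ X i
      ... | inj₁ j = subst (_ ∈_) (sym eq) (∈-++⁺ˡ j)
      ... | inj₂ (here refl) = subst (_ ∈_) (sym eq) (∈-++⁺ʳ X (here refl))
      un : Uniq (X ++ e ∷ [])
      un v = ≤-trans (≤-reflexive (wsum-++ (δ v) X (e ∷ []))) (≤-trans (+-monoʳ-≤ (wsum (δ v) X) (+-monoʳ-≤ (δ v e) z≤n))
               (≤-trans (≤-reflexive (sym (wsum-++ (δ v) X (e ∷ Y)))) (uniqX v)))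
      up′ : ∀ {v} → v ∈ x ∷ X ++ e ∷ [] → v ∈ x ∷ lx ∷ L
      up′ (here p) = here p
      up′ (there i) = there (R⊆ i)
      data Kept (v : V) : Set where
        kept : v ≢ y → v ∉ Y → Kept v
      R∩ : ∀ {v} → v ∈ x ∷ X ++ e ∷ [] → Kept v
      R∩ (here refl) = kept (λ { refl → x∉ (In-y sp) }) (λ j → x∉ (In-ys sp (on-ys (subst (x ∈_) (sym eq) (∈-++⁺ʳ X (there j))))))
      R∩ (there i) = kept (λ { refl → closed∩ys sp (on-ys (R⊆ i)) (here refl) }) (XY i)
      only-e : ∀ {v} → Kept v → v ∈ e ∷ y ∷ Y → v ≡ e
      only-e k (here p) = p
      only-e (kept ≢y _) (there (here p)) = ⊥-elim (≢y p)
      only-e (kept _ ∉Y) (there (there i)) = ⊥-elim (∉Y i)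
      cut : ∀ {r s} → On x (X ++ e ∷ Y) y r s → Kept r → Kept s → r ~ s → On x (X ++ e ∷ []) q r s
      cut o kr ks a with On-++⁻ X Y o
      ... | inj₁ o′ = On-++⁺ˡ X [] o′
      ... | inj₂ o′ with only-e kr (On-∈ Y o′) | only-e ks (On-∈ʳ Y o′)
      ...   | refl | refl = ⊥-elim (~-irr a)
      attP : ∀ {r s} → r ∈ X ++ e ∷ [] → s ∈ P → r ~ s → On x (X ++ e ∷ []) q r s
      attP i s∈ a with att (R⊆ i) s∈ a
      ... | refl with ∈-++⁻ X i
      ...   | inj₁ j = ⊥-elim (X0 j (~-sym a))
      ...   | inj₂ (here refl) = On-++⁺ʳ X [] (inj₁ (refl , refl))
      atty : ∀ {r} → r ∈ X ++ e ∷ [] → r ~ y → On x (X ++ e ∷ []) q r y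
      atty {r} i a with On-++⁻ X Y (subst (λ l → On x l y r y) eq (inj₂ (arc-on (up (R⊆ i)) (there (here refl)) a)))
      ... | inj₁ o = ⊥-elim (y∉ (On-∈ʳ X o))
        where
        y∉ : y ∉ x ∷ e ∷ X
        y∉ (here refl) = x∉ (In-y sp)
        y∉ (there (here refl)) = closed∩ys sp (on-ys (R⊆ (∈-++⁺ʳ X (here refl)))) (here refl)
        y∉ (there (there j)) = closed∩ys sp (on-ys (R⊆ (∈-++⁺ˡ j))) (here refl)
      ... | inj₂ o with only-e (R∩ (there i)) (On-∈ Y o)
      ...   | refl = ⊥-elim (tf q~e a q~y)

    c2-contradiction : x ≁ y ⊎ (∃ λ e → e ∈ lx ∷ L × q ~ e) → ⊥
    c2-contradiction (inj₂ (e , e∈ , q~e)) = attached e∈ q~e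
    c2-contradiction (inj₁ x≁y) with find-first (q ~?_) (lx ∷ L)
    ... | inj₁ (first X e Y eq q~e _) = attached {e} (subst (e ∈_) (sym eq) (∈-++⁺ʳ X (here refl))) q~e
    ... | inj₂ none = core (lx ∷ L) (In-y hole) (λ { _ xs refl → x≁y xs }) (x~lx , Split.walk₁ arc) uniq-lxL (λ i → i) full
            (λ i s∈ a → ⊥-elim (none i (~-sym (subst (_ ~_) (att i s∈ a) a))))
            (λ i a → inj₂ (arc-on (up i) (there (here refl)) a))

  Uniq-cl : ∀ {W : Weight} {y m z ys} → Split W y m z ys → Uniq (y ∷ m ++ z ∷ [])
  Uniq-cl {y = y} {m} {z} s v = ≤-trans (≤-reflexive eq) (uniq-closed s v)
    where
    abstract
      l : ∀ y m z → y + (m + (z + 0)) ≡ y + (z + m)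
      l = solve-∀
    eq : wsum (δ v) (y ∷ m ++ z ∷ []) ≡ wsum (δ v) (y ∷ z ∷ m)
    eq rewrite wsum-++ (δ v) m (z ∷ []) = l (δ v y) (wsum (δ v) m) (δ v z)

  cl-∈ : ∀ {y z : V} {m v} → v ∈ y ∷ z ∷ m → v ∈ y ∷ m ++ z ∷ []
  cl-∈ (here e) = here e
  cl-∈ {m = m} (there (here e)) = there (∈-++⁺ʳ m (here e))
  cl-∈ (there (there i)) = there (∈-++⁺ˡ i)

  ∈-cl : ∀ {y z : V} m {v} → v ∈ y ∷ m ++ z ∷ [] → v ∈ y ∷ z ∷ m
  ∈-cl m (here e) = here e
  ∈-cl m (there i) with ∈-++⁻ m i
  ... | inj₁ j = there (there j)
  ... | inj₂ (here e) = there (here e)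

  cl-far : ∀ {W : Weight} {y m z ys} → Split W y m z ys → y ≁ z → ∀ A {c} B → y ∷ m ++ z ∷ [] ≡ A ++ c ∷ B →
           ∀ {u v} → u ∈ A → v ∈ B → u ≁ v
  cl-far {y = y} {m} {z} s y≁z A {c} B eq {u} {v} i j e =
    Cons-far A c B (subst Uniq eq (Uniq-cl s)) (subst (λ l → Cons l u v) eq (On⇒Cons m (arc-ind s y≁z (back (∈-++⁺ˡ i)) (back (∈-++⁺ʳ A (there j))) e))) i j
    where
    back : ∀ {w} → w ∈ A ++ c ∷ B → w ∈ y ∷ z ∷ m
    back k = ∈-cl m (subst (_ ∈_) (sym eq) k)

  In? : ∀ (W : Weight) v → Dec (In W v)
  In? W v with 1 ≤? W (δ v)
  ... | yes p = yes (in! p)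
  ... | no np = no λ i → np (In.pos i)

  -- xa and xb are the first and the last neighbour of x on the path y m z.
  record Ends (x y : V) (m : List V) (z : V) : Set where
    constructor ends
    field
      A     : List V
      xa    : V
      M     : List V
      xb    : V
      B     : List V
      eq    : y ∷ m ++ z ∷ [] ≡ A ++ xa ∷ M ++ xb ∷ B
      x~a   : x ~ xa
      x~b   : x ~ xb
      A0    : cnt x A ≡ 0
      B0    : cnt x B ≡ 0

  find-ends : ∀ x y m z → 2 ≤ cnt x (y ∷ z ∷ m) → Ends x y m z
  find-ends x y m z h with first-nb x (y ∷ m ++ z ∷ []) (≤-trans (s≤s z≤n) (≤-trans h (≤-reflexive (sym same′))))
    where
    abstract
      l : ∀ y m z → y + (m + (z + 0)) ≡ y + (z + m)
      l = solve-∀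
    same′ : cnt x (y ∷ m ++ z ∷ []) ≡ cnt x (y ∷ z ∷ m)
    same′ rewrite wsum-++ (nb x) m (z ∷ []) = l (nb x y) (cnt x m) (nb x z)
  ... | first A xa R eq xxa A0 with last-nb x R R≥1
    where
    abstract
      l : ∀ y m z → y + (m + (z + 0)) ≡ y + (z + m)
      l = solve-∀
    same′ : cnt x (y ∷ m ++ z ∷ []) ≡ cnt x (y ∷ z ∷ m)
    same′ rewrite wsum-++ (nb x) m (z ∷ []) = l (nb x y) (cnt x m) (nb x z)
    R≥1 : 1 ≤ cnt x R
    R≥1 with trans (cong (cnt x) eq) (wsum-++ (nb x) A (xa ∷ R))
    ... | e rewrite ≁⇒cnt≡0 A A0 | nb-yes {x} xxa = ≤-pred (≤-trans h (≤-reflexive (trans (sym same′) e)))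
  ...   | last M xb B refl xxb B0 = ends A xa M xb B eq xxa xxb (≁⇒cnt≡0 A A0) (≁⇒cnt≡0 B B0)

  module _ {W : Weight} {x y : V} {m : List V} {z : V} {ys P : List V} (x∉ : ¬ In W x) (proper : Proper W x)
    (d : Detour W x y m z ys P) (en : Ends x y m z)
    (bound : ∀ {w} → ¬ In ⟨ y , m , z , P ⟩ w → x ≁ w → w ≢ x →
             cnt w (Ends.xa en ∷ Ends.A en) + (cnt w (Ends.xb en ∷ Ends.B en) + cnt w P) ≤ 3) where

    open Detour d
    open Ends en

    private
      W′ = ⟨ y , m , z , P ⟩
      T : V → Set
      T v = v ∈ A ⊎ v ∈ B ⊎ v ∈ P

      l-split : ∀ {v} → v ∈ y ∷ z ∷ m → v ∈ A ++ xa ∷ M ++ xb ∷ B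
      l-split i = subst (_ ∈_) eq (cl-∈ i)

      eq₂ : y ∷ m ++ z ∷ [] ≡ (A ++ xa ∷ M) ++ xb ∷ B
      eq₂ = trans eq (sym (++-assoc A (xa ∷ M) (xb ∷ B)))

      y-pos : y ∈ A ⊎ y ≡ xa
      y-pos = head-pos A eq

      z-pos : z ∈ B ⊎ z ≡ xb
      z-pos = last-pos (y ∷ m) (A ++ xa ∷ M) eq₂

      In-cases : ∀ {v} → In W′ v → v ∈ P ⊎ v ∈ A ++ xa ∷ M ++ xb ∷ B
      In-cases i with In⇒∈ y m z P i
      ... | inj₁ j = inj₁ j
      ... | inj₂ j = inj₂ (l-split j)

      closure : ∀ {u v} → T u → In W′ v → u ~ v → T v ⊎ v ≡ xa ⊎ v ≡ xb
      closure (inj₂ (inj₂ u∈)) v∈ e with In⇒∈ y m z P v∈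
      ... | inj₁ j = inj₁ (inj₂ (inj₂ j))
      ... | inj₂ j with On-∈ʳ P (ind u∈ (inj₂ j) e)
      ...   | there (there k) = inj₁ (inj₂ (inj₂ k))
      ...   | here refl with z-pos
      ...     | inj₁ k = inj₁ (inj₂ (inj₁ k))
      ...     | inj₂ k = inj₂ (inj₂ k)
      closure (inj₂ (inj₂ u∈)) v∈ e | inj₂ j | there (here refl) with y-pos
      ...     | inj₁ k = inj₁ (inj₁ k)
      ...     | inj₂ k = inj₂ (inj₁ k)
      closure (inj₁ u∈) v∈ e with In-cases v∈
      ... | inj₁ j = inj₁ (inj₂ (inj₂ j))
      ... | inj₂ j with ∈-++⁻ A j
      ...   | inj₁ k = inj₁ (inj₁ k)
      ...   | inj₂ (here k) = inj₂ (inj₁ k)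
      ...   | inj₂ (there k) = ⊥-elim (cl-far sp y≁z A (M ++ xb ∷ B) eq u∈ k e)
      closure (inj₂ (inj₁ u∈)) v∈ e with In-cases v∈
      ... | inj₁ j = inj₁ (inj₂ (inj₂ j))
      ... | inj₂ j with ∈-++⁻ (A ++ xa ∷ M) (subst (_ ∈_) (sym (++-assoc A (xa ∷ M) (xb ∷ B))) j)
      ...   | inj₁ k = ⊥-elim (cl-far sp y≁z (A ++ xa ∷ M) B eq₂ k u∈ (~-sym e))
      ...   | inj₂ (here k) = inj₂ (inj₂ k)
      ...   | inj₂ (there k) = inj₁ (inj₂ (inj₁ k))

      T-free : ∀ {v} → T v → x ≁ v
      T-free (inj₁ i) = cnt≡0⇒≁ A A0 i
      T-free (inj₂ (inj₁ i)) = cnt≡0⇒≁ B B0 i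
      T-free (inj₂ (inj₂ i)) = x≁ i

      stay : ∀ {u v} → T u → In W′ v → x ≁ v → u ~ v → T v
      stay t v∈ x≁v e with closure t v∈ e
      ... | inj₁ t′ = t′
      ... | inj₂ (inj₁ refl) = ⊥-elim (x≁v x~a)
      ... | inj₂ (inj₂ refl) = ⊥-elim (x≁v x~b)

      exit : ∀ {u v} → T u → In W′ v → x ~ v → u ~ v → v ≡ xa ⊎ v ≡ xb
      exit t v∈ x~v e with closure t v∈ e
      ... | inj₁ t′ = ⊥-elim (T-free t′ x~v)
      ... | inj₂ r = r

      follow : ∀ {u} xs {v} → Walk u xs v → T u → (∀ {w} → w ∈ xs → In W′ w × x ≁ w) → In W′ v → x ≁ v → T v
      follow [] e t h v∈ x≁v = stay t v∈ x≁v e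
      follow (w ∷ xs) (e , wk) t h v∈ x≁v =
        follow xs wk (stay t (proj₁ (h (here refl))) (proj₂ (h (here refl))) e) (λ i → h (there i)) v∈ x≁v

      T-list : List V
      T-list = (xa ∷ A) ++ (xb ∷ B) ++ P

      T⇒∈ : ∀ {v} → T v → v ∈ T-list
      T⇒∈ (inj₁ i) = there (∈-++⁺ˡ i)
      T⇒∈ (inj₂ (inj₁ i)) = ∈-++⁺ʳ (xa ∷ A) (there (∈-++⁺ˡ i))
      T⇒∈ (inj₂ (inj₂ i)) = ∈-++⁺ʳ (xa ∷ A) (∈-++⁺ʳ (xb ∷ B) i)

      ends⇒∈ : ∀ {v} → v ≡ xa ⊎ v ≡ xb → v ∈ T-list
      ends⇒∈ (inj₁ e) = here e
      ends⇒∈ (inj₂ e) = ∈-++⁺ʳ (xa ∷ A) (here e)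

    -- A sector that avoids `P` lies on the old rim. The only other one runs from `xa` through `A`,
    -- `P` and `B` to `xb`; the assumed bound of three suffices for it, because exactly three
    -- neighbours are excluded by `sector-≢3`.
    smaller-proper : Proper W′ x
    smaller-proper {a} s {b} in-W wk un xa′ xb′ s0 {p} p∉ x≁p p≢x with find-first (_∈? P) s
    ... | inj₂ none with In? W p
    ...   | no p∉W = proper s in-old wk un xa′ xb′ s0 p∉W x≁p p≢x
      where
      in-old : ∀ {v} → v ∈ a ∷ b ∷ s → In W v
      in-old {v} i with In⇒∈ y m z P (in-W i)
      ... | inj₂ j = closed-In sp j
      in-old (here refl) | inj₁ j = ⊥-elim (x≁ j xa′)
      in-old (there (here refl)) | inj₁ j = ⊥-elim (x≁ j xb′)
      in-old (there (there i)) | inj₁ j = ⊥-elim (none i j)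
    -- A vertex of the removed arc sees at most `y` and `z` on the kept one.
    ...   | yes p∈W = ≤-trans (wsum-⊆ (nb p) (a ∷ b ∷ s) (y ∷ z ∷ m) un in-cl) few
      where
      in-cl : ∀ {v} → v ∈ a ∷ b ∷ s → v ∈ y ∷ z ∷ m
      in-cl {v} i with In⇒∈ y m z P (in-W i)
      ... | inj₂ j = j
      in-cl (here refl) | inj₁ j = ⊥-elim (x≁ j xa′)
      in-cl (there (here refl)) | inj₁ j = ⊥-elim (x≁ j xb′)
      in-cl (there (there i)) | inj₁ j = ⊥-elim (none i j)
      p∈ys : p ∈ ys
      p∈ys with Split.In⇒at sp p∈W
      ... | _ , at0 (here refl) = ⊥-elim (p∉ (In-y hole))
      ... | _ , atS (at0 i) = ⊥-elim (p∉ (In-m hole i))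
      ... | _ , atS (atS (at0 (here refl))) = ⊥-elim (p∉ (In-z hole))
      ... | _ , atS (atS (atS (at0 i))) = i
      few : cnt p (y ∷ z ∷ m) ≤ 2
      few rewrite ≁⇒cnt≡0 {p} m (λ i e → Split.far sp i p∈ys (~-sym e)) | +-identityʳ (nb p z) = +-mono-≤ (nb≤1 p y) (nb≤1 p z)
    smaller-proper {a} s {b} in-W wk un xa′ xb′ s0 {p} p∉ x≁p p≢x | inj₁ (first S₁ r S₂ eqs r∈P _) =
      at-most (≤-trans (wsum-⊆ (nb p) (a ∷ b ∷ s) T-list un in-T) (≤-trans (≤-reflexive sums) (bound p∉ x≁p p≢x)))
      where
      r∈ : r ∈ s
      r∈ = subst (r ∈_) (sym eqs) (∈-++⁺ʳ S₁ (here refl))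
      s-ok : ∀ {v} → v ∈ s → In W′ v × x ≁ v
      s-ok i = in-W (there (there i)) , cnt≡0⇒≁ s s0 i
      s⊆T : ∀ {v} → v ∈ s → T v
      s⊆T {v} i with v ≟ r
      ... | yes refl = inj₂ (inj₂ r∈P)
      ... | no v≢r with between s wk r∈ i (λ e → v≢r (sym e))
      ...   | inj₁ (sub zs wk′ _ ⊆) = follow zs wk′ (inj₂ (inj₂ r∈P)) (λ j → s-ok (⊆ j)) (proj₁ (s-ok i)) (proj₂ (s-ok i))
      ...   | inj₂ (sub zs wk′ _ ⊆) = follow (reverse zs) (Walk-reverse zs wk′) (inj₂ (inj₂ r∈P)) (λ j → s-ok (⊆ (reverse⁻ j))) (proj₁ (s-ok i)) (proj₂ (s-ok i))
      first-of : ∀ {u} l {w} → Walk u l w → r ∈ l → ∃ λ v → v ∈ l × u ~ v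
      first-of (v ∷ l) (e , _) _ = v , here refl , e
      in-T : ∀ {v} → v ∈ a ∷ b ∷ s → v ∈ T-list
      in-T (here refl) with first-of s wk r∈
      ... | v , v∈ , e = ends⇒∈ (exit (s⊆T v∈) (in-W (here refl)) xa′ (~-sym e))
      in-T (there (here refl)) with first-of (reverse s) (Walk-reverse s wk) (reverse⁺ r∈)
      ... | v , v∈ , e = ends⇒∈ (exit (s⊆T (reverse⁻ v∈)) (in-W (there (here refl))) xb′ (~-sym e))
      in-T (there (there i)) = T⇒∈ (s⊆T i)
      sums : cnt p T-list ≡ cnt p (xa ∷ A) + (cnt p (xb ∷ B) + cnt p P)
      sums = trans (wsum-++ (nb p) (xa ∷ A) ((xb ∷ B) ++ P)) (cong (cnt p (xa ∷ A) +_) (wsum-++ (nb p) (xb ∷ B) P))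
      at-most : cnt p (a ∷ b ∷ s) ≤ 3 → cnt p (a ∷ b ∷ s) ≤ 2
      at-most h with m≤n⇒m<n∨m≡n h
      ... | inj₁ lt = ≤-pred lt
      ... | inj₂ e with arc-unique hole s in-W wk un (common≁ xa′ xb′)
      ...   | N , sp′ = ⊥-elim (sector-≢3 sp′ (hub-out x∉) xa′ xb′ s0 p∉ x≁p p≢x e)

  -- The hole in cyclic order is s m₂ z L′ fx N₁ c N₂ lx L y m₁; the hub x sees s, the first spoke fx after z and the
  -- last spoke lx before y, while p sees y and z.
  module OneSpokeArc {W : Weight} {x p : V} (x∉ : ¬ In W x) (p∉ : ¬ In W p) (x≁p : x ≁ p) (p≢x : p ≢ x)
    {s : V} (m₂ : List V) {z : V} (L′ : List V) {fx : V} (N₁ : List V) {c : V} (N₂ : List V) {lx : V} (L : List V) {y : V} (m₁ : List V)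
    (S₀ : Split W s (m₂ ++ z ∷ L′ ++ fx ∷ N₁) c (N₂ ++ lx ∷ L ++ y ∷ m₁))
    (x~s : x ~ s) (x~fx : x ~ fx) (x~lx : x ~ lx) (x≁y : x ≁ y) (x≁z : x ≁ z)
    (x≁m₁ : cnt x m₁ ≡ 0) (x≁m₂ : cnt x m₂ ≡ 0) (x≁L : cnt x L ≡ 0) (x≁L′ : cnt x L′ ≡ 0)
    (p~y : p ~ y) (p~z : p ~ z) (p≁s : p ≁ s) (p≁m₁ : cnt p m₁ ≡ 0) (p≁m₂ : cnt p m₂ ≡ 0)
    (p≁fx : p ≁ fx) (p≁L′ : cnt p L′ ≡ 0) where

    private
      A B F : List V
      A = m₂ ++ z ∷ L′ ++ fx ∷ N₁
      B = N₂ ++ lx ∷ L ++ y ∷ m₁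
      F = lx ∷ L ++ y ∷ []

      S₁ : Split W z (L′ ++ fx ∷ N₁) c (B ++ s ∷ m₂)
      S₁ = moveL m₂ (L′ ++ fx ∷ N₁) S₀
      Sq : Split W z L′ fx (N₁ ++ c ∷ B ++ s ∷ m₂)
      Sq = moveR L′ N₁ S₁
      Sz : Split W s m₂ z ((L′ ++ fx ∷ N₁) ++ c ∷ B)
      Sz = moveR m₂ (L′ ++ fx ∷ N₁) S₀
      S₃ : Split W lx (L ++ y ∷ m₁) s (A ++ c ∷ N₂)
      S₃ = moveL N₂ (L ++ y ∷ m₁) (swap S₀)
      S₄ : Split W y m₁ s ((A ++ c ∷ N₂) ++ lx ∷ L)
      S₄ = moveL L m₁ S₃
      S₅ : Split W lx L y (m₁ ++ s ∷ A ++ c ∷ N₂)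
      S₅ = moveR L m₁ S₃

      nonempty-ind : ∀ {a M b} N {v N′} → Split W a M b (N ++ v ∷ N′) → ∀ {r q} → r ∈ a ∷ b ∷ M → q ∈ a ∷ b ∷ M → r ~ q → On a M b r q
      nonempty-ind []      sp = arc-ind′ sp
      nonempty-ind (_ ∷ _) sp = arc-ind′ sp

      on-y-s : ∀ {r q} → r ∈ y ∷ s ∷ m₁ → q ∈ y ∷ s ∷ m₁ → r ~ q → On y m₁ s r q
      on-y-s = nonempty-ind (A ++ c ∷ N₂) S₄
      on-s-z : ∀ {r q} → r ∈ s ∷ z ∷ m₂ → q ∈ s ∷ z ∷ m₂ → r ~ q → On s m₂ z r q
      on-s-z = nonempty-ind (L′ ++ fx ∷ N₁) Sz
      on-lx-y : ∀ {r q} → r ∈ lx ∷ y ∷ L → q ∈ lx ∷ y ∷ L → r ~ q → On lx L y r q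
      on-lx-y = nonempty-ind m₁ S₅
      on-z-fx : ∀ {r q} → r ∈ z ∷ fx ∷ L′ → q ∈ z ∷ fx ∷ L′ → r ~ q → On z L′ fx r q
      on-z-fx = nonempty-ind N₁ Sq

      zL′fx⊆A : ∀ {v} → v ∈ z ∷ fx ∷ L′ → v ∈ A
      zL′fx⊆A (here e) = ∈-++⁺ʳ m₂ (here e)
      zL′fx⊆A (there (here e)) = ∈-++⁺ʳ m₂ (there (∈-++⁺ʳ L′ (here e)))
      zL′fx⊆A (there (there i)) = ∈-++⁺ʳ m₂ (there (∈-++⁺ˡ i))
      m₂⊆A : ∀ {v} → v ∈ m₂ → v ∈ A
      m₂⊆A = ∈-++⁺ˡ
      F⊆B : ∀ {v} → v ∈ F → v ∈ B
      F⊆B (here e) = ∈-++⁺ʳ N₂ (here e)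
      F⊆B (there i) with ∈-++⁻ L i
      ... | inj₁ j = ∈-++⁺ʳ N₂ (there (∈-++⁺ˡ j))
      ... | inj₂ (here e) = ∈-++⁺ʳ N₂ (there (∈-++⁺ʳ L (here e)))
      m₁⊆B : ∀ {v} → v ∈ m₁ → v ∈ B
      m₁⊆B i = ∈-++⁺ʳ N₂ (there (∈-++⁺ʳ L (there i)))
      y∈B : y ∈ B
      y∈B = F⊆B (there (∈-++⁺ʳ L (here refl)))

      A≁B : ∀ {u v} → u ∈ A → v ∈ B → u ≁ v
      A≁B = Split.far S₀
      A∩B : ∀ {u} → u ∈ A → u ∈ B → ⊥
      A∩B i j = closed∩ys S₀ j (there (there i))
      s∉A : s ∉ A
      s∉A i = apart (Split.ap S₀) (λ ()) (Split.at-y S₀) (Split.in-m S₀ i)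
      s∉B : s ∉ B
      s∉B i = closed∩ys S₀ i (here refl)
      In-A : ∀ {v} → v ∈ A → In W v
      In-A = In-m S₀
      In-B : ∀ {v} → v ∈ B → In W v
      In-B = In-ys S₀

      F-split : ∀ {v} → v ∈ F → v ∈ lx ∷ y ∷ L
      F-split (here e) = here e
      F-split (there i) with ∈-++⁻ L i
      ... | inj₁ j = there (there j)
      ... | inj₂ (here e) = there (here e)

      x-F : ∀ {v} → v ∈ F → x ~ v → v ≡ lx
      x-F i e with F-split i
      ... | here q = q
      ... | there (here refl) = ⊥-elim (x≁y e)
      ... | there (there j) = ⊥-elim (cnt≡0⇒≁ L x≁L j e)

    -- With `e` the first neighbour of `p` on the way from `lx` to `y`, the path from `fx` through
    -- `x`, `lx` and `e` to `p` and `z` closes with `L′` to a hole.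
    module Route (X : List V) {e : V} (Z : List V) (eqF : F ≡ X ++ e ∷ Z) (p~e : p ~ e) (X0 : ∀ {u} → u ∈ X → p ≁ u) where

      Q : List V
      Q = x ∷ X ++ e ∷ p ∷ []

      E⊆F : ∀ {v} → v ∈ X ++ e ∷ [] → v ∈ F
      E⊆F i with ∈-++⁻ X i
      ... | inj₁ j = subst (_ ∈_) (sym eqF) (∈-++⁺ˡ j)
      ... | inj₂ (here refl) = subst (_ ∈_) (sym eqF) (∈-++⁺ʳ X (here refl))

      uniqF : Uniq F
      uniqF = Uniq-cl S₅

      E∩Z : ∀ {v} → v ∈ X ++ e ∷ [] → v ∉ Z
      E∩Z {v} i j = <⇒≱ two (subst Uniq eqF uniqF v)
        where
        abstract
          ass : ∀ a b c → a + (b + 0) + c ≡ a + (b + c)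
          ass = solve-∀
        two : 2 ≤ wsum (δ v) (X ++ e ∷ Z)
        two with +-mono-≤ (∈⇒1≤ i) (∈⇒1≤ j)
        ... | h rewrite wsum-++ (δ v) X (e ∷ Z) | wsum-++ (δ v) X (e ∷ []) = ≤-trans h (≤-reflexive (ass (wsum (δ v) X) (δ v e) (wsum (δ v) Z)))

      data Part (v : V) : Set where
        is-x : v ≡ x → Part v
        in-E : v ∈ X ++ e ∷ [] → Part v
        is-p : v ≡ p → Part v

      part : ∀ {v} → v ∈ Q → Part v
      part (here q) = is-x q
      part (there i) with ∈-++⁻ X i
      ... | inj₁ j = in-E (∈-++⁺ˡ j)
      ... | inj₂ (here q) = in-E (∈-++⁺ʳ X (here q))
      ... | inj₂ (there (here q)) = is-p q

      walkF : Walk x (X ++ e ∷ Z) p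
      walkF = subst (λ l → Walk x l p) eqF (x~lx , Walk-++ L [] (Split.walk₁ S₅) (~-sym p~y))

      cut : ∀ {r q} → On x F p r q → r ∈ x ∷ X ++ e ∷ [] → q ∈ x ∷ X ++ e ∷ [] → r ~ q → On x X e r q
      cut {r} {q} o i j a with On-++⁻ X Z (subst (λ l → On x l p r q) eqF o)
      ... | inj₁ o′ = o′
      ... | inj₂ o′ with just-e i (On-∈ Z o′) | just-e j (On-∈ʳ Z o′)
        where
        just-e : ∀ {v} → v ∈ x ∷ X ++ e ∷ [] → v ∈ e ∷ p ∷ Z → v ≡ e
        just-e _ (here r) = r
        just-e (here refl) (there (here r)) = ⊥-elim (p≢x (sym r))
        just-e (there i) (there (here refl)) = ⊥-elim (p∉ (In-B (F⊆B (E⊆F i))))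
        just-e (here refl) (there (there k)) = ⊥-elim (x∉ (In-B (F⊆B (subst (x ∈_) (sym eqF) (∈-++⁺ʳ X (there k))))))
        just-e (there i) (there (there k)) = ⊥-elim (E∩Z i k)
      ...   | refl | refl = ⊥-elim (~-irr a)

      E-only : ∀ {v} → v ∈ X ++ e ∷ [] → p ~ v → v ≡ e
      E-only i a with ∈-++⁻ X i
      ... | inj₁ j = ⊥-elim (X0 j a)
      ... | inj₂ (here q) = q

      on-xE : ∀ {r q} → On x X e r q → On fx Q z r q
      on-xE o = inj₂ (On-++⁺ˡ X (p ∷ []) o)
      on-ep : On fx Q z e p
      on-ep = inj₂ (On-++⁺ʳ X (p ∷ []) (inj₁ (inj₁ (refl , refl))))
      on-pz : On fx Q z p z
      on-pz = inj₂ (On-++⁺ʳ X (p ∷ []) (inj₂ (inj₁ (refl , refl))))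

      first-on : ∀ {v} → v ∈ X ++ e ∷ [] → x ~ v → On x X e x v
      first-on i a with x-F (E⊆F i) a
      ... | refl = cut (inj₁ (inj₁ (refl , refl))) (here refl) (there i) a

      indQ : ∀ {r q} → r ∈ Q → q ∈ Q ⊎ q ∈ z ∷ fx ∷ L′ → r ~ q → On fx Q z r q
      indQ i (inj₁ j) a with part i | part j
      ... | is-x refl | is-x refl = ⊥-elim (~-irr a)
      ... | is-x refl | in-E k = on-xE (first-on k a)
      ... | is-x refl | is-p refl = ⊥-elim (x≁p a)
      ... | in-E k | is-x refl = On-sym Q (on-xE (first-on k (~-sym a)))
      ... | in-E k | in-E l = on-xE (cut (inj₂ (On-++⁺ˡ L [] (on-lx-y (F-split (E⊆F k)) (F-split (E⊆F l)) a))) (there k) (there l) a)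
      ... | in-E k | is-p refl with E-only k (~-sym a)
      ...   | refl = on-ep
      indQ i (inj₁ j) a | is-p refl | is-x refl = ⊥-elim (x≁p (~-sym a))
      indQ i (inj₁ j) a | is-p refl | is-p refl = ⊥-elim (~-irr a)
      indQ i (inj₁ j) a | is-p refl | in-E k with E-only k a
      ...   | refl = On-sym Q on-ep
      indQ i (inj₂ j) a with part i
      ... | in-E k = ⊥-elim (A≁B (zL′fx⊆A j) (F⊆B (E⊆F k)) (~-sym a))
      indQ i (inj₂ (here refl)) a | is-x refl = ⊥-elim (x≁z a)
      indQ i (inj₂ (there (here refl))) a | is-x refl = inj₁ (inj₂ (refl , refl))
      indQ i (inj₂ (there (there k))) a | is-x refl = ⊥-elim (cnt≡0⇒≁ L′ x≁L′ k a)
      indQ i (inj₂ (here refl)) a | is-p refl = on-pz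
      indQ i (inj₂ (there (here refl))) a | is-p refl = ⊥-elim (p≁fx a)
      indQ i (inj₂ (there (there k))) a | is-p refl = ⊥-elim (cnt≡0⇒≁ L′ p≁L′ k a)

      uniqQ : Uniq Q
      uniqQ = Uniq-∷ x (X ++ e ∷ p ∷ []) x∉Q un′
        where
        x∉Q : x ∉ X ++ e ∷ p ∷ []
        x∉Q i with ∈-++⁻ X i
        ... | inj₁ j = x∉ (In-B (F⊆B (E⊆F (∈-++⁺ˡ j))))
        ... | inj₂ (here refl) = x∉ (In-B (F⊆B (E⊆F (∈-++⁺ʳ X (here refl)))))
        ... | inj₂ (there (here q)) = p≢x (sym q)
        abstract
          ass : ∀ a b c → a + (b + (c + 0)) ≡ c + (a + b)
          ass = solve-∀
        unpE : Uniq (p ∷ X ++ e ∷ [])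
        unpE = Uniq-∷ p (X ++ e ∷ []) (λ i → p∉ (In-B (F⊆B (E⊆F i)))) unE
          where
          unE : Uniq (X ++ e ∷ [])
          unE v = ≤-trans (≤-reflexive (wsum-++ (δ v) X (e ∷ []))) (≤-trans (+-monoʳ-≤ (wsum (δ v) X) (+-monoʳ-≤ (δ v e) z≤n))
               (≤-trans (≤-reflexive (sym (wsum-++ (δ v) X (e ∷ Z)))) (subst Uniq eqF uniqF v)))
        un′ : Uniq (X ++ e ∷ p ∷ [])
        un′ v = ≤-trans (≤-reflexive eq′) (unpE v)
          where
          eq′ : wsum (δ v) (X ++ e ∷ p ∷ []) ≡ wsum (δ v) (p ∷ X ++ e ∷ [])
          eq′ rewrite wsum-++ (δ v) X (e ∷ p ∷ []) | wsum-++ (δ v) X (e ∷ []) | +-identityʳ (δ v e) = ass (wsum (δ v) X) (δ v e) (δ v p)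

      outQ : ∀ {r} → r ∈ Q → r ∉ z ∷ fx ∷ L′
      outQ i j with part i
      ... | is-x refl = x∉ (In-A (zL′fx⊆A j))
      ... | in-E k = A∩B (zL′fx⊆A j) (F⊆B (E⊆F k))
      ... | is-p refl = p∉ (In-A (zL′fx⊆A j))

      H : Split ⟨ z , L′ , fx , Q ⟩ z L′ fx Q
      H = reroute Sq on-z-fx Q (~-sym x~fx , Walk-++ X (p ∷ []) (proj₁ (Walk-++⁻ X Z walkF)) (~-sym p~e , p~z)) uniqQ outQ indQ

      -- The ear leaves s along m₁ (and possibly y) to t, along m₂ to z, and directly to x.
      ear : ∀ R {t} → In ⟨ z , L′ , fx , Q ⟩ t → t ≢ x → t ≢ z → Walk s R t → Uniq R → (∀ {v} → v ∈ R → v ∈ m₁ ⊎ (v ≡ y × y ∉ X ++ e ∷ [])) →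
        (∀ {r q} → On y m₁ s r q → On s R t r q) → (∀ {r} → r ∈ R → r ~ p → On s R t r p) →
        (y ∈ R → ∀ {q} → q ∈ X ++ e ∷ [] → y ≁ q) → ⊥
      ear R {t} t∈ t≢x t≢z wk unR R⊆ conv toP toE =
        ear-any no-isk4 H t∈ (In-ys H (here refl)) (In-y H) t≢x t≢z (λ { refl → x∉ (In-y Sq) }) s R m₂ wk (~-sym x~s) (Split.walk₁ Sz) un out ind
        where
        R⊆B : ∀ {v} → v ∈ R → v ∈ B
        R⊆B i with R⊆ i
        ... | inj₁ j = m₁⊆B j
        ... | inj₂ (refl , _) = y∈B
        R⊆y : ∀ {v} → v ∈ R → v ∈ y ∷ s ∷ m₁
        R⊆y i with R⊆ i
        ... | inj₁ j = there (there j)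
        ... | inj₂ (q , _) = here q
        un₂ : Uniq m₂
        un₂ v = ≤-trans (m≤n+m _ (δ v z)) (≤-trans (m≤n+m _ (δ v s)) (uniq-closed Sz v))
        un : Uniq (s ∷ R ++ m₂)
        un = Uniq-∷ s (R ++ m₂) (λ i → [ (λ j → s∉B (R⊆B j)) , (λ j → s∉A (m₂⊆A j)) ]′ (∈-++⁻ R i)) both
          where
          both : Uniq (R ++ m₂)
          both v rewrite wsum-++ (δ v) R m₂ with v ∈? R
          ... | no nv rewrite n<1⇒n≡0 (≰⇒> (λ h → nv (1≤⇒∈ R h))) = un₂ v
          ... | yes iv rewrite n<1⇒n≡0 (≰⇒> (λ h → A∩B (m₂⊆A (1≤⇒∈ m₂ h)) (R⊆B iv))) | +-identityʳ (wsum (δ v) R) = unR v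
        data Piece (v : V) : Set where
          is-s  : v ≡ s → Piece v
          in-R  : v ∈ R → Piece v
          in-m₂ : v ∈ m₂ → Piece v
        piece : ∀ {v} → v ∈ s ∷ R ++ m₂ → Piece v
        piece (here q) = is-s q
        piece (there i) = [ in-R , in-m₂ ]′ (∈-++⁻ R i)
        data Spot (v : V) : Set where
          sp-x  : v ≡ x → Spot v
          sp-E  : v ∈ X ++ e ∷ [] → Spot v
          sp-p  : v ≡ p → Spot v
          sp-z  : v ≡ z → Spot v
          sp-fx : v ∈ fx ∷ L′ → Spot v
        spot : ∀ {v} → In ⟨ z , L′ , fx , Q ⟩ v → Spot v
        spot i with In⇒∈ z L′ fx Q i
        ... | inj₂ (here q) = sp-z q
        ... | inj₂ (there j) = sp-fx j
        ... | inj₁ j with part j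
        ...   | is-x q = sp-x q
        ...   | in-E k = sp-E k
        ...   | is-p q = sp-p q
        spot-out : ∀ {v} → Piece v → Spot v → ⊥
        spot-out (is-s refl) (sp-x refl) = ~-irr x~s
        spot-out (is-s refl) (sp-E k) = s∉B (F⊆B (E⊆F k))
        spot-out (is-s refl) (sp-p refl) = x≁p x~s
        spot-out (is-s refl) (sp-z refl) = s∉A (zL′fx⊆A (here refl))
        spot-out (is-s refl) (sp-fx k) = s∉A (zL′fx⊆A (there k))
        spot-out (in-R i) (sp-x refl) = x∉ (In-B (R⊆B i))
        spot-out (in-R i) (sp-E k) with R⊆ i
        ... | inj₂ (refl , y∉) = y∉ k
        ... | inj₁ j with F-split (E⊆F k)
        ...   | here refl = apart (Split.ap S₃) (λ ()) (Split.at-y S₃) (Split.in-m S₃ (∈-++⁺ʳ L (there j)))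
        ...   | there (here refl) = apart (Split.ap S₄) (λ ()) (Split.at-y S₄) (Split.in-m S₄ j)
        ...   | there (there l) = closed∩ys S₅ (∈-++⁺ˡ j) (there (there l))
        spot-out (in-R i) (sp-p refl) = p∉ (In-B (R⊆B i))
        spot-out (in-R i) (sp-z refl) = A∩B (zL′fx⊆A (here refl)) (R⊆B i)
        spot-out (in-R i) (sp-fx k) = A∩B (zL′fx⊆A (there k)) (R⊆B i)
        spot-out (in-m₂ i) (sp-x refl) = x∉ (In-A (m₂⊆A i))
        spot-out (in-m₂ i) (sp-E k) = A∩B (m₂⊆A i) (F⊆B (E⊆F k))
        spot-out (in-m₂ i) (sp-p refl) = p∉ (In-A (m₂⊆A i))
        spot-out (in-m₂ i) (sp-z refl) = apart (Split.ap Sz) (λ ()) (Split.in-m Sz i) (Split.at-z Sz)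
        spot-out (in-m₂ i) (sp-fx (here refl)) = closed∩ys Sz (∈-++⁺ˡ (∈-++⁺ʳ L′ (here refl))) (there (there i))
        spot-out (in-m₂ i) (sp-fx (there k)) = closed∩ys Sz (∈-++⁺ˡ (∈-++⁺ˡ k)) (there (there i))
        out : ∀ {v} → v ∈ s ∷ R ++ m₂ → ¬ In ⟨ z , L′ , fx , Q ⟩ v
        out i j = spot-out (piece i) (spot j)
        Goal : V → V → Set
        Goal r q = On s R t r q ⊎ Pair s x r q ⊎ On s m₂ z r q
        via-R : ∀ {r q} → r ∈ y ∷ s ∷ m₁ → q ∈ y ∷ s ∷ m₁ → r ~ q → Goal r q
        via-R i j a = inj₁ (conv (on-y-s i j a))
        via-m₂ : ∀ {r q} → r ∈ s ∷ z ∷ m₂ → q ∈ s ∷ z ∷ m₂ → r ~ q → Goal r q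
        via-m₂ i j a = inj₂ (inj₂ (on-s-z i j a))
        pp : ∀ {r q} → Piece r → Piece q → r ~ q → Goal r q
        pp (is-s refl) (is-s refl) a = ⊥-elim (~-irr a)
        pp (is-s refl) (in-R j) a = via-R (there (here refl)) (R⊆y j) a
        pp (is-s refl) (in-m₂ j) a = via-m₂ (here refl) (there (there j)) a
        pp (in-R i) (is-s refl) a = via-R (R⊆y i) (there (here refl)) a
        pp (in-R i) (in-R j) a = via-R (R⊆y i) (R⊆y j) a
        pp (in-R i) (in-m₂ j) a = ⊥-elim (A≁B (m₂⊆A j) (R⊆B i) (~-sym a))
        pp (in-m₂ i) (is-s refl) a = via-m₂ (there (there i)) (here refl) a
        pp (in-m₂ i) (in-R j) a = ⊥-elim (A≁B (m₂⊆A i) (R⊆B j) a)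
        pp (in-m₂ i) (in-m₂ j) a = via-m₂ (there (there i)) (there (there j)) a
        x-R : ∀ {r} → r ∈ R → x ≁ r
        x-R i with R⊆ i
        ... | inj₁ j = cnt≡0⇒≁ m₁ x≁m₁ j
        ... | inj₂ (refl , _) = x≁y
        R-E : ∀ {r q} → r ∈ R → q ∈ X ++ e ∷ [] → r ~ q → Goal r q
        R-E i k a with R⊆ i
        ... | inj₂ (refl , _) = ⊥-elim (toE i k a)
        ... | inj₁ j with F-split (E⊆F k)
        ...   | here refl = ⊥-elim (≁-left L m₁ S₃ j a)
        ...   | there (here refl) = via-R (there (there j)) (here refl) a
        ...   | there (there l) = ⊥-elim (≁-mid L m₁ S₃ l j (~-sym a))
        s-E : ∀ {q} → q ∈ X ++ e ∷ [] → s ~ q → Goal s q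
        s-E k a with F-split (E⊆F k)
        ... | here refl = ⊥-elim (common≁ x~s x~lx a)
        ... | there (here refl) = via-R (there (here refl)) (here refl) a
        ... | there (there l) = ⊥-elim (≁-right L m₁ S₃ l (~-sym a))
        ps : ∀ {r q} → Piece r → Spot q → r ~ q → Goal r q
        ps (is-s refl) (sp-x refl) a = inj₂ (inj₁ (inj₁ (refl , refl)))
        ps (is-s refl) (sp-E k) a = s-E k a
        ps (is-s refl) (sp-p refl) a = ⊥-elim (p≁s (~-sym a))
        ps (is-s refl) (sp-z refl) a = via-m₂ (here refl) (there (here refl)) a
        ps (is-s refl) (sp-fx (here refl)) a = ⊥-elim (common≁ x~s x~fx a)
        ps (is-s refl) (sp-fx (there k)) a = ⊥-elim (≁-left m₂ (L′ ++ fx ∷ N₁) S₀ (∈-++⁺ˡ k) (~-sym a))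
        ps (in-R i) (sp-x refl) a = ⊥-elim (x-R i (~-sym a))
        ps (in-R i) (sp-E k) a = R-E i k a
        ps (in-R i) (sp-p refl) a = inj₁ (toP i a)
        ps (in-R i) (sp-z refl) a = ⊥-elim (A≁B (zL′fx⊆A (here refl)) (R⊆B i) (~-sym a))
        ps (in-R i) (sp-fx k) a = ⊥-elim (A≁B (zL′fx⊆A (there k)) (R⊆B i) (~-sym a))
        ps (in-m₂ i) (sp-x refl) a = ⊥-elim (cnt≡0⇒≁ m₂ x≁m₂ i (~-sym a))
        ps (in-m₂ i) (sp-E k) a = ⊥-elim (A≁B (m₂⊆A i) (F⊆B (E⊆F k)) a)
        ps (in-m₂ i) (sp-p refl) a = ⊥-elim (cnt≡0⇒≁ m₂ p≁m₂ i (~-sym a))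
        ps (in-m₂ i) (sp-z refl) a = via-m₂ (there (there i)) (there (here refl)) a
        ps (in-m₂ i) (sp-fx (here refl)) a = ⊥-elim (≁-mid m₂ (L′ ++ fx ∷ N₁) S₀ i (∈-++⁺ʳ L′ (here refl)) a)
        ps (in-m₂ i) (sp-fx (there k)) a = ⊥-elim (≁-mid m₂ (L′ ++ fx ∷ N₁) S₀ i (∈-++⁺ˡ k) a)
        ind : ∀ {r q} → r ∈ s ∷ R ++ m₂ → q ∈ s ∷ R ++ m₂ ⊎ In ⟨ z , L′ , fx , Q ⟩ q → r ~ q → Goal r q
        ind i (inj₁ j) a = pp (piece i) (piece j) a
        ind i (inj₂ j) a = ps (piece i) (spot j) a

      unm₁ : Uniq (reverse m₁)
      unm₁ v = ≤-trans (≤-reflexive (wsum-reverse (δ v) m₁)) (≤-trans (m≤n+m _ (δ v s)) (≤-trans (m≤n+m _ (δ v y)) (uniq-closed S₄ v)))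

      e≢x : e ≢ x
      e≢x refl = x≁p (~-sym p~e)

      E∈H : ∀ {v} → v ∈ X ++ e ∷ [] → In ⟨ z , L′ , fx , Q ⟩ v
      E∈H i with ∈-++⁻ X i
      ... | inj₁ j = In-ys H (there (∈-++⁺ˡ j))
      ... | inj₂ (here q) = In-ys H (there (∈-++⁺ʳ X (here q)))

      -- Now `e` is `y`, which is on the hole, and the leg along `m₁` ends there.
      at-y : Z ≡ [] → ⊥
      at-y refl with last-pos (lx ∷ L) X eqF
      ... | inj₂ refl = ear (reverse m₁) (E∈H (∈-++⁺ʳ X (here refl))) e≢x (λ { refl → A∩B (zL′fx⊆A (here refl)) y∈B })
              (Walk-reverse m₁ (Split.walk₁ S₄)) unm₁ (λ i → inj₁ (reverse⁻ i)) (On-reverse m₁)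
              (λ i a → ⊥-elim (cnt≡0⇒≁ m₁ p≁m₁ (reverse⁻ i) (~-sym a)))
              (λ i → ⊥-elim (apart (Split.ap S₄) (λ ()) (Split.at-y S₄) (Split.in-m S₄ (reverse⁻ i))))

      -- Now `y` lies beyond `e` and off the hole; the leg along `m₁` continues through `y` to `p`.
      before-y : ∀ {c Z′} → Z ≡ c ∷ Z′ → ⊥
      before-y refl = ear (reverse m₁ ++ y ∷ []) (In-ys H (there (∈-++⁺ʳ X (there (here refl))))) p≢x (λ { refl → p∉ (In-y Sq) })
              (Walk-++ (reverse m₁) [] (Walk-reverse m₁ (Split.walk₁ S₄)) (~-sym p~y)) un R⊆
              (λ o → On-++⁺ˡ (reverse m₁) [] (On-reverse m₁ o)) toP (λ _ → y≁E)
        where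
        y∈Z : y ∈ Z
        y∈Z with last-pos (lx ∷ L) X eqF
        ... | inj₁ i = i
        ... | inj₂ refl with last-pos (lx ∷ L) (X ++ y ∷ []) (trans eqF (sym (++-assoc X (y ∷ []) Z)))
        ...   | inj₁ i = there i
        ...   | inj₂ q = here q
        y∉E : y ∉ X ++ e ∷ []
        y∉E i = E∩Z i y∈Z
        y≁E : ∀ {q} → q ∈ X ++ e ∷ [] → y ≁ q
        y≁E {q} k a with ∈-++⁻ X k
        ... | inj₂ (here refl) = tf p~y a p~e
        ... | inj₁ j = Cons-far X e Z (subst Uniq eqF uniqF)
                (subst (λ l → Cons l q y) eqF (On⇒Cons L (on-lx-y (F-split (E⊆F k)) (there (here refl)) (~-sym a)))) j y∈Z
        R⊆ : ∀ {v} → v ∈ reverse m₁ ++ y ∷ [] → v ∈ m₁ ⊎ (v ≡ y × y ∉ X ++ e ∷ [])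
        R⊆ i with ∈-++⁻ (reverse m₁) i
        ... | inj₁ j = inj₁ (reverse⁻ j)
        ... | inj₂ (here q) = inj₂ (q , y∉E)
        un : Uniq (reverse m₁ ++ y ∷ [])
        un v = ≤-trans (≤-reflexive eq′) (≤-trans (+-monoʳ-≤ (δ v y) (m≤n+m _ (δ v s))) (uniq-closed S₄ v))
          where
          eq′ : wsum (δ v) (reverse m₁ ++ y ∷ []) ≡ δ v y + wsum (δ v) m₁
          eq′ rewrite wsum-++ (δ v) (reverse m₁) (y ∷ []) | wsum-reverse (δ v) m₁ | +-identityʳ (δ v y) = +-comm (wsum (δ v) m₁) (δ v y)
        toP : ∀ {r} → r ∈ reverse m₁ ++ y ∷ [] → r ~ p → On s (reverse m₁ ++ y ∷ []) p r p
        toP i a with ∈-++⁻ (reverse m₁) i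
        ... | inj₁ j = ⊥-elim (cnt≡0⇒≁ m₁ p≁m₁ (reverse⁻ j) (~-sym a))
        ... | inj₂ (here refl) = On-++⁺ʳ (reverse m₁) [] (inj₁ (refl , refl))

      done : ⊥
      done = go Z refl
        where
        go : ∀ l → Z ≡ l → ⊥
        go []      = at-y
        go (_ ∷ _) = before-y

    c1-contradiction : ⊥
    c1-contradiction with find-first (p ~?_) F
    ... | inj₂ none = none (there (∈-++⁺ʳ L (here refl))) p~y
    ... | inj₁ (first X e Z eqF p~e X0) = Route.done X Z eqF p~e X0

  extendL : ∀ {W : Weight} {y m z} N {v} L → Split W y m z (N ++ v ∷ L) → Split W v (L ++ y ∷ m) z N
  extendL N L s = swap (moveR N L (swap s))

  flip-ends : ∀ {x y m z} → Ends x y m z → Ends x z (reverse m) y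
  flip-ends {x} {y} {m} {z} (ends A xa M xb B eq x~a x~b A0 B0) =
    ends (reverse B) xb (reverse M) xa (reverse A) eq′ x~b x~a (trans (wsum-reverse (nb x) B) B0) (trans (wsum-reverse (nb x) A) A0)
    where
    rev-l : reverse (y ∷ m ++ z ∷ []) ≡ z ∷ reverse m ++ y ∷ []
    rev-l = trans (reverse-++ (y ∷ m) (z ∷ [])) (cong (z ∷_) (unfold-reverse y m))
    eq′ : z ∷ reverse m ++ y ∷ [] ≡ reverse B ++ xb ∷ reverse M ++ xa ∷ reverse A
    eq′ = trans (sym rev-l) (trans (cong reverse eq) (trans (reverse-mid A (M ++ xb ∷ B))
            (trans (cong (_++ xa ∷ reverse A) (reverse-mid M B)) (++-assoc (reverse B) (xb ∷ reverse M) (xa ∷ reverse A)))))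

  proper-split : ∀ {W : Weight} {x a s b R} → Proper W x → Split W a s b R → x ~ a → x ~ b → cnt x s ≡ 0 →
    ∀ {p} → ¬ In W p → x ≁ p → p ≢ x → cnt p (a ∷ b ∷ s) ≤ 2
  proper-split {s = s} proper sp xa xb s0 = proper s (closed-In sp) (Split.walk₁ sp) (uniq-closed sp) xa xb s0

  ∈⇒In : ∀ y m z P {v} → v ∈ y ∷ z ∷ m → In ⟨ y , m , z , P ⟩ v
  ∈⇒In y m z P {v} i = in! (≤-trans (∈⇒1≤ i) (≤-trans (m≤m+n _ (wsum (δ v) P)) (≤-reflexive (lem (δ v y) (δ v z) _ _))))
    where
    abstract
      lem : ∀ y z m p → y + (z + m) + p ≡ y + m + z + p
      lem = solve-∀

  left-behind : ∀ {W : Weight} {y m z ys} → Split W y m z ys → ∀ P {w} → ¬ In ⟨ y , m , z , P ⟩ w → In W w → w ∈ ys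
  left-behind {y = y} {m} {z} sp P w∉′ w∈ with Split.In⇒at sp w∈
  ... | _ , at0 (here e) = ⊥-elim (w∉′ (∈⇒In y m z P (here e)))
  ... | _ , atS (at0 i) = ⊥-elim (w∉′ (∈⇒In y m z P (there (there i))))
  ... | _ , atS (atS (at0 (here e))) = ⊥-elim (w∉′ (∈⇒In y m z P (there (here e))))
  ... | _ , atS (atS (atS (at0 i))) = i

  module _ {W : Weight} {x y : V} {m : List V} {z : V} {ys : List V} (sp : Split W y m z ys) (en : Ends x y m z) where
    open Ends en

    private
      abstract
        lem : ∀ A a M b → A + (a + (M + b)) ≡ (a + A + b) + M
        lem = solve-∀

    ends-uniq : Uniq ((xa ∷ A) ++ xb ∷ B)
    ends-uniq v = ≤-trans (≤-trans (≤-reflexive (wsum-++ (δ v) (xa ∷ A) (xb ∷ B))) (≤-trans (m≤m+n _ (wsum (δ v) M)) (≤-reflexive (sym sums)))) (subst Uniq eq (Uniq-cl sp) v)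
      where
      sums : wsum (δ v) (A ++ xa ∷ M ++ xb ∷ B) ≡ wsum (δ v) (xa ∷ A) + wsum (δ v) (xb ∷ B) + wsum (δ v) M
      sums rewrite wsum-++ (δ v) A (xa ∷ M ++ xb ∷ B) | wsum-++ (δ v) M (xb ∷ B) = lem (wsum (δ v) A) (δ v xa) (wsum (δ v) M) (wsum (δ v) (xb ∷ B))

    uniq-A : Uniq (xa ∷ A)
    uniq-A v = ≤-trans (≤-trans (m≤m+n _ _) (≤-reflexive (sym (wsum-++ (δ v) (xa ∷ A) (xb ∷ B))))) (ends-uniq v)

    uniq-B : Uniq (xb ∷ B)
    uniq-B v = ≤-trans (≤-trans (m≤n+m _ (wsum (δ v) (xa ∷ A))) (≤-reflexive (sym (wsum-++ (δ v) (xa ∷ A) (xb ∷ B))))) (ends-uniq v)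

    ends-few : ∀ {w} → w ∈ ys → cnt w (xa ∷ A) + cnt w (xb ∷ B) ≤ 2
    ends-few {w} w∈ = ≤-trans (≤-reflexive (sym (wsum-++ (nb w) (xa ∷ A) (xb ∷ B)))) (≤-trans (wsum-⊆ (nb w) ((xa ∷ A) ++ xb ∷ B) (y ∷ z ∷ m) ends-uniq sub′) few)
      where
      few : cnt w (y ∷ z ∷ m) ≤ 2
      few rewrite ≁⇒cnt≡0 {w} m (λ i e → Split.far sp i w∈ (~-sym e)) | +-identityʳ (nb w z) = +-mono-≤ (nb≤1 w y) (nb≤1 w z)
      re : ∀ {v} → v ∈ (xa ∷ A) ++ xb ∷ B → v ∈ A ++ xa ∷ M ++ xb ∷ B
      re (here q) = ∈-++⁺ʳ A (here q)
      re (there i) with ∈-++⁻ A i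
      ... | inj₁ j = ∈-++⁺ˡ j
      ... | inj₂ j = ∈-++⁺ʳ A (there (∈-++⁺ʳ M j))
      sub′ : ∀ {v} → v ∈ (xa ∷ A) ++ xb ∷ B → v ∈ y ∷ z ∷ m
      sub′ i = ∈-cl m (subst (_ ∈_) (sym eq) (re i))

  module _ {W : Weight} {x : V} (x∉ : ¬ In W x) (proper : Proper W x) where

    -- `xa ∷ A` is part of a sector of the old wheel that runs on into the removed arc, and `B′`
    -- lies at the other end of the kept arc. The vertex `z` is excepted because it may have
    -- neighbours on the removed arc.
    record Side (w z xa : V) (A : List V) (B′ : List V) : Set where
      field
        ≤2   : cnt w (xa ∷ A) ≤ 2
        ≡2⇒  : cnt w (xa ∷ A) ≡ 2 → ∀ {v} → v ∈ B′ → w ~ v → v ≢ z → ⊥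

    -- Prolonged to the last spoke `lx` before `y`, the list `xa ∷ A` lies in a closed sector,
    -- whence the bound by properness. If it holds two neighbours, the sector has no others, and one
    -- more in `B′` is excluded by `two-plus`.
    side : ∀ {y m z ys} → Split W y m z ys → y ≁ z → (en : Ends x y m z) → 1 ≤ cnt x ys →
      ∀ {w} → ¬ In W w → x ≁ w → w ≢ x → Side w z (Ends.xa en) (Ends.A en) (Ends.xb en ∷ Ends.B en)
    side sp y≁z (ends [] xa M xb B eq x~a x~b A0 B0) h {w} w∉ x≁w w≢x =
      record { ≤2 = ≤-trans le (s≤s z≤n) ; ≡2⇒ = λ e → ⊥-elim (<⇒≱ (s≤s (s≤s z≤n)) (≤-trans (≤-reflexive (sym e)) le)) }
      where
      le : cnt w (xa ∷ []) ≤ 1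
      le rewrite +-identityʳ (nb w xa) = nb≤1 w xa
    side {y} {m} {z} {ys} sp y≁z en@(ends (a ∷ A′) xa M xb B eq x~a x~b A0 B0) h {w} w∉ x≁w w≢x
      with ∷-injective eq
    ... | refl , eqm with snoc-split m A′ eqm | last-nb x ys h
    ...   | inj₁ e | _ = ⊥-elim (append-not-[] M e)
    ...   | inj₂ (Y′ , eqY , refl) | last rest lx L refl x~lx L0 = record { ≤2 = ≤2 ; ≡2⇒ = contra }
      where
      Sa : Split W lx (L ++ y ∷ A′) xa (Y′ ++ z ∷ rest)
      Sa = extendL (Y′ ++ z ∷ rest) L (subst (Split W y A′ xa) (sym (++-assoc Y′ (z ∷ rest) (lx ∷ L))) (moveR A′ Y′ sp))
      x-free : cnt x (L ++ y ∷ A′) ≡ 0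
      x-free = trans (wsum-++ (nb x) L (y ∷ A′)) (cong₂ _+_ (≁⇒cnt≡0 L L0) A0)
      prop : cnt w (lx ∷ xa ∷ L ++ y ∷ A′) ≤ 2
      prop = proper-split proper Sa x~lx x~a x-free w∉ x≁w w≢x
      abstract
        lem : ∀ l xa L A → l + (xa + (L + A)) ≡ (xa + A) + (l + L)
        lem = solve-∀
      sums : cnt w (lx ∷ xa ∷ L ++ y ∷ A′) ≡ cnt w (xa ∷ y ∷ A′) + (nb w lx + cnt w L)
      sums rewrite wsum-++ (nb w) L (y ∷ A′) = lem (nb w lx) (nb w xa) (cnt w L) (cnt w (y ∷ A′))
      ≤2 : cnt w (xa ∷ y ∷ A′) ≤ 2
      ≤2 = ≤-trans (m≤m+n _ _) (≤-trans (≤-reflexive (sym sums)) prop)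
      contra : cnt w (xa ∷ y ∷ A′) ≡ 2 → ∀ {v} → v ∈ xb ∷ B → w ~ v → v ≢ z → ⊥
      contra e {v} v∈ wv v≢z = TwoPlus.two-plus x∉ w∉ x≁w w≢x Sa x~lx x~a x-free
        (≤-antisym prop (≤-trans (≤-reflexive (sym e)) (≤-trans (m≤m+n _ _) (≤-reflexive (sym sums)))))
        (∈-++⁺ˡ v∈Y) wv (Split.far sp (∈-++⁺ʳ A′ (there v∈Y)) (∈-++⁺ʳ rest (here refl)))
        (v≁xa v∈) (∈⇒1≤cnt {x} {xb} {Y′ ++ z ∷ rest} xb∈ x~b)
        where
        v∈Y : v ∈ Y′
        v∈Y with ∈-++⁻ Y′ (subst (v ∈_) eqY (∈-++⁺ʳ M v∈))
        ... | inj₁ i = i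
        ... | inj₂ (here q) = ⊥-elim (v≢z q)
        v≁xa : v ∈ xb ∷ B → v ≁ xa
        v≁xa (here refl) = common≁ x~b x~a
        v≁xa (there i) a = cl-far sp y≁z (y ∷ A′ ++ xa ∷ M) B (trans eq (sym (++-assoc (y ∷ A′) (xa ∷ M) (xb ∷ B)))) (∈-++⁺ʳ (y ∷ A′) (here refl)) i (~-sym a)
        xb∈ : xb ∈ Y′ ++ z ∷ rest
        xb∈ with ∈-++⁻ Y′ (subst (xb ∈_) eqY (∈-++⁺ʳ M (here refl)))
        ... | inj₁ i = ∈-++⁺ˡ i
        ... | inj₂ (here q) = ∈-++⁺ʳ Y′ (here q)

    module _ {p : V} (p∉ : ¬ In W p) (x≁p : x ≁ p) (p≢x : p ≢ x) where

      single-detour : ∀ {y m z ys} → Split W y m z ys → p ~ y → p ~ z → cnt p m ≡ 0 → Detour W x y m z ys (p ∷ [])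
      single-detour {y} {m} {z} sp py pz pm = record
        { sp = sp ; y≁z = common≁ py pz ; walk = ~-sym pz , py ; uniq = Uniq-one p
        ; out = λ { (here refl) → p∉ } ; x≁ = λ { (here refl) → x≁p } ; x∉P = λ { (here q) → p≢x (sym q) } ; ind = ind }
        where
        ind : ∀ {r q} → r ∈ p ∷ [] → q ∈ p ∷ [] ⊎ q ∈ y ∷ z ∷ m → r ~ q → On z (p ∷ []) y r q
        ind (here refl) (inj₁ (here refl)) e = ⊥-elim (~-irr e)
        ind (here refl) (inj₂ (here refl)) e = inj₂ (inj₁ (refl , refl))
        ind (here refl) (inj₂ (there (here refl))) e = inj₁ (inj₂ (refl , refl))
        ind (here refl) (inj₂ (there (there i))) e = ⊥-elim (cnt≡0⇒≁ m pm i e)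

      -- For `w` off the old rim, four neighbours would need two on one side. By `Side` a neighbour
      -- on the other side can then only be the end `z` or `y` there. So there is just one, and `p`
      -- must be the fourth neighbour; but `p` sees both ends, which gives a triangle.
      single-bound : ∀ {y m z ys} (sp : Split W y m z ys) → p ~ y → p ~ z → (en : Ends x y m z) → 1 ≤ cnt x ys →
        ∀ {w} → ¬ In ⟨ y , m , z , p ∷ [] ⟩ w → x ≁ w → w ≢ x →
        cnt w (Ends.xa en ∷ Ends.A en) + (cnt w (Ends.xb en ∷ Ends.B en) + cnt w (p ∷ [])) ≤ 3
      single-bound {y} {m} {z} {ys} sp py pz en h {w} w∉′ x≁w w≢x with In? W w
      ... | yes w∈W = ≤-trans (≤-reflexive (sym (+-assoc (cnt w (xa ∷ A)) (cnt w (xb ∷ B)) (cnt w (p ∷ [])))))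
                        (+-mono-≤ (ends-few sp en (left-behind sp (p ∷ []) w∉′ w∈W)) le₁)
        where
        open Ends en
        le₁ : cnt w (p ∷ []) ≤ 1
        le₁ rewrite +-identityʳ (nb w p) = nb≤1 w p
      ... | no w∉ = ≮⇒≥ many
        where
        open Ends en
        y≁z : y ≁ z
        y≁z = common≁ py pz
        left : Side w z xa A (xb ∷ B)
        left = side sp y≁z en h w∉ x≁w w≢x
        right : Side w y xb (reverse B) (xa ∷ reverse A)
        right = side (flip-swap sp) (λ e → y≁z (~-sym e)) (flip-ends en) (≤-trans h (≤-reflexive (sym (wsum-reverse (nb x) ys)))) w∉ x≁w w≢x
        ca cb cp : ℕ
        ca = cnt w (xa ∷ A)
        cb = cnt w (xb ∷ B)
        cp = cnt w (p ∷ [])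
        cb-rev : cnt w (xb ∷ reverse B) ≡ cb
        cb-rev = cong (nb w xb +_) (wsum-reverse (nb w) B)
        cb≤2 : cb ≤ 2
        cb≤2 = ≤-trans (≤-reflexive (sym cb-rev)) (Side.≤2 right)
        cp≤1 : cp ≤ 1
        cp≤1 rewrite +-identityʳ (nb w p) = nb≤1 w p
        w~p : 1 ≤ cp → w ~ p
        w~p le with first-nb w (p ∷ []) le
        ... | first [] _ [] refl e _ = e
        ... | first (_ ∷ []) _ _ () e _
        ... | first (_ ∷ _ ∷ _) _ _ () e _
        left-contra : ca ≡ 2 → ∀ {v} → v ∈ xb ∷ B → w ~ v → v ≢ z → ⊥
        left-contra = Side.≡2⇒ left
        right-contra : cb ≡ 2 → ∀ {v} → v ∈ xa ∷ A → w ~ v → v ≢ y → ⊥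
        right-contra e i = Side.≡2⇒ right (trans cb-rev e) (re i)
          where
          re : ∀ {v} → v ∈ xa ∷ A → v ∈ xa ∷ reverse A
          re (here q) = here q
          re (there i) = there (reverse⁺ i)
        many : 3 < ca + (cb + cp) → ⊥
        many gt with ca in ea | Side.≤2 left
        ... | 0 | _ = <⇒≱ gt (+-mono-≤ cb≤2 cp≤1)
        ... | 1 | _ with cb in eb | cb≤2
        ...   | 0 | _ = <⇒≱ gt (s≤s (≤-trans cp≤1 (s≤s z≤n)))
        ...   | 1 | _ = <⇒≱ gt (s≤s (s≤s cp≤1))
        ...   | 2 | _ with first-nb w (xa ∷ A) (≤-reflexive (sym ea))
        ...     | first X v Y q wv _ = right-contra eb (subst (v ∈_) (sym q) (∈-++⁺ʳ X (here refl))) wv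
                    (λ { refl → tf (w~p (≤-pred (≤-pred (≤-pred gt)))) py wv })
        many gt | 1 | _ | suc (suc (suc _)) | s≤s (s≤s ())
        many gt | 2 | _ with cb in eb | cb≤2
        ...   | 0 | _ = <⇒≱ gt (s≤s (s≤s cp≤1))
        ...   | 1 | _ with first-nb w (xb ∷ B) (≤-reflexive (sym eb))
        ...     | first X v Y q wv _ = left-contra ea (subst (v ∈_) (sym q) (∈-++⁺ʳ X (here refl))) wv
                    (λ { refl → tf (w~p (≤-pred (≤-pred (≤-pred gt)))) pz wv })
        many gt | 2 | _ | 2 | _ with find-two w (xb ∷ B) (uniq-B sp en) eb
        ...     | two-nbs {u} {v} u∈ v∈ u≢v wu wv _ with u ≟ z
        ...       | no u≢z = left-contra ea u∈ wu u≢z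
        ...       | yes refl = left-contra ea v∈ wv (λ q → u≢v (sym q))
        many gt | 2 | _ | suc (suc (suc _)) | s≤s (s≤s ())
        many gt | suc (suc (suc _)) | s≤s (s≤s ())

  extendR : ∀ {W : Weight} {y m z} A {v} B → Split W y m z (A ++ v ∷ B) → Split W y (m ++ z ∷ A) v B
  extendR A B s = swap (moveL A B (swap s))

  next-spoke : ∀ {W : Weight} {x f m z ys} → Split W f m z ys → x ~ f → 2 ≤ W (nb x) →
    ∃ λ s → ∃ λ g → ∃ λ R → Split W f s g R × x ~ g × cnt x s ≡ 0
  next-spoke {W} {x} {f} {m} {z} {ys} sp xf k≥2 with find-first (x ~?_) m
  ... | inj₁ (first A g B refl xg A0) = A , g , _ , moveR A B sp , xg , ≁⇒cnt≡0 A A0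
  ... | inj₂ m0 with x ~? z
  ...   | yes xz = m , z , ys , sp , xz , ≁⇒cnt≡0 m m0
  ...   | no x≁z with find-first (x ~?_) ys
  ...     | inj₁ (first A g B refl xg A0) = m ++ z ∷ A , g , B , extendR A B sp , xg ,
              trans (wsum-++ (nb x) m (z ∷ A)) (cong₂ _+_ (≁⇒cnt≡0 m m0) (cong₂ _+_ (nb-no {x} x≁z) (≁⇒cnt≡0 A A0)))
  ...     | inj₂ ys0 = ⊥-elim (<⇒≱ k≥2 (≤-trans (≤-reflexive (sym (closed-count x sp))) few))
    where
    few : cnt x (f ∷ z ∷ m) + cnt x ys ≤ 1
    few rewrite ≁⇒cnt≡0 m m0 | ≁⇒cnt≡0 ys ys0 | nb-no {x} x≁z | +-identityʳ (nb x f + 0) | +-identityʳ (nb x f) = nb≤1 x f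

  No-smaller : Weight → V → Set
  No-smaller W x = ∀ {W′ : Weight} {y m z ys} → Split W′ y m z ys → ¬ In W′ x → Proper W′ x → 4 ≤ W′ (nb x) → W′ (nb x) < W (nb x) → ⊥

  -- Proper wheels with the fewest spokes for their hub

  module Spokes {W : Weight} {x : V} (x∉ : ¬ In W x) (proper : Proper W x) (k≥4 : 4 ≤ W (nb x)) (no-smaller : No-smaller W x) where

    Bound : ∀ {y m z} → List V → Ends x y m z → Set
    Bound {y} {m} {z} P en = ∀ {w} → ¬ In ⟨ y , m , z , P ⟩ w → x ≁ w → w ≢ x →
      cnt w (Ends.xa en ∷ Ends.A en) + (cnt w (Ends.xb en ∷ Ends.B en) + cnt w P) ≤ 3

    four-spokes : ∀ {y m z ys P} → Detour W x y m z ys P → 4 ≤ cnt x (y ∷ z ∷ m) → 1 ≤ cnt x ys → (∀ en → Bound P en) → ⊥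
    four-spokes {y} {m} {z} {ys} {P} d c≥4 h bd =
      no-smaller hole (hub-out x∉) (smaller-proper x∉ proper d en (bd en)) (≤-trans c≥4 (≤-reflexive (sym count))) lt
      where
      open Detour d
      en = find-ends x y m z (≤-trans (s≤s (s≤s z≤n)) c≥4)
      lt : ⟨ y , m , z , P ⟩ (nb x) < W (nb x)
      lt = ≤-trans (≤-reflexive (trans (cong suc count) (+-comm 1 _))) (≤-trans (+-monoʳ-≤ (cnt x (y ∷ z ∷ m)) h) (≤-reflexive (closed-count x sp)))

    rest-count : ∀ {y m z ys} c → Split W y m z ys → cnt x (y ∷ z ∷ m) ≡ c → 4 ≤ c + cnt x ys
    rest-count c sp e = ≤-trans k≥4 (≤-reflexive (trans (sym (closed-count x sp)) (cong (_+ _) e)))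

    last-spoke : ∀ ys → 2 ≤ cnt x ys → ∃ λ r₀ → ∃ λ rest → ∃ λ lx → ∃ λ L → ys ≡ r₀ ∷ rest ++ lx ∷ L × x ~ lx × cnt x L ≡ 0 × 1 ≤ cnt x (r₀ ∷ rest)
    last-spoke ys h with last-nb x ys (≤-trans (s≤s z≤n) h)
    ... | last [] lx L refl xlx L0 = ⊥-elim (<⇒≱ h (≤-trans (≤-reflexive (trans (cong (nb x lx +_) (≁⇒cnt≡0 L L0)) (+-identityʳ _))) (nb≤1 x lx)))
    ... | last (r₀ ∷ rest) lx L refl xlx L0 = r₀ , rest , lx , L , refl , xlx , ≁⇒cnt≡0 L L0 , more
      where
      more : 1 ≤ cnt x (r₀ ∷ rest)
      more with trans (wsum-++ (nb x) (r₀ ∷ rest) (lx ∷ L)) (cong (cnt x (r₀ ∷ rest) +_) (cong₂ _+_ (nb-yes {x} xlx) (≁⇒cnt≡0 L L0)))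
      ... | e = ≤-pred (≤-trans h (≤-reflexive (trans e (+-comm (cnt x (r₀ ∷ rest)) 1))))

    module _ {p : V} (p∉ : ¬ In W p) (x≁p : x ≁ p) (p≢x : p ≢ x) where

      two-spokes : ∀ {y m z ys} → Split W y m z ys → p ~ y → p ~ z → cnt p m ≡ 0 → cnt x (y ∷ z ∷ m) ≡ 2 → x ≁ y → ⊥
      two-spokes {ys = ys} sp py pz pm c2 x≁y with last-spoke ys (≤-pred (≤-pred (rest-count 2 sp c2)))
      ... | r₀ , rest , lx , L , refl , xlx , L0 , _ =
        TwoSpokeArc.c2-contradiction x∉ r₀ rest lx L (p ∷ []) (single-detour x∉ proper p∉ x≁p p≢x sp py pz pm) (here refl) py xlx L0 c2
          (λ { _ (here q) _ → q }) (inj₁ x≁y)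

      module OneMid {y : V} (m₁ : List V) {s : V} (m₂ : List V) {z : V} (L′ : List V) {fx : V} (N₁ : List V) {c : V} (N₂ : List V) {lx : V} (L : List V)
        (S₀ : Split W s (m₂ ++ z ∷ L′ ++ fx ∷ N₁) c (N₂ ++ lx ∷ L ++ y ∷ m₁))
        (x~s : x ~ s) (x~fx : x ~ fx) (x~lx : x ~ lx) (x≁y : x ≁ y) (x≁z : x ≁ z)
        (x≁m₁ : cnt x m₁ ≡ 0) (x≁m₂ : cnt x m₂ ≡ 0) (x≁L : cnt x L ≡ 0) (x≁L′ : cnt x L′ ≡ 0)
        (p~y : p ~ y) (p~z : p ~ z) (p≁s : p ≁ s) (p≁m₁ : cnt p m₁ ≡ 0) (p≁m₂ : cnt p m₂ ≡ 0) where

        -- The vertices `e` and `y` are already two neighbours of `p` in the closed sector from `lx`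
        -- to `s`, and `e′` is a further one away from it, contrary to `two-plus`.
        both : ∀ {e e′} → e ∈ lx ∷ L → p ~ e → e′ ∈ fx ∷ L′ → p ~ e′ → ⊥
        both {e} {e′} e∈ pe e′∈ pe′ = TwoPlus.two-plus x∉ p∉ x≁p p≢x S₃ x~lx x~s x-free
          (≤-antisym (proper-split proper S₃ x~lx x~s x-free p∉ x≁p p≢x) two) (∈-++⁺ˡ (in-A e′∈)) pe′
          (Split.far S₀ (in-A e′∈) (∈-++⁺ʳ N₂ (here refl))) (≁s e′∈)
          (∈⇒1≤cnt {x} {fx} (∈-++⁺ˡ (in-A (here refl))) x~fx)
          where
          A = m₂ ++ z ∷ L′ ++ fx ∷ N₁
          S₃ : Split W lx (L ++ y ∷ m₁) s (A ++ c ∷ N₂)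
          S₃ = moveL N₂ (L ++ y ∷ m₁) (swap S₀)
          x-free : cnt x (L ++ y ∷ m₁) ≡ 0
          x-free = trans (wsum-++ (nb x) L (y ∷ m₁)) (cong₂ _+_ x≁L (cong₂ _+_ (nb-no {x} x≁y) x≁m₁))
          in-A : ∀ {v} → v ∈ fx ∷ L′ → v ∈ A
          in-A (here q) = ∈-++⁺ʳ m₂ (there (∈-++⁺ʳ L′ (here q)))
          in-A (there i) = ∈-++⁺ʳ m₂ (there (∈-++⁺ˡ i))
          ≁s : ∀ {v} → v ∈ fx ∷ L′ → v ≁ s
          ≁s (here refl) = common≁ x~fx x~s
          ≁s (there i) = ≁-left m₂ (L′ ++ fx ∷ N₁) S₀ (∈-++⁺ˡ i)
          abstract
            lem : ∀ l s L y m → l + (s + (L + (y + m))) ≡ (l + L + y) + (s + m)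
            lem = solve-∀
          two : 2 ≤ cnt p (lx ∷ s ∷ L ++ y ∷ m₁)
          two rewrite wsum-++ (nb p) L (y ∷ m₁) | lem (nb p lx) (nb p s) (cnt p L) (nb p y) (cnt p m₁) =
            ≤-trans (+-mono-≤ (∈⇒1≤cnt e∈ pe) (≤-reflexive (sym (nb-yes {p} p~y)))) (m≤m+n _ _)

        -- By `both` the vertex `p` misses all of `fx ∷ L′` or all of `lx ∷ L`; the second case is
        -- the mirror image of the first.
        one-mid : ⊥
        one-mid with find-first (p ~?_) (fx ∷ L′) | find-first (p ~?_) (lx ∷ L)
        ... | inj₁ (first X e′ Y q pe′ _) | inj₁ (first X₁ e Y₁ q₁ pe _) =
          both (subst (e ∈_) (sym q₁) (∈-++⁺ʳ X₁ (here refl))) pe (subst (e′ ∈_) (sym q) (∈-++⁺ʳ X (here refl))) pe′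
        ... | inj₂ none | _ = OneSpokeArc.c1-contradiction x∉ p∉ x≁p p≢x m₂ L′ N₁ N₂ L m₁ S₀ x~s x~fx x~lx x≁y x≁z x≁m₁ x≁m₂ x≁L x≁L′
            p~y p~z p≁s p≁m₁ p≁m₂ (none (here refl)) (≁⇒cnt≡0 L′ (λ i → none (there i)))
        ... | inj₁ _ | inj₂ none = OneSpokeArc.c1-contradiction x∉ p∉ x≁p p≢x (reverse m₁) (reverse L) (reverse N₂) (reverse N₁) (reverse L′) (reverse m₂) S₀′
            x~s x~lx x~fx x≁z x≁y (r0 m₂ x≁m₂) (r0 m₁ x≁m₁) (r0 L′ x≁L′) (r0 L x≁L)
            p~z p~y p≁s (r0 m₂ p≁m₂) (r0 m₁ p≁m₁) (none (here refl)) (r0 L (≁⇒cnt≡0 L (λ i → none (there i))))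
          where
          r0 : ∀ {v} l → cnt v l ≡ 0 → cnt v (reverse l) ≡ 0
          r0 {v} l e = trans (wsum-reverse (nb v) l) e
          revB : reverse (N₂ ++ lx ∷ L ++ y ∷ m₁) ≡ reverse m₁ ++ y ∷ reverse L ++ lx ∷ reverse N₂
          revB = trans (reverse-mid N₂ (L ++ y ∷ m₁)) (trans (cong (_++ lx ∷ reverse N₂) (reverse-mid L m₁)) (++-assoc (reverse m₁) (y ∷ reverse L) (lx ∷ reverse N₂)))
          revA : reverse (m₂ ++ z ∷ L′ ++ fx ∷ N₁) ≡ reverse N₁ ++ fx ∷ reverse L′ ++ z ∷ reverse m₂
          revA = trans (reverse-mid m₂ (L′ ++ fx ∷ N₁)) (trans (cong (_++ z ∷ reverse m₂) (reverse-mid L′ N₁)) (++-assoc (reverse N₁) (fx ∷ reverse L′) (z ∷ reverse m₂)))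
          S₀′ : Split W s (reverse m₁ ++ y ∷ reverse L ++ lx ∷ reverse N₂) c (reverse N₁ ++ fx ∷ reverse L′ ++ z ∷ reverse m₂)
          S₀′ = subst (λ l → Split W s l c _) revB (subst (λ l → Split W s _ c l) revA (flip S₀))

      -- With one spoke on the arc from `y` to `z`, at least three lie on `ys`. The outermost are
      -- `fx` and `lx`, and one between them, `c`, is the second cutting point.
      one-spoke : ∀ {y} m₁ {s} m₂ {z ys} → Split W y (m₁ ++ s ∷ m₂) z ys → p ~ y → p ~ z → cnt p (m₁ ++ s ∷ m₂) ≡ 0 → x ~ s →
        cnt x (y ∷ z ∷ m₁ ++ s ∷ m₂) ≡ 1 → ⊥
      one-spoke {y} m₁ {s} m₂ {z} {ys} sp py pz pm xs c1 with first-nb x ys (≤-trans (s≤s z≤n) triple)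
        where
        triple : 3 ≤ cnt x ys
        triple = ≤-pred (rest-count 1 sp c1)
      ... | first L′ fx Y₁ refl xfx L′0 with last-spoke (fx ∷ Y₁) more
        where
        triple : 3 ≤ cnt x (L′ ++ fx ∷ Y₁)
        triple = ≤-pred (rest-count 1 sp c1)
        more : 2 ≤ cnt x (fx ∷ Y₁)
        more with wsum-++ (nb x) L′ (fx ∷ Y₁)
        ... | e rewrite ≁⇒cnt≡0 L′ L′0 = ≤-trans (s≤s (s≤s z≤n)) (≤-trans triple (≤-reflexive e))
      ...   | r₀ , mid , lx , L , eqY , xlx , L0 , _ with ∷-injective eqY
      ...     | refl , refl with first-nb x mid mid≥1
        where
        triple : 3 ≤ cnt x (L′ ++ fx ∷ mid ++ lx ∷ L)
        triple = ≤-pred (rest-count 1 sp c1)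
        sums : cnt x (L′ ++ fx ∷ mid ++ lx ∷ L) ≡ suc (cnt x mid + 1)
        sums = trans (wsum-++ (nb x) L′ (fx ∷ mid ++ lx ∷ L)) (trans (cong₂ _+_ (≁⇒cnt≡0 L′ L′0) refl)
                 (cong₂ _+_ (nb-yes {x} xfx) (trans (wsum-++ (nb x) mid (lx ∷ L)) (cong (cnt x mid +_) (cong₂ _+_ (nb-yes {x} xlx) L0)))))
        mid≥1 : 1 ≤ cnt x mid
        mid≥1 = ≤-pred (≤-trans (≤-pred (≤-trans triple (≤-reflexive sums))) (≤-reflexive (+-comm (cnt x mid) 1)))
      ...       | first N₁ c N₂ refl xc _ =
        OneMid.one-mid m₁ m₂ L′ N₁ N₂ L S₀ xs xfx xlx (from-nb y (proj₁ zs)) (from-nb z (proj₁ (proj₂ zs)))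
          (proj₁ (proj₂ (proj₂ zs))) (proj₂ (proj₂ (proj₂ zs))) L0 (≁⇒cnt≡0 L′ L′0)
          py pz (cnt≡0⇒≁ (m₁ ++ s ∷ m₂) pm (∈-++⁺ʳ m₁ (here refl)))
          (≁⇒cnt≡0 m₁ (λ i → cnt≡0⇒≁ (m₁ ++ s ∷ m₂) pm (∈-++⁺ˡ i))) (≁⇒cnt≡0 m₂ (λ i → cnt≡0⇒≁ (m₁ ++ s ∷ m₂) pm (∈-++⁺ʳ m₁ (there i))))
        where
        from-nb : ∀ v → nb x v ≡ 0 → x ≁ v
        from-nb v e a rewrite nb-yes {x} a with e
        ... | ()
        abstract
          lem : ∀ y z a b → y + (z + (a + (1 + b))) ≡ suc (y + (z + (a + b)))
          lem = solve-∀
        zero-sum : nb x y + (nb x z + (cnt x m₁ + cnt x m₂)) ≡ 0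
        zero-sum = cong pred (trans (sym (lem (nb x y) (nb x z) (cnt x m₁) (cnt x m₂))) (trans (cong (λ k → nb x y + (nb x z + k))
                     (sym (trans (wsum-++ (nb x) m₁ (s ∷ m₂)) (cong (λ k → cnt x m₁ + (k + cnt x m₂)) (nb-yes {x} xs))))) c1))
        zs : nb x y ≡ 0 × nb x z ≡ 0 × cnt x m₁ ≡ 0 × cnt x m₂ ≡ 0
        zs = let q = m+n≡0⇒n≡0 (nb x y) zero-sum ; r = m+n≡0⇒n≡0 (nb x z) q in
             m+n≡0⇒m≡0 (nb x y) zero-sum , m+n≡0⇒m≡0 (nb x z) q , m+n≡0⇒m≡0 (cnt x m₁) r , m+n≡0⇒n≡0 (cnt x m₁) r
        eqys : (L′ ++ fx ∷ (N₁ ++ c ∷ N₂) ++ lx ∷ L) ++ y ∷ m₁ ≡ (L′ ++ fx ∷ N₁) ++ c ∷ (N₂ ++ lx ∷ L ++ y ∷ m₁)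
        eqys = trans (++-assoc L′ (fx ∷ (N₁ ++ c ∷ N₂) ++ lx ∷ L) (y ∷ m₁)) (trans (cong (λ l → L′ ++ fx ∷ l)
                 (trans (++-assoc (N₁ ++ c ∷ N₂) (lx ∷ L) (y ∷ m₁)) (++-assoc N₁ (c ∷ N₂) (lx ∷ L ++ y ∷ m₁))))
                 (sym (++-assoc L′ (fx ∷ N₁) (c ∷ (N₂ ++ lx ∷ L ++ y ∷ m₁)))))
        S₀ : Split W s (m₂ ++ z ∷ L′ ++ fx ∷ N₁) c (N₂ ++ lx ∷ L ++ y ∷ m₁)
        S₀ = extendR (L′ ++ fx ∷ N₁) (N₂ ++ lx ∷ L ++ y ∷ m₁) (subst (Split W s m₂ z) eqys (moveL m₁ m₂ sp))

      -- Rerouting through `p` keeps the spokes on the arc from `y` to `z`. Four or more contradict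
      -- the choice of the wheel, exactly three give an ISK4, and two or one lead to the ears of
      -- `TwoSpokeArc` and `OneSpokeArc`.
      consecutive : ∀ {y} m₁ {s} m₂ {z ys} → Split W y (m₁ ++ s ∷ m₂) z ys → p ~ y → p ~ z → cnt p (m₁ ++ s ∷ m₂) ≡ 0 → x ~ s → 1 ≤ cnt x ys → ⊥
      consecutive {y} m₁ {s} m₂ {z} {ys} sp py pz pm xs h = go (cnt x (y ∷ z ∷ m)) refl
        where
        m = m₁ ++ s ∷ m₂
        d : Detour W x y m z ys (p ∷ [])
        d = single-detour x∉ proper p∉ x≁p p≢x sp py pz pm
        c≥1 : 1 ≤ cnt x m
        c≥1 = ∈⇒1≤cnt {x} {s} {m} (∈-++⁺ʳ m₁ (here refl)) xs
        go : ∀ c → cnt x (y ∷ z ∷ m) ≡ c → ⊥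
        go 0 e = <⇒≱ c≥1 (≤-reflexive (m+n≡0⇒n≡0 (nb x z) (m+n≡0⇒n≡0 (nb x y) e)))
        go 1 e = one-spoke m₁ m₂ sp py pz pm xs e
        -- Besides `s` only one further spoke is kept, so `y` or `z` is not a spoke.
        go 2 e with x ~? y
        ... | no x≁y = two-spokes sp py pz pm e x≁y
        ... | yes xy = two-spokes (flip-swap sp) pz py (trans (wsum-reverse (nb p) m) pm) (trans (flip-count x y m z) e) x≁z
          where
          x≁z : x ≁ z
          x≁z xz = <⇒≱ (+-mono-≤ (≤-reflexive (sym (nb-yes {x} xy))) (+-mono-≤ (≤-reflexive (sym (nb-yes {x} xz))) c≥1)) (≤-reflexive e)
        go 3 e = Detour.≢3 d x∉ e
        go (suc (suc (suc (suc c)))) e = four-spokes d (≤-trans (s≤s (s≤s (s≤s (s≤s z≤n)))) (≤-reflexive (sym e))) h (λ en → single-bound x∉ proper p∉ x≁p p≢x sp py pz en h)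

      advance : ∀ {y} X {s} R {z ys} → Split W y (X ++ s ∷ R) z ys → p ~ y →
        ∃ λ y′ → ∃ λ X′ → ∃ λ ys′ → Split W y′ (X′ ++ s ∷ R) z ys′ × p ~ y′ × cnt p X′ ≡ 0 × cnt x ys ≤ cnt x ys′
      advance {y} X {s} R {z} {ys} sp py with find-last (p ~?_) X
      ... | inj₂ none = y , X , ys , sp , py , ≁⇒cnt≡0 X none , ≤-refl
      ... | inj₁ (last X₁ y′ X₂ refl py′ X₂0) = y′ , X₂ , _ , moveL X₁ (X₂ ++ s ∷ R) (subst (λ l → Split W y l z ys) (++-assoc X₁ (y′ ∷ X₂) (s ∷ R)) sp) , py′ , ≁⇒cnt≡0 X₂ X₂0 ,
          ≤-trans (m≤m+n _ _) (≤-reflexive (sym (wsum-++ (nb x) ys (y ∷ X₁))))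

      -- The ends are moved to the neighbours of `p` nearest to the missed spoke `s`, which makes
      -- the arc between them free of `p`. The removed arc only gains spokes.
      around : ∀ {y} X {s} Y {z ys} → Split W y (X ++ s ∷ Y) z ys → p ~ y → p ~ z → x ~ s → p ≁ s → 1 ≤ cnt x ys → ⊥
      around X {s} Y sp py pz xs p≁s h with advance X Y sp py
      ... | y′ , X′ , ys′ , sp′ , py′ , X′0 , le with advance (reverse Y) (reverse X′) (subst (λ l → Split W _ l y′ (reverse ys′)) (reverse-mid X′ Y) (flip-swap sp′)) pz
      ...   | z′ , Y′ , ys″ , sp″ , pz′ , Y′0 , le′ =
        consecutive Y′ (reverse X′) sp″ pz′ py′ free xs (≤-trans h (≤-trans le (≤-trans (≤-reflexive (sym (wsum-reverse (nb x) ys′))) le′)))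
        where
        free : cnt p (Y′ ++ s ∷ reverse X′) ≡ 0
        free = trans (wsum-++ (nb p) Y′ (s ∷ reverse X′)) (cong₂ _+_ Y′0 (cong₂ _+_ (nb-no {p} p≁s) (trans (wsum-reverse (nb p) X′) X′0)))

      -- Two consecutive spokes `f`, `g` are two neighbours of `p` in their sector, and any third
      -- spoke is a common neighbour of `p` and the hub away from it.
      dominated : ∀ {f m z ys} → Split W f m z ys → x ~ f → (∀ {v} → In W v → x ~ v → p ~ v) → ⊥
      dominated {f} sp xf dom with next-spoke sp xf (≤-trans (s≤s (s≤s z≤n)) k≥4)
      ... | s , g , R , sp′ , xg , s0 with first-nb x R R≥1
        where
        R≥1 : 1 ≤ cnt x R
        R≥1 with closed-count x sp′
        ... | e rewrite nb-yes {x} xf | nb-yes {x} xg | s0 = ≤-trans (s≤s z≤n) (≤-pred (≤-pred (≤-trans k≥4 (≤-reflexive (sym e)))))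
      ...   | first A t B refl xt _ = TwoPlus.direct x∉ p∉ x≁p p≢x sp′ xf xg s0
                (≤-antisym (proper-split proper sp′ xf xg s0 p∉ x≁p p≢x) two) t∈ (dom (In-ys sp′ t∈) xt) xt
        where
        t∈ : t ∈ A ++ t ∷ B
        t∈ = ∈-++⁺ʳ A (here refl)
        two : 2 ≤ cnt p (f ∷ g ∷ s)
        two rewrite nb-yes {p} (dom (In-y sp′) xf) | nb-yes {p} (dom (In-z sp′) xg) = s≤s (s≤s z≤n)

      private
        Miss : V → Set
        Miss v = x ~ v × p ≁ v
        miss? : ∀ v → Dec (Miss v)
        miss? v with x ~? v | p ~? v
        ... | yes a | no b = yes (a , b)
        ... | yes a | yes b = no λ (_ , c) → c b
        ... | no a | _ = no λ (b , _) → a b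
        hit : ∀ {v} → ¬ Miss v → x ~ v → p ~ v
        hit {v} nm a with p ~? v
        ... | yes b = b
        ... | no b = ⊥-elim (nm (a , b))

      -- A spoke missed by `p` on either arc leads to `around`; if none is missed, `dominated`
      -- applies.
      one-vertex : ∀ {y m z ys} → Split W y m z ys → 1 ≤ cnt x m → 1 ≤ cnt x ys → p ~ y → p ~ z → ⊥
      one-vertex {y} {m} {z} {ys} sp hm hys py pz with find-first miss? m
      ... | inj₁ (first X s Y refl (xs , p≁s) _) = around X Y sp py pz xs p≁s hys
      ... | inj₂ none-m with find-first miss? ys
      ...   | inj₁ (first X s Y refl (xs , p≁s) _) = around X Y (swap sp) pz py xs p≁s hm
      ...   | inj₂ none-ys with first-nb x m hm
      ...     | first A f B refl xf _ = dominated (moveL A B sp) xf dom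
        where
        dom : ∀ {v} → In W v → x ~ v → p ~ v
        dom i a with Split.In⇒at sp i
        ... | _ , at0 (here refl) = py
        ... | _ , atS (at0 j) = hit (none-m j) a
        ... | _ , atS (atS (at0 (here refl))) = pz
        ... | _ , atS (atS (atS (at0 j))) = hit (none-ys j) a

    Ok : V → Set
    Ok v = ¬ In W v × x ≁ v × v ≢ x

    -- The spokes are counted strictly inside the two arcs, so `u` and `v` may be spokes themselves
    -- without contributing.
    record Sep (u v : V) : Set where
      constructor sep
      field
        {m ys} : List V
        sp     : Split W u m v ys
        h₁     : 1 ≤ cnt x m
        h₂     : 1 ≤ cnt x ys

    sep-sym : ∀ {u v} → Sep u v → Sep v u
    sep-sym (sep sp h₁ h₂) = sep (swap sp) h₂ h₁

    no-sep : ∀ {p u v} → Ok p → p ~ u → p ~ v → Sep u v → ⊥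
    no-sep (p∉ , x≁p , p≢x) pu pv (sep sp h₁ h₂) = one-vertex p∉ x≁p p≢x sp h₁ h₂ pu pv

    sep-pivot : ∀ {y m z ys} → Split W y m z ys → 1 ≤ cnt x ys → ∀ X {f} Y → y ∷ m ++ z ∷ [] ≡ X ++ f ∷ Y → x ~ f →
                ∀ {a b} → a ∈ X → b ∈ Y → Sep a b
    sep-pivot {y} {m} {z} {ys} sp h (y₀ ∷ X) {f} Y eq xf {a} {b} a∈ b∈ with ∷-injective eq
    ... | refl , eqm with snoc-split m X eqm
    ...   | inj₁ refl = ⊥-elim (nil b∈)
      where
      nil : b ∉ []
      nil ()
    ...   | inj₂ (Y′ , refl , refl) = go₁ a∈
      where
      f∈ : ∀ (U V′ : List V) → 1 ≤ cnt x (U ++ f ∷ V′)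
      f∈ U V′ = ∈⇒1≤cnt {x} {f} {U ++ f ∷ V′} (∈-++⁺ʳ U (here refl)) xf
      go₂ : ∀ {u} U {ys′} → Split W u (U ++ f ∷ Y′) z ys′ → 1 ≤ cnt x ys′ → b ∈ Y′ ++ z ∷ [] → Sep u b
      go₂ U sp h i with ∈-++⁻ Y′ i
      ... | inj₂ (here refl) = sep sp (f∈ U Y′) h
      ... | inj₁ j with ∈-∃++ j
      ...   | V₁ , V₂ , refl = sep (moveR (U ++ f ∷ V₁) V₂ (subst (λ l → Split W _ l z _) (sym (++-assoc U (f ∷ V₁) (b ∷ V₂))) sp)) (f∈ U V₁)
                (≤-trans h (≤-trans (m≤n+m _ (cnt x V₂ + nb x z)) (≤-reflexive (trans (+-assoc (cnt x V₂) _ _) (sym (wsum-++ (nb x) V₂ (z ∷ _)))))))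
      go₁ : a ∈ y ∷ X → Sep a b
      go₁ (here refl) = go₂ X sp h b∈
      go₁ (there i) with ∈-∃++ i
      ... | U₁ , U₂ , refl = go₂ U₂ (moveL U₁ (U₂ ++ f ∷ Y′) (subst (λ l → Split W y l z ys) (++-assoc U₁ (a ∷ U₂) (f ∷ Y′)) sp))
              (≤-trans h (≤-trans (m≤m+n _ _) (≤-reflexive (sym (wsum-++ (nb x) ys (y ∷ U₁)))))) b∈

    sep-≁ : ∀ {u v} → Sep u v → u ≁ v
    sep-≁ {u} {v} (sep {m} {ys} sp h₁ h₂) e with first-nb x m h₁ | first-nb x ys h₂
    ... | first A f B refl xf _ | first A′ g B′ refl xg _ =
      ≁-right (B ++ v ∷ A′) B′ (subst (λ l → Split W f l u A) (sym (++-assoc B (v ∷ A′) (g ∷ B′))) (swap (moveR A B sp))) (∈-++⁺ʳ B (here refl)) (~-sym e)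

    Below : ℕ → Set
    Below l = ∀ P {y z} → len P < l → (∀ {r} → r ∈ P → Ok r) → Walk z P y → Sep y z → ⊥

    -- The ends on the rim are not part of the data, since they get moved while `P` is kept; hence
    -- `ind` is stated for all `z` and `y`. The condition `p≢q` leaves aside the single vertex,
    -- treated by `one-vertex`.
    record MinPath (P : List V) : Set where
      field
        p q      : V
        P″ P′    : List V
        eq₁      : P ≡ p ∷ P″
        eq₂      : P ≡ P′ ++ q ∷ []
        ok       : ∀ {r} → r ∈ P → Ok r
        uniq     : Uniq P
        ind      : ∀ {r s} → r ∈ P → s ∈ P → r ~ s → ∀ z y → On z P y r s
        p≢q      : p ≢ q

      q∈ : q ∈ P
      q∈ = subst (q ∈_) (sym eq₂) (∈-++⁺ʳ P′ (here refl))
      first-or : ∀ {r} → r ∈ P → r ≡ p ⊎ r ∈ P″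
      first-or i with subst (_ ∈_) eq₁ i
      ... | here e = inj₁ e
      ... | there j = inj₂ j
      last-or : ∀ {r} → r ∈ P → r ≡ q ⊎ r ∈ P′
      last-or i with ∈-++⁻ P′ (subst (_ ∈_) eq₂ i)
      ... | inj₁ j = inj₂ j
      ... | inj₂ (here e) = inj₁ e
      on-q : ∀ z y → On z P y q y
      on-q z y = subst (λ l → On z l y q y) (sym eq₂) (On-++⁺ʳ P′ [] (inj₁ (refl , refl)))
      on-p : ∀ z y → On z P y p z
      on-p z y = subst (λ l → On z l y p z) (sym eq₁) (inj₁ (inj₂ (refl , refl)))
      rewalk : ∀ {z₀ y₀ z y} → Walk z₀ P y₀ → p ~ z → q ~ y → Walk z P y
      rewalk {z₀} {y₀} {z} {y} wk pz qy = tail-walk (subst (λ l → Walk z₀ l y₀) eq₁ wk)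
        where
        head-walk : Walk p P″ y₀ → Walk z P y₀
        head-walk w = subst (λ l → Walk z l y₀) (sym eq₁) (~-sym pz , w)
        tail-walk : Walk z₀ (p ∷ P″) y₀ → Walk z P y
        tail-walk (_ , w) = subst (λ l → Walk z l y) (sym eq₂) (Walk-++ P′ [] (proj₁ (Walk-++⁻ P′ [] (subst (λ l → Walk z l y₀) eq₂ (head-walk w)))) qy)

    mp-reverse : ∀ {P} → MinPath P → MinPath (reverse P)
    mp-reverse {P} mp = record
      { p = q ; q = p ; P″ = reverse P′ ; P′ = reverse P″
      ; eq₁ = trans (cong reverse eq₂) (reverse-++ P′ (q ∷ []))
      ; eq₂ = trans (cong reverse eq₁) (unfold-reverse p P″)
      ; ok = λ i → ok (reverse⁻ i) ; uniq = λ v → ≤-trans (≤-reflexive (wsum-reverse (δ v) P)) (uniq v)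
      ; ind = λ i j e z y → On-reverse P (ind (reverse⁻ i) (reverse⁻ j) e y z)
      ; p≢q = λ e → p≢q (sym e) }
      where open MinPath mp

    module Min {P : List V} (mp : MinPath P) (below : Below (len P)) where
      open MinPath mp

      -- Otherwise a shorter initial part of P would join z to the separated vertex v.
      from-z : ∀ {z r u} → Walk z P u → r ∈ P → ∀ {v} → r ~ v → Sep v z → r ≡ q
      from-z wk i e s with last-or i
      ... | inj₁ p = p
      ... | inj₂ j with ∈-∃++ j
      ...   | X , Y , refl = ⊥-elim (below (X ++ _ ∷ []) lt okX (Walk-++ X [] (proj₁ (Walk-++⁻ X (Y ++ q ∷ []) (subst (λ l → Walk _ l _) eq wk))) e) s)
        where
        eq : P ≡ X ++ _ ∷ Y ++ q ∷ []
        eq = trans eq₂ (++-assoc X (_ ∷ Y) (q ∷ []))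
        lt : len (X ++ _ ∷ []) < len P
        lt = ≤-trans (≤-reflexive (trans (cong suc (len-++ X (_ ∷ []))) (sym (+-suc (len X) 1)))) (≤-trans (+-monoʳ-≤ (len X) (s≤s (≤-trans (m≤n+m 1 (len Y)) (≤-reflexive (sym (len-++ Y (q ∷ [])))))))
               (≤-reflexive (sym (trans (cong len eq) (len-++ X (_ ∷ Y ++ q ∷ []))))))
        okX : ∀ {v} → v ∈ X ++ _ ∷ [] → Ok v
        okX k with ∈-++⁻ X k
        ... | inj₁ k′ = ok (subst (_ ∈_) (sym eq) (∈-++⁺ˡ k′))
        ... | inj₂ (here refl) = ok i

      from-y : ∀ {y r u} → Walk u P y → r ∈ P → ∀ {v} → r ~ v → Sep y v → r ≡ p
      from-y {r = r} wk i e s with first-or i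
      ... | inj₁ p = p
      ... | inj₂ j with ∈-∃++ j
      ...   | X , Y , refl = ⊥-elim (below (_ ∷ Y) lt okY (~-sym e , proj₂ (Walk-++⁻ (p ∷ X) Y (subst (λ l → Walk _ l _) eq₁ wk))) s)
        where
        lt : len (r ∷ Y) < len P
        lt = ≤-trans (s≤s (m≤n+m (suc (len Y)) (len X))) (≤-reflexive (sym (trans (cong len eq₁) (cong suc (len-++ X (r ∷ Y))))))
        okY : ∀ {v} → v ∈ r ∷ Y → Ok v
        okY k = ok (subst (_ ∈_) (sym eq₁) (there (∈-++⁺ʳ X k)))

      -- The situation in which `P` replaces the arc `ys` cleanly: only the first and the last
      -- vertex of `P` see the kept arc, and only at its ends. At least two spokes are kept and at
      -- least one is lost.
      record Ready (y : V) (m : List V) (z : V) (ys : List V) : Set where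
        field
          sp     : Split W y m z ys
          wk     : Walk z P y
          free   : ∀ {r v} → r ∈ P → v ∈ m → r ≁ v
          only-y : ∀ {r} → r ∈ P → r ~ y → r ≡ q
          only-z : ∀ {r} → r ∈ P → r ~ z → r ≡ p
          q~y    : q ~ y
          p~z    : p ~ z
          c≥2    : 2 ≤ cnt x (y ∷ z ∷ m)
          h      : 1 ≤ cnt x ys

        y≁z : y ≁ z
        y≁z e with x ~? y | x ~? z
        ... | yes xy | yes xz = tf xy e xz
        ... | no x≁y | _ = sep-≁ (sep sp m≥1 h) e
          where
          m≥1 : 1 ≤ cnt x m
          m≥1 = ≤-pred (≤-trans c≥2 (≤-trans (≤-reflexive (cong (_+ (nb x z + cnt x m)) (nb-no {x} x≁y))) (+-monoˡ-≤ (cnt x m) (nb≤1 x z))))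
        ... | yes _ | no x≁z = sep-≁ (sep sp m≥1 h) e
          where
          m≥1 : 1 ≤ cnt x m
          m≥1 = ≤-pred (≤-trans c≥2 (≤-trans (≤-reflexive (cong (λ k → nb x y + (k + cnt x m)) (nb-no {x} x≁z))) (+-monoˡ-≤ (cnt x m) (nb≤1 x y))))

        detour : Detour W x y m z ys P
        detour = record
          { sp = sp ; y≁z = y≁z ; walk = wk ; uniq = uniq ; out = λ i → proj₁ (ok i) ; x≁ = λ i → proj₁ (proj₂ (ok i))
          ; x∉P = λ i → proj₂ (proj₂ (ok i)) refl ; ind = ind′ }
          where
          ind′ : ∀ {r s} → r ∈ P → s ∈ P ⊎ s ∈ y ∷ z ∷ m → r ~ s → On z P y r s
          ind′ i (inj₁ j) e = ind i j e z y
          ind′ i (inj₂ (here refl)) e with only-y i e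
          ... | refl = on-q z y
          ind′ i (inj₂ (there (here refl))) e with only-z i e
          ... | refl = on-p z y
          ind′ i (inj₂ (there (there j))) e = ⊥-elim (free i j e)

      -- The hypotheses of `TwoSpokeArc` come from minimality. On the removed arc, a vertex from
      -- `lx` on is separated from `z`, so only `q` can see it; a vertex before `lx` is separated
      -- from `y`, so `q` cannot see it. A further neighbour of `q` therefore lies on `lx ∷ L`.
      two-from-y : ∀ {y m z ys} (rd : Ready y m z ys) → cnt x (y ∷ z ∷ m) ≡ 2 → x ≁ y ⊎ (∃ λ e → In W e × q ~ e × e ≢ y) → ⊥
      two-from-y {y} {m} {z} {ys} rd c2 side′ with last-spoke ys (≤-pred (≤-pred (rest-count 2 (Ready.sp rd) c2)))
      ... | r₀ , rest , lx , L , refl , xlx , L0 , rest≥1 =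
        TwoSpokeArc.c2-contradiction x∉ r₀ rest lx L P detour q∈ q~y xlx L0 c2 att (pick side′)
        where
        open Ready rd
        zm≥1 : 1 ≤ cnt x (z ∷ m)
        zm≥1 = ≤-pred (≤-trans (≤-reflexive (sym c2)) (+-monoˡ-≤ (cnt x (z ∷ m)) (nb≤1 x y)))
        ym≥1 : 1 ≤ nb x y + cnt x m
        ym≥1 = ≤-pred (≤-trans (≤-reflexive (trans (sym c2) (swp (nb x y) (nb x z) (cnt x m)))) (+-monoˡ-≤ (nb x y + cnt x m) (nb≤1 x z)))
          where
          abstract
            swp : ∀ a b c → a + (b + c) ≡ b + (a + c)
            swp = solve-∀
        sep-z : ∀ {e} → e ∈ lx ∷ L → Sep e z
        sep-z {e} (here refl) = sep (extendL (r₀ ∷ rest) L sp) (≤-trans ym≥1 (≤-trans (m≤n+m _ (cnt x L)) (≤-reflexive (sym (wsum-++ (nb x) L (y ∷ m)))))) rest≥1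
        sep-z {e} (there i) with ∈-∃++ i
        ... | L₁ , L₂ , refl = sep (extendL (r₀ ∷ rest ++ lx ∷ L₁) L₂ (subst (Split W y m z) (sym (++-assoc (r₀ ∷ rest) (lx ∷ L₁) (e ∷ L₂))) sp))
                (≤-trans ym≥1 (≤-trans (m≤n+m _ (cnt x L₂)) (≤-reflexive (sym (wsum-++ (nb x) L₂ (y ∷ m))))))
                (∈⇒1≤cnt {x} {lx} {r₀ ∷ rest ++ lx ∷ L₁} (∈-++⁺ʳ (r₀ ∷ rest) (here refl)) xlx)
        sep-y : ∀ {e} → e ∈ r₀ ∷ rest → Sep e y
        sep-y {e} i with ∈-∃++ i
        ... | R₁ , R₂ , eqR = sep (moveL R₁ (R₂ ++ lx ∷ L) (subst (λ l → Split W z l y m) (trans (cong (_++ lx ∷ L) eqR) (++-assoc R₁ (e ∷ R₂) (lx ∷ L))) (swap sp)))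
                (∈⇒1≤cnt {x} {lx} {R₂ ++ lx ∷ L} (∈-++⁺ʳ R₂ (here refl)) xlx)
                (≤-trans zm≥1 (≤-trans (≤-reflexive (+-comm (nb x z) (cnt x m))) (≤-trans (+-monoʳ-≤ (cnt x m) (m≤m+n (nb x z) (cnt x R₁))) (≤-reflexive (sym (wsum-++ (nb x) m (z ∷ R₁)))))))
        att : ∀ {e r} → e ∈ lx ∷ L → r ∈ P → e ~ r → r ≡ q
        att i r∈ a = from-z wk r∈ (~-sym a) (sep-z i)
        pick : x ≁ y ⊎ (∃ λ e → In W e × q ~ e × e ≢ y) → x ≁ y ⊎ (∃ λ e → e ∈ lx ∷ L × q ~ e)
        pick (inj₁ p) = inj₁ p
        pick (inj₂ (e , e∈ , qe , e≢y)) with Split.In⇒at sp e∈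
        ... | _ , at0 (here r) = ⊥-elim (e≢y r)
        ... | _ , atS (at0 i) = ⊥-elim (free q∈ i qe)
        ... | _ , atS (atS (at0 (here refl))) = ⊥-elim (p≢q (sym (only-z q∈ qe)))
        ... | _ , atS (atS (atS (at0 i))) with ∈-++⁻ (r₀ ∷ rest) i
        ...   | inj₂ j = inj₂ (e , j , qe)
        ...   | inj₁ j = ⊥-elim (no-sep (ok q∈) qe q~y (sep-y j))

      data Twice (w : V) : Set where
        once-at-most : cnt w P ≤ 1 → Twice w
        twice        : ∀ X r₁ t r₂ Z → P ≡ X ++ r₁ ∷ t ∷ r₂ ∷ Z → w ~ r₁ → w ~ r₂ → cnt w P ≡ 2 → Twice w

      -- Since P is shortest, the neighbours of w on P are at distance at most two.
      nbs-on-path : ∀ {w y z} → Ok w → Walk z P y → Sep y z → Twice w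
      nbs-on-path {w} {y} {z} okw wk s with find-first (w ~?_) P
      ... | inj₂ none = once-at-most (≤-trans (≤-reflexive (≁⇒cnt≡0 P none)) z≤n)
      ... | inj₁ (first X r₁ R eqP wr₁ X0) with find-last (w ~?_) R
      ...   | inj₂ none = once-at-most (≤-trans (≤-reflexive (trans (cong (cnt w) eqP) (trans (wsum-++ (nb w) X (r₁ ∷ R))
                (cong₂ _+_ (≁⇒cnt≡0 X X0) (trans (cong (nb w r₁ +_) (≁⇒cnt≡0 R none)) (+-identityʳ _)))))) (nb≤1 w r₁))
      ...   | inj₁ (last [] r₂ Z refl wr₂ Z0) = ⊥-elim (tf wr₁ (proj₁ (proj₂ (Walk-++⁻ X (r₂ ∷ Z) (subst (λ l → Walk z l y) eqP wk)))) wr₂)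
      ...   | inj₁ (last (t ∷ []) r₂ Z refl wr₂ Z0) = twice X r₁ t r₂ Z eqP wr₁ wr₂
                (trans (cong (cnt w) eqP) (trans (wsum-++ (nb w) X (r₁ ∷ t ∷ r₂ ∷ Z)) (cong₂ _+_ (≁⇒cnt≡0 X X0)
                  (cong₂ _+_ (nb-yes {w} wr₁) (cong₂ _+_ (nb-no {w} w≁t) (cong₂ _+_ (nb-yes {w} wr₂) (≁⇒cnt≡0 Z Z0)))))))
        where
        w≁t : w ≁ t
        w≁t e = tf wr₁ (proj₁ (proj₂ (Walk-++⁻ X (t ∷ r₂ ∷ Z) (subst (λ l → Walk z l y) eqP wk)))) e
      ...   | inj₁ (last (t ∷ t′ ∷ Y) r₂ Z refl wr₂ Z0) = ⊥-elim (below (X ++ r₁ ∷ w ∷ r₂ ∷ Z) lt ok′ wk′ s)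
        where
        wk₁ : Walk z X r₁ × Walk r₁ (t ∷ t′ ∷ Y ++ r₂ ∷ Z) y
        wk₁ = Walk-++⁻ X (t ∷ t′ ∷ Y ++ r₂ ∷ Z) (subst (λ l → Walk z l y) eqP wk)
        wk′ : Walk z (X ++ r₁ ∷ w ∷ r₂ ∷ Z) y
        wk′ = Walk-++ X (w ∷ r₂ ∷ Z) (proj₁ wk₁) (~-sym wr₁ , wr₂ , proj₂ (Walk-++⁻ (t ∷ t′ ∷ Y) Z (proj₂ wk₁)))
        lt : len (X ++ r₁ ∷ w ∷ r₂ ∷ Z) < len P
        lt = ≤-trans (≤-reflexive (trans (cong suc (len-++ X (r₁ ∷ w ∷ r₂ ∷ Z))) (sym (+-suc (len X) _))))
               (≤-trans (+-monoʳ-≤ (len X) (s≤s (s≤s (s≤s (≤-trans (m≤n+m (suc (len Z)) (len Y)) (≤-reflexive (sym (len-++ Y (r₂ ∷ Z)))))))))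
               (≤-reflexive (sym (trans (cong len eqP) (len-++ X (r₁ ∷ t ∷ t′ ∷ Y ++ r₂ ∷ Z))))))
        inP : ∀ {v} → v ∈ X ++ r₁ ∷ t ∷ t′ ∷ Y ++ r₂ ∷ Z → Ok v
        inP i = ok (subst (_ ∈_) (sym eqP) i)
        ok′ : ∀ {v} → v ∈ X ++ r₁ ∷ w ∷ r₂ ∷ Z → Ok v
        ok′ i with ∈-++⁻ X i
        ... | inj₁ j = inP (∈-++⁺ˡ j)
        ... | inj₂ (here e) = inP (∈-++⁺ʳ X (here e))
        ... | inj₂ (there (here refl)) = okw
        ... | inj₂ (there (there j)) = inP (∈-++⁺ʳ X (there (there (there (∈-++⁺ʳ Y j)))))

      cnt-single : ∀ {w t} → (∀ {r} → r ∈ P → w ~ r → r ≡ t) → cnt w P ≤ 1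
      cnt-single {w} {t} h = ≤-trans (go P h) (uniq t)
        where
        go : ∀ l → (∀ {r} → r ∈ l → w ~ r → r ≡ t) → cnt w l ≤ wsum (δ t) l
        go [] h = z≤n
        go (r ∷ l) h = +-mono-≤ le (go l (λ i → h (there i)))
          where
          le : nb w r ≤ δ t r
          le with w ~? r
          ... | no ne rewrite nb-no {w} ne = z≤n
          ... | yes e rewrite h (here refl) e | δ-refl t = nb≤1 w t

      -- With four kept spokes there is one between `xa` and `xb`. It separates the two outer
      -- pieces, so a vertex `w` off the rim sees only one of them, at most twice. If it also sees
      -- `P` twice, a neighbour in `A` or `B` would give a shorter path between separated vertices,
      -- which leaves at most the spoke at the end of the piece.
      path-bound : ∀ {y m z ys} (rd : Ready y m z ys) → 4 ≤ cnt x (y ∷ z ∷ m) → (en : Ends x y m z) → Bound P en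
      path-bound {y} {m} {z} {ys} rd c≥4 en {w} w∉′ x≁w w≢x = main (In? W w)
        where
        open Ready rd
        open Ends en
        ca cb cp : ℕ
        ca = cnt w (xa ∷ A)
        cb = cnt w (xb ∷ B)
        cp = cnt w P
        m≥2 : 2 ≤ cnt x m
        m≥2 = ≤-pred (≤-pred (≤-trans c≥4 (+-mono-≤ (nb≤1 x y) (+-monoˡ-≤ (cnt x m) (nb≤1 x z)))))
        m≥1 : 1 ≤ cnt x m
        m≥1 = ≤-trans (s≤s z≤n) m≥2
        syz : Sep y z
        syz = sep sp m≥1 h

        -- Some spoke on `ys` separates `w` from `y` or from `z`, so by minimality only one end of
        -- `P` can see it.
        on-rim : w ∈ ys → cp ≤ 1
        on-rim i with ∈-∃++ i
        ... | Y₁ , Y₂ , refl with find-first (x ~?_) Y₂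
        ...   | inj₁ (first X f Y refl xf _) = cnt-single (λ r∈ e → from-y wk r∈ (~-sym e) (sep-sym (sep (moveL Y₁ Y₂ (swap sp))
                  (∈⇒1≤cnt {x} {f} {X ++ f ∷ Y} (∈-++⁺ʳ X (here refl)) xf) (≤-trans m≥1 (≤-trans (m≤m+n _ _) (≤-reflexive (sym (wsum-++ (nb x) m (z ∷ Y₁)))))))))
        ...   | inj₂ none = cnt-single (λ r∈ e → from-z wk r∈ (~-sym e) (sep-sym (sep (moveR Y₁ Y₂ (swap sp)) Y₁≥1
                  (≤-trans m≥1 (≤-trans (m≤n+m _ (cnt x Y₂ + nb x y)) (≤-reflexive (trans (+-assoc (cnt x Y₂) _ _) (sym (wsum-++ (nb x) Y₂ (y ∷ m))))))))))
          where
          Y₁≥1 : 1 ≤ cnt x Y₁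
          Y₁≥1 = ≤-trans h (≤-reflexive (trans (wsum-++ (nb x) Y₁ (w ∷ Y₂)) (trans (cong (cnt x Y₁ +_) (cong₂ _+_ (nb-no {x} x≁w) (≁⇒cnt≡0 Y₂ none))) (+-identityʳ _))))

        module Off (w∉ : ¬ In W w) where
          okw : Ok w
          okw = w∉ , x≁w , w≢x
          ca≤2 : ca ≤ 2
          ca≤2 = Side.≤2 (side x∉ proper sp y≁z en h w∉ x≁w w≢x)
          cb≤2 : cb ≤ 2
          cb≤2 = ≤-trans (≤-reflexive (cong (nb w xb +_) (sym (wsum-reverse (nb w) B))))
                   (Side.≤2 (side x∉ proper (flip-swap sp) (λ e → y≁z (~-sym e)) (flip-ends en) (≤-trans h (≤-reflexive (sym (wsum-reverse (nb x) ys)))) w∉ x≁w w≢x))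
          M≥1 : 1 ≤ cnt x M
          M≥1 = ≤-pred (≤-pred (≤-trans (s≤s (s≤s (s≤s z≤n))) (≤-trans c≥4 (≤-reflexive total))))
            where
            abstract
              lem₁ : ∀ y m z → y + (z + m) ≡ y + (m + (z + 0))
              lem₁ = solve-∀
              lem₂ : ∀ M → 0 + (1 + (M + (1 + 0))) ≡ 2 + M
              lem₂ = solve-∀
            total : cnt x (y ∷ z ∷ m) ≡ 2 + cnt x M
            total = trans (lem₁ (nb x y) (cnt x m) (nb x z)) (trans (cong (nb x y +_) (sym (wsum-++ (nb x) m (z ∷ [])))) (trans (cong (cnt x) eq)
              (trans (wsum-++ (nb x) A (xa ∷ M ++ xb ∷ B)) (trans (cong₂ _+_ A0 (cong₂ _+_ (nb-yes {x} x~a)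
                (trans (wsum-++ (nb x) M (xb ∷ B)) (cong (cnt x M +_) (cong₂ _+_ (nb-yes {x} x~b) B0))))) (lem₂ (cnt x M))))))
          sepAB : ∀ {a b} → a ∈ xa ∷ A → b ∈ xb ∷ B → Sep a b
          sepAB {a} {b} i j with first-nb x M M≥1
          ... | first M₁ f M₂ refl xf _ = sep-pivot sp h (A ++ xa ∷ M₁) (M₂ ++ xb ∷ B)
                  (trans eq (trans (cong (λ l → A ++ xa ∷ l) (++-assoc M₁ (f ∷ M₂) (xb ∷ B))) (sym (++-assoc A (xa ∷ M₁) (f ∷ M₂ ++ xb ∷ B))))) xf (re i) (∈-++⁺ʳ M₂ j)
            where
            re : a ∈ xa ∷ A → a ∈ A ++ xa ∷ M₁
            re (here e) = ∈-++⁺ʳ A (here e)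
            re (there k) = ∈-++⁺ˡ k
          not-both : 1 ≤ ca → 1 ≤ cb → ⊥
          not-both ha hb with first-nb w (xa ∷ A) ha | first-nb w (xb ∷ B) hb
          ... | first X a Y qa wa _ | first X′ b Y′ qb wb _ =
            no-sep okw wa wb (sepAB (subst (a ∈_) (sym qa) (∈-++⁺ʳ X (here refl))) (subst (b ∈_) (sym qb) (∈-++⁺ʳ X′ (here refl))))
          eqB : y ∷ m ++ z ∷ [] ≡ (A ++ xa ∷ M) ++ xb ∷ B
          eqB = trans eq (sym (++-assoc A (xa ∷ M) (xb ∷ B)))
          -- The path from `z` along `P` to `r₁` and through `w` to `a` is shorter, as `w` stands
          -- for `t`, `r₂` and the rest; the spoke `xa` separates `a` from `z`.
          near-y : ∀ {a} X r₁ t r₂ Z → P ≡ X ++ r₁ ∷ t ∷ r₂ ∷ Z → w ~ r₁ → a ∈ A → w ~ a → ⊥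
          near-y {a} X r₁ t r₂ Z eqP wr₁ a∈ wa = below (X ++ r₁ ∷ w ∷ []) lt ok′
              (Walk-++ X (w ∷ []) (proj₁ (Walk-++⁻ X (t ∷ r₂ ∷ Z) (subst (λ l → Walk z l y) eqP wk))) (~-sym wr₁ , wa))
              (sep-pivot sp h A (M ++ xb ∷ B) eq x~a a∈ z∈)
            where
            z∈ : z ∈ M ++ xb ∷ B
            z∈ with last-pos (y ∷ m) (A ++ xa ∷ M) eqB
            ... | inj₁ i = ∈-++⁺ʳ M (there i)
            ... | inj₂ e = ∈-++⁺ʳ M (here e)
            lt : len (X ++ r₁ ∷ w ∷ []) < len P
            lt = ≤-trans (≤-reflexive (trans (cong suc (len-++ X (r₁ ∷ w ∷ []))) (sym (+-suc (len X) 2))))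
                   (≤-trans (+-monoʳ-≤ (len X) (s≤s (s≤s (s≤s z≤n)))) (≤-reflexive (sym (trans (cong len eqP) (len-++ X (r₁ ∷ t ∷ r₂ ∷ Z))))))
            ok′ : ∀ {v} → v ∈ X ++ r₁ ∷ w ∷ [] → Ok v
            ok′ i with ∈-++⁻ X i
            ... | inj₁ j = ok (subst (_ ∈_) (sym eqP) (∈-++⁺ˡ j))
            ... | inj₂ (here e) = ok (subst (_ ∈_) (sym eqP) (∈-++⁺ʳ X (here e)))
            ... | inj₂ (there (here refl)) = okw
          near-z : ∀ {b} X r₁ t r₂ Z → P ≡ X ++ r₁ ∷ t ∷ r₂ ∷ Z → w ~ r₂ → b ∈ B → w ~ b → ⊥
          near-z {b} X r₁ t r₂ Z eqP wr₂ b∈ wb = below (w ∷ r₂ ∷ Z) lt ok′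
              (~-sym wb , wr₂ , proj₂ (proj₂ (proj₂ (Walk-++⁻ X (t ∷ r₂ ∷ Z) (subst (λ l → Walk z l y) eqP wk)))))
              (sep-pivot sp h (A ++ xa ∷ M) B eqB x~b y∈ b∈)
            where
            y∈ : y ∈ A ++ xa ∷ M
            y∈ with head-pos A eq
            ... | inj₁ i = ∈-++⁺ˡ i
            ... | inj₂ e = ∈-++⁺ʳ A (here e)
            lt : len (w ∷ r₂ ∷ Z) < len P
            lt = ≤-trans (m≤n+m (3 + len Z) (len X)) (≤-reflexive (sym (trans (cong len eqP) (len-++ X (r₁ ∷ t ∷ r₂ ∷ Z)))))
            ok′ : ∀ {v} → v ∈ w ∷ r₂ ∷ Z → Ok v
            ok′ (here refl) = okw
            ok′ (there i) = ok (subst (_ ∈_) (sym eqP) (∈-++⁺ʳ X (there (there i))))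
          away : ∀ {c : V} {l} → Uniq (c ∷ l) → cnt w (c ∷ l) ≡ 2 → ∃ λ a → a ∈ l × w ~ a
          away {c} {l} un e with find-two w (c ∷ l) un e
          ... | two-nbs {a} (there a∈) _ _ wa _ _ = a , a∈ , wa
          ... | two-nbs {a} {b} (here refl) (there b∈) _ _ wb _ = b , b∈ , wb
          ... | two-nbs (here refl) (here refl) a≢b _ _ _ = ⊥-elim (a≢b refl)
          few : Twice w → ca + (cb + cp) ≤ 3
          few (once-at-most le) with ca in ea
          ... | 0 = +-mono-≤ cb≤2 le
          ... | suc k with cb in eb
          ...   | 0 = +-mono-≤ (subst (_≤ 2) ea ca≤2) le
          ...   | suc k′ = ⊥-elim (not-both (≤-trans (s≤s z≤n) (≤-reflexive (sym ea))) (≤-trans (s≤s z≤n) (≤-reflexive (sym eb))))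
          few (twice X r₁ t r₂ Z eqP wr₁ wr₂ cp2) with ca in ea | cb in eb
          ... | 0 | 0 = ≤-trans (≤-reflexive cp2) (s≤s (s≤s z≤n))
          ... | 0 | 1 = ≤-trans (≤-reflexive (cong suc cp2)) ≤-refl
          ... | 1 | 0 = ≤-trans (≤-reflexive (cong suc cp2)) ≤-refl
          ... | 0 | 2 = let b , b∈ , wb = away (uniq-B sp en) eb in ⊥-elim (near-z X r₁ t r₂ Z eqP wr₂ b∈ wb)
          ... | 2 | 0 = let a , a∈ , wa = away (uniq-A sp en) ea in ⊥-elim (near-y X r₁ t r₂ Z eqP wr₁ a∈ wa)
          ... | suc _ | suc _ = ⊥-elim (not-both (≤-trans (s≤s z≤n) (≤-reflexive (sym ea))) (≤-trans (s≤s z≤n) (≤-reflexive (sym eb))))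
          ... | 0 | suc (suc (suc _)) = ⊥-elim (<⇒≱ (s≤s (s≤s (s≤s z≤n))) (subst (_≤ 2) eb cb≤2))
          ... | suc (suc (suc _)) | 0 = ⊥-elim (<⇒≱ (s≤s (s≤s (s≤s z≤n))) (subst (_≤ 2) ea ca≤2))

        main : Dec (In W w) → ca + (cb + cp) ≤ 3
        main (yes w∈W) = ≤-trans (≤-reflexive (sym (+-assoc ca cb cp))) (+-mono-≤ (ends-few sp en w∈ys) (on-rim w∈ys))
          where
          w∈ys : w ∈ ys
          w∈ys = left-behind sp P w∉′ w∈W
        main (no w∉) = Off.few w∉ (nbs-on-path (Off.okw w∉) wk syz)

    below-reverse : ∀ (P : List V) → Below (len P) → Below (len (reverse P))
    below-reverse P = subst Below (sym (wsum-reverse (λ _ → 1) P))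

    module _ {P : List V} (mp : MinPath P) (below : Below (len P)) where
      open MinPath mp
      open Min mp below
      private
        mp′ : MinPath (reverse P)
        mp′ = mp-reverse mp
        below′ : Below (len (reverse P))
        below′ = below-reverse P below
        module R = Min mp′ below′

      ready-flip : ∀ {y m z ys} → Ready y m z ys → R.Ready z (reverse m) y (reverse ys)
      ready-flip {y} {m} {z} {ys} rd = record
        { sp = flip-swap sp ; wk = Walk-reverse P wk
        ; free = λ i j → free (reverse⁻ i) (reverse⁻ j)
        ; only-y = λ i → only-z (reverse⁻ i) ; only-z = λ i → only-y (reverse⁻ i)
        ; q~y = p~z ; p~z = q~y
        ; c≥2 = ≤-trans c≥2 (≤-reflexive (sym (flip-count x y m z)))
        ; h = ≤-trans h (≤-reflexive (sym (wsum-reverse (nb x) ys))) }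
        where open Ready rd

      -- What `two-from-y` requires, either at `y` or, for the reversed path, at `z`.
      Witness : V → V → Set
      Witness y z = (x ≁ y ⊎ (∃ λ e → In W e × q ~ e × e ≢ y)) ⊎ (x ≁ z ⊎ (∃ λ e → In W e × p ~ e × e ≢ z))

      finish : ∀ {y m z ys} → Ready y m z ys → (cnt x (y ∷ z ∷ m) ≡ 2 → Witness y z) → ⊥
      finish {y} {m} {z} {ys} rd wit = go (cnt x (y ∷ z ∷ m)) refl
        where
        open Ready rd
        go : ∀ c → cnt x (y ∷ z ∷ m) ≡ c → ⊥
        go 0 e = <⇒≱ c≥2 (≤-trans (≤-reflexive e) z≤n)
        go 1 e = <⇒≱ c≥2 (≤-reflexive e)
        go 2 e with wit e
        ... | inj₁ w = two-from-y rd e w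
        ... | inj₂ w = R.two-from-y (ready-flip rd) (trans (flip-count x y m z) e) w
        go 3 e = Detour.≢3 detour x∉ e
        go (suc (suc (suc (suc c)))) e = four-spokes detour c≥4 h (λ en → path-bound rd c≥4 en)
          where
          c≥4 : 4 ≤ cnt x (y ∷ z ∷ m)
          c≥4 = ≤-trans (s≤s (s≤s (s≤s (s≤s z≤n)))) (≤-reflexive (sym e))

    record Pulled (t y₀ : V) (M₁ : List V) (xa : V) (R : List V) (z₀ : V) (ys₀ : List V) : Set where
      field
        y      : V
        U ys   : List V
        sp     : Split W y (U ++ R) z₀ ys
        t~y    : t ~ y
        U-free : ∀ {v} → v ∈ U → t ≁ v
        U⊆     : ∀ {v} → v ∈ U → v ∈ M₁ ++ xa ∷ []
        spoke  : 1 ≤ nb x y + cnt x U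
        more   : cnt x ys₀ ≤ cnt x ys
        pos    : (y ≡ y₀ × xa ∈ U) ⊎ y ∈ M₁ ++ xa ∷ []

    -- The end moves to the last neighbour of `t` no further than the spoke `xa`. So `U` is free of
    -- `t`, and `xa` is kept, on `U` or as the new end.
    pull : ∀ {t y₀} M₁ {xa} R {z₀ ys₀} → Split W y₀ ((M₁ ++ xa ∷ []) ++ R) z₀ ys₀ → t ~ y₀ → x ~ xa → Pulled t y₀ M₁ xa R z₀ ys₀
    pull {t} {y₀} M₁ {xa} R {z₀} {ys₀} sp ty xxa with find-last (t ~?_) (M₁ ++ xa ∷ [])
    ... | inj₂ none = record
      { sp = sp ; t~y = ty ; U-free = none ; U⊆ = λ i → i ; more = ≤-refl ; pos = inj₁ (refl , ∈-++⁺ʳ M₁ (here refl))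
      ; spoke = ≤-trans (∈⇒1≤cnt {x} {xa} {M₁ ++ xa ∷ []} (∈-++⁺ʳ M₁ (here refl)) xxa) (m≤n+m _ (nb x y₀)) }
    ... | inj₁ (last X₁ y X₂ eq ty′ X₂0) = record
      { sp = moveL X₁ (X₂ ++ R) (subst (λ l → Split W y₀ l z₀ ys₀) (trans (cong (_++ R) eq) (++-assoc X₁ (y ∷ X₂) R)) sp)
      ; t~y = ty′ ; U-free = X₂0 ; U⊆ = λ i → subst (_ ∈_) (sym eq) (∈-++⁺ʳ X₁ (there i))
      ; more = ≤-trans (m≤m+n _ _) (≤-reflexive (sym (wsum-++ (nb x) ys₀ (y₀ ∷ X₁))))
      ; pos = inj₂ (subst (y ∈_) (sym eq) (∈-++⁺ʳ X₁ (here refl)))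
      ; spoke = spoke′ (last-pos M₁ X₁ eq) }
      where
      spoke′ : xa ∈ X₂ ⊎ xa ≡ y → 1 ≤ nb x y + cnt x X₂
      spoke′ (inj₁ i) = ≤-trans (∈⇒1≤cnt i xxa) (m≤n+m _ (nb x y))
      spoke′ (inj₂ refl) = ≤-trans (≤-reflexive (sym (nb-yes {x} xxa))) (m≤m+n _ _)

    -- By minimality only `q` sees the arc before `xb` and only `p` sees it after `xa`. As `p` and
    -- `q` differ, `P` does not see `M₂`. Pulling in the two ends, each up to its spoke, frees the
    -- rest of the arc and keeps both spokes.
    module CaseA {P : List V} (mp : MinPath P) (below : Below (len P))
      {y₀ : V} (M₁ : List V) {xa : V} (M₂ : List V) {xb : V} (M₃ : List V) {z₀ : V} {ys₀ : List V}
      (sp₀ : Split W y₀ (M₁ ++ xa ∷ M₂ ++ xb ∷ M₃) z₀ ys₀) (wk₀ : Walk z₀ P y₀) (xxa : x ~ xa) (xxb : x ~ xb) (h₀ : 1 ≤ cnt x ys₀)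
      (p~z₀ : MinPath.p mp ~ z₀) (q~y₀ : MinPath.q mp ~ y₀) where
      open MinPath mp
      open Min mp below

      attL : ∀ {r v} → r ∈ P → v ∈ y₀ ∷ M₁ ++ xa ∷ M₂ → r ~ v → r ≡ q
      attL r∈ v∈ e = from-z wk₀ r∈ e (sep-pivot sp₀ h₀ (y₀ ∷ M₁ ++ xa ∷ M₂) (M₃ ++ z₀ ∷ []) eq xxb v∈ (∈-++⁺ʳ M₃ (here refl)))
        where
        eq : y₀ ∷ (M₁ ++ xa ∷ M₂ ++ xb ∷ M₃) ++ z₀ ∷ [] ≡ (y₀ ∷ M₁ ++ xa ∷ M₂) ++ xb ∷ M₃ ++ z₀ ∷ []
        eq = cong (y₀ ∷_) (trans (cong (_++ z₀ ∷ []) (sym (++-assoc M₁ (xa ∷ M₂) (xb ∷ M₃)))) (++-assoc (M₁ ++ xa ∷ M₂) (xb ∷ M₃) (z₀ ∷ [])))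

      attR : ∀ {r v} → r ∈ P → v ∈ (M₂ ++ xb ∷ M₃) ++ z₀ ∷ [] → r ~ v → r ≡ p
      attR r∈ v∈ e = from-y wk₀ r∈ e (sep-pivot sp₀ h₀ (y₀ ∷ M₁) ((M₂ ++ xb ∷ M₃) ++ z₀ ∷ []) eq xxa (here refl) v∈)
        where
        eq : y₀ ∷ (M₁ ++ xa ∷ M₂ ++ xb ∷ M₃) ++ z₀ ∷ [] ≡ (y₀ ∷ M₁) ++ xa ∷ (M₂ ++ xb ∷ M₃) ++ z₀ ∷ []
        eq = cong (y₀ ∷_) (++-assoc M₁ (xa ∷ M₂ ++ xb ∷ M₃) (z₀ ∷ []))

      abstract
       A : Pulled q y₀ M₁ xa (M₂ ++ xb ∷ M₃) z₀ ys₀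
       A = pull M₁ (M₂ ++ xb ∷ M₃) (subst (λ l → Split W y₀ l z₀ ys₀) (sym (++-assoc M₁ (xa ∷ []) (M₂ ++ xb ∷ M₃))) sp₀) q~y₀ xxa
      module A = Pulled A

      revM : reverse (A.U ++ M₂ ++ xb ∷ M₃) ≡ (reverse M₃ ++ xb ∷ []) ++ reverse M₂ ++ reverse A.U
      revM = trans (cong reverse (sym (++-assoc A.U M₂ (xb ∷ M₃)))) (trans (reverse-mid (A.U ++ M₂) M₃)
               (trans (cong (λ l → reverse M₃ ++ xb ∷ l) (reverse-++ A.U M₂)) (sym (++-assoc (reverse M₃) (xb ∷ []) (reverse M₂ ++ reverse A.U)))))

      abstract
       B : Pulled p z₀ (reverse M₃) xb (reverse M₂ ++ reverse A.U) A.y (reverse A.ys)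
       B = pull (reverse M₃) (reverse M₂ ++ reverse A.U) (subst (λ l → Split W z₀ l A.y (reverse A.ys)) revM (flip-swap A.sp)) p~z₀ xxb
      module B = Pulled B

      y z : V
      y = A.y
      z = B.y
      m : List V
      m = reverse (B.U ++ reverse M₂ ++ reverse A.U)

      xa-part : ∀ {v} → v ∈ M₁ ++ xa ∷ [] → v ∈ y₀ ∷ M₁ ++ xa ∷ M₂
      xa-part i with ∈-++⁻ M₁ i
      ... | inj₁ j = there (∈-++⁺ˡ j)
      ... | inj₂ (here e) = there (∈-++⁺ʳ M₁ (here e))
      xb-part : ∀ {v} → v ∈ reverse M₃ ++ xb ∷ [] → v ∈ (M₂ ++ xb ∷ M₃) ++ z₀ ∷ []
      xb-part i with ∈-++⁻ (reverse M₃) i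
      ... | inj₁ j = ∈-++⁺ˡ (∈-++⁺ʳ M₂ (there (reverse⁻ j)))
      ... | inj₂ (here e) = ∈-++⁺ˡ (∈-++⁺ʳ M₂ (here e))

      free : ∀ {r v} → r ∈ P → v ∈ m → r ≁ v
      free {r} {v} r∈ v∈ e with ∈-++⁻ B.U (reverse⁻ v∈)
      ... | inj₁ i with attR r∈ (xb-part (B.U⊆ i)) e
      ...   | refl = B.U-free i e
      free {r} {v} r∈ v∈ e | inj₂ j with ∈-++⁻ (reverse M₂) j
      ... | inj₂ k with attL r∈ (xa-part (A.U⊆ (reverse⁻ k))) e
      ...   | refl = A.U-free (reverse⁻ k) e
      free {r} {v} r∈ v∈ e | inj₂ j | inj₁ k =
        p≢q (trans (sym (attR r∈ (∈-++⁺ˡ (∈-++⁺ˡ v∈M₂)) e)) (attL r∈ (there (∈-++⁺ʳ M₁ (there v∈M₂))) e))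
        where
        v∈M₂ : v ∈ M₂
        v∈M₂ = reverse⁻ k

      only-y : ∀ {r} → r ∈ P → r ~ y → r ≡ q
      only-y r∈ e with A.pos
      ... | inj₁ (y≡ , _) = attL r∈ (here y≡) e
      ... | inj₂ i = attL r∈ (xa-part i) e
      only-z : ∀ {r} → r ∈ P → r ~ z → r ≡ p
      only-z r∈ e with B.pos
      ... | inj₁ (z≡ , _) = attR r∈ (∈-++⁺ʳ (M₂ ++ xb ∷ M₃) (here z≡)) e
      ... | inj₂ i = attR r∈ (xb-part i) e

      abstract
        regroup : ∀ y z V M U → y + (z + (V + (M + U))) ≡ (y + U) + (z + V) + M
        regroup = solve-∀
      count-m : cnt x (y ∷ z ∷ m) ≡ (nb x y + cnt x A.U) + (nb x z + cnt x B.U) + cnt x M₂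
      count-m = trans (cong (λ k → nb x y + (nb x z + k)) (trans (wsum-reverse (nb x) (B.U ++ reverse M₂ ++ reverse A.U))
                  (trans (wsum-++ (nb x) B.U (reverse M₂ ++ reverse A.U)) (cong (cnt x B.U +_) (trans (wsum-++ (nb x) (reverse M₂) (reverse A.U))
                    (cong₂ _+_ (wsum-reverse (nb x) M₂) (wsum-reverse (nb x) A.U)))))))
                  (regroup (nb x y) (nb x z) (cnt x B.U) (cnt x M₂) (cnt x A.U))

      ready : Ready y m z (reverse B.ys)
      ready = record
        { sp = flip-swap B.sp ; wk = rewalk wk₀ B.t~y A.t~y ; free = free ; only-y = only-y ; only-z = only-z ; q~y = A.t~y ; p~z = B.t~y
        ; c≥2 = ≤-trans (+-mono-≤ A.spoke B.spoke) (≤-trans (m≤m+n _ (cnt x M₂)) (≤-reflexive (sym count-m)))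
        ; h = ≤-trans h₀ (≤-trans A.more (≤-trans (≤-reflexive (sym (wsum-reverse (nb x) A.ys))) (≤-trans B.more (≤-reflexive (sym (wsum-reverse (nb x) B.ys)))))) }

      -- An end that was moved leaves `y₀` or `z₀` behind as a second neighbour of `q` or `p`. If
      -- neither was moved and `y` is a spoke, then `y`, `xa` and a spoke on the side of `z` are
      -- more than two.
      witness : cnt x (y ∷ z ∷ m) ≡ 2 → Witness mp below y z
      witness c2 with y₀ ≟ y | z₀ ≟ z | x ~? y
      ... | no ne | _ | _ = inj₁ (inj₂ (y₀ , In-y sp₀ , q~y₀ , ne))
      ... | yes _ | no ne | _ = inj₂ (inj₂ (z₀ , In-z sp₀ , p~z₀ , ne))
      ... | yes _ | yes _ | no x≁y = inj₁ (inj₁ x≁y)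
      ... | yes y₀≡y | yes _ | yes xy with A.pos
      ...   | inj₁ (_ , xa∈) = ⊥-elim (<⇒≱ (+-mono-≤ (+-mono-≤ (≤-reflexive (sym (nb-yes {x} xy))) (∈⇒1≤cnt xa∈ xxa)) B.spoke)
                (≤-trans (m≤m+n _ (cnt x M₂)) (≤-reflexive (trans (sym count-m) c2))))
      ...   | inj₂ i = ⊥-elim (y₀∉ (subst (_∈ M₁ ++ xa ∷ []) (sym y₀≡y) i))
        where
        y₀∉ : y₀ ∉ M₁ ++ xa ∷ []
        y₀∉ j with ∈-++⁻ M₁ j
        ... | inj₁ k = apart (Split.ap sp₀) (λ ()) (Split.at-y sp₀) (Split.in-m sp₀ (∈-++⁺ˡ k))
        ... | inj₂ (here refl) = apart (Split.ap sp₀) (λ ()) (Split.at-y sp₀) (Split.in-m sp₀ (∈-++⁺ʳ M₁ (here refl)))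

      contradiction-A : ⊥
      contradiction-A = finish mp below ready witness

    ends-adj : ∀ {P} (mp : MinPath P) {y z} → Walk z P y → MinPath.p mp ~ z × MinPath.q mp ~ y
    ends-adj mp {y} {z} wk = ~-sym (proj₁ (subst (λ l → Walk z l y) eq₁ wk)) , proj₂ (Walk-++⁻ P′ [] (subst (λ l → Walk z l y) eq₂ wk))
      where open MinPath mp

    case-A : ∀ {P} (mp : MinPath P) (below : Below (len P)) {y₀ m₀ z₀ ys₀} → Split W y₀ m₀ z₀ ys₀ → Walk z₀ P y₀ → 2 ≤ cnt x m₀ → 1 ≤ cnt x ys₀ → ⊥
    case-A mp below {m₀ = m₀} sp wk h₂ h₁ with first-nb x m₀ (≤-trans (s≤s z≤n) h₂)
    ... | first M₁ xa M′ refl xxa M₁0 with last-nb x M′ M′≥1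
      where
      M′≥1 : 1 ≤ cnt x M′
      M′≥1 = ≤-pred (≤-trans h₂ (≤-reflexive (trans (wsum-++ (nb x) M₁ (xa ∷ M′)) (cong₂ _+_ (≁⇒cnt≡0 M₁ M₁0) (cong (_+ cnt x M′) (nb-yes {x} xxa))))))
    ...   | last M₂ xb M₃ refl xxb _ = CaseA.contradiction-A mp below M₁ M₂ M₃ sp wk xxa xxb h₁ (proj₁ (ends-adj mp wk)) (proj₂ (ends-adj mp wk))

    sep-cross : ∀ {y m z ys} → Split W y m z ys → x ~ y → x ~ z → ∀ {u v} → u ∈ m → v ∈ ys → Sep u v
    sep-cross {y} {m} {z} {ys} sp xy xz {u} {v} i j with ∈-∃++ i | ∈-∃++ j
    ... | A , B , refl | C , D , refl = sep (extendR C (D ++ y ∷ A) (subst (Split W u B z) (++-assoc C (v ∷ D) (y ∷ A)) (moveL A B sp)))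
            (∈⇒1≤cnt {x} {z} {B ++ z ∷ C} (∈-++⁺ʳ B (here refl)) xz) (∈⇒1≤cnt {x} {y} {D ++ y ∷ A} (∈-++⁺ʳ D (here refl)) xy)

    -- With `P` ending at `v′` instead of `z₀`, minimality shows that only `q` sees `m₀`. Its last
    -- neighbour `y` there is the new end. A spoke remains from `y` on, since otherwise `q` would
    -- see the separated vertices `y₀` and `y`. The old end `y₀` is the further neighbour of `q`
    -- needed when just two spokes are kept.
    case-C : ∀ {P} (mp : MinPath P) (below : Below (len P)) {y₀ m₀ z₀ ys₀} → Split W y₀ m₀ z₀ ys₀ → Walk z₀ P y₀ → x ~ y₀ → x ~ z₀ →
      1 ≤ cnt x m₀ → 1 ≤ cnt x ys₀ → ∀ {v v′} → v ∈ m₀ → MinPath.q mp ~ v → v′ ∈ ys₀ → MinPath.p mp ~ v′ → ⊥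
    case-C {P} mp below {y₀} {m₀} {z₀} {ys₀} sp₀ wk₀ xy₀ xz₀ hm hys {v} {v′} v∈ qv v′∈ pv′ with find-last (MinPath.q mp ~?_) m₀
    ... | inj₂ none = none v∈ qv
    ... | inj₁ (last X y Y refl qy Y0) = finish mp below ready (λ _ → inj₁ (inj₂ (y₀ , In-y sp₀ , q~y₀ , y₀≢y)))
      where
      open MinPath mp
      open Min mp below
      p~z₀ : p ~ z₀
      p~z₀ = proj₁ (ends-adj mp wk₀)
      q~y₀ : q ~ y₀
      q~y₀ = proj₂ (ends-adj mp wk₀)
      y∈ : y ∈ X ++ y ∷ Y
      y∈ = ∈-++⁺ʳ X (here refl)
      y₀≢y : y₀ ≢ y
      y₀≢y refl = apart (Split.ap sp₀) (λ ()) (Split.at-y sp₀) (Split.in-m sp₀ y∈)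
      is-q : ∀ {r u} → r ∈ P → u ∈ X ++ y ∷ Y → r ~ u → r ≡ q
      is-q r∈ u∈ e = from-z (rewalk wk₀ pv′ q~y₀) r∈ e (sep-cross sp₀ xy₀ xz₀ u∈ v′∈)
      spoke : 1 ≤ cnt x (y ∷ Y)
      spoke with find-first (x ~?_) (y ∷ Y)
      ... | inj₁ (first C f D eq xf _) = ∈⇒1≤cnt {x} {f} {y ∷ Y} (subst (f ∈_) (sym eq) (∈-++⁺ʳ C (here refl))) xf
      ... | inj₂ none = ⊥-elim (no-sep (ok q∈) q~y₀ qy (sep (moveR X Y sp₀) X≥1 (∈⇒1≤cnt {x} {z₀} {Y ++ z₀ ∷ ys₀} (∈-++⁺ʳ Y (here refl)) xz₀)))
        where
        X≥1 : 1 ≤ cnt x X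
        X≥1 = ≤-trans hm (≤-reflexive (trans (wsum-++ (nb x) X (y ∷ Y)) (trans (cong (cnt x X +_) (≁⇒cnt≡0 (y ∷ Y) none)) (+-identityʳ _))))
      abstract
        swp : ∀ a b c → b + (a + c) ≡ a + (b + c)
        swp = solve-∀
      ready : Ready y Y z₀ (ys₀ ++ y₀ ∷ X)
      ready = record
        { sp = moveL X Y sp₀ ; wk = rewalk wk₀ p~z₀ qy
        ; free = λ {r} {u} r∈ u∈ e → Y0 u∈ (subst (_~ u) (is-q r∈ (∈-++⁺ʳ X (there u∈)) e) e)
        ; only-y = λ r∈ e → is-q r∈ y∈ e
        ; only-z = λ r∈ e → from-y wk₀ r∈ e (sep sp₀ hm hys)
        ; q~y = qy ; p~z = p~z₀
        ; c≥2 = ≤-trans (+-mono-≤ (≤-reflexive (sym (nb-yes {x} xz₀))) spoke) (≤-reflexive (swp (nb x y) (nb x z₀) (cnt x Y)))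
        ; h = ∈⇒1≤cnt {x} {y₀} {ys₀ ++ y₀ ∷ X} (∈-++⁺ʳ ys₀ (here refl)) xy₀ }

    -- Both arcs between y₀ and z₀ contain exactly one spoke, so y₀ and z₀ are spokes as well.
    module CaseC {P : List V} (mp : MinPath P) (below : Below (len P)) {y₀ : V} {m₀ : List V} {z₀ : V} {ys₀ : List V}
      (sp₀ : Split W y₀ m₀ z₀ ys₀) (wk₀ : Walk z₀ P y₀) (m1 : cnt x m₀ ≡ 1) (ys1 : cnt x ys₀ ≡ 1) where
      open MinPath mp
      open Min mp below

      private
        abstract
          swp : ∀ a b → a + (b + 1) + 1 ≡ 2 + (a + b)
          swp = solve-∀
      both : 2 ≤ nb x y₀ + nb x z₀
      both = ≤-pred (≤-pred (≤-trans k≥4 (≤-reflexive (trans (sym (closed-count x sp₀)) (trans (cong₂ (λ a b → nb x y₀ + (nb x z₀ + a) + b) m1 ys1) (swp (nb x y₀) (nb x z₀)))))))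
      xy₀ : x ~ y₀
      xy₀ with x ~? y₀
      ... | yes e = e
      ... | no ne = ⊥-elim (<⇒≱ both (≤-trans (≤-reflexive (cong (_+ nb x z₀) (nb-no {x} ne))) (nb≤1 x z₀)))
      xz₀ : x ~ z₀
      xz₀ with x ~? z₀
      ... | yes e = e
      ... | no ne = ⊥-elim (<⇒≱ both (≤-trans (≤-reflexive (trans (cong (nb x y₀ +_) (nb-no {x} ne)) (+-identityʳ _))) (nb≤1 x y₀)))
      hm : 1 ≤ cnt x m₀
      hm = ≤-reflexive (sym m1)
      hys : 1 ≤ cnt x ys₀
      hys = ≤-reflexive (sym ys1)
      p~z₀ : p ~ z₀
      p~z₀ = proj₁ (ends-adj mp wk₀)
      q~y₀ : q ~ y₀
      q~y₀ = proj₂ (ends-adj mp wk₀)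

      -- No end has to be moved, and the kept arc has the spokes `y₀`, `z₀` and one inside: exactly
      -- three.
      unattached : (∀ {r v} → r ∈ P → v ∈ m₀ → r ≁ v) → ⊥
      unattached free = finish mp below ready (λ e → ⊥-elim (<⇒≢ (≤-reflexive (sym c3)) (sym e)))
        where
        c3 : cnt x (y₀ ∷ z₀ ∷ m₀) ≡ 3
        c3 = cong₂ _+_ (nb-yes {x} xy₀) (cong₂ _+_ (nb-yes {x} xz₀) m1)
        ready : Ready y₀ m₀ z₀ ys₀
        ready = record
          { sp = sp₀ ; wk = wk₀ ; free = free
          ; only-y = λ r∈ e → from-z wk₀ r∈ e (sep sp₀ hm hys) ; only-z = λ r∈ e → from-y wk₀ r∈ e (sep sp₀ hm hys)
          ; q~y = q~y₀ ; p~z = p~z₀ ; c≥2 = ≤-trans (s≤s (s≤s z≤n)) (≤-reflexive (sym c3)) ; h = hys }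

      -- As `r` is not an end of `P`, the piece of `P` between `r` and `r′` is shorter than `P`, yet
      -- it joins separated vertices.
      inner : ∀ {r r′ v v′} → r ∈ P → r′ ∈ P → r ≢ p → r ≢ q → r ~ v → r′ ~ v′ → Sep v v′ → ⊥
      inner {r} {r′} {v} {v′} r∈ r′∈ r≢p r≢q e e′ s with ∈-∃++ r∈
      ... | A , B , eqP with ∈-++⁻ A (subst (r′ ∈_) eqP r′∈)
      ...   | inj₂ (here refl) = no-sep (ok r∈) e e′ s
      ...   | inj₁ i with ∈-∃++ i
      ...     | A₁ , A₂ , refl = below (r′ ∷ A₂ ++ r ∷ []) lt ok′ (~-sym e′ , Walk-++ A₂ [] (proj₂ (Walk-++⁻ A₁ A₂ (proj₁ (Walk-++⁻ (A₁ ++ r′ ∷ A₂) B (subst (λ l → Walk z₀ l y₀) eqP wk₀))))) e) s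
        where
        B≥1 : 1 ≤ len B
        B≥1 = go B (last-pos P′ (A₁ ++ r′ ∷ A₂) (trans (sym eq₂) eqP))
          where
          go : ∀ B → q ∈ B ⊎ q ≡ r → 1 ≤ len B
          go []      (inj₂ q≡r) = ⊥-elim (r≢q (sym q≡r))
          go (_ ∷ _) _          = s≤s z≤n
        lt : len (r′ ∷ A₂ ++ r ∷ []) < len P
        lt = ≤-trans (s≤s (s≤s (≤-reflexive (len-++ A₂ (r ∷ []))))) (≤-trans (≤-trans (≤-trans (≤-reflexive (bump (len A₂))) (+-monoʳ-≤ (suc (len A₂)) (s≤s B≥1))) (m≤n+m _ (len A₁)))
               (≤-reflexive (trans (sym (+-assoc (len A₁) (suc (len A₂)) (suc (len B)))) (sym (trans (cong len eqP) (trans (len-++ (A₁ ++ r′ ∷ A₂) (r ∷ B)) (cong (_+ suc (len B)) (len-++ A₁ (r′ ∷ A₂)))))))))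
          where
          abstract
            bump : ∀ a → suc (suc (a + 1)) ≡ suc a + 2
            bump = solve-∀
        ok′ : ∀ {u} → u ∈ r′ ∷ A₂ ++ r ∷ [] → Ok u
        ok′ (here refl) = ok r′∈
        ok′ (there k) with ∈-++⁻ A₂ k
        ... | inj₁ k′ = ok (subst (_ ∈_) (sym eqP) (∈-++⁺ˡ (∈-++⁺ʳ A₁ (there k′))))
        ... | inj₂ (here refl) = ok r∈
      inner {r} {r′} {v} {v′} r∈ r′∈ r≢p r≢q e e′ s | A , B , eqP | inj₂ (there i) with ∈-∃++ i
      ...     | B₁ , B₂ , refl = below (r ∷ B₁ ++ r′ ∷ []) lt ok′ (~-sym e , Walk-++ B₁ [] (proj₁ (Walk-++⁻ B₁ B₂ (proj₂ (Walk-++⁻ A (B₁ ++ r′ ∷ B₂) (subst (λ l → Walk z₀ l y₀) eqP wk₀))))) e′) (sep-sym s)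
        where
        A≥1 : 1 ≤ len A
        A≥1 = go A (head-pos A (trans (sym eq₁) eqP))
          where
          go : ∀ A → p ∈ A ⊎ p ≡ r → 1 ≤ len A
          go []      (inj₂ p≡r) = ⊥-elim (r≢p (sym p≡r))
          go (_ ∷ _) _          = s≤s z≤n
        lt : len (r ∷ B₁ ++ r′ ∷ []) < len P
        lt = ≤-trans (+-mono-≤ A≥1 (s≤s (≤-trans (≤-reflexive (len-++ B₁ (r′ ∷ []))) (≤-trans (+-monoʳ-≤ (len B₁) (s≤s z≤n)) (≤-reflexive (sym (len-++ B₁ (r′ ∷ B₂))))))))
               (≤-reflexive (sym (trans (cong len eqP) (len-++ A (r ∷ B₁ ++ r′ ∷ B₂)))))
        ok′ : ∀ {u} → u ∈ r ∷ B₁ ++ r′ ∷ [] → Ok u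
        ok′ (here refl) = ok r∈
        ok′ (there k) with ∈-++⁻ B₁ k
        ... | inj₁ k′ = ok (subst (_ ∈_) (sym eqP) (∈-++⁺ʳ A (there (∈-++⁺ˡ k′))))
        ... | inj₂ (here refl) = ok r′∈

      -- By `inner` the attachment to `m₀` comes from an end of `P`. Minimality puts the one to
      -- `ys₀` at the opposite end, and `case-C` applies, reversed if that is needed.
      attached : ∀ {r v r′ v′} → r ∈ P → v ∈ m₀ → r ~ v → r′ ∈ P → v′ ∈ ys₀ → r′ ~ v′ → ⊥
      attached {r} {v} {r′} {v′} r∈ v∈ e r′∈ v′∈ e′ with r ≟ q | r ≟ p
      ... | no r≢q | no r≢p = inner r∈ r′∈ r≢p r≢q e e′ (sep-cross sp₀ xy₀ xz₀ v∈ v′∈)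
      ... | yes refl | _ with from-y (rewalk wk₀ p~z₀ e) r′∈ e′ (sep-cross sp₀ xy₀ xz₀ v∈ v′∈)
      ...   | refl = case-C mp below sp₀ wk₀ xy₀ xz₀ hm hys v∈ e v′∈ e′
      attached {r} {v} {r′} {v′} r∈ v∈ e r′∈ v′∈ e′ | no _ | yes refl
        with from-z (rewalk wk₀ e q~y₀) r′∈ e′ (sep-sym (sep-cross sp₀ xy₀ xz₀ v∈ v′∈))
      ...   | refl = case-C (mp-reverse mp) (below-reverse P below) (flip-swap sp₀) (Walk-reverse P wk₀) xz₀ xy₀
                (≤-trans hm (≤-reflexive (sym (wsum-reverse (nb x) m₀)))) (≤-trans hys (≤-reflexive (sym (wsum-reverse (nb x) ys₀))))
                (reverse⁺ v∈) e (reverse⁺ v′∈) e′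

-- The closed neighbourhood of the hub as a star cutset

module NoWheel {n : ℕ} (G : Graph n)
  (tf : Holes.Triangle-free G) (no-isk4 : ¬ HasISK4 G) (no-star : Holes.No-star G) where

  open Holes G
  open Wheels G tf no-isk4

  module Final {W : Weight} {x : V} (x∉ : ¬ In W x) (proper : Proper W x) (k≥4 : 4 ≤ W (nb x)) (no-smaller : No-smaller W x) where

    open Spokes x∉ proper k≥4 no-smaller

    module Long (p r : V) (P₁ : List V) (below : Below (len (p ∷ r ∷ P₁))) (ok : ∀ {v} → v ∈ p ∷ r ∷ P₁ → Ok v)
      {y z : V} (wk : Walk z (p ∷ r ∷ P₁) y) (s : Sep y z) where

      private
        P : List V
        P = p ∷ r ∷ P₁

        module S = Shortest Ok P wk ok (λ P′ lt wk′ ok′ → below P′ lt ok′ wk′ s)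

        z≢y : z ≢ y
        z≢y e = Split.y≢z (Sep.sp s) (sym e)

        un : Uniq (z ∷ y ∷ P)
        un = S.uniq z≢y

        ≢z : ∀ {v} → v ∈ P → v ≢ z
        ≢z i refl = Uniq-head z (y ∷ P) un (there i)
        ≢y : ∀ {v} → v ∈ P → v ≢ y
        ≢y i refl = Uniq-head y P (Uniq-tail z (y ∷ P) un) i
        unP : Uniq P
        unP = Uniq-tail y P (Uniq-tail z (y ∷ P) un)

        mp : MinPath P
        mp = go (init-last p (r ∷ P₁))
          where
          last∈ : ∀ P′ {q} → P ≡ P′ ++ q ∷ [] → q ∈ r ∷ P₁
          last∈ [] e with proj₂ (∷-injective e)
          ... | ()
          last∈ (_ ∷ P′) e = subst (_ ∈_) (sym (proj₂ (∷-injective e))) (∈-++⁺ʳ P′ (here refl))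
          go : (∃ λ P′ → ∃ λ q → P ≡ P′ ++ q ∷ []) → MinPath P
          go (P′ , q , e) = record
            { p = p ; q = q ; P″ = r ∷ P₁ ; P′ = P′ ; eq₁ = refl ; eq₂ = e ; ok = ok ; uniq = unP
            ; ind = λ i j a z′ y′ → On-change P (S.induced (there (there i)) (there (there j)) a) (≢z i) (≢z j) (≢y i) (≢y j)
            ; p≢q = λ { refl → Uniq-head p (r ∷ P₁) unP (last∈ P′ e) } }

        Attach : V → Set
        Attach v = ∃ λ r′ → r′ ∈ P × r′ ~ v
        attach? : ∀ v → Dec (Attach v)
        attach? v with find-first (_~? v) P
        ... | inj₁ (first A r′ B eq e _) = yes (r′ , subst (r′ ∈_) (sym eq) (∈-++⁺ʳ A (here refl)) , e)
        ... | inj₂ none = no λ (r′ , i , e) → none i e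

      long : ⊥
      long = go (Sep.sp s) (Sep.h₁ s) (Sep.h₂ s)
       where
       go : ∀ {m ys} → Split W y m z ys → 1 ≤ cnt x m → 1 ≤ cnt x ys → ⊥
       go {m} {ys} sp h₁ h₂ with m≤n⇒m<n∨m≡n h₁ | m≤n⇒m<n∨m≡n h₂
       ... | inj₁ m≥2 | _ = case-A mp below sp wk m≥2 h₂
       ... | inj₂ _ | inj₁ ys≥2 = case-A (mp-reverse mp) (below-reverse P below) (swap sp) (Walk-reverse P wk) ys≥2 h₁
       ... | inj₂ m≡1 | inj₂ ys≡1 with find-first attach? m | find-first attach? ys
       ...   | inj₂ none | _ = CaseC.unattached mp below sp wk (sym m≡1) (sym ys≡1) (λ i j e → none j (_ , i , e))
       ...   | inj₁ _ | inj₂ none = CaseC.unattached (mp-reverse mp) (below-reverse P below) (swap sp) (Walk-reverse P wk) (sym ys≡1) (sym m≡1)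
                  (λ i j e → none j (_ , reverse⁻ i , e))
       ...   | inj₁ (first A v B eq (r₁ , r₁∈ , e₁) _) | inj₁ (first A′ v′ B′ eq′ (r₂ , r₂∈ , e₂) _) =
                  CaseC.attached mp below sp wk (sym m≡1) (sym ys≡1) r₁∈ (subst (v ∈_) (sym eq) (∈-++⁺ʳ A (here refl))) e₁
                    r₂∈ (subst (v′ ∈_) (sym eq′) (∈-++⁺ʳ A′ (here refl))) e₂

    -- Strong induction on the number of vertices off the rim: none is excluded by `sep-≁`, one by
    -- `no-sep`, and from two on the first and the last vertex are distinct and `Long` applies.
    connected : ∀ l → Below l
    connected = <-rec Below step′
      where
      step′ : ∀ l → (∀ {l′} → l′ < l → Below l′) → Below l
      step′ l ih P lt ok wk s = go P (ih lt) ok wk s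
        where
        go : ∀ P → Below (len P) → (∀ {r} → r ∈ P → Ok r) → ∀ {y z} → Walk z P y → Sep y z → ⊥
        go [] _ ok wk s = sep-≁ s (~-sym wk)
        go (p ∷ []) _ ok (zp , py) s = no-sep (ok (here refl)) py (~-sym zp) s
        go (p ∷ r ∷ P) below ok wk s = Long.long p r P below ok wk s

    module Cut {f : V} {t : List V} {g : V} {R : List V} (sp : Split W f t g R) (xf : x ~ f) (xg : x ~ g) (t0 : cnt x t ≡ 0) where

      C : V → Set
      C v = v ≡ x ⊎ x ~ v

      -- The side of the sector `t` once the closed neighbourhood of the hub is deleted: rim
      -- vertices belong to it only inside `t`, all others are reached from `t` by walks off the
      -- rim.
      data S (v : V) : Set where
        inside  : v ∈ t → S v
        outside : ∀ {u} P → u ∈ t → (∀ {r} → r ∈ P → Ok r) → Ok v → Walk u P v → S v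

      not-In : ∀ {v} → v ∈ t → v ≢ x × x ≁ v
      not-In i = (λ { refl → x∉ (In-m sp i) }) , cnt≡0⇒≁ t t0 i

      no-exit : ∀ {u v} P → u ∈ t → (∀ {r} → r ∈ P → Ok r) → Walk u P v → v ∈ R → ⊥
      no-exit P u∈ ok wk v∈ = connected (suc (len P)) P ≤-refl ok wk (sep-sym (sep-cross sp xf xg u∈ v∈))

      ok-b : ∀ {b} → ¬ In W b → ¬ C b → Ok b
      ok-b b∉ nc = b∉ , (λ e → nc (inj₂ e)) , (λ e → nc (inj₁ e))

      closed : ∀ {a b} → S a → a ~ b → ¬ C b → S b
      closed {a} {b} sa e nc with In? W b
      closed {a} {b} (inside i) e nc | no b∉ = outside [] i (λ ()) (ok-b b∉ nc) e
      closed {a} {b} (outside P u∈ okP oka wk) e nc | no b∉ = outside (P ++ a ∷ []) u∈ ok′ (ok-b b∉ nc) (Walk-++ P [] wk e)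
        where
        ok′ : ∀ {r} → r ∈ P ++ a ∷ [] → Ok r
        ok′ i with ∈-++⁻ P i
        ... | inj₁ j = okP j
        ... | inj₂ (here refl) = oka
      closed {a} {b} sa e nc | yes b∈ with Split.In⇒at sp b∈
      ... | _ , at0 (here refl) = ⊥-elim (nc (inj₂ xf))
      ... | _ , atS (at0 i) = inside i
      ... | _ , atS (atS (at0 (here refl))) = ⊥-elim (nc (inj₂ xg))
      closed {a} {b} (inside i) e nc | yes b∈ | _ , atS (atS (atS (at0 j))) = ⊥-elim (Split.far sp i j e)
      closed {a} {b} (outside P u∈ okP oka wk) e nc | yes b∈ | _ , atS (atS (atS (at0 j))) =
        ⊥-elim (no-exit (P ++ a ∷ []) u∈ ok′ (Walk-++ P [] wk e) j)
        where
        ok′ : ∀ {r} → r ∈ P ++ a ∷ [] → Ok r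
        ok′ i with ∈-++⁻ P i
        ... | inj₁ j = okP j
        ... | inj₂ (here refl) = oka

      cut : ⊥
      cut = go t R refl refl (Split.walk₁ sp) (Split.walk₂ sp)
        where
        go : ∀ t′ R′ → t ≡ t′ → R ≡ R′ → Walk f t′ g → Walk g R′ f → ⊥
        -- The spokes `f` and `g` are not adjacent, having the hub as common neighbour, so neither
        -- arc is empty.
        go [] _ _ _ e _ = common≁ xf xg e
        go (_ ∷ _) [] _ _ _ e = common≁ xg xf e
        -- `v` follows the spoke `g` on the other arc. It is not a neighbour of the hub, which would
        -- give a triangle, and so witnesses the other side.
        go (u ∷ _) (v ∷ _) refl refl _ (gv , _) =
          no-star C S (inside (here refl)) (λ { (inj₁ e) → proj₁ (not-In (here refl)) e ; (inj₂ e) → proj₂ (not-In (here refl)) e })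
            (λ { (inside i) → closed∩ys sp (here refl) (there (there i)) ; (outside _ _ _ o _) → proj₁ o (In-ys sp (here refl)) })
            (λ { (inj₁ refl) → x∉ (In-ys sp (here refl)) ; (inj₂ e) → tf xg gv e })
            (inj₁ refl) (λ { (inj₁ e) ne → ⊥-elim (ne e) ; (inj₂ e) _ → e }) closed

    contradiction-wheel : ∀ {y m z ys} → Split W y m z ys → ⊥
    contradiction-wheel sp with some-nb sp (≤-trans (s≤s z≤n) k≥4)
    ... | f , f∈ , xf with rebase sp f∈
    ...   | _ , _ , _ , sp′ with next-spoke sp′ xf (≤-trans (s≤s (s≤s z≤n)) k≥4)
    ...     | t , g , R , sp″ , xg , t0 = Cut.cut sp″ xf xg t0

  No-proper : V → ℕ → Set
  No-proper x k = ∀ (W : Weight) {y m z ys} → Split W y m z ys → ¬ In W x → Proper W x → 4 ≤ W (nb x) → W (nb x) ≡ k → ⊥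

  no-proper : ∀ x k → No-proper x k
  no-proper x = <-rec (No-proper x) λ k ih W sp x∉ proper k≥4 e →
    Final.contradiction-wheel {W} {x} x∉ (λ {a} → proper {a}) k≥4
      (λ {W′} sp′ x∉′ proper′ k≥4′ lt → ih (subst (W′ (nb x) <_) e lt) W′ sp′ x∉′ (λ {a} → proper′ {a}) k≥4′ refl) sp

  No-wheel-of : ℕ → Set
  No-wheel-of l = ∀ (W : Weight) (x : V) {y m z ys} → Split W y m z ys → ¬ In W x → 4 ≤ W (nb x) → W (λ _ → 1) ≡ l → ⊥

  -- The induction on the length of the rim only serves to obtain `Proper`; spokes are minimised
  -- afterwards, among proper wheels with the same hub and with no regard to length.
  no-wheel-of : ∀ l → No-wheel-of l
  no-wheel-of = <-rec No-wheel-of λ l ih W x sp x∉ k≥4 e →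
    no-proper x (W (nb x)) W sp x∉
      (λ {a} → shortest-proper sp x∉ k≥4 (λ {W′} {x′ = x′} sp′ x∉′ k≥4′ lt → ih (subst (W′ (λ _ → 1) <_) e lt) W′ x′ sp′ x∉′ k≥4′ refl) {a}) k≥4 refl

  no-wheel : No-wheel
  no-wheel {W} {x = x} sp x∉ k≥4 = no-wheel-of (W (λ _ → 1)) W x sp x∉ k≥4 refl

-- Finite search and conclusion

module _ {n : ℕ} (G : Graph n) where
  open Holes G

  -- A star cutset together with a union S of components of the rest that contains u but not v; unlike Cutset this is decidable.
  Star : Subset n → Subset n → V → V → V → Set
  Star C S u v c = u ∈ˢ S × u ∉ˢ C × v ∉ˢ S × v ∉ˢ C × c ∈ˢ C × (∀ x → x ∈ˢ C → x ≢ c → c ~ x) ×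
                   (∀ a → a ∈ˢ S → ∀ b → a ~ b → b ∉ˢ C → b ∈ˢ S)

  star? : Dec (∃ λ C → ∃ λ S → ∃ λ u → ∃ λ v → ∃ λ c → Star C S u v c)
  star? = anySubset? λ C → anySubset? λ S → anyF? λ u → anyF? λ v → anyF? λ c →
    (u ∈ˢ? S) ×-dec ¬? (u ∈ˢ? C) ×-dec ¬? (v ∈ˢ? S) ×-dec ¬? (v ∈ˢ? C) ×-dec (c ∈ˢ? C) ×-dec
    all? (λ x → (x ∈ˢ? C) →-dec (¬? (x ≟ c) →-dec (c ~? x))) ×-dec
    all? (λ a → (a ∈ˢ? S) →-dec all? (λ b → (a ~? b) →-dec (¬? (b ∈ˢ? C) →-dec (b ∈ˢ? S))))

  star⇒cutset : ∀ {C S u v c} → Star C S u v c → HasStarCutset G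
  star⇒cutset {C} {S} {u} {v} {c} (uS , uC , vS , vC , cC , adj-c , closed) =
    C , (u , v , uC , vC , λ r → vS (stays r)) , c , cC , adj-c
    where
    stays : ∀ {w} → Reach G C u w → w ∈ˢ S
    stays (here _)      = uS
    stays (next r e w∉) = closed _ (stays r) _ e w∉

  subset-of : ∀ {P : V → Set} → (∀ v → Dec (P v)) → ∃ λ (S : Subset n) → (∀ {v} → v ∈ˢ S → P v) × (∀ {v} → P v → v ∈ˢ S)
  subset-of {P} P? = S , to , from
    where
    S : Subset n
    S = tabulate (λ v → does (P? v))
    to : ∀ {v} → v ∈ˢ S → P v
    to {v} i with trans (sym (lookup∘tabulate (λ v → does (P? v)) v)) ([]=⇒lookup i)
    ... | e with P? v
    ...   | yes p = p
    to {v} i | () | no _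
    from : ∀ {v} → P v → v ∈ˢ S
    from {v} p = lookup⇒[]= v S (trans (lookup∘tabulate (λ v → does (P? v)) v) does-true)
      where
      does-true : does (P? v) ≡ true
      does-true with P? v
      ... | yes _ = refl
      ... | no np = ⊥-elim (np p)

  -- The goal is `⊥`, so the two predicates may be taken as decidable and turned into subsets, which
  -- the search has excluded.
  no-star : ¬ (∃ λ C → ∃ λ S → ∃ λ u → ∃ λ v → ∃ λ c → Star C S u v c) → Holes.No-star G
  no-star none C S {u} {v} {c} uS uC vS vC cC adj-c closed = ¬¬-all-dec C λ C? → ¬¬-all-dec S λ S? → go C? S?
    where
    go : (∀ v → Dec (C v)) → (∀ v → Dec (S v)) → ⊥
    go C? S? with subset-of C? | subset-of S?
    ... | C′ , toC , fromC | S′ , toS , fromS =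
      none (C′ , S′ , u , v , c , fromS uS , (λ i → uC (toC i)) , (λ i → vS (toS i)) , (λ i → vC (toC i)) , fromC cC ,
        (λ x i ne → adj-c (toC i) ne) , λ a i b e b∉ → fromS (closed (toS i) e (λ p → b∉ (fromC p))))

  Bipartition : Subset n → Set
  Bipartition σ = (∃ λ a → lookup σ a ≡ true) × (∃ λ b → lookup σ b ≡ false) × (∀ i j → adj G i j ≡ lookup σ i xor lookup σ j)

  bipartition? : Dec (∃ Bipartition)
  bipartition? = anySubset? λ σ → anyF? (λ a → lookup σ a ≟ᵇ true) ×-dec anyF? (λ b → lookup σ b ≟ᵇ false) ×-dec
    all? (λ i → all? (λ j → adj G i j ≟ᵇ (lookup σ i xor lookup σ j)))

  bipartite : ∃ Bipartition → CompleteBipartite G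
  proj₁ (bipartite (σ , _)) = lookup σ
  proj₁ (proj₂ (bipartite (σ , a , _))) = a
  proj₁ (proj₂ (proj₂ (bipartite (σ , a , b , _)))) = b
  proj₂ (proj₂ (proj₂ (bipartite (σ , a , b , h)))) i j with lookup σ i | lookup σ j | h i j
  ... | true  | true  | e = e
  ... | true  | false | e = e
  ... | false | true  | e = e
  ... | false | false | e = e

  module _ (tf : Holes.Triangle-free G) (no-isk4 : ¬ HasISK4 G) (ns : Holes.No-star G) (no-bip : ¬ (∃ Bipartition)) where
    open BipartiteSubgraphs G tf no-isk4

    private
      module _ (k : K33) where
        open K33 k
        module BasicA = Basic k
        module BasicB = Basic (swapK k)

        3-dec : ∀ {P : Fin 3 → Set} → (∀ i → Dec (P i)) → Dec (∀ i → P i)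
        3-dec = all?

        -- A vertex outside both `A` and `B` starts a component that yields a star cutset. If there
        -- is no such vertex, membership in `A` makes the graph complete bipartite.
        no-K33 : ⊥
        no-K33 with anyF? (λ v → ¬? (3-dec (λ j → v ~? b j)) ×-dec ¬? (3-dec (λ i → v ~? a i)))
        ... | yes (v , out) = Separate.separated k ns out
        ... | no none = no-bip (proj₁ A , (a zero , in-true (a∈A zero)) , (b zero , in-false (b∈B zero)) , adjacency)
          where
          A = subset-of (λ v → 3-dec (λ j → v ~? b j))
          in-true : ∀ {v} → inA v → lookup (proj₁ A) v ≡ true
          in-true p = []=⇒lookup (proj₂ (proj₂ A) p)
          in-false : ∀ {v} → inB v → lookup (proj₁ A) v ≡ false
          in-false {v} q with lookup (proj₁ A) v in e
          ... | false = refl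
          ... | true  = ⊥-elim (BasicA.A∩B (proj₁ (proj₂ A) (lookup⇒[]= v (proj₁ A) e)) q)
          ≁⇒false : ∀ {i j} → i ≁ j → adj G i j ≡ false
          ≁⇒false {i} {j} ne with adj G i j
          ... | true  = ⊥-elim (ne refl)
          ... | false = refl
          which : ∀ v → inA v ⊎ inB v
          which v with 3-dec (λ j → v ~? b j) | 3-dec (λ i → v ~? a i)
          ... | yes p | _     = inj₁ p
          ... | no _  | yes q = inj₂ q
          ... | no p  | no q  = ⊥-elim (none (v , p , q))
          adjacency : ∀ i j → adj G i j ≡ lookup (proj₁ A) i xor lookup (proj₁ A) j
          adjacency i j with which i | which j
          ... | inj₁ p | inj₁ q rewrite in-true p | in-true q = ≁⇒false (BasicA.A-indep p q)
          ... | inj₁ p | inj₂ q rewrite in-true p | in-false q = BasicA.complete p q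
          ... | inj₂ p | inj₁ q rewrite in-false p | in-true q = ~-sym (BasicA.complete q p)
          ... | inj₂ p | inj₂ q rewrite in-false p | in-false q = ≁⇒false (BasicB.A-indep p q)

    series-parallel : SeriesParallel G
    series-parallel (m , H , s , f , inj , hom) =
      MinimalTK4.no-TK4 G tf no-isk4 (NoWheel.no-wheel G tf no-isk4 ns) no-k33
        (TK4-map H G f inj (λ {i} {j} → hom i j) (Subdivision⇒TK4 s))
      where
      triple : V → V → V → Fin 3 → V
      triple a b c zero             = a
      triple a b c (suc zero)       = b
      triple a b c (suc (suc zero)) = c
      distinct : ∀ {a b c} → a ≢ b → a ≢ c → b ≢ c → ∀ {i j} → i ≢ j → triple a b c i ≢ triple a b c j
      distinct ab ac bc {zero}             {zero}             ne e = ne refl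
      distinct ab ac bc {zero}             {suc zero}         ne e = ab e
      distinct ab ac bc {zero}             {suc (suc zero)}   ne e = ac e
      distinct ab ac bc {suc zero}         {zero}             ne e = ab (sym e)
      distinct ab ac bc {suc zero}         {suc zero}         ne e = ne refl
      distinct ab ac bc {suc zero}         {suc (suc zero)}   ne e = bc e
      distinct ab ac bc {suc (suc zero)}   {zero}             ne e = ac (sym e)
      distinct ab ac bc {suc (suc zero)}   {suc zero}         ne e = bc (sym e)
      distinct ab ac bc {suc (suc zero)}   {suc (suc zero)}   ne e = ne refl
      no-k33 : Holes.No-K33 G
      no-k33 {a₁} {a₂} {a₃} {b₁} {b₂} {b₃} a₁₂ a₁₃ a₂₃ b₁₂ b₁₃ b₂₃ e₁₁ e₁₂ e₁₃ e₂₁ e₂₂ e₂₃ e₃₁ e₃₂ e₃₃ = no-K33 record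
        { a = triple a₁ a₂ a₃ ; b = triple b₁ b₂ b₃ ; a-inj = distinct a₁₂ a₁₃ a₂₃ ; b-inj = distinct b₁₂ b₁₃ b₂₃ ; a~b = edge }
        where
        edge : ∀ i j → triple a₁ a₂ a₃ i ~ triple b₁ b₂ b₃ j
        edge zero             zero             = e₁₁
        edge zero             (suc zero)       = e₁₂
        edge zero             (suc (suc zero)) = e₁₃
        edge (suc zero)       zero             = e₂₁
        edge (suc zero)       (suc zero)       = e₂₂
        edge (suc zero)       (suc (suc zero)) = e₂₃
        edge (suc (suc zero)) zero             = e₃₁
        edge (suc (suc zero)) (suc zero)       = e₃₂
        edge (suc (suc zero)) (suc (suc zero)) = e₃₃

  triangle-free : TriangleFree G → Holes.Triangle-free G
  triangle-free no-K₃ {a} {b} {c} ab bc ac = no-K₃ (f , inj , same)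
    where
    f : Fin 3 → V
    f zero             = a
    f (suc zero)       = b
    f (suc (suc zero)) = c
    edge : ∀ i j → i ≢ j → f i ~ f j
    edge zero             zero             ne = ⊥-elim (ne refl)
    edge zero             (suc zero)       ne = ab
    edge zero             (suc (suc zero)) ne = ac
    edge (suc zero)       zero             ne = ~-sym ab
    edge (suc zero)       (suc zero)       ne = ⊥-elim (ne refl)
    edge (suc zero)       (suc (suc zero)) ne = bc
    edge (suc (suc zero)) zero             ne = ~-sym ac
    edge (suc (suc zero)) (suc zero)       ne = ~-sym bc
    edge (suc (suc zero)) (suc (suc zero)) ne = ⊥-elim (ne refl)
    inj : ∀ {i j} → f i ≡ f j → i ≡ j
    inj {i} {j} e with i ≟ j
    ... | yes p = p
    ... | no ne = ⊥-elim (~⇒≢ (edge i j ne) e)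
    same : ∀ i j → adj G (f i) (f j) ≡ not (eqb i j)
    same i j with i ≟ j
    ... | yes refl = adj-irr G (f i)
    ... | no ne    = edge i j ne

theorem2p2 : ∀ {n} (G : Graph n) → TriangleFree G → ISK4Free G →
    SeriesParallel G ⊎ CompleteBipartite G ⊎ HasSmallCliqueCutset G ⊎ HasStarCutset G
theorem2p2 G no-K₃ no-isk4 with star? G | bipartition? G
... | yes (_ , _ , _ , _ , _ , s) | _ = inj₂ (inj₂ (inj₂ (star⇒cutset G s)))
... | no _ | yes b = inj₂ (inj₁ (bipartite G b))
... | no ns | no nb = inj₁ (series-parallel G (triangle-free G no-K₃) no-isk4 (no-star G ns) nb)
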